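{- Let $\Gamma$ be a $Q$-polynomial distance-regular graph with diameter $D \ge 3$ and valency $k \ge 3$. Then the girth of $\Gamma$ is equal to $6$ if and only if $\Gamma$ is isomorphic either to the Odd graph on a set of cardinality $2D+1$, or to a generalized hexagon of order $(1,k-1)$.
   Context: All graphs are finite, undirected, connected, without loops or multiple edges; $\partial$ is the path-length distance and $D$ the diameter. $\Gamma_i(x)$ is the set of vertices at distance $i$ from $x$. $\Gamma$ is distance-regular if for all $0\le h,i,j\le D$ and all vertices $x,y$ with $\partial(x,y)=h$ the number $p^h_{ij}=|\Gamma_i(x)\cap\Gamma_j(y)|$ depends only on $h,i,j$. For such $\Gamma$ let $A_0,\dots,A_D$ be the distance matrices (with $(A_i)_{xy}=1$ iff $\partial(x,y)=i$), spanning the Bose–Mesner algebra $M$, and let $E_0=|X|^{ -1}J,E_1,\dots,E_D$ be the primitive idempotents of $M$. The Krein parameters $q^h_{ij}$ are defined by $E_i\circ E_j=|X|^{ -1}\sum_h q^h_{ij}E_h$ ($\circ$ = entrywise product). $\Gamma$ is $Q$-polynomial (with respect to the ordering $E_0,\dots,E_D$) if for all distinct $0\le i,j\le D$, $q^1_{ij}\ne 0$ iff $|i-j|=1$; $\Gamma$ is called $Q$-polynomial if it is $Q$-polynomial with respect to some ordering. The Odd graph on a $(2D+1)$-set has as vertices the $D$-subsets, adjacent when disjoint. A generalized hexagon of order $(1,k-1)$ is (equivalently) a bipartite distance-regular graph of diameter $3$ with intersection array $\{k,k-1,k-1;1,1,k\}$. -}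

module Defs where

open import Level using (Level; 0ℓ) renaming (suc to lsuc; _⊔_ to _⊔ˡ_)
open import Data.Bool using (Bool; true; false; _∧_; _∨_; if_then_else_; T)
open import Data.Nat using (ℕ; zero; suc; _≤_; _<_; _≡ᵇ_; _∸_)
open import Data.Fin using (Fin; zero; suc; inject₁; fromℕ; _≟_)
import Data.Fin.Subset as Sub
open import Data.Product using (Σ; ∃; _×_; _,_; proj₁)
open import Data.Sum using (_⊎_)
open import Relation.Nullary using (¬_; ⌊_⌋)
open import Relation.Binary.PropositionalEquality using (_≡_; _≢_)
open import Function.Bundles using (_↔_; _⇔_)
open import Algebra.Bundles using (CommutativeRing)

record Graph : Set where
  field
    n      : ℕ
    adj    : Fin n → Fin n → Bool
    sym    : ∀ x y → adj x y ≡ adj y x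
    irrefl : ∀ x → adj x x ≡ false

module _ (G : Graph) where
  open Graph G

  anyFin : ∀ {m} → (Fin m → Bool) → Bool
  anyFin {zero}  p = false
  anyFin {suc m} p = p zero ∨ anyFin (λ z → p (suc z))

  within : ℕ → Fin n → Fin n → Bool
  within zero    x y = ⌊ x ≟ y ⌋
  within (suc m) x y = within m x y ∨ anyFin (λ z → adj x z ∧ within m z y)

  -- least d with i ≤ d ≤ i + fuel and p d (or i + fuel if none)
  search : (ℕ → Bool) → ℕ → ℕ → ℕ
  search p i zero       = i
  search p i (suc fuel) = if p i then i else search p (suc i) fuel

  dist : Fin n → Fin n → ℕ
  dist x y = search (λ m → within m x y) 0 n

  Connected : Set
  Connected = ∀ x y → T (within n x y)

count : ∀ {m} → (Fin m → Bool) → ℕ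
count {zero}  p = 0
count {suc m} p = (if p zero then 1 else 0) Data.Nat.+ count (λ z → p (suc z))

module _ (G : Graph) where
  open Graph G

  HasDiameter : ℕ → Set
  HasDiameter D = (∀ x y → dist G x y ≤ D) × Σ (Fin n) (λ x → Σ (Fin n) (λ y → dist G x y ≡ D))

  Valency : ℕ → Set
  Valency k = ∀ x → count (adj x) ≡ k

  pij : Fin n → Fin n → ℕ → ℕ → ℕ
  pij x y i j = count (λ z → (dist G x z ≡ᵇ i) ∧ (dist G y z ≡ᵇ j))

  IsDistanceRegular : Set
  IsDistanceRegular = ∀ x y x' y' → dist G x y ≡ dist G x' y' →
                        ∀ i j → pij x y i j ≡ pij x' y' i j

  Bipartite : Set
  Bipartite = Σ (Fin n → Bool) λ c → ∀ x y → adj x y ≡ true → c x ≢ c y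

  HasCycle : ℕ → Set
  HasCycle zero    = Data.Empty.⊥ where import Data.Empty
  HasCycle (suc m) =
    (3 ≤ suc m) × Σ (Fin (suc m) → Fin n) λ v →
      (∀ i j → v i ≡ v j → i ≡ j) ×
      (∀ (i : Fin m) → adj (v (inject₁ i)) (v (suc i)) ≡ true) ×
      (adj (v (fromℕ m)) (v zero) ≡ true)

  GirthEq : ℕ → Set
  GirthEq g = HasCycle g × (∀ l → l < g → ¬ HasCycle l)

  cpar : Fin n → Fin n → ℕ
  cpar x y = count (λ z → adj y z ∧ (dist G x z ≡ᵇ (dist G x y ∸ 1)))
  bpar : Fin n → Fin n → ℕ
  bpar x y = count (λ z → adj y z ∧ (dist G x z ≡ᵇ suc (dist G x y)))

_≅_ : Graph → Graph → Set
G ≅ H = Σ (Fin (Graph.n G) ↔ Fin (Graph.n H)) λ f →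
          ∀ x y → Graph.adj G x y ≡ Graph.adj H (Inverse.to f x) (Inverse.to f y)
  where open Function.Bundles using (Inverse)

-- generalized hexagon of order (1,k-1): bipartite distance-regular graph of
-- diameter 3 with intersection array {k,k-1,k-1;1,1,k}
IsGenHexagon1 : ℕ → Graph → Set
IsGenHexagon1 k H =
  Connected H × IsDistanceRegular H × HasDiameter H 3 × Bipartite H ×
  (∀ x y → dist H x y ≡ 0 → bpar H x y ≡ k) ×
  (∀ x y → dist H x y ≡ 1 → bpar H x y ≡ k ∸ 1 × cpar H x y ≡ 1) ×
  (∀ x y → dist H x y ≡ 2 → bpar H x y ≡ k ∸ 1 × cpar H x y ≡ 1) ×
  (∀ x y → dist H x y ≡ 3 → cpar H x y ≡ k)

OddVertex : ℕ → Set
OddVertex D = Σ (Sub.Subset (suc (D Data.Nat.+ D))) λ S → Sub.∣ S ∣ ≡ D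

IsoOdd : Graph → ℕ → Set
IsoOdd G D = Σ (Fin (Graph.n G) ↔ OddVertex D) λ f →
  ∀ x y → (Graph.adj G x y ≡ true) ⇔
          (proj₁ (Inverse.to f x) Sub.∩ proj₁ (Inverse.to f y) ≡ Sub.⊥)
  where open Function.Bundles using (Inverse)

ringℕ : ∀ {c ℓ} (R : CommutativeRing c ℓ) → ℕ → CommutativeRing.Carrier R
ringℕ R zero    = CommutativeRing.0# R
ringℕ R (suc m) = CommutativeRing._+_ R (CommutativeRing.1# R) (ringℕ R m)

record Char0Field (c ℓ : Level) : Set (lsuc (c ⊔ˡ ℓ)) where
  field
    cring : CommutativeRing c ℓ
  open CommutativeRing cring public
  field
    _⁻¹        : Carrier → Carrier
    nontrivial : ¬ (1# ≈ 0#)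
    inverseʳ   : ∀ x → ¬ (x ≈ 0#) → x * (x ⁻¹) ≈ 1#
    char0      : ∀ m → ¬ (ringℕ cring (suc m) ≈ 0#)
  fromℕ' : ℕ → Carrier
  fromℕ' = ringℕ cring

module BM (G : Graph) (F : Char0Field 0ℓ 0ℓ) where
  open Graph G
  open Char0Field F using (Carrier; _≈_; _+_; _*_; 0#; 1#; _⁻¹; fromℕ')

  Mat : Set
  Mat = Fin n → Fin n → Carrier

  sumTo : ℕ → (ℕ → Carrier) → Carrier
  sumTo zero    f = f 0
  sumTo (suc m) f = sumTo m f + f (suc m)

  sumV : ∀ {m} → (Fin m → Carrier) → Carrier
  sumV {zero}  f = 0#
  sumV {suc m} f = f zero + sumV (λ z → f (suc z))

  A : ℕ → Mat
  A h x y = if dist G x y ≡ᵇ h then 1# else 0#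

  I : Mat
  I x y = if ⌊ x ≟ y ⌋ then 1# else 0#

  J : Mat
  J x y = 1#

  O : Mat
  O x y = 0#

  _·_ : Mat → Mat → Mat
  (M · N) x y = sumV (λ z → M x z * N z y)

  _∘_ : Mat → Mat → Mat
  (M ∘ N) x y = M x y * N x y

  _≈M_ : Mat → Mat → Set
  M ≈M N = ∀ x y → M x y ≈ N x y

  InBM : ℕ → Mat → Set
  InBM D M = Σ (ℕ → Carrier) λ a → M ≈M (λ x y → sumTo D (λ h → a h * A h x y))

  PrimitiveIdempotents : ℕ → (ℕ → Mat) → Set
  PrimitiveIdempotents D E =
    (∀ i → i ≤ D → InBM D (E i)) ×
    (∀ i j → i ≤ D → j ≤ D → (E i · E j) ≈M (if i ≡ᵇ j then E i else O)) ×
    (∀ i → i ≤ D → ¬ (E i ≈M O)) ×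
    ((λ x y → sumTo D (λ i → E i x y)) ≈M I) ×
    (E 0 ≈M (λ x y → (fromℕ' n ⁻¹) * J x y))

  KreinParams : ℕ → (ℕ → Mat) → (ℕ → ℕ → ℕ → Carrier) → Set
  KreinParams D E q = ∀ i j → i ≤ D → j ≤ D →
    (E i ∘ E j) ≈M (λ x y → (fromℕ' n ⁻¹) * sumTo D (λ h → q h i j * E h x y))

  QPolyOrdering : ℕ → (ℕ → ℕ → ℕ → Carrier) → Set
  QPolyOrdering D q = ∀ i j → i ≤ D → j ≤ D → i ≢ j →
    (¬ (q 1 i j ≈ 0#)) ⇔ (i ≡ suc j ⊎ j ≡ suc i)

-- Γ (of diameter D) is Q-polynomial: w.r.t. some ordering of the primitive
-- idempotents, computed over some field of characteristic 0 splitting M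
IsQPolynomial : Graph → ℕ → Set₁
IsQPolynomial G D = Σ (Char0Field 0ℓ 0ℓ) λ F → let open BM G F in
  Σ (ℕ → Mat) λ E → Σ (ℕ → ℕ → ℕ → Char0Field.Carrier F) λ q →
    PrimitiveIdempotents D E × KreinParams D E q × QPolyOrdering D q

{-# OPTIONS --safe #-}
-- In girth six, a₁ = a₂ = 0 and c₂ = 1. Write C(x;y) for the set of neighbours of x closer to y, and W₀, …, W_D for the
-- entries of the first nontrivial idempotent E₁. The Q-polynomial property gives the balanced relation
--   Σ_{z ∈ C(x;y)} W(u,z) − Σ_{z ∈ C(y;x)} W(u,z) = ρ_h (W(u,x) − W(u,y)),   h = d(x,y).
-- Comparing its instances for different u yields a_h = 0 for h < D and makes the intersections of the sets C(y;x)
-- constant, so that they form symmetric designs. Eliminating the W_h leaves polynomial equations between natural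
-- numbers, which have no solution unless c₃ = k, D = 3 (generalized hexagon) or c₃ = 2. If c₃ = 2, then
-- W_{2m} = W₀ + mε and W_{2m+1} = W₁ − mε, k = D + 1, and the parity of min(d(x,u), d(y,u)) is the same for opposite
-- edges xy of a hexagon. The sets {u : min(d(x,u), d(y,u)) is odd} are then the 2D + 1 points of an Odd graph.
module Submission where

open import Defs
open import Level using (0ℓ)
open import Algebra.Bundles using (CommutativeRing)
open import Data.Bool using (Bool; true; false; _∧_; _∨_; not; if_then_else_; T)
import Data.Bool.Properties as Boolₚ
open import Data.Empty using (⊥; ⊥-elim)
open import Data.Nat using (ℕ; zero; suc; _+_; _*_; _∸_; _≤_; _<_; z≤n; s≤s; _≡ᵇ_; _≤?_; _<?_; NonZero)
import Data.Nat as ℕ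
import Data.Nat.Properties as ℕₚ
open import Data.Nat.Divisibility using (_∣_; divides)
import Data.Nat.Divisibility as Div
open import Data.Nat.GCD using (gcd; gcd[m,n]∣m; gcd[m,n]∣n; gcd-greatest)
open import Data.Nat.Coprimality using (Coprime; coprime-divisor)
import Data.Nat.Tactic.RingSolver as ℕR
open import Data.Integer using (ℤ; +_; -[1+_])
import Data.Integer as ℤ
import Data.Integer.Properties as ℤₚ
open import Data.Fin using (Fin; zero; suc; toℕ; fromℕ<; inject₁; punchIn)
import Data.Fin as Fin
import Data.Fin.Properties as Finₚ
import Data.Fin.Subset as Sub
open import Data.List using (List; []; _∷_; tabulate; allFin; cartesianProduct)
import Data.List as List
open import Data.List.Relation.Unary.Any using (here; there)
open import Data.List.Membership.Propositional using (_∈_)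
open import Data.List.Membership.Propositional.Properties using (∈-allFin; ∈-cartesianProduct⁺)
open import Data.Vec using (Vec; []; _∷_)
import Data.Vec as Vec
import Data.Vec.Properties as Vecₚ
open import Data.Vec.Relation.Unary.All using ([]; _∷_)
open import Data.Vec.Relation.Unary.Unique.Propositional using (Unique; []; _∷_)
open import Data.Vec.Relation.Unary.Unique.Propositional.Properties using (lookup-injective)
open import Data.Product using (Σ; ∃; _×_; _,_; proj₁; proj₂)
open import Data.Sum using (_⊎_; inj₁; inj₂; [_,_]′)
open import Data.Unit using (⊤)
open import Data.Maybe using (Maybe; just; nothing)
open import Function using (_∘_; id)
open import Function.Bundles using (_⇔_; mk⇔; _↔_; mk↔ₛ′; Inverse; Equivalence)
open import Relation.Nullary using (¬_; Dec; yes; no; does)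
open import Relation.Nullary.Decidable using (decidable-stable; isYes≗does)
open import Relation.Binary.PropositionalEquality using (_≡_; _≢_; refl; sym; trans; cong; cong₂; subst; subst₂; module ≡-Reasoning)
import Algebra.Solver.Ring as RingSolver
import Algebra.Solver.Ring.AlmostCommutativeRing as ACR
import Algebra.Properties.Ring as RingProps
import Algebra.Properties.CommutativeMonoid.Sum as MonoidSum
import Algebra.Properties.Semiring.Sum as SemiringSum
import Relation.Binary.Reasoning.Setoid as SetoidReasoning
open import Relation.Binary.Definitions using (tri<; tri≈; tri>)

-- Arithmetic in a field of characteristic zero

-- The field is an arbitrary one of characteristic zero: it has no order, and its equality is
-- undecidable. The classical arguments use real positivity to see that the diagonal of an
-- idempotent is nonzero and that a triple sum vanishes together with its Krein parameter. Both uses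
-- are replaced by `gram`, which needs only that the arrays concerned are combinations of 0-1
-- arrays. Existence statements of linear algebra hold under double negation; this suffices because
-- they serve to prove equalities, made stable beforehand, or contradictions. The classification
-- rests on integrality. For the two kinds of pairs on one level, `Below` and `Above`, the balanced
-- relations differ by an integer multiple of a cosine difference, so quotients such as (W₁ - W₃) :
-- (W₂ - W₄) are integers. For 3 ≤ c₃ < k two natural numbers n and m then determine the cosine
-- ratios; further equations, from the last level or from level five, fail by size or force n = m,
-- where the number of vertices at distance three would not be an integer.

module FieldKit (K : Char0Field 0ℓ 0ℓ) where
  open Char0Field K public
    using (Carrier; _≈_; 0#; 1#; _⁻¹; inverseʳ; char0; nontrivial; cring; setoid
          ; +-cong; *-cong; -‿cong; +-identityˡ; +-identityʳ; *-identityˡ; *-identityʳ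
          ; +-assoc; +-comm; *-assoc; *-comm; distribˡ; distribʳ; zeroˡ; zeroʳ; -‿inverseˡ; -‿inverseʳ)
    renaming (_+_ to infixl 6 _⊕_; _*_ to infixl 7 _⊛_; -_ to infix 8 ⊖_; fromℕ' to ν; refl to ≈-refl; sym to ≈-sym; trans to ≈-trans; reflexive to ≈-reflexive)
  open RingProps (CommutativeRing.ring cring) public using (-0#≈0#; -‿distribˡ-*; -‿distribʳ-*; -‿+-comm; -‿involutive)
  open SetoidReasoning setoid

  ν-+ : ∀ m n → ν (m + n) ≈ ν m ⊕ ν n
  ν-+ zero    n = ≈-sym (+-identityˡ _)
  ν-+ (suc m) n = ≈-trans (+-cong ≈-refl (ν-+ m n)) (≈-sym (+-assoc _ _ _))

  ν-* : ∀ m n → ν (m * n) ≈ ν m ⊛ ν n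
  ν-* zero    n = ≈-sym (zeroˡ _)
  ν-* (suc m) n = begin
    ν (n + m * n)             ≈⟨ ν-+ n (m * n) ⟩
    ν n ⊕ ν (m * n)           ≈⟨ +-cong (≈-sym (*-identityˡ _)) (ν-* m n) ⟩
    1# ⊛ ν n ⊕ ν m ⊛ ν n      ≈⟨ ≈-sym (distribʳ _ _ _) ⟩
    (1# ⊕ ν m) ⊛ ν n          ∎

  ι : ℤ → Carrier
  ι (+ n)      = ν n
  ι (-[1+ n ]) = ⊖ ν (suc n)

  ι-neg : ∀ z → ι (ℤ.- z) ≈ ⊖ ι z
  ι-neg (+ zero)   = ≈-sym -0#≈0#
  ι-neg (+ suc n)  = ≈-refl
  ι-neg -[1+ n ]   = ≈-sym (-‿involutive _)

  private
    cancel-suc : ∀ a b → a ⊕ ⊖ b ≈ (1# ⊕ a) ⊕ ⊖ (1# ⊕ b)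
    cancel-suc a b = ≈-sym (begin
      (1# ⊕ a) ⊕ ⊖ (1# ⊕ b)         ≈⟨ +-cong (+-comm _ _) (≈-sym (-‿+-comm _ _)) ⟩
      (a ⊕ 1#) ⊕ (⊖ 1# ⊕ ⊖ b)       ≈⟨ +-assoc _ _ _ ⟩
      a ⊕ (1# ⊕ (⊖ 1# ⊕ ⊖ b))       ≈⟨ +-cong ≈-refl (≈-sym (+-assoc _ _ _)) ⟩
      a ⊕ ((1# ⊕ ⊖ 1#) ⊕ ⊖ b)       ≈⟨ +-cong ≈-refl (+-cong (-‿inverseʳ _) ≈-refl) ⟩
      a ⊕ (0# ⊕ ⊖ b)                ≈⟨ +-cong ≈-refl (+-identityˡ _) ⟩
      a ⊕ ⊖ b                       ∎)

  ι-⊖ : ∀ m n → ι (m ℤ.⊖ n) ≈ ν m ⊕ ⊖ ν n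
  ι-⊖ zero    zero    = ≈-sym (≈-trans (+-identityˡ _) -0#≈0#)
  ι-⊖ zero    (suc n) = ≈-sym (+-identityˡ _)
  ι-⊖ (suc m) zero    = ≈-sym (≈-trans (+-cong ≈-refl -0#≈0#) (+-identityʳ _))
  ι-⊖ (suc m) (suc n) = ≈-trans (≈-reflexive (cong ι (ℤₚ.[1+m]⊖[1+n]≡m⊖n m n))) (≈-trans (ι-⊖ m n) (cancel-suc _ _))

  ι-+ : ∀ a b → ι (a ℤ.+ b) ≈ ι a ⊕ ι b
  ι-+ (+ m)    (+ n)    = ν-+ m n
  ι-+ (+ m)    -[1+ n ] = ι-⊖ m (suc n)
  ι-+ -[1+ m ] (+ n)    = ≈-trans (ι-⊖ n (suc m)) (+-comm _ _)
  ι-+ -[1+ m ] -[1+ n ] = ≈-trans (-‿cong (≈-trans (≈-reflexive (cong ν (cong suc (sym (ℕₚ.+-suc m n))))) (ν-+ (suc m) (suc n)))) (≈-sym (-‿+-comm _ _))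

  private
    ι-*⁺ : ∀ m b → ι (+ m ℤ.* b) ≈ ν m ⊛ ι b
    ι-*⁺ m (+ n) = ≈-trans (≈-reflexive (cong ι (sym (ℤₚ.pos-* m n)))) (ν-* m n)
    ι-*⁺ m -[1+ n ] = begin
      ι (+ m ℤ.* -[1+ n ])         ≈⟨ ≈-reflexive (cong ι (sym (ℤₚ.neg-distribʳ-* (+ m) (+ suc n)))) ⟩
      ι (ℤ.- (+ m ℤ.* + suc n))    ≈⟨ ι-neg (+ m ℤ.* + suc n) ⟩
      ⊖ ι (+ m ℤ.* + suc n)        ≈⟨ -‿cong (ι-*⁺ m (+ suc n)) ⟩
      ⊖ (ν m ⊛ ν (suc n))          ≈⟨ -‿distribʳ-* _ _ ⟩
      ν m ⊛ ⊖ ν (suc n)            ∎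

  ι-* : ∀ a b → ι (a ℤ.* b) ≈ ι a ⊛ ι b
  ι-* (+ m) b = ι-*⁺ m b
  ι-* -[1+ m ] b = begin
    ι (-[1+ m ] ℤ.* b)           ≈⟨ ≈-reflexive (cong ι (sym (ℤₚ.neg-distribˡ-* (+ suc m) b))) ⟩
    ι (ℤ.- (+ suc m ℤ.* b))      ≈⟨ ι-neg (+ suc m ℤ.* b) ⟩
    ⊖ ι (+ suc m ℤ.* b)          ≈⟨ -‿cong (ι-*⁺ (suc m) b) ⟩
    ⊖ (ν (suc m) ⊛ ι b)          ≈⟨ -‿distribˡ-* _ _ ⟩
    ⊖ ν (suc m) ⊛ ι b            ∎

  ι-1 : ι (+ 1) ≈ 1#
  ι-1 = +-identityʳ _

  private
    ℤ-raw = CommutativeRing.rawRing ℤₚ.+-*-commutativeRing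
    acr = ACR.fromCommutativeRing cring

    morphism : ℤ-raw ACR.-Raw-AlmostCommutative⟶ acr
    morphism = record
      { ⟦_⟧ = ι ; +-homo = ι-+ ; *-homo = ι-* ; -‿homo = ι-neg ; 0-homo = ≈-refl ; 1-homo = ι-1 }

    -- The solver works with integer coefficients because equality of field elements cannot be
    -- decided.
    coeff≟ : ∀ a b → Maybe (ι a ≈ ι b)
    coeff≟ a b with a ℤ.≟ b
    ... | yes a≡b = just (≈-reflexive (cong ι a≡b))
    ... | no  _   = nothing

  module P = RingSolver ℤ-raw acr morphism coeff≟
  open P public using (Polynomial; _:+_; _:*_; _:-_; :-_; con) renaming (solve to ring-solve; _:=_ to _:≈_)

  -- The solver reads `# 1` as `ι (+ 1)`, which is `1# ⊕ 0#`. Identities are therefore stated with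
  -- `ι (+ 1)`, and `ι-1` translates where `1#` itself occurs.
  #_ : ∀ {m} → ℕ → Polynomial m
  # n = con (+ n)

  ι-injective : ∀ a b → ι a ≈ ι b → a ≡ b
  ι-injective a b eq = ℤₚ.i-j≡0⇒i≡j a b (zero-only (a ℤ.- b) (begin
      ι (a ℤ.- b)        ≈⟨ ι-+ a (ℤ.- b) ⟩
      ι a ⊕ ι (ℤ.- b)    ≈⟨ +-cong eq (ι-neg b) ⟩
      ι b ⊕ ⊖ ι b        ≈⟨ -‿inverseʳ _ ⟩
      0#                 ∎))
    where
    zero-only : ∀ z → ι z ≈ 0# → z ≡ + 0
    zero-only (+ zero)  _ = refl
    zero-only (+ suc n) e = ⊥-elim (char0 n e)
    zero-only -[1+ n ]  e = ⊥-elim (char0 n (≈-trans (≈-sym (-‿involutive _)) (≈-trans (-‿cong e) -0#≈0#)))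

  ι≉0 : ∀ {z} → z ≢ + 0 → ¬ ι z ≈ 0#
  ι≉0 z≢0 e = z≢0 (ι-injective _ _ e)

  _⊝_ : Carrier → Carrier → Carrier
  x ⊝ y = x ⊕ ⊖ y
  infixl 6 _⊝_

  diff0 : ∀ {x y} → x ≈ y → x ⊝ y ≈ 0#
  diff0 eq = ≈-trans (+-cong eq ≈-refl) (-‿inverseʳ _)

  undiff : ∀ {x y} → x ⊝ y ≈ 0# → x ≈ y
  undiff {x} {y} eq = begin
    x                  ≈⟨ ring-solve 2 (λ x y → x :≈ (x :- y) :+ y) ≈-refl x y ⟩
    (x ⊝ y) ⊕ y        ≈⟨ +-cong eq ≈-refl ⟩
    0# ⊕ y             ≈⟨ +-identityˡ y ⟩
    y                  ∎

  scaled-diff0 : ∀ {l r} c → l ≈ r → c ⊛ (l ⊝ r) ≈ 0#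
  scaled-diff0 c h = ≈-trans (*-cong ≈-refl (diff0 h)) (zeroʳ c)

  sum0 : ∀ {a b} → a ≈ 0# → b ≈ 0# → a ⊕ b ≈ 0#
  sum0 a≈0 b≈0 = ≈-trans (+-cong a≈0 b≈0) (+-identityˡ 0#)

  -- Certificates for elimination: the multipliers exhibit the difference of the goal as a
  -- combination of the differences of the hypotheses, and what remains is a polynomial identity for
  -- `ring-solve`.
  lc₁ : ∀ {p q l r} c → l ≈ r → p ⊝ q ≈ c ⊛ (l ⊝ r) → p ≈ q
  lc₁ c h e = undiff (≈-trans e (scaled-diff0 c h))

  lc₂ : ∀ {p q l₁ r₁ l₂ r₂} c₁ c₂ → l₁ ≈ r₁ → l₂ ≈ r₂ →
        p ⊝ q ≈ c₁ ⊛ (l₁ ⊝ r₁) ⊕ c₂ ⊛ (l₂ ⊝ r₂) → p ≈ q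
  lc₂ c₁ c₂ h₁ h₂ e = undiff (≈-trans e (sum0 (scaled-diff0 c₁ h₁) (scaled-diff0 c₂ h₂)))

  lc₃ : ∀ {p q l₁ r₁ l₂ r₂ l₃ r₃} c₁ c₂ c₃ → l₁ ≈ r₁ → l₂ ≈ r₂ → l₃ ≈ r₃ →
        p ⊝ q ≈ c₁ ⊛ (l₁ ⊝ r₁) ⊕ c₂ ⊛ (l₂ ⊝ r₂) ⊕ c₃ ⊛ (l₃ ⊝ r₃) → p ≈ q
  lc₃ c₁ c₂ c₃ h₁ h₂ h₃ e =
    undiff (≈-trans e (sum0 (sum0 (scaled-diff0 c₁ h₁) (scaled-diff0 c₂ h₂)) (scaled-diff0 c₃ h₃)))

  cancelˡ : ∀ {a b c} → ¬ a ≈ 0# → a ⊛ b ≈ a ⊛ c → b ≈ c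
  cancelˡ {a} {b} {c} a≉0 eq = begin
    b                   ≈⟨ step b ⟩
    a ⁻¹ ⊛ (a ⊛ b)      ≈⟨ *-cong ≈-refl eq ⟩
    a ⁻¹ ⊛ (a ⊛ c)      ≈⟨ ≈-sym (step c) ⟩
    c                   ∎
    where
    step : ∀ b → b ≈ a ⁻¹ ⊛ (a ⊛ b)
    step b = ≈-sym (≈-trans (≈-sym (*-assoc _ _ _)) (≈-trans (*-cong (≈-trans (*-comm _ _) (inverseʳ a a≉0)) ≈-refl) (*-identityˡ b)))

  cancel0 : ∀ {a b} → ¬ a ≈ 0# → a ⊛ b ≈ 0# → b ≈ 0#
  cancel0 a≉0 eq = cancelˡ a≉0 (≈-trans eq (≈-sym (zeroʳ _)))

  *≉0 : ∀ {a b} → ¬ a ≈ 0# → ¬ b ≈ 0# → ¬ a ⊛ b ≈ 0#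
  *≉0 a≉0 b≉0 e = b≉0 (cancel0 a≉0 e)

  diff≉0 : ∀ {a b} → ¬ a ≈ b → ¬ a ⊝ b ≈ 0#
  diff≉0 a≉b e = a≉b (undiff e)

-- Linear algebra and a substitute for positivity

private
  ¬¬-dec : ∀ {ℓ} (A : Set ℓ) → ¬ ¬ Dec A
  ¬¬-dec A k = k (no (λ a → k (yes a)))

module LinearAlgebra (K : Char0Field 0ℓ 0ℓ) where
  open FieldKit K
  open SetoidReasoning setoid

  ∑ : {A : Set} → List A → (A → Carrier) → Carrier
  ∑ []       f = 0#
  ∑ (x ∷ xs) f = f x ⊕ ∑ xs f

  ∑-cong∈ : {A : Set} (xs : List A) {f g : A → Carrier} → (∀ a → a ∈ xs → f a ≈ g a) → ∑ xs f ≈ ∑ xs g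
  ∑-cong∈ []       h = ≈-refl
  ∑-cong∈ (x ∷ xs) h = +-cong (h x (here refl)) (∑-cong∈ xs (λ a a∈ → h a (there a∈)))

  ∑-cong : {A : Set} (xs : List A) {f g : A → Carrier} → (∀ a → f a ≈ g a) → ∑ xs f ≈ ∑ xs g
  ∑-cong xs h = ∑-cong∈ xs (λ a _ → h a)

  ∑-zero : {A : Set} (xs : List A) {f : A → Carrier} → (∀ a → f a ≈ 0#) → ∑ xs f ≈ 0#
  ∑-zero []       h = ≈-refl
  ∑-zero (x ∷ xs) h = sum0 (h x) (∑-zero xs h)

  ∑-+ : {A : Set} (xs : List A) (f g : A → Carrier) → ∑ xs (λ a → f a ⊕ g a) ≈ ∑ xs f ⊕ ∑ xs g
  ∑-+ []       f g = ≈-sym (+-identityˡ 0#)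
  ∑-+ (x ∷ xs) f g = ≈-trans (+-cong ≈-refl (∑-+ xs f g))
    (ring-solve 4 (λ a b s t → (a :+ b) :+ (s :+ t) :≈ (a :+ s) :+ (b :+ t)) ≈-refl _ _ _ _)

  ∑-*ˡ : {A : Set} (xs : List A) (c : Carrier) (f : A → Carrier) → ∑ xs (λ a → c ⊛ f a) ≈ c ⊛ ∑ xs f
  ∑-*ˡ []       c f = ≈-sym (zeroʳ c)
  ∑-*ˡ (x ∷ xs) c f = ≈-trans (+-cong ≈-refl (∑-*ˡ xs c f)) (≈-sym (distribˡ _ _ _))

  ∑-*ʳ : {A : Set} (xs : List A) (c : Carrier) (f : A → Carrier) → ∑ xs (λ a → f a ⊛ c) ≈ ∑ xs f ⊛ c
  ∑-*ʳ xs c f = ≈-trans (∑-cong xs (λ a → *-comm _ _)) (≈-trans (∑-*ˡ xs c f) (*-comm _ _))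

  ∑-neg : {A : Set} (xs : List A) (f : A → Carrier) → ∑ xs (λ a → ⊖ f a) ≈ ⊖ ∑ xs f
  ∑-neg []       f = ≈-sym -0#≈0#
  ∑-neg (x ∷ xs) f = ≈-trans (+-cong ≈-refl (∑-neg xs f)) (-‿+-comm _ _)

  ∑-⊝ : {A : Set} (xs : List A) (f g : A → Carrier) → ∑ xs (λ a → f a ⊝ g a) ≈ ∑ xs f ⊝ ∑ xs g
  ∑-⊝ xs f g = ≈-trans (∑-+ xs f _) (+-cong ≈-refl (∑-neg xs g))

  ∑-swap : {A B : Set} (xs : List A) (ys : List B) (f : A → B → Carrier) →
           ∑ xs (λ a → ∑ ys (f a)) ≈ ∑ ys (λ b → ∑ xs (λ a → f a b))
  ∑-swap []       ys f = ≈-sym (∑-zero ys (λ _ → ≈-refl))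
  ∑-swap (x ∷ xs) ys f = ≈-trans (+-cong ≈-refl (∑-swap xs ys f)) (≈-sym (∑-+ ys _ _))

  ∑-++ : {A : Set} (xs ys : List A) (f : A → Carrier) → ∑ (xs List.++ ys) f ≈ ∑ xs f ⊕ ∑ ys f
  ∑-++ []       ys f = ≈-sym (+-identityˡ _)
  ∑-++ (x ∷ xs) ys f = ≈-trans (+-cong ≈-refl (∑-++ xs ys f)) (≈-sym (+-assoc _ _ _))

  ∑-map : {A B : Set} (g : A → B) (xs : List A) (f : B → Carrier) → ∑ (List.map g xs) f ≈ ∑ xs (f ∘ g)
  ∑-map g []       f = ≈-refl
  ∑-map g (x ∷ xs) f = +-cong ≈-refl (∑-map g xs f)

  ∑-cartesian : {A B : Set} (xs : List A) (ys : List B) (f : A × B → Carrier) →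
                ∑ (cartesianProduct xs ys) f ≈ ∑ xs (λ a → ∑ ys (λ b → f (a , b)))
  ∑-cartesian []       ys f = ≈-refl
  ∑-cartesian (x ∷ xs) ys f = ≈-trans (∑-++ (List.map (x ,_) ys) _ f) (+-cong (∑-map (x ,_) ys f) (∑-cartesian xs ys f))

  ∑-tabulate : {A : Set} {m : ℕ} (g : Fin m → A) (f : A → Carrier) (h : Fin m → Carrier) →
               (∀ i → f (g i) ≈ h i) → ∑ (tabulate g) f ≈ MonoidSum.sum (CommutativeRing.+-commutativeMonoid cring) h
  ∑-tabulate {m = zero}  g f h e = ≈-refl
  ∑-tabulate {m = suc m} g f h e = +-cong (e zero) (∑-tabulate (g ∘ suc) f (h ∘ suc) (e ∘ suc))

  private
    delta-tab : ∀ {A : Set} {m} (g : Fin m → A) (f : A → Carrier) (i : Fin m) →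
                (∀ j → j ≢ i → f (g j) ≈ 0#) → ∑ (tabulate g) f ≈ f (g i)
    delta-tab {m = suc m} g f zero h = ≈-trans (+-cong ≈-refl (≈-trans (∑-tabulate (g ∘ suc) f (λ _ → 0#) (λ j → h (suc j) (λ ())))
                             (∑-tab0 m))) (+-identityʳ _)
      where
      ∑-tab0 : ∀ m → MonoidSum.sum (CommutativeRing.+-commutativeMonoid cring) {m} (λ _ → 0#) ≈ 0#
      ∑-tab0 zero    = ≈-refl
      ∑-tab0 (suc m) = ≈-trans (+-identityˡ _) (∑-tab0 m)
    delta-tab g f (suc i) h = ≈-trans (+-cong (h zero (λ ())) (delta-tab (g ∘ suc) f i (λ j j≢i → h (suc j) (λ e → j≢i (Finₚ.suc-injective e)))))
                                (+-identityˡ _)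

  ∑-delta : ∀ {m} (f : Fin m → Carrier) (i : Fin m) → (∀ j → j ≢ i → f j ≈ 0#) → ∑ (allFin m) f ≈ f i
  ∑-delta f i h = delta-tab id f i h

  module Definite (stable : ∀ {x y} → ¬ ¬ (x ≈ y) → x ≈ y) where

    private
      normSq : {C : Set} → List C → (C → ℤ) → ℕ
      normSq []       v = 0
      normSq (c ∷ cs) v = ℤ.∣ v c ∣ * ℤ.∣ v c ∣ + normSq cs v

      dot : {C : Set} → List C → (C → ℤ) → (C → ℤ) → ℤ
      dot []       u v = + 0
      dot (c ∷ cs) u v = u c ℤ.* v c ℤ.+ dot cs u v

      square : ∀ z → ν (ℤ.∣ z ∣ * ℤ.∣ z ∣) ≈ ι z ⊛ ι z
      square (+ n)    = ν-* n n
      square -[1+ n ] = ≈-trans (ν-* (suc n) (suc n)) (ring-solve 1 (λ a → a :* a :≈ (:- a) :* (:- a)) ≈-refl _)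

      ν-normSq : {C : Set} (cs : List C) (v : C → ℤ) → ν (normSq cs v) ≈ ∑ cs (λ c → ι (v c) ⊛ ι (v c))
      ν-normSq []       v = ≈-refl
      ν-normSq (c ∷ cs) v = ≈-trans (ν-+ (ℤ.∣ v c ∣ * ℤ.∣ v c ∣) (normSq cs v)) (+-cong (square (v c)) (ν-normSq cs v))

      ι-dot : {C : Set} (cs : List C) (u v : C → ℤ) → ι (dot cs u v) ≈ ∑ cs (λ c → ι (u c) ⊛ ι (v c))
      ι-dot []       u v = ≈-refl
      ι-dot (c ∷ cs) u v = ≈-trans (ι-+ (u c ℤ.* v c) _) (+-cong (ι-* (u c) (v c)) (ι-dot cs u v))

      normSq≡0 : {C : Set} (cs : List C) (v : C → ℤ) → normSq cs v ≡ 0 → ∀ c → c ∈ cs → v c ≡ + 0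
      normSq≡0 (c ∷ cs) v e .c (here refl) =
        ℤₚ.∣i∣≡0⇒i≡0 ([ id , id ]′ (ℕₚ.m*n≡0⇒m≡0∨n≡0 ℤ.∣ v c ∣ (ℕₚ.m+n≡0⇒m≡0 _ e)))
      normSq≡0 (c ∷ cs) v e a (there a∈) = normSq≡0 cs v (ℕₚ.m+n≡0⇒n≡0 (ℤ.∣ v c ∣ * ℤ.∣ v c ∣) e) a a∈

    combination : {A C : Set} → List A → (A → Carrier) → (A → C → ℤ) → C → Carrier
    combination as f v c = ∑ as (λ a → f a ⊛ ι (v a c))

    -- Integer vectors span a space on which the dot product is definite, even though the field is not ordered:
    -- a combination orthogonal to all of them vanishes. Each step is one step of fraction-free Gram–Schmidt,
    -- which multiplies the combination by a norm.
    gram : {A C : Set} (cs : List C) (as : List A) (f : A → Carrier) (v : A → C → ℤ) →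
           (∀ a → ∑ cs (λ c → ι (v a c) ⊛ combination as f v c) ≈ 0#) →
           ∀ c → c ∈ cs → combination as f v c ≈ 0#
    gram cs []        f v h c c∈ = ≈-refl
    gram {A} {C} cs (a₀ ∷ as) f v h c c∈ = byNorm (normSq cs v₀) refl
      where
      v₀ = v a₀
      S = combination (a₀ ∷ as) f v

      byNorm : ∀ N → normSq cs v₀ ≡ N → S c ≈ 0#
      -- A sum of squares of integers that is zero has zero terms; this is the only positivity used.
      byNorm zero N≡0 = ≈-trans (drop c c∈) (gram cs as f v h′ c c∈)
        where
        drop : ∀ c → c ∈ cs → S c ≈ combination as f v c
        drop c c∈ = ≈-trans (+-cong (≈-trans (*-cong ≈-refl (≈-reflexive (cong ι (normSq≡0 cs v₀ N≡0 c c∈)))) (zeroʳ _)) ≈-refl) (+-identityˡ _)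
        h′ : ∀ a → ∑ cs (λ c → ι (v a c) ⊛ combination as f v c) ≈ 0#
        h′ a = ≈-trans (∑-cong∈ cs (λ c c∈ → *-cong ≈-refl (≈-sym (drop c c∈)))) (h a)
      byNorm (suc N) N≡ = cancel0 (char0 N) (≈-trans (≈-sym (scaled c)) (gram cs as f v′ h′ c c∈))
        where
        gg = ν (suc N)
        v′ : A → C → ℤ
        v′ a c = + suc N ℤ.* v a c ℤ.- dot cs v₀ (v a) ℤ.* v₀ c

        ι-v′ : ∀ a c → ι (v′ a c) ≈ gg ⊛ ι (v a c) ⊝ ι (dot cs v₀ (v a)) ⊛ ι (v₀ c)
        ι-v′ a c = ≈-trans (ι-+ (+ suc N ℤ.* v a c) _) (+-cong (ι-* (+ suc N) (v a c))
                     (≈-trans (ι-neg (dot cs v₀ (v a) ℤ.* v₀ c)) (-‿cong (ι-* (dot cs v₀ (v a)) (v₀ c)))))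

        -- Orthogonality of `S` to `v₀`, expanded. It trades the term `f a₀` for the projections
        -- subtracted in `v′`.
        orth : gg ⊛ f a₀ ⊕ ∑ as (λ a → f a ⊛ ι (dot cs v₀ (v a))) ≈ 0#
        orth = begin
          gg ⊛ f a₀ ⊕ ∑ as (λ a → f a ⊛ ι (dot cs v₀ (v a)))
            ≈⟨ +-cong (*-cong (≈-trans (≈-reflexive (cong ν (sym N≡))) (ν-normSq cs v₀)) ≈-refl)
                      (∑-cong as (λ a → ≈-trans (*-cong ≈-refl (ι-dot cs v₀ (v a))) (≈-sym (∑-*ˡ cs (f a) _)))) ⟩
          ∑ cs (λ c → ι (v₀ c) ⊛ ι (v₀ c)) ⊛ f a₀ ⊕ ∑ as (λ a → ∑ cs (λ c → f a ⊛ (ι (v₀ c) ⊛ ι (v a c))))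
            ≈⟨ +-cong (≈-sym (∑-*ʳ cs (f a₀) _)) (∑-swap as cs _) ⟩
          ∑ cs (λ c → ι (v₀ c) ⊛ ι (v₀ c) ⊛ f a₀) ⊕ ∑ cs (λ c → ∑ as (λ a → f a ⊛ (ι (v₀ c) ⊛ ι (v a c))))
            ≈⟨ ≈-sym (∑-+ cs _ _) ⟩
          ∑ cs (λ c → ι (v₀ c) ⊛ ι (v₀ c) ⊛ f a₀ ⊕ ∑ as (λ a → f a ⊛ (ι (v₀ c) ⊛ ι (v a c))))
            ≈⟨ ∑-cong cs (λ c → ≈-trans (+-cong (ring-solve 2 (λ x y → x :* x :* y :≈ x :* (y :* x)) ≈-refl _ _)
                  (≈-trans (∑-cong as (λ a → ring-solve 3 (λ x y z → x :* (y :* z) :≈ y :* (x :* z)) ≈-refl _ _ _)) (∑-*ˡ as (ι (v₀ c)) _)))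
                  (≈-sym (distribˡ _ _ _))) ⟩
          ∑ cs (λ c → ι (v₀ c) ⊛ S c)
            ≈⟨ h a₀ ⟩
          0# ∎

        scaled : ∀ c → combination as f v′ c ≈ gg ⊛ S c
        scaled c = begin
          ∑ as (λ a → f a ⊛ ι (v′ a c))
            ≈⟨ ∑-cong as (λ a → ≈-trans (*-cong ≈-refl (ι-v′ a c))
                  (ring-solve 5 (λ f g x d w → f :* (g :* x :- d :* w) :≈ g :* (f :* x) :- w :* (f :* d)) ≈-refl _ _ _ _ _)) ⟩
          ∑ as (λ a → gg ⊛ (f a ⊛ ι (v a c)) ⊝ ι (v₀ c) ⊛ (f a ⊛ ι (dot cs v₀ (v a))))
            ≈⟨ ≈-trans (∑-⊝ as _ _) (+-cong (∑-*ˡ as gg _) (-‿cong (∑-*ˡ as (ι (v₀ c)) _))) ⟩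
          gg ⊛ ∑ as (λ a → f a ⊛ ι (v a c)) ⊝ ι (v₀ c) ⊛ ∑ as (λ a → f a ⊛ ι (dot cs v₀ (v a)))
            ≈⟨ lc₁ (⊖ ι (v₀ c)) orth (ring-solve 5 (λ g s w o f →
                  ((g :* s :- w :* o) :- (g :* (f :* w :+ s))) :≈ (:- w) :* ((g :* f :+ o) :- # 0)) ≈-refl _ _ _ _ _) ⟩
          gg ⊛ S c ∎

        h′ : ∀ a → ∑ cs (λ c → ι (v′ a c) ⊛ combination as f v′ c) ≈ 0#
        h′ a = begin
          ∑ cs (λ c → ι (v′ a c) ⊛ combination as f v′ c)
            ≈⟨ ∑-cong cs (λ c → ≈-trans (*-cong (ι-v′ a c) (scaled c))
                 (ring-solve 5 (λ g x d w s → (g :* x :- d :* w) :* (g :* s) :≈ (g :* g) :* (x :* s) :- (d :* g) :* (w :* s)) ≈-refl _ _ _ _ _)) ⟩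
          ∑ cs (λ c → (gg ⊛ gg) ⊛ (ι (v a c) ⊛ S c) ⊝ (ι (dot cs v₀ (v a)) ⊛ gg) ⊛ (ι (v₀ c) ⊛ S c))
            ≈⟨ ≈-trans (∑-⊝ cs _ _) (+-cong (∑-*ˡ cs _ _) (-‿cong (∑-*ˡ cs _ _))) ⟩
          (gg ⊛ gg) ⊛ ∑ cs (λ c → ι (v a c) ⊛ S c) ⊝ (ι (dot cs v₀ (v a)) ⊛ gg) ⊛ ∑ cs (λ c → ι (v₀ c) ⊛ S c)
            ≈⟨ sum0 (≈-trans (*-cong ≈-refl (h a)) (zeroʳ _)) (≈-trans (-‿cong (≈-trans (*-cong ≈-refl (h a₀)) (zeroʳ _))) -0#≈0#) ⟩
          0# ∎

    private
      module FinSum = MonoidSum (CommutativeRing.+-commutativeMonoid cring)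
      module FinSumR = SemiringSum (CommutativeRing.semiring cring)
      sum = FinSum.sum

      sum-cong : ∀ {n} (f g : Fin n → Carrier) → (∀ i → f i ≈ g i) → sum f ≈ sum g
      sum-cong f g h = FinSum.sum-cong-≋ {x = f} {y = g} h

    -- Gaussian elimination on the first coordinate, free of fractions. The existence of a pivot is
    -- undecidable, hence the double negation.
    dependent : ∀ m (v : Fin (suc m) → Fin m → Carrier) →
                ¬ ¬ Σ (Fin (suc m) → Carrier) (λ a → Σ (Fin (suc m)) (λ i → ¬ a i ≈ 0#) × (∀ j → sum (λ i → a i ⊛ v i j) ≈ 0#))
    dependent zero    v k = k ((λ _ → 1#) , (zero , nontrivial) , λ ())
    dependent (suc m) v k = ¬¬-dec (Σ (Fin (suc (suc m))) (λ p → ¬ v p zero ≈ 0#)) λ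
      { (no none) → dependent m (λ i j → v (suc i) (suc j)) λ (a , (i , aᵢ≉0) , rel) →
          k ( 0∷ a
            , (suc i , aᵢ≉0)
            , λ { zero → ≈-trans (sum-cong (λ i → (0∷ a) i ⊛ v i zero) (λ _ → 0#) (λ i → ≈-trans (*-cong ≈-refl (stable (λ e → none (i , e)))) (zeroʳ _))) (FinSum.sum-replicate-zero (suc (suc m)))
                ; (suc j) → ≈-trans (+-cong (zeroˡ _) (rel j)) (+-identityˡ _) })
      ; (yes (p , vₚ≉0)) →
          let vₚ = v p zero
              w = λ i j → vₚ ⊛ v (punchIn p i) (suc j) ⊝ v (punchIn p i) zero ⊛ v p (suc j)
          in dependent m w λ (a , (i , aᵢ≉0) , rel) →
          let lead = sum (λ i → a i ⊛ v (punchIn p i) zero)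
              coeff = λ j → pick p (⊖ lead) (λ i → vₚ ⊛ a i) j
              rest = λ (j : Fin (suc m)) → sum (λ i → a i ⊛ v (punchIn p i) j)
              split : ∀ j → sum (λ i → coeff i ⊛ v i j) ≈ ⊖ lead ⊛ v p j ⊕ vₚ ⊛ rest j
              split j = begin
                sum (λ i → coeff i ⊛ v i j)
                  ≈⟨ FinSum.sum-remove {i = p} (λ i → coeff i ⊛ v i j) ⟩
                coeff p ⊛ v p j ⊕ sum (λ i → coeff (punchIn p i) ⊛ v (punchIn p i) j)
                  ≈⟨ +-cong (*-cong (≈-reflexive (pick-here p _ _)) ≈-refl)
                       (sum-cong (λ i → coeff (punchIn p i) ⊛ v (punchIn p i) j) (λ i → vₚ ⊛ (a i ⊛ v (punchIn p i) j)) (λ i → ≈-trans (*-cong (≈-reflexive (pick-there p _ _ i)) ≈-refl) (*-assoc _ _ _))) ⟩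
                ⊖ lead ⊛ v p j ⊕ sum (λ i → vₚ ⊛ (a i ⊛ v (punchIn p i) j))
                  ≈⟨ +-cong ≈-refl (≈-sym (FinSumR.*-distribˡ-sum vₚ (λ i → a i ⊛ v (punchIn p i) j))) ⟩
                ⊖ lead ⊛ v p j ⊕ vₚ ⊛ rest j ∎
              later : ∀ j → vₚ ⊛ rest (suc j) ⊝ lead ⊛ v p (suc j) ≈ 0#
              later j = begin
                vₚ ⊛ rest (suc j) ⊝ lead ⊛ v p (suc j)
                  ≈⟨ +-cong (FinSumR.*-distribˡ-sum vₚ (λ i → a i ⊛ v (punchIn p i) (suc j))) (≈-trans (-‿distribʳ-* _ _) (FinSumR.*-distribʳ-sum (⊖ v p (suc j)) (λ i → a i ⊛ v (punchIn p i) zero))) ⟩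
                sum (λ i → vₚ ⊛ (a i ⊛ v (punchIn p i) (suc j))) ⊕ sum (λ i → (a i ⊛ v (punchIn p i) zero) ⊛ ⊖ v p (suc j))
                  ≈⟨ ≈-sym (FinSum.∑-distrib-+ (λ i → vₚ ⊛ (a i ⊛ v (punchIn p i) (suc j))) (λ i → (a i ⊛ v (punchIn p i) zero) ⊛ ⊖ v p (suc j))) ⟩
                sum (λ i → vₚ ⊛ (a i ⊛ v (punchIn p i) (suc j)) ⊕ (a i ⊛ v (punchIn p i) zero) ⊛ ⊖ v p (suc j))
                  ≈⟨ sum-cong (λ i → vₚ ⊛ (a i ⊛ v (punchIn p i) (suc j)) ⊕ (a i ⊛ v (punchIn p i) zero) ⊛ ⊖ v p (suc j)) (λ i → a i ⊛ w i j)
                       (λ i → ring-solve 5 (λ b a x y z → b :* (a :* x) :+ (a :* y) :* (:- z) :≈ a :* (b :* x :- y :* z)) ≈-refl vₚ (a i) (v (punchIn p i) (suc j)) (v (punchIn p i) zero) (v p (suc j))) ⟩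
                sum (λ i → a i ⊛ w i j)
                  ≈⟨ rel j ⟩
                0# ∎
          in k ( coeff
               , (punchIn p i , λ e → *≉0 vₚ≉0 aᵢ≉0 (≈-trans (≈-reflexive (sym (pick-there p _ _ i))) e))
               , λ { zero → ≈-trans (split zero) (ring-solve 2 (λ l b → (:- l) :* b :+ b :* l :≈ # 0) ≈-refl lead vₚ)
                   ; (suc j) → ≈-trans (split (suc j)) (≈-trans (ring-solve 4 (λ l x b r → (:- l) :* x :+ b :* r :≈ b :* r :- l :* x) ≈-refl lead _ vₚ _) (later j)) }) }
      where
      0∷ : ∀ {n} → (Fin n → Carrier) → Fin (suc n) → Carrier
      0∷ a zero    = 0#
      0∷ a (suc i) = a i
      pick : ∀ {n} → Fin (suc n) → Carrier → (Fin n → Carrier) → Fin (suc n) → Carrier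
      pick p x f j with p Fin.≟ j
      ... | yes _ = x
      ... | no p≢j = f (Fin.punchOut p≢j)
      pick-here : ∀ {n} (p : Fin (suc n)) x f → pick p x f p ≡ x
      pick-here p x f with p Fin.≟ p
      ... | yes _ = refl
      ... | no p≢p = ⊥-elim (p≢p refl)
      pick-there : ∀ {n} (p : Fin (suc n)) x f i → pick p x f (punchIn p i) ≡ f i
      pick-there p x f i with p Fin.≟ punchIn p i
      ... | yes e = ⊥-elim (Finₚ.punchInᵢ≢i p i (sym e))
      ... | no p≢ = cong f (trans (Finₚ.punchOut-cong p refl) (Finₚ.punchOut-punchIn p))

-- Counting and distances

∧-true : ∀ {a b} → a ∧ b ≡ true → a ≡ true × b ≡ true
∧-true {true} {true} refl = refl , refl

∧-intro : ∀ {a b} → a ≡ true → b ≡ true → a ∧ b ≡ true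
∧-intro refl refl = refl

true≢false : true ≢ false
true≢false ()

T⇒≡ : ∀ {b} → T b → b ≡ true
T⇒≡ {true} _ = refl

≡⇒T : ∀ {b} → b ≡ true → T b
≡⇒T refl = _

≡ᵇ-true : ∀ m n → (m ≡ᵇ n) ≡ true → m ≡ n
≡ᵇ-true m n e = ℕₚ.≡ᵇ⇒≡ m n (≡⇒T e)

≡ᵇ-intro : ∀ {m n} → m ≡ n → (m ≡ᵇ n) ≡ true
≡ᵇ-intro {m} {n} e = T⇒≡ (ℕₚ.≡⇒≡ᵇ m n e)

≡ᵇ-false : ∀ {m n} → m ≢ n → (m ≡ᵇ n) ≡ false
≡ᵇ-false {m} {n} m≢n with m ≡ᵇ n in e
... | true  = ⊥-elim (m≢n (≡ᵇ-true m n e))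
... | false = refl

≢true⇒false : ∀ {b} → b ≢ true → b ≡ false
≢true⇒false {true}  h = ⊥-elim (h refl)
≢true⇒false {false} h = refl

bool-ext : ∀ {a b} → (a ≡ true → b ≡ true) → (b ≡ true → a ≡ true) → a ≡ b
bool-ext {true}  {b}     f g = sym (f refl)
bool-ext {false} {true}  f g = g refl
bool-ext {false} {false} f g = refl

eqᵇ : ∀ {m} → Fin m → Fin m → Bool
eqᵇ x y = does (x Fin.≟ y)

eqᵇ-true : ∀ {m} (x y : Fin m) → eqᵇ x y ≡ true → x ≡ y
eqᵇ-true x y e with x Fin.≟ y
... | yes x≡y = x≡y

eqᵇ-refl : ∀ {m} (x : Fin m) → eqᵇ x x ≡ true
eqᵇ-refl x with x Fin.≟ x
... | yes _ = refl
... | no x≢x = ⊥-elim (x≢x refl)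

eqᵇ-false : ∀ {m} {x y : Fin m} → x ≢ y → eqᵇ x y ≡ false
eqᵇ-false {x = x} {y} x≢y with x Fin.≟ y
... | yes x≡y = ⊥-elim (x≢y x≡y)
... | no _ = refl

not-eqᵇ : ∀ {m} {x y : Fin m} → x ≢ y → not (eqᵇ x y) ≡ true
not-eqᵇ x≢y = cong not (eqᵇ-false x≢y)

not-eqᵇ-elim : ∀ {m} (x y : Fin m) → not (eqᵇ x y) ≡ true → x ≢ y
not-eqᵇ-elim x .x e refl with eqᵇ x x | eqᵇ-refl x
not-eqᵇ-elim x .x () refl | true | refl

bit : Bool → ℕ
bit b = if b then 1 else 0

count-cong : ∀ {m} {p q : Fin m → Bool} → (∀ z → p z ≡ q z) → count p ≡ count q
count-cong {zero}  h = refl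
count-cong {suc m} h = cong₂ _+_ (cong bit (h zero)) (count-cong (h ∘ suc))

count-none : ∀ {m} {p : Fin m → Bool} → (∀ z → p z ≡ false) → count p ≡ 0
count-none {zero}  h = refl
count-none {suc m} h = cong₂ _+_ (cong bit (h zero)) (count-none (h ∘ suc))

count-pos : ∀ {m} {p : Fin m → Bool} z → p z ≡ true → 0 < count p
count-pos {suc m} {p} zero e = ℕₚ.≤-trans (ℕₚ.≤-reflexive (sym (cong bit e))) (ℕₚ.m≤m+n _ _)
count-pos {suc m} {p} (suc z) e = ℕₚ.≤-trans (count-pos z e) (ℕₚ.m≤n+m _ _)

count-∃ : ∀ {m} (p : Fin m → Bool) → 0 < count p → ∃ λ z → p z ≡ true
count-∃ {suc m} p h with p zero in e
... | true  = zero , e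
... | false = let z , pz = count-∃ (p ∘ suc) h in suc z , pz

count-split : ∀ {m} (p q : Fin m → Bool) → count p ≡ count (λ z → p z ∧ q z) + count (λ z → p z ∧ not (q z))
count-split {zero}  p q = refl
count-split {suc m} p q with p zero | q zero | count-split (p ∘ suc) (q ∘ suc)
... | true  | true  | ih = cong suc ih
... | true  | false | ih = trans (cong suc ih) (sym (ℕₚ.+-suc _ _))
... | false | _     | ih = ih

count-eq : ∀ {m} (x : Fin m) → count (eqᵇ x) ≡ 1
count-eq {suc m} zero = cong suc (count-none {p = λ z → eqᵇ {suc m} zero (suc z)} (λ z → refl))
count-eq {suc m} (suc x) = trans (count-cong shift) (count-eq x)
  where
  shift : ∀ z → eqᵇ (suc x) (suc z) ≡ eqᵇ x z
  shift z = bool-ext (λ e → subst (λ z → eqᵇ x z ≡ true) (Finₚ.suc-injective (eqᵇ-true (suc x) (suc z) e)) (eqᵇ-refl x))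
                     (λ e → subst (λ z → eqᵇ (suc x) (suc z) ≡ true) (eqᵇ-true x z e) (eqᵇ-refl (suc x)))

count-remove : ∀ {m} (p : Fin m → Bool) x → p x ≡ true → count p ≡ suc (count (λ z → p z ∧ not (eqᵇ x z)))
count-remove p x px = trans (count-split p (eqᵇ x)) (cong (_+ count (λ z → p z ∧ not (eqᵇ x z)))
  (trans (count-cong (λ z → bool-ext (λ e → proj₂ (∧-true {p z} e)) (λ e → ∧-intro (subst (λ z → p z ≡ true) (eqᵇ-true x z e) px) e))) (count-eq x)))

count-other : ∀ {m} (p : Fin m → Bool) x → 1 < count p → ∃ λ z → p z ≡ true × x ≢ z
count-other p x h with p x in px
... | true = let z , e = count-∃ _ (ℕₚ.≤-pred (subst (1 <_) (count-remove p x px) h))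
                 pz , ne = ∧-true {p z} e in z , pz , not-eqᵇ-elim x z ne
... | false = let z , pz = count-∃ p (ℕₚ.<-trans (s≤s z≤n) h) in z , pz , λ { refl → true≢false (trans (sym pz) px) }

count-mono : ∀ {m} {p q : Fin m → Bool} → (∀ z → p z ≡ true → q z ≡ true) → count p ≤ count q
count-mono {p = p} {q} h = ℕₚ.≤-trans (ℕₚ.≤-reflexive (count-cong (λ z → bool-ext {p z} {q z ∧ p z} (λ e → ∧-intro (h z e) e) (λ e → proj₂ (∧-true {q z} e)))))
  (ℕₚ.≤-trans (ℕₚ.m≤m+n _ _) (ℕₚ.≤-reflexive (sym (count-split q p))))

count-unique : ∀ {m} {p : Fin m → Bool} → count p ≤ 1 → ∀ {x y} → p x ≡ true → p y ≡ true → x ≡ y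
count-unique {p = p} h {x} {y} px py with x Fin.≟ y
... | yes x≡y = x≡y
... | no x≢y = ⊥-elim (ℕₚ.<-irrefl refl (ℕₚ.≤-trans (s≤s (count-pos y (∧-intro py (not-eqᵇ x≢y)))) (ℕₚ.≤-trans (ℕₚ.≤-reflexive (sym (count-remove p x px))) h)))

count-single : ∀ {m} {p : Fin m → Bool} x → p x ≡ true → (∀ y → p y ≡ true → x ≡ y) → count p ≡ 1
count-single {p = p} x px uniq = trans (count-cong (λ z → bool-ext (λ e → subst (λ z → eqᵇ x z ≡ true) (uniq z e) (eqᵇ-refl x)) (λ e → subst (λ z → p z ≡ true) (eqᵇ-true x z e) px))) (count-eq x)

total : ∀ {m} → (Fin m → ℕ) → ℕ
total {zero}  f = 0
total {suc m} f = f zero + total (f ∘ suc)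

private
  total-+ : ∀ {m} (f g : Fin m → ℕ) → total (λ i → f i + g i) ≡ total f + total g
  total-+ {zero}  f g = refl
  total-+ {suc m} f g = trans (cong (λ t → (f zero + g zero) + t) (total-+ (f ∘ suc) (g ∘ suc))) (interchange (f zero) (g zero) _ _)
    where
    interchange : ∀ a b s t → (a + b) + (s + t) ≡ (a + s) + (b + t)
    interchange = ℕR.solve-∀

  total-zero : ∀ m → total {m} (λ _ → 0) ≡ 0
  total-zero zero    = refl
  total-zero (suc m) = total-zero m

  total-swap : ∀ {m k} (r : Fin m → Fin k → Bool) → total (λ i → count (r i)) ≡ total (λ j → count (λ i → r i j))
  total-swap {zero}  {k} r = sym (total-zero k)
  total-swap {suc m} r = trans (cong (λ t → count (r zero) + t) (total-swap (r ∘ suc)))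
    (trans (cong (_+ total (λ j → count (λ i → r (suc i) j))) (count-total (r zero))) (sym (total-+ (bit ∘ r zero) (λ j → count (λ i → r (suc i) j)))))
    where
    count-total : ∀ {k} (p : Fin k → Bool) → count p ≡ total (bit ∘ p)
    count-total {zero}  p = refl
    count-total {suc k} p = cong (λ t → bit (p zero) + t) (count-total (p ∘ suc))

  total-const : ∀ {m k} (p : Fin m → Bool) (r : Fin m → Fin k → Bool) a →
                (∀ i → p i ≡ true → count (r i) ≡ a) → (∀ i → p i ≡ false → count (r i) ≡ 0) → total (λ i → count (r i)) ≡ count p * a
  total-const {zero}  p r a h₁ h₀ = refl
  total-const {suc m} p r a h₁ h₀ with p zero | h₁ zero | h₀ zero | total-const (p ∘ suc) (r ∘ suc) a (h₁ ∘ suc) (h₀ ∘ suc)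
  ... | true  | e₁ | _  | ih = cong₂ _+_ (e₁ refl) ih
  ... | false | _  | e₀ | ih = trans (cong (_+ total (λ i → count (r (suc i)))) (e₀ refl)) ih

double-count : ∀ {m k} (p : Fin m → Bool) (q : Fin k → Bool) (r : Fin m → Fin k → Bool) a b →
               (∀ i → p i ≡ true → count (λ j → q j ∧ r i j) ≡ a) →
               (∀ j → q j ≡ true → count (λ i → p i ∧ r i j) ≡ b) →
               count p * a ≡ count q * b
double-count p q r a b hp hq = trans (sym (total-const p R a
    (λ i pi → trans (count-cong (λ j → cong (_∧ (q j ∧ r i j)) pi)) (hp i pi))
    (λ i pi → count-none (λ j → cong (_∧ (q j ∧ r i j)) pi))))
  (trans (total-swap R) (total-const q (λ j i → R i j) b
    (λ j qj → trans (count-cong (λ i → cong (p i ∧_) (cong (_∧ r i j) qj))) (hq j qj))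
    (λ j qj → count-none (λ i → trans (cong (p i ∧_) (cong (_∧ r i j) qj)) (Boolₚ.∧-zeroʳ (p i))))))
  where R = λ i j → p i ∧ (q j ∧ r i j)

module Metric (G : Graph) (conn : Connected G) where
  open Graph G public using (n; adj; irrefl) renaming (sym to adj-sym)

  d : Fin n → Fin n → ℕ
  d = dist G

  _~_ : Fin n → Fin n → Set
  x ~ y = adj x y ≡ true
  infix 4 _~_

  ~-sym : ∀ {x y} → x ~ y → y ~ x
  ~-sym {x} {y} e = trans (adj-sym y x) e

  ~⇒≢ : ∀ {x y} → x ~ y → x ≢ y
  ~⇒≢ {x} e refl = true≢false (trans (sym e) (irrefl x))

  private
    W : ℕ → Fin n → Fin n → Set
    W m x y = within G m x y ≡ true

    anyFin-intro : ∀ {m} (p : Fin m → Bool) z → p z ≡ true → anyFin G p ≡ true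
    anyFin-intro p zero    e = cong (_∨ anyFin G (p ∘ suc)) e
    anyFin-intro p (suc z) e = trans (cong (p zero ∨_) (anyFin-intro (p ∘ suc) z e)) (Boolₚ.∨-zeroʳ (p zero))

    anyFin-elim : ∀ {m} (p : Fin m → Bool) → anyFin G p ≡ true → ∃ λ z → p z ≡ true
    anyFin-elim {suc m} p e with p zero in e₀
    ... | true  = zero , e₀
    ... | false = let z , pz = anyFin-elim (p ∘ suc) e in suc z , pz

    W-mono : ∀ m {x y} → W m x y → W (suc m) x y
    W-mono m {x} {y} w = cong (_∨ anyFin G (λ z → adj x z ∧ within G m z y)) w

    W-cons : ∀ m {x z y} → x ~ z → W m z y → W (suc m) x y
    W-cons m {x} {z} {y} a w = trans (cong (within G m x y ∨_) (anyFin-intro _ z (∧-intro a w))) (Boolₚ.∨-zeroʳ _)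

    W-case : ∀ m {x y} → W (suc m) x y → W m x y ⊎ (∃ λ z → x ~ z × W m z y)
    W-case m {x} {y} w with within G m x y
    ... | true = inj₁ refl
    ... | false = let z , e = anyFin-elim _ w in inj₂ (z , ∧-true {adj x z} e)

    W-0 : ∀ x → W 0 x x
    W-0 x with x Fin.≟ x
    ... | yes _ = refl
    ... | no x≢x = ⊥-elim (x≢x refl)

    W-0⇒≡ : ∀ {x y} → W 0 x y → x ≡ y
    W-0⇒≡ {x} {y} e with x Fin.≟ y
    ... | yes x≡y = x≡y

    W-snoc : ∀ m {x z y} → W m x z → z ~ y → W (suc m) x y
    W-snoc zero {x} {z} {y} w a with W-0⇒≡ w
    ... | refl = W-cons 0 a (W-0 y)
    W-snoc (suc m) w a with W-case m w
    ... | inj₁ w′ = W-mono (suc m) (W-snoc m w′ a)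
    ... | inj₂ (u , a′ , w′) = W-cons (suc m) a′ (W-snoc m w′ a)

    W-sym : ∀ m {x y} → W m x y → W m y x
    W-sym zero {x} w with W-0⇒≡ w
    ... | refl = W-0 x
    W-sym (suc m) w with W-case m w
    ... | inj₁ w′ = W-mono m (W-sym m w′)
    ... | inj₂ (u , a , w′) = W-snoc m (W-sym m w′) (~-sym a)

    W-trans : ∀ m k {x y z} → W m x y → W k y z → W (m + k) x z
    W-trans zero k {x} w w′ with W-0⇒≡ w
    ... | refl = w′
    W-trans (suc m) k w w′ with W-case m w
    ... | inj₁ v = W-mono (m + k) (W-trans m k v w′)
    ... | inj₂ (u , a , v) = W-cons (m + k) a (W-trans m k v w′)

    search-spec : ∀ (p : ℕ → Bool) i fuel → p (i + fuel) ≡ true → p (search G p i fuel) ≡ true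
    search-spec p i zero e = trans (cong p (sym (ℕₚ.+-identityʳ i))) e
    search-spec p i (suc f) e with p i in e₀
    ... | true = e₀
    ... | false = search-spec p (suc i) f (trans (cong p (sym (ℕₚ.+-suc i f))) e)

    search-least : ∀ (p : ℕ → Bool) i fuel j → i ≤ j → p j ≡ true → search G p i fuel ≤ j
    search-least p i zero j i≤j e = i≤j
    search-least p i (suc f) j i≤j e with p i in e₀
    ... | true = i≤j
    ... | false = search-least p (suc i) f j (ℕₚ.≤∧≢⇒< i≤j (λ { refl → true≢false (trans (sym e) e₀) })) e

    W-d : ∀ x y → W (d x y) x y
    W-d x y = search-spec (λ m → within G m x y) 0 n (T⇒≡ (conn x y))

    d≤ : ∀ {m x y} → W m x y → d x y ≤ m
    d≤ {m} {x} {y} w = search-least (λ m → within G m x y) 0 n m z≤n w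

  d-refl : ∀ x → d x x ≡ 0
  d-refl x = ℕₚ.n≤0⇒n≡0 (d≤ (W-0 x))

  d≡0⇒≡ : ∀ {x y} → d x y ≡ 0 → x ≡ y
  d≡0⇒≡ {x} {y} e = W-0⇒≡ (subst (λ m → W m x y) e (W-d x y))

  d-sym : ∀ x y → d x y ≡ d y x
  d-sym x y = ℕₚ.≤-antisym (d≤ (W-sym (d y x) (W-d y x))) (d≤ (W-sym (d x y) (W-d x y)))

  d-triangle : ∀ x y z → d x z ≤ d x y + d y z
  d-triangle x y z = d≤ (W-trans (d x y) (d y z) (W-d x y) (W-d y z))

  d≤1 : ∀ {x y} → x ~ y → d x y ≤ 1
  d≤1 {x} {y} a = d≤ (W-cons 0 a (W-0 y))

  d-pos : ∀ {x y} → x ≢ y → 0 < d x y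
  d-pos x≢y = ℕₚ.n≢0⇒n>0 (λ e → x≢y (d≡0⇒≡ e))

  ~⇒d≡1 : ∀ {x y} → x ~ y → d x y ≡ 1
  ~⇒d≡1 a = ℕₚ.≤-antisym (d≤1 a) (d-pos (~⇒≢ a))

  d-step : ∀ {x y m} → d x y ≡ suc m → ∃ λ z → x ~ z × d z y ≡ m
  d-step {x} {y} {m} e with W-case m (subst (λ m → W m x y) e (W-d x y))
  ... | inj₁ w = ⊥-elim (ℕₚ.<-irrefl refl (ℕₚ.≤-trans (ℕₚ.≤-reflexive (sym e)) (d≤ w)))
  ... | inj₂ (z , a , w) = z , a , ℕₚ.≤-antisym (d≤ w)
        (ℕₚ.≤-pred (ℕₚ.≤-trans (ℕₚ.≤-reflexive (sym e)) (ℕₚ.≤-trans (d-triangle x z y) (ℕₚ.+-monoˡ-≤ (d z y) (d≤1 a)))))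

  d≡1⇒~ : ∀ {x y} → d x y ≡ 1 → x ~ y
  d≡1⇒~ {x} e with d-step e
  ... | z , a , e₀ = subst (x ~_) (d≡0⇒≡ e₀) a

  d-near : ∀ {x z} y → x ~ z → d z y ≤ suc (d x y)
  d-near {x} {z} y a = ℕₚ.≤-trans (d-triangle z x y) (ℕₚ.+-monoˡ-≤ (d x y) (d≤1 (~-sym a)))

  adj≡ : ∀ x y → adj x y ≡ (d x y ≡ᵇ 1)
  adj≡ x y = bool-ext (λ e → ≡ᵇ-intro (~⇒d≡1 e)) (λ e → d≡1⇒~ (≡ᵇ-true _ _ e))

  pair-at : ∀ {D} x y → d x y ≡ D → ∀ h → h ≤ D → ∃ λ x′ → d x′ y ≡ h
  pair-at {zero} x y e zero z≤n = x , e
  pair-at {suc D} x y e h h≤ with h ℕ.≟ suc D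
  ... | yes refl = x , e
  ... | no h≢ = let z , _ , e′ = d-step e in pair-at z y e′ h (ℕₚ.≤-pred (ℕₚ.≤∧≢⇒< h≤ h≢))

-- The Bose–Mesner algebra and the balanced relation

module BoseMesner (G : Graph) (conn : Connected G) (D : ℕ) (d≤D : ∀ x y → dist G x y ≤ D) (1≤D : 1 ≤ D)
                  (K : Char0Field 0ℓ 0ℓ) (stable : ∀ {x y} → ¬ ¬ (Char0Field._≈_ K x y) → Char0Field._≈_ K x y) where
  open Metric G conn
  open FieldKit K
  open LinearAlgebra K
  open Definite stable
  open SetoidReasoning setoid

  V : List (Fin n)
  V = allFin n

  δ : Bool → Carrier
  δ b = if b then 1# else 0#

  private
    sum = MonoidSum.sum (CommutativeRing.+-commutativeMonoid cring)

  abstract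
    ix : List (Fin (suc D))
    ix = allFin (suc D)

    ix-delta : (f : Fin (suc D) → Carrier) (i : Fin (suc D)) → (∀ j → j ≢ i → f j ≈ 0#) → ∑ ix f ≈ f i
    ix-delta = ∑-delta

    ix-sum : (f : Fin (suc D) → Carrier) → ∑ ix f ≈ sum f
    ix-sum f = ∑-tabulate id f f (λ _ → ≈-refl)

  at : ∀ {h} → h ≤ D → Fin (suc D)
  at h≤D = fromℕ< (s≤s h≤D)

  toℕ-at : ∀ {h} (h≤D : h ≤ D) → toℕ (at h≤D) ≡ h
  toℕ-at h≤D = Finₚ.toℕ-fromℕ< (s≤s h≤D)

  one : Fin (suc D)
  one = at 1≤D

  select : (f : ℕ → Carrier) (h : ℕ) → h ≤ D → ∑ ix (λ j → f (toℕ j) ⊛ δ (h ≡ᵇ toℕ j)) ≈ f h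
  select f h h≤D = ≈-trans (ix-delta _ (at h≤D) off) on
    where
    off : ∀ j → j ≢ at h≤D → f (toℕ j) ⊛ δ (h ≡ᵇ toℕ j) ≈ 0#
    off j j≢ = ≈-trans (*-cong ≈-refl (≈-reflexive (cong δ (≡ᵇ-false (λ h≡ → j≢ (Finₚ.toℕ-injective (trans (sym h≡) (sym (toℕ-at h≤D)))))))))
                 (zeroʳ _)
    on : f (toℕ (at h≤D)) ⊛ δ (h ≡ᵇ toℕ (at h≤D)) ≈ f h
    on = ≈-trans (*-cong (≈-reflexive (cong f (toℕ-at h≤D))) (≈-reflexive (cong δ (≡ᵇ-intro (sym (toℕ-at h≤D)))))) (*-identityʳ _)

  δ-∧ : ∀ a b → δ (a ∧ b) ≈ δ a ⊛ δ b
  δ-∧ true  b = ≈-sym (*-identityˡ _)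
  δ-∧ false b = ≈-sym (zeroˡ _)

  bitℤ : Bool → ℤ
  bitℤ b = if b then + 1 else + 0

  ι-bit : ∀ b → ι (bitℤ b) ≈ δ b
  ι-bit true  = ι-1
  ι-bit false = ≈-refl

  module Idempotents
    (e : Fin (suc D) → ℕ → Carrier)
    (idem : ∀ i j x y → ∑ V (λ w → e i (d x w) ⊛ e j (d w y)) ≈ (if toℕ i ≡ᵇ toℕ j then e i (d x y) else 0#))
    (nonzero : ∀ i → ¬ (∀ x y → e i (d x y) ≈ 0#))
    (unit : ∀ x y → ∑ ix (λ i → e i (d x y)) ≈ δ (eqᵇ x y))
    (const₀ : ∀ x y → e zero (d x y) ≈ ν n ⁻¹)
    (n≉0 : ¬ ν n ⁻¹ ≈ 0#)
    (q : Fin (suc D) → Fin (suc D) → Fin (suc D) → Carrier)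
    (krein : ∀ i j x y → e i (d x y) ⊛ e j (d x y) ≈ ν n ⁻¹ ⊛ ∑ ix (λ h → q h i j ⊛ e h (d x y)))
    (q-vanish : ∀ i j → i ≢ j → ¬ (toℕ i ≡ suc (toℕ j) ⊎ toℕ j ≡ suc (toℕ i)) → q one i j ≈ 0#)
    (q-nonzero : ∀ i j → toℕ i ≡ suc (toℕ j) → ¬ q one i j ≈ 0#)
    where

    idem-same : ∀ i x y → ∑ V (λ w → e i (d x w) ⊛ e i (d w y)) ≈ e i (d x y)
    idem-same i x y = ≈-trans (idem i i x y) (≈-reflexive (cong (if_then e i (d x y) else 0#) (≡ᵇ-intro {toℕ i} refl)))

    idem-diff : ∀ {i j} x y → i ≢ j → ∑ V (λ w → e i (d x w) ⊛ e j (d w y)) ≈ 0#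
    idem-diff {i} {j} x y i≢j = ≈-trans (idem i j x y) (≈-reflexive (cong (if_then e i (d x y) else 0#) (≡ᵇ-false (λ eq → i≢j (Finₚ.toℕ-injective eq)))))

    e-sym : ∀ i x y → e i (d x y) ≈ e i (d y x)
    e-sym i x y = ≈-reflexive (cong (e i) (d-sym x y))

    scalar0 : ∀ i {c} → (∀ x y → c ⊛ e i (d x y) ≈ 0#) → c ≈ 0#
    scalar0 i h = stable (λ c≉0 → nonzero i (λ x y → cancel0 c≉0 (h x y)))

    -- Distinct idempotents annihilate each other, so multiplication by the `r`-th reads off the
    -- coefficient at `r`.
    project : (c : Fin (suc D) → Carrier) (r : Fin (suc D)) (x z : Fin n) →
              ∑ V (λ y → ∑ ix (λ i → c i ⊛ e i (d x y)) ⊛ e r (d y z)) ≈ c r ⊛ e r (d x z)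
    project c r x z = begin
      ∑ V (λ y → ∑ ix (λ i → c i ⊛ e i (d x y)) ⊛ e r (d y z))
        ≈⟨ ∑-cong V (λ y → ≈-trans (≈-sym (∑-*ʳ ix _ _)) (∑-cong ix (λ i → *-assoc _ _ _))) ⟩
      ∑ V (λ y → ∑ ix (λ i → c i ⊛ (e i (d x y) ⊛ e r (d y z))))
        ≈⟨ ≈-trans (∑-swap V ix _) (∑-cong ix (λ i → ∑-*ˡ V (c i) _)) ⟩
      ∑ ix (λ i → c i ⊛ ∑ V (λ y → e i (d x y) ⊛ e r (d y z)))
        ≈⟨ ix-delta _ r (λ i i≢r → ≈-trans (*-cong ≈-refl (idem-diff x z i≢r)) (zeroʳ _)) ⟩
      c r ⊛ ∑ V (λ y → e r (d x y) ⊛ e r (d y z))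
        ≈⟨ *-cong ≈-refl (idem-same r x z) ⟩
      c r ⊛ e r (d x z) ∎

    -- `μ i` is the eigenvalue of the `a`-th distance matrix on the image of the `i`-th idempotent.
    Spans : ℕ → (Fin (suc D) → Carrier) → Set
    Spans a μ = ∀ x y → δ (d x y ≡ᵇ a) ≈ ∑ ix (λ i → μ i ⊛ e i (d x y))

    -- The indicator of distance `a` and the D + 1 idempotents are D + 2 functions on D + 1
    -- distances, hence dependent. The coefficient of the indicator is nonzero, since `project`
    -- shows the idempotents to be independent.
    spanned : ∀ a → ¬ ¬ Σ (Fin (suc D) → Carrier) (Spans a)
    spanned a k = dependent (suc D) vec λ { (b , (i₀ , b≉0) , rel) → conclude b i₀ b≉0 rel }
      where
      vec : Fin (suc (suc D)) → Fin (suc D) → Carrier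
      vec zero    j = δ (toℕ j ≡ᵇ a)
      vec (suc i) j = e i (toℕ j)

      conclude : ∀ b i₀ → ¬ b i₀ ≈ 0# → (∀ j → sum (λ i → b i ⊛ vec i j) ≈ 0#) → ⊥
      conclude b i₀ b≉0 rel = k ((λ i → ⊖ (b zero ⁻¹ ⊛ b (suc i))) , spans)
        where
        rel′ : ∀ x y → b zero ⊛ δ (d x y ≡ᵇ a) ⊕ ∑ ix (λ i → b (suc i) ⊛ e i (d x y)) ≈ 0#
        rel′ x y = ≈-trans (+-cong ≈-refl (ix-sum _))
          (subst (λ h → b zero ⊛ δ (h ≡ᵇ a) ⊕ sum (λ i → b (suc i) ⊛ e i h) ≈ 0#) (toℕ-at (d≤D x y)) (rel (at (d≤D x y))))

        b₀≉0 : ¬ b zero ≈ 0#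
        b₀≉0 b₀≈0 = all0 i₀ b≉0
          where
          rel″ : ∀ x y → ∑ ix (λ i → b (suc i) ⊛ e i (d x y)) ≈ 0#
          rel″ x y = ≈-trans (≈-sym (≈-trans (+-cong (≈-trans (*-cong b₀≈0 ≈-refl) (zeroˡ _)) ≈-refl) (+-identityˡ _))) (rel′ x y)
          all0 : ∀ i → ¬ ¬ (b i ≈ 0#)
          all0 zero    h = h b₀≈0
          all0 (suc r) h = h (scalar0 r (λ x z → ≈-trans (≈-sym (project (b ∘ suc) r x z))
                             (∑-zero V (λ y → ≈-trans (*-cong (rel″ x y) ≈-refl) (zeroˡ _)))))

        spans : ∀ x y → δ (d x y ≡ᵇ a) ≈ ∑ ix (λ i → ⊖ (b zero ⁻¹ ⊛ b (suc i)) ⊛ e i (d x y))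
        spans x y = cancelˡ b₀≉0 (begin
          b zero ⊛ δ (d x y ≡ᵇ a)
            ≈⟨ lc₁ 1# (rel′ x y) (≈-sym (≈-trans (*-identityˡ _) (ring-solve 2 (λ p s → (p :+ s) :- # 0 :≈ p :- (:- s)) ≈-refl _ _))) ⟩
          ⊖ ∑ ix (λ i → b (suc i) ⊛ e i (d x y))
            ≈⟨ ≈-trans (≈-sym (∑-neg ix _)) (∑-cong ix (λ i → ≈-trans (-‿distribˡ-* _ _) (*-cong (-‿cong (≈-sym (≈-trans (*-cong (inverseʳ _ b₀≉0) ≈-refl) (*-identityˡ _)))) ≈-refl))) ⟩
          ∑ ix (λ i → ⊖ (b zero ⊛ b zero ⁻¹ ⊛ b (suc i)) ⊛ e i (d x y))
            ≈⟨ ∑-cong ix (λ i → ring-solve 4 (λ b c s t → (:- (b :* c :* s)) :* t :≈ b :* ((:- (c :* s)) :* t)) ≈-refl _ _ _ _) ⟩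
          ∑ ix (λ i → b zero ⊛ (⊖ (b zero ⁻¹ ⊛ b (suc i)) ⊛ e i (d x y)))
            ≈⟨ ∑-*ˡ ix _ _ ⟩
          b zero ⊛ ∑ ix (λ i → ⊖ (b zero ⁻¹ ⊛ b (suc i)) ⊛ e i (d x y)) ∎)

    eigen : ∀ {a μ} → Spans a μ → ∀ i x z → ∑ V (λ y → δ (d x y ≡ᵇ a) ⊛ e i (d y z)) ≈ μ i ⊛ e i (d x z)
    eigen {a} {μ} span i x z = ≈-trans (∑-cong V (λ y → *-cong (span x y) ≈-refl)) (project μ i x z)

    W : ℕ → Carrier
    W = e one

    -- Over the reals the diagonal entry is a multiplicity divided by `n`. Here a row of E₁ is a
    -- combination of the 0-1 rows of the distance matrices, and its product with such a row is an
    -- eigenvalue times `W 0`. If that vanishes, `gram` makes E₁ zero.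
    diagonal≉0 : ¬ W 0 ≈ 0#
    diagonal≉0 W₀≈0 = nonzero one (λ x y → ≈-trans (≈-sym (comb x y)) (gram V ix (W ∘ toℕ) (v x) (orth x) y (∈-allFin y)))
      where
      v : Fin n → Fin (suc D) → Fin n → ℤ
      v x j y = bitℤ (d x y ≡ᵇ toℕ j)
      comb : ∀ x y → combination ix (W ∘ toℕ) (v x) y ≈ W (d x y)
      comb x y = ≈-trans (∑-cong ix (λ j → *-cong ≈-refl (ι-bit _))) (select W (d x y) (d≤D x y))
      orth : ∀ x j → ∑ V (λ y → ι (v x j y) ⊛ combination ix (W ∘ toℕ) (v x) y) ≈ 0#
      orth x j = stable λ k → spanned (toℕ j) λ (μ , span) → k (begin
        ∑ V (λ y → ι (v x j y) ⊛ combination ix (W ∘ toℕ) (v x) y)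
          ≈⟨ ∑-cong V (λ y → *-cong (ι-bit _) (≈-trans (comb x y) (e-sym one x y))) ⟩
        ∑ V (λ y → δ (d x y ≡ᵇ toℕ j) ⊛ W (d y x))
          ≈⟨ eigen span one x x ⟩
        μ one ⊛ W (d x x)
          ≈⟨ ≈-trans (*-cong ≈-refl (≈-trans (≈-reflexive (cong W (d-refl x))) W₀≈0)) (zeroʳ _) ⟩
        0# ∎)

    krein-sum : ∀ i j r x y → ∑ V (λ w → (e i (d x w) ⊛ e j (d x w)) ⊛ e r (d w y)) ≈ ν n ⁻¹ ⊛ (q r i j ⊛ e r (d x y))
    krein-sum i j r x y = begin
      ∑ V (λ w → (e i (d x w) ⊛ e j (d x w)) ⊛ e r (d w y))
        ≈⟨ ∑-cong V (λ w → ≈-trans (*-cong (krein i j x w) ≈-refl) (*-assoc _ _ _)) ⟩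
      ∑ V (λ w → ν n ⁻¹ ⊛ (∑ ix (λ h → q h i j ⊛ e h (d x w)) ⊛ e r (d w y)))
        ≈⟨ ∑-*ˡ V _ _ ⟩
      ν n ⁻¹ ⊛ ∑ V (λ w → ∑ ix (λ h → q h i j ⊛ e h (d x w)) ⊛ e r (d w y))
        ≈⟨ *-cong ≈-refl (project (λ h → q h i j) r x y) ⟩
      ν n ⁻¹ ⊛ (q r i j ⊛ e r (d x y)) ∎

    -- The triple product Σ_w E₁(x,w)Eᵢ(y,w)Eⱼ(z,w), as an array in y and z, is a combination of the arrays
    -- A_b(w,y)A_c(w,z) and orthogonal to all of them when the Krein parameter vanishes.
    triple-vanish : ∀ i j → q one i j ≈ 0# → ∀ x y z → ∑ V (λ w → W (d x w) ⊛ (e i (d w y) ⊛ e j (d w z))) ≈ 0#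
    triple-vanish i j q≈0 x y z = ≈-trans (≈-sym (comb (y , z))) (gram (cartesianProduct V V) idx f v orth (y , z) (∈-cartesianProduct⁺ (∈-allFin y) (∈-allFin z)))
      where
      Idx = Fin n × (Fin (suc D) × Fin (suc D))
      idx : List Idx
      idx = cartesianProduct V (cartesianProduct ix ix)
      f : Idx → Carrier
      f (w , b , c) = W (d x w) ⊛ (e i (toℕ b) ⊛ e j (toℕ c))
      v : Idx → Fin n × Fin n → ℤ
      v (w , b , c) (y , z) = bitℤ ((d w y ≡ᵇ toℕ b) ∧ (d w z ≡ᵇ toℕ c))

      ι-v : ∀ w b c y z → ι (v (w , b , c) (y , z)) ≈ δ (d w y ≡ᵇ toℕ b) ⊛ δ (d w z ≡ᵇ toℕ c)
      ι-v w b c y z = ≈-trans (ι-bit _) (δ-∧ (d w y ≡ᵇ toℕ b) _)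

      comb : ∀ p → combination idx f v p ≈ ∑ V (λ w → W (d x w) ⊛ (e i (d w (proj₁ p)) ⊛ e j (d w (proj₂ p))))
      comb (y , z) = ≈-trans (∑-cartesian V _ _) (∑-cong V inner)
        where
        inner : ∀ w → ∑ (cartesianProduct ix ix) (λ bc → f (w , bc) ⊛ ι (v (w , bc) (y , z))) ≈ W (d x w) ⊛ (e i (d w y) ⊛ e j (d w z))
        inner w = begin
          ∑ (cartesianProduct ix ix) (λ bc → f (w , bc) ⊛ ι (v (w , bc) (y , z)))
            ≈⟨ ∑-cartesian ix ix _ ⟩
          ∑ ix (λ b → ∑ ix (λ c → f (w , b , c) ⊛ ι (v (w , b , c) (y , z))))
            ≈⟨ ∑-cong ix (λ b → ≈-trans (∑-cong ix (λ c → ≈-trans (*-cong ≈-refl (ι-v w b c y z))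
                 (ring-solve 5 (λ t a c s u → (t :* (a :* c)) :* (s :* u) :≈ (t :* (a :* s)) :* (c :* u)) ≈-refl _ _ _ _ _))) (∑-*ˡ ix _ _)) ⟩
          ∑ ix (λ b → (W (d x w) ⊛ (e i (toℕ b) ⊛ δ (d w y ≡ᵇ toℕ b))) ⊛ ∑ ix (λ c → e j (toℕ c) ⊛ δ (d w z ≡ᵇ toℕ c)))
            ≈⟨ ≈-trans (∑-*ʳ ix _ _) (*-cong (≈-trans (∑-*ˡ ix _ _) (*-cong ≈-refl (select (e i) (d w y) (d≤D w y)))) (select (e j) (d w z) (d≤D w z))) ⟩
          (W (d x w) ⊛ e i (d w y)) ⊛ e j (d w z)
            ≈⟨ *-assoc _ _ _ ⟩
          W (d x w) ⊛ (e i (d w y) ⊛ e j (d w z)) ∎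

      orth : ∀ a → ∑ (cartesianProduct V V) (λ p → ι (v a p) ⊛ combination idx f v p) ≈ 0#
      -- Summing over `y` and `z` applies two distance matrices to the i-th and j-th idempotents and
      -- produces eigenvalues. What is left is an entry of the entrywise product of these
      -- idempotents times E₁, a multiple of the Krein parameter.
      orth (w , b , c) = stable λ k → spanned (toℕ b) λ (μ , spanμ) → spanned (toℕ c) λ (κ , spanκ) → k (begin
        ∑ (cartesianProduct V V) (λ p → ι (v (w , b , c) p) ⊛ combination idx f v p)
          ≈⟨ ∑-cartesian V V _ ⟩
        ∑ V (λ y → ∑ V (λ z → ι (v (w , b , c) (y , z)) ⊛ combination idx f v (y , z)))
          ≈⟨ ∑-cong V (λ y → ∑-cong V (λ z → ≈-trans (*-cong (ι-v w b c y z) (comb (y , z)))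
               (≈-trans (≈-sym (∑-*ˡ V _ _)) (∑-cong V (λ u → ring-solve 5 (λ s t w a c → (s :* t) :* (w :* (a :* c)) :≈ (w :* (s :* a)) :* (t :* c)) ≈-refl _ _ _ _ _))))) ⟩
        ∑ V (λ y → ∑ V (λ z → ∑ V (λ u → (W (d x u) ⊛ (δ (d w y ≡ᵇ toℕ b) ⊛ e i (d u y))) ⊛ (δ (d w z ≡ᵇ toℕ c) ⊛ e j (d u z)))))
          ≈⟨ ≈-trans (∑-cong V (λ y → ∑-swap V V _)) (∑-swap V V _) ⟩
        ∑ V (λ u → ∑ V (λ y → ∑ V (λ z → (W (d x u) ⊛ (δ (d w y ≡ᵇ toℕ b) ⊛ e i (d u y))) ⊛ (δ (d w z ≡ᵇ toℕ c) ⊛ e j (d u z)))))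
          ≈⟨ ∑-cong V (λ u → ≈-trans (∑-cong V (λ y → ∑-*ˡ V _ _)) (≈-trans (∑-*ʳ V _ _) (*-cong (∑-*ˡ V _ _) ≈-refl))) ⟩
        ∑ V (λ u → (W (d x u) ⊛ ∑ V (λ y → δ (d w y ≡ᵇ toℕ b) ⊛ e i (d u y))) ⊛ ∑ V (λ z → δ (d w z ≡ᵇ toℕ c) ⊛ e j (d u z)))
          ≈⟨ ∑-cong V (λ u → *-cong (*-cong ≈-refl (≈-trans (∑-cong V (λ y → *-cong ≈-refl (e-sym i u y))) (eigen spanμ i w u)))
                                    (≈-trans (∑-cong V (λ z → *-cong ≈-refl (e-sym j u z))) (eigen spanκ j w u))) ⟩
        ∑ V (λ u → (W (d x u) ⊛ (μ i ⊛ e i (d w u))) ⊛ (κ j ⊛ e j (d w u)))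
          ≈⟨ ≈-trans (∑-cong V (λ u → ≈-trans (*-cong (*-cong (e-sym one x u) ≈-refl) ≈-refl) (ring-solve 5 (λ w m a k c → (w :* (m :* a)) :* (k :* c) :≈ (m :* k) :* ((a :* c) :* w)) ≈-refl _ _ _ _ _))) (∑-*ˡ V _ _) ⟩
        (μ i ⊛ κ j) ⊛ ∑ V (λ u → (e i (d w u) ⊛ e j (d w u)) ⊛ e one (d u x))
          ≈⟨ *-cong ≈-refl (krein-sum i j one w x) ⟩
        (μ i ⊛ κ j) ⊛ (ν n ⁻¹ ⊛ (q one i j ⊛ W (d w x)))
          ≈⟨ ≈-trans (*-cong ≈-refl (≈-trans (*-cong ≈-refl (≈-trans (*-cong q≈0 ≈-refl) (zeroˡ _))) (zeroʳ _))) (zeroʳ _) ⟩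
        0# ∎)

    -- Classically the two Krein parameters are proportional through multiplicities. Here the triple
    -- product with `z = x` carries the vanishing from one to the other.
    q′-vanish : ∀ i j → i ≢ j → ¬ (toℕ i ≡ suc (toℕ j) ⊎ toℕ j ≡ suc (toℕ i)) → q i one j ≈ 0#
    q′-vanish i j i≢j far = scalar0 i (λ x y → cancel0 n≉0 (≈-trans (≈-sym (krein-sum one j i x y))
      (≈-trans (∑-cong V (λ w → ≈-trans (*-cong (*-cong ≈-refl (e-sym j x w)) ≈-refl) (ring-solve 3 (λ a b c → (a :* b) :* c :≈ a :* (c :* b)) ≈-refl _ _ _)))
               (triple-vanish i j (q-vanish i j i≢j far) x y x))))

    -- With all three vertices equal the triple product is symmetric in its three idempotents.
    -- Evaluated in two ways it equates `q one i j ⊛ W 0` with a multiple of `q i one j`, and the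
    -- former is nonzero by `diagonal≉0`.
    q′-nonzero : ∀ i j → toℕ i ≡ suc (toℕ j) → Fin n → ¬ q i one j ≈ 0#
    q′-nonzero i j i≡ x q≈0 = *≉0 n≉0 (*≉0 (q-nonzero i j i≡) diagonal≉0) (begin
      ν n ⁻¹ ⊛ (q one i j ⊛ W 0)
        ≈⟨ *-cong ≈-refl (*-cong ≈-refl (≈-reflexive (cong W (sym (d-refl x))))) ⟩
      ν n ⁻¹ ⊛ (q one i j ⊛ W (d x x))
        ≈⟨ ≈-sym (krein-sum i j one x x) ⟩
      ∑ V (λ w → (e i (d x w) ⊛ e j (d x w)) ⊛ W (d w x))
        ≈⟨ ∑-cong V (λ w → ≈-trans (*-cong (*-cong (e-sym i x w) ≈-refl) (e-sym one w x)) (ring-solve 3 (λ a b c → (a :* b) :* c :≈ (c :* b) :* a) ≈-refl _ _ _)) ⟩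
      ∑ V (λ w → (W (d x w) ⊛ e j (d x w)) ⊛ e i (d w x))
        ≈⟨ krein-sum one j i x x ⟩
      ν n ⁻¹ ⊛ (q i one j ⊛ e i (d x x))
        ≈⟨ ≈-trans (*-cong ≈-refl (≈-trans (*-cong q≈0 ≈-refl) (zeroˡ _))) (zeroʳ _) ⟩
      0# ∎)

    -- Since E₁ generates the algebra under entrywise product, equal entries of E₁ force equal entries of every Eᵢ.
    W-distinct : ∀ x y x′ y′ → d x y ≢ d x′ y′ → ¬ W (d x y) ≈ W (d x′ y′)
    W-distinct x y x′ y′ a≢b Wa≈Wb = spanned (d x y) λ (μ , span) → nontrivial (begin
      1#                                  ≈⟨ ≈-reflexive (cong δ (sym (≡ᵇ-intro {d x y} refl))) ⟩
      δ (d x y ≡ᵇ d x y)                  ≈⟨ span x y ⟩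
      ∑ ix (λ i → μ i ⊛ e i (d x y))      ≈⟨ ∑-cong ix (λ i → *-cong ≈-refl (all-equal (toℕ i) i ℕₚ.≤-refl)) ⟩
      ∑ ix (λ i → μ i ⊛ e i (d x′ y′))    ≈⟨ ≈-sym (span x′ y′) ⟩
      δ (d x′ y′ ≡ᵇ d x y)                ≈⟨ ≈-reflexive (cong δ (≡ᵇ-false (a≢b ∘ sym))) ⟩
      0#                                  ∎)
      where
      a = d x y
      b = d x′ y′

      all-equal : ∀ m i → toℕ i ≤ m → e i a ≈ e i b
      -- In the Krein expansion of the entrywise product of E₁ and the r-th idempotent, indices up
      -- to `r` agree by induction and those above r + 1 have coefficient zero; so the term at r + 1
      -- must agree too.
      step : ∀ r i → toℕ i ≡ suc (toℕ r) → (∀ h → toℕ h ≤ toℕ r → e h a ≈ e h b) → e i a ≈ e i b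

      all-equal m zero _ = ≈-trans (const₀ x y) (≈-sym (const₀ x′ y′))
      all-equal (suc m) (suc i) (s≤s i≤m) = step (inject₁ i) (suc i) (cong suc (sym (Finₚ.toℕ-inject₁ i)))
        (λ h h≤ → all-equal m h (ℕₚ.≤-trans h≤ (ℕₚ.≤-trans (ℕₚ.≤-reflexive (Finₚ.toℕ-inject₁ i)) i≤m)))

      step r i i≡ ih = undiff (cancel0 (q′-nonzero i r i≡ x) (≈-trans (≈-sym (ix-delta (λ h → q h one r ⊛ (e h a ⊝ e h b)) i others)) total0))
        where
        others : ∀ h → h ≢ i → q h one r ⊛ (e h a ⊝ e h b) ≈ 0#
        others h h≢i with toℕ h ≤? toℕ r
        ... | yes h≤r = ≈-trans (*-cong ≈-refl (diff0 (ih h h≤r))) (zeroʳ _)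
        ... | no h≰r = ≈-trans (*-cong (q′-vanish h r (λ { refl → h≰r ℕₚ.≤-refl }) far) ≈-refl) (zeroˡ _)
          where
          far : ¬ (toℕ h ≡ suc (toℕ r) ⊎ toℕ r ≡ suc (toℕ h))
          far (inj₁ h≡) = h≢i (Finₚ.toℕ-injective (trans h≡ (sym i≡)))
          far (inj₂ r≡) = h≰r (ℕₚ.≤-trans (ℕₚ.n≤1+n _) (ℕₚ.≤-reflexive (sym r≡)))
        total0 : ∑ ix (λ h → q h one r ⊛ (e h a ⊝ e h b)) ≈ 0#
        total0 = cancel0 n≉0 (begin
          ν n ⁻¹ ⊛ ∑ ix (λ h → q h one r ⊛ (e h a ⊝ e h b))
            ≈⟨ *-cong ≈-refl (≈-trans (∑-cong ix (λ h → ring-solve 3 (λ q x y → q :* (x :- y) :≈ q :* x :- q :* y) ≈-refl _ _ _)) (∑-⊝ ix _ _)) ⟩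
          ν n ⁻¹ ⊛ (∑ ix (λ h → q h one r ⊛ e h a) ⊝ ∑ ix (λ h → q h one r ⊛ e h b))
            ≈⟨ ring-solve 3 (λ n s t → n :* (s :- t) :≈ n :* s :- n :* t) ≈-refl _ _ _ ⟩
          ν n ⁻¹ ⊛ ∑ ix (λ h → q h one r ⊛ e h a) ⊝ ν n ⁻¹ ⊛ ∑ ix (λ h → q h one r ⊛ e h b)
            ≈⟨ +-cong (≈-sym (krein one r x y)) (-‿cong (≈-sym (krein one r x′ y′))) ⟩
          W a ⊛ e r a ⊝ W b ⊛ e r b
            ≈⟨ diff0 (*-cong Wa≈Wb (ih r ℕₚ.≤-refl)) ⟩
          0# ∎)

    -- With R = Σ αᵢEᵢ, S = Σ βᵢEᵢ and A* = diag(W(d x ·)), the matrix R A* S − S A* R is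
    -- Σ (αᵢβⱼ − βᵢαⱼ) Eᵢ A* Eⱼ with only |i − j| ≤ 1 contributing; there αᵢβⱼ − βᵢαⱼ = yᵢ − yⱼ, and
    -- Σ (yᵢ − yⱼ) Eᵢ A* Eⱼ = Y A* − A* Y.
    balanced : ∀ a b → ¬ ¬ Σ (ℕ → Carrier) λ Y → ∀ x y z →
      ∑ V (λ w → δ (d y w ≡ᵇ a) ⊛ (W (d x w) ⊛ δ (d w z ≡ᵇ b))) ⊝ ∑ V (λ w → δ (d y w ≡ᵇ b) ⊛ (W (d x w) ⊛ δ (d w z ≡ᵇ a)))
        ≈ Y (d y z) ⊛ (W (d x z) ⊝ W (d x y))
    balanced a b k = spanned a λ (α , spanα) → spanned b λ (β , spanβ) → k (conclude α spanα β spanβ)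
      where
      conclude : ∀ α → Spans a α → ∀ β → Spans b β → Σ (ℕ → Carrier) λ Y → ∀ x y z →
        ∑ V (λ w → δ (d y w ≡ᵇ a) ⊛ (W (d x w) ⊛ δ (d w z ≡ᵇ b))) ⊝ ∑ V (λ w → δ (d y w ≡ᵇ b) ⊛ (W (d x w) ⊛ δ (d w z ≡ᵇ a)))
          ≈ Y (d y z) ⊛ (W (d x z) ⊝ W (d x y))
      conclude α spanα β spanβ = (λ h → ∑ ix (λ i → yy (toℕ i) ⊛ e i h)) , identity
        where
        ext : (Fin (suc D) → Carrier) → ℕ → Carrier
        ext f i with i <? suc D
        ... | yes i< = f (fromℕ< i<)
        ... | no _ = 0#
        ext-toℕ : ∀ f i → ext f (toℕ i) ≡ f i
        ext-toℕ f i with toℕ i <? suc D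
        ... | yes i< = cong f (Finₚ.fromℕ<-toℕ i i<)
        ... | no i≮ = ⊥-elim (i≮ (Finₚ.toℕ<n i))

        commutator : ℕ → ℕ → Carrier
        commutator i j = ext α i ⊛ ext β j ⊝ ext β i ⊛ ext α j

        -- A potential whose consecutive differences are the commutators. It exists because only
        -- neighbouring indices contribute, so there is a single path along which to sum; `ext`
        -- makes the recursion on ℕ possible.
        yy : ℕ → Carrier
        yy zero    = 0#
        yy (suc i) = yy i ⊝ commutator i (suc i)

        N : Fin (suc D) → Fin (suc D) → Fin n → Fin n → Fin n → Carrier
        N i j x y z = ∑ V (λ w → e i (d y w) ⊛ (W (d x w) ⊛ e j (d w z)))

        N-far : ∀ i j x y z → q one i j ≈ 0# → N i j x y z ≈ 0#
        N-far i j x y z q≈0 = ≈-trans (∑-cong V (λ w → ≈-trans (*-cong (e-sym i y w) ≈-refl)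
          (ring-solve 3 (λ a b c → a :* (b :* c) :≈ b :* (a :* c)) ≈-refl _ _ _))) (triple-vanish i j q≈0 x y z)

        entry : ∀ i j x y z → (α i ⊛ β j ⊝ β i ⊛ α j) ⊛ N i j x y z ≈ (yy (toℕ i) ⊝ yy (toℕ j)) ⊛ N i j x y z
        entry i j x y z with i Fin.≟ j
        ... | yes refl = *-cong (ring-solve 3 (λ a b y → a :* b :- b :* a :≈ y :- y) ≈-refl _ _ _) ≈-refl
        ... | no i≢j with toℕ i ℕ.≟ suc (toℕ j) | toℕ j ℕ.≟ suc (toℕ i)
        ... | yes i≡ | _ = *-cong (≈-trans (coefficients) (≈-sym (+-cong (≈-reflexive (cong yy i≡)) ≈-refl))) ≈-refl
          where
          coefficients : α i ⊛ β j ⊝ β i ⊛ α j ≈ (yy (toℕ j) ⊝ commutator (toℕ j) (suc (toℕ j))) ⊝ yy (toℕ j)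
          coefficients = begin
            α i ⊛ β j ⊝ β i ⊛ α j
              ≈⟨ ring-solve 5 (λ a b c e y → a :* b :- c :* e :≈ (y :- (e :* c :- b :* a)) :- y) ≈-refl _ _ _ _ (yy (toℕ j)) ⟩
            (yy (toℕ j) ⊝ (α j ⊛ β i ⊝ β j ⊛ α i)) ⊝ yy (toℕ j)
              ≈⟨ ≈-reflexive (cong₂ (λ s t → (yy (toℕ j) ⊝ (proj₁ s ⊛ proj₂ t ⊝ proj₂ s ⊛ proj₁ t)) ⊝ yy (toℕ j))
                   (cong₂ _,_ (sym (ext-toℕ α j)) (sym (ext-toℕ β j)))
                   (cong₂ _,_ (trans (sym (ext-toℕ α i)) (cong (ext α) i≡)) (trans (sym (ext-toℕ β i)) (cong (ext β) i≡)))) ⟩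
            (yy (toℕ j) ⊝ commutator (toℕ j) (suc (toℕ j))) ⊝ yy (toℕ j) ∎
        ... | no _ | yes j≡ = *-cong (≈-trans (coefficients) (≈-sym (+-cong ≈-refl (-‿cong (≈-reflexive (cong yy j≡)))))) ≈-refl
          where
          coefficients : α i ⊛ β j ⊝ β i ⊛ α j ≈ yy (toℕ i) ⊝ (yy (toℕ i) ⊝ commutator (toℕ i) (suc (toℕ i)))
          coefficients = begin
            α i ⊛ β j ⊝ β i ⊛ α j
              ≈⟨ ring-solve 5 (λ a b c e y → a :* b :- c :* e :≈ y :- (y :- (a :* b :- c :* e))) ≈-refl _ _ _ _ (yy (toℕ i)) ⟩
            yy (toℕ i) ⊝ (yy (toℕ i) ⊝ (α i ⊛ β j ⊝ β i ⊛ α j))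
              ≈⟨ ≈-reflexive (cong₂ (λ s t → yy (toℕ i) ⊝ (yy (toℕ i) ⊝ (proj₁ s ⊛ proj₂ t ⊝ proj₂ s ⊛ proj₁ t)))
                   (cong₂ _,_ (sym (ext-toℕ α i)) (sym (ext-toℕ β i)))
                   (cong₂ _,_ (trans (sym (ext-toℕ α j)) (cong (ext α) j≡)) (trans (sym (ext-toℕ β j)) (cong (ext β) j≡)))) ⟩
            yy (toℕ i) ⊝ (yy (toℕ i) ⊝ commutator (toℕ i) (suc (toℕ i))) ∎
        ... | no i≢ | no j≢ = ≈-trans (*-cong ≈-refl N≈0) (≈-trans (zeroʳ _) (≈-sym (≈-trans (*-cong ≈-refl N≈0) (zeroʳ _))))
          where N≈0 = N-far i j x y z (q-vanish i j i≢j (λ { (inj₁ p) → i≢ p ; (inj₂ p) → j≢ p }))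

        expand : ∀ (s t : Fin n → Fin n → Carrier) (σ τ : Fin (suc D) → Carrier) →
          (∀ x y → s x y ≈ ∑ ix (λ i → σ i ⊛ e i (d x y))) → (∀ x y → t x y ≈ ∑ ix (λ i → τ i ⊛ e i (d x y))) → ∀ x y z →
          ∑ V (λ w → s y w ⊛ (W (d x w) ⊛ t w z)) ≈ ∑ ix (λ i → ∑ ix (λ j → (σ i ⊛ τ j) ⊛ N i j x y z))
        expand s t σ τ hs ht x y z = begin
          ∑ V (λ w → s y w ⊛ (W (d x w) ⊛ t w z))
            ≈⟨ ∑-cong V (λ w → ≈-trans (*-cong (hs y w) (≈-trans (*-cong ≈-refl (ht w z)) (≈-sym (∑-*ˡ ix _ _)))) (≈-trans (≈-sym (∑-*ʳ ix _ _)) (∑-cong ix (λ i → ≈-sym (∑-*ˡ ix _ _))))) ⟩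
          ∑ V (λ w → ∑ ix (λ i → ∑ ix (λ j → (σ i ⊛ e i (d y w)) ⊛ (W (d x w) ⊛ (τ j ⊛ e j (d w z))))))
            ≈⟨ ≈-trans (∑-swap V ix _) (∑-cong ix (λ i → ∑-swap V ix _)) ⟩
          ∑ ix (λ i → ∑ ix (λ j → ∑ V (λ w → (σ i ⊛ e i (d y w)) ⊛ (W (d x w) ⊛ (τ j ⊛ e j (d w z))))))
            ≈⟨ ∑-cong ix (λ i → ∑-cong ix (λ j → ≈-trans (∑-cong V (λ w → ring-solve 5 (λ s e w t f → (s :* e) :* (w :* (t :* f)) :≈ (s :* t) :* (e :* (w :* f))) ≈-refl _ _ _ _ _)) (∑-*ˡ V _ _))) ⟩
          ∑ ix (λ i → ∑ ix (λ j → (σ i ⊛ τ j) ⊛ N i j x y z)) ∎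

        unit′ : ∀ x y → δ (eqᵇ x y) ≈ ∑ ix (λ i → 1# ⊛ e i (d x y))
        unit′ x y = ≈-trans (≈-sym (unit x y)) (∑-cong ix (λ i → ≈-sym (*-identityˡ _)))

        Yₑ : Fin n → Fin n → Carrier
        Yₑ y z = ∑ ix (λ i → yy (toℕ i) ⊛ e i (d y z))

        right-unit : ∀ x y z → ∑ V (λ w → Yₑ y w ⊛ (W (d x w) ⊛ δ (eqᵇ w z))) ≈ Yₑ y z ⊛ W (d x z)
        right-unit x y z = ≈-trans (∑-delta _ z (λ w w≢z → ≈-trans (*-cong ≈-refl (≈-trans (*-cong ≈-refl (≈-reflexive (cong δ (eqᵇ-false w≢z)))) (zeroʳ _))) (zeroʳ _)))
          (*-cong ≈-refl (≈-trans (*-cong ≈-refl (≈-reflexive (cong δ (eqᵇ-refl z)))) (*-identityʳ _)))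

        left-unit : ∀ x y z → ∑ V (λ w → δ (eqᵇ y w) ⊛ (W (d x w) ⊛ Yₑ w z)) ≈ W (d x y) ⊛ Yₑ y z
        left-unit x y z = ≈-trans (∑-delta _ y (λ w w≢y → ≈-trans (*-cong (≈-reflexive (cong δ (eqᵇ-false (w≢y ∘ sym)))) ≈-refl) (zeroˡ _)))
          (≈-trans (*-cong (≈-reflexive (cong δ (eqᵇ-refl y))) ≈-refl) (*-identityˡ _))

        ∑∑-⊝ : ∀ (f g : Fin (suc D) → Fin (suc D) → Carrier) →
               ∑ ix (λ i → ∑ ix (f i)) ⊝ ∑ ix (λ i → ∑ ix (g i)) ≈ ∑ ix (λ i → ∑ ix (λ j → f i j ⊝ g i j))
        ∑∑-⊝ f g = ≈-sym (≈-trans (∑-cong ix (λ i → ∑-⊝ ix (f i) (g i))) (∑-⊝ ix _ _))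

        identity : ∀ x y z →
          ∑ V (λ w → δ (d y w ≡ᵇ a) ⊛ (W (d x w) ⊛ δ (d w z ≡ᵇ b))) ⊝ ∑ V (λ w → δ (d y w ≡ᵇ b) ⊛ (W (d x w) ⊛ δ (d w z ≡ᵇ a)))
            ≈ Yₑ y z ⊛ (W (d x z) ⊝ W (d x y))
        identity x y z = begin
          ∑ V (λ w → δ (d y w ≡ᵇ a) ⊛ (W (d x w) ⊛ δ (d w z ≡ᵇ b))) ⊝ ∑ V (λ w → δ (d y w ≡ᵇ b) ⊛ (W (d x w) ⊛ δ (d w z ≡ᵇ a)))
            ≈⟨ +-cong (expand _ _ α β spanα spanβ x y z) (-‿cong (expand _ _ β α spanβ spanα x y z)) ⟩
          ∑ ix (λ i → ∑ ix (λ j → (α i ⊛ β j) ⊛ N i j x y z)) ⊝ ∑ ix (λ i → ∑ ix (λ j → (β i ⊛ α j) ⊛ N i j x y z))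
            ≈⟨ ∑∑-⊝ _ _ ⟩
          ∑ ix (λ i → ∑ ix (λ j → (α i ⊛ β j) ⊛ N i j x y z ⊝ (β i ⊛ α j) ⊛ N i j x y z))
            ≈⟨ ∑-cong ix (λ i → ∑-cong ix (λ j → ≈-trans (ring-solve 3 (λ a b n → a :* n :- b :* n :≈ (a :- b) :* n) ≈-refl _ _ _)
                 (≈-trans (entry i j x y z) (ring-solve 3 (λ a b n → (a :- b) :* n :≈ (a :* # 1) :* n :- (# 1 :* b) :* n) ≈-refl _ _ _)))) ⟩
          ∑ ix (λ i → ∑ ix (λ j → (yy (toℕ i) ⊛ ι (+ 1)) ⊛ N i j x y z ⊝ (ι (+ 1) ⊛ yy (toℕ j)) ⊛ N i j x y z))
            ≈⟨ ∑-cong ix (λ i → ∑-cong ix (λ j → +-cong (*-cong (*-cong ≈-refl ι-1) ≈-refl) (-‿cong (*-cong (*-cong ι-1 ≈-refl) ≈-refl)))) ⟩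
          ∑ ix (λ i → ∑ ix (λ j → (yy (toℕ i) ⊛ 1#) ⊛ N i j x y z ⊝ (1# ⊛ yy (toℕ j)) ⊛ N i j x y z))
            ≈⟨ ≈-sym (∑∑-⊝ _ _) ⟩
          ∑ ix (λ i → ∑ ix (λ j → (yy (toℕ i) ⊛ 1#) ⊛ N i j x y z)) ⊝ ∑ ix (λ i → ∑ ix (λ j → (1# ⊛ yy (toℕ j)) ⊛ N i j x y z))
            ≈⟨ ≈-sym (+-cong (expand Yₑ (λ x y → δ (eqᵇ x y)) (yy ∘ toℕ) (λ _ → 1#) (λ _ _ → ≈-refl) unit′ x y z)
                             (-‿cong (expand (λ x y → δ (eqᵇ x y)) Yₑ (λ _ → 1#) (yy ∘ toℕ) unit′ (λ _ _ → ≈-refl) x y z))) ⟩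
          ∑ V (λ w → Yₑ y w ⊛ (W (d x w) ⊛ δ (eqᵇ w z))) ⊝ ∑ V (λ w → δ (eqᵇ y w) ⊛ (W (d x w) ⊛ Yₑ w z))
            ≈⟨ +-cong (right-unit x y z) (-‿cong (left-unit x y z)) ⟩
          Yₑ y z ⊛ W (d x z) ⊝ W (d x y) ⊛ Yₑ y z
            ≈⟨ ring-solve 3 (λ y a b → y :* a :- b :* y :≈ y :* (a :- b)) ≈-refl _ _ _ ⟩
          Yₑ y z ⊛ (W (d x z) ⊝ W (d x y)) ∎

-- The form in which the Q-polynomial structure enters from here on. `W h` is the entry of E₁ at
-- distance `h`, the cosine sequence up to a factor.
record Cosines (G : Graph) (conn : Connected G) (D : ℕ) : Set₁ where
  field
    field₀ : Char0Field 0ℓ 0ℓ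
  open FieldKit field₀
  open LinearAlgebra field₀
  open Metric G conn
  field
    stable : ∀ {x y} → ¬ ¬ (x ≈ y) → x ≈ y
    W : ℕ → Carrier
    distinct : ∀ x y x′ y′ → d x y ≢ d x′ y′ → ¬ W (d x y) ≈ W (d x′ y′)
    eigenvalue : ¬ ¬ Σ Carrier λ θ → ∀ x z →
      ∑ (allFin n) (λ y → (if d x y ≡ᵇ 1 then 1# else 0#) ⊛ W (d y z)) ≈ θ ⊛ W (d x z)
    balanced : ∀ a b → ¬ ¬ Σ (ℕ → Carrier) λ Y → ∀ x y z →
      ∑ (allFin n) (λ w → (if d y w ≡ᵇ a then 1# else 0#) ⊛ (W (d x w) ⊛ (if d w z ≡ᵇ b then 1# else 0#)))
        ⊝ ∑ (allFin n) (λ w → (if d y w ≡ᵇ b then 1# else 0#) ⊛ (W (d x w) ⊛ (if d w z ≡ᵇ a then 1# else 0#)))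
        ≈ Y (d y z) ⊛ (W (d x z) ⊝ W (d x y))

-- Weakening equality to its double negation makes it stable.
stabilize : Char0Field 0ℓ 0ℓ → Char0Field 0ℓ 0ℓ
stabilize K = record
  { cring = ring′
  ; _⁻¹ = _⁻¹
  ; nontrivial = λ h → h nontrivial
  ; inverseʳ = λ x h → pure (inverseʳ x (λ e → h (pure e)))
  ; char0 = λ m h → h (λ e → char0 m (K.trans (K.reflexive (ringℕ-same (suc m))) e))
  }
  where
  module K = Char0Field K
  open K using (_⁻¹; nontrivial; inverseʳ; char0)
  pure : ∀ {A : Set} → A → ¬ ¬ A
  pure a k = k a
  map² : ∀ {A B C : Set} → (A → B → C) → ¬ ¬ A → ¬ ¬ B → ¬ ¬ C
  map² f a b k = a (λ a → b (λ b → k (f a b)))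
  map¹ : ∀ {A B : Set} → (A → B) → ¬ ¬ A → ¬ ¬ B
  map¹ f a k = a (λ a → k (f a))
  ring′ : CommutativeRing 0ℓ 0ℓ
  ring′ = record
    { Carrier = K.Carrier ; _≈_ = λ x y → ¬ ¬ (x K.≈ y) ; _+_ = K._+_ ; _*_ = K._*_ ; -_ = K.-_ ; 0# = K.0# ; 1# = K.1#
    ; isCommutativeRing = record
      { isRing = record
        { +-isAbelianGroup = record
          { isGroup = record
            { isMonoid = record
              { isSemigroup = record
                { isMagma = record
                  { isEquivalence = record { refl = pure K.refl ; sym = map¹ K.sym ; trans = map² K.trans }
                  ; ∙-cong = map² K.+-cong }
                ; assoc = λ x y z → pure (K.+-assoc x y z) }
              ; identity = (λ x → pure (K.+-identityˡ x)) , (λ x → pure (K.+-identityʳ x)) }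
            ; inverse = (λ x → pure (K.-‿inverseˡ x)) , (λ x → pure (K.-‿inverseʳ x))
            ; ⁻¹-cong = map¹ K.-‿cong }
          ; comm = λ x y → pure (K.+-comm x y) }
        ; *-cong = map² K.*-cong
        ; *-assoc = λ x y z → pure (K.*-assoc x y z)
        ; *-identity = (λ x → pure (K.*-identityˡ x)) , (λ x → pure (K.*-identityʳ x))
        ; distrib = (λ x y z → pure (K.distribˡ x y z)) , (λ x y z → pure (K.distribʳ x y z)) }
      ; *-comm = λ x y → pure (K.*-comm x y) } }
  ringℕ-same : ∀ m → ringℕ K.cring m ≡ ringℕ ring′ m
  ringℕ-same zero    = refl
  ringℕ-same (suc m) = cong (K.1# K.+_) (ringℕ-same m)

module Convert (G : Graph) (conn : Connected G) (D : ℕ) (d≤D : ∀ x y → dist G x y ≤ D) (1≤D : 1 ≤ D)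
               (K₀ : Char0Field 0ℓ 0ℓ) (E : ℕ → BM.Mat G K₀) (q₀ : ℕ → ℕ → ℕ → Char0Field.Carrier K₀)
               (prim : BM.PrimitiveIdempotents G K₀ D E) (kr : BM.KreinParams G K₀ D E q₀) (qp : BM.QPolyOrdering G K₀ D q₀)
               (x₀ : Fin (Graph.n G)) where
  K = stabilize K₀
  module K₀ = Char0Field K₀
  open Metric G conn
  open FieldKit K
  open LinearAlgebra K
  open SetoidReasoning setoid
  module B = BM G K₀

  stable : ∀ {x y} → ¬ ¬ (x ≈ y) → x ≈ y
  stable h k = h (λ e → e k)

  module M = BoseMesner G conn D d≤D 1≤D K stable
  open M using (ix; one; V; δ; toℕ-at)

  up : ∀ {x y} → x K₀.≈ y → x ≈ y
  up e k = k e

  sumV≈ : ∀ {m} {A : Set} (g : Fin m → A) (f : A → Carrier) → ∑ (tabulate g) f ≈ B.sumV (f ∘ g)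
  sumV≈ {zero}  g f = ≈-refl
  sumV≈ {suc m} g f = +-cong (≈-refl {f (g zero)}) (sumV≈ (g ∘ suc) f)

  sumTo-head : ∀ m (f : ℕ → Carrier) → B.sumTo (suc m) f ≈ f 0 ⊕ B.sumTo m (f ∘ suc)
  sumTo-head zero    f = ≈-refl {f 0 ⊕ f 1}
  sumTo-head (suc m) f = ≈-trans (+-cong (sumTo-head m f) (≈-refl {f (suc (suc m))})) (+-assoc (f 0) _ _)

  sumTo-sum : ∀ m (f : ℕ → Carrier) → B.sumTo m f ≈ MonoidSum.sum (CommutativeRing.+-commutativeMonoid cring) {suc m} (f ∘ toℕ)
  sumTo-sum zero    f = ≈-sym (+-identityʳ (f 0))
  sumTo-sum (suc m) f = ≈-trans (sumTo-head m f) (+-cong (≈-refl {f 0}) (sumTo-sum m (f ∘ suc)))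

  sumTo-ix : (f : ℕ → Carrier) → B.sumTo D f ≈ ∑ ix (f ∘ toℕ)
  sumTo-ix f = ≈-trans (sumTo-sum D f) (≈-sym (M.ix-sum (f ∘ toℕ)))

  ≤D : (i : Fin (suc D)) → toℕ i ≤ D
  ≤D i = Finₚ.toℕ≤pred[n] i

  e : Fin (suc D) → ℕ → Carrier
  e i = proj₁ (proj₁ prim (toℕ i) (≤D i))

  E≈e : ∀ i x y → E (toℕ i) x y ≈ e i (d x y)
  E≈e i x y = ≈-trans (up (proj₂ (proj₁ prim (toℕ i) (≤D i)) x y)) (≈-trans (sumTo-ix _) (M.select (e i) (d x y) (d≤D x y)))

  E′ : Fin (suc D) → B.Mat
  E′ i = E (toℕ i)

  idem : ∀ i j x y → ∑ V (λ w → e i (d x w) ⊛ e j (d w y)) ≈ (if toℕ i ≡ᵇ toℕ j then e i (d x y) else 0#)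
  idem i j x y = ≈-trans (∑-cong V (λ w → *-cong (≈-sym (E≈e i x w)) (≈-sym (E≈e j w y))))
    (≈-trans (sumV≈ id (λ w → E′ i x w ⊛ E′ j w y)) (≈-trans (up (proj₁ (proj₂ prim) (toℕ i) (toℕ j) (≤D i) (≤D j) x y)) branch))
    where
    branch : (if toℕ i ≡ᵇ toℕ j then E′ i else B.O) x y ≈ (if toℕ i ≡ᵇ toℕ j then e i (d x y) else 0#)
    branch with toℕ i ≡ᵇ toℕ j
    ... | true  = E≈e i x y
    ... | false = ≈-refl {0#}

  -- Each entry is zero only up to double negation in the stabilized field. As there are finitely
  -- many entries, the double negation can be moved in front of the quantifiers.
  nonzero : ∀ i → ¬ (∀ x y → e i (d x y) ≈ 0#)
  nonzero i h = finite n n (λ x y → E′ i x y K₀.≈ K₀.0#) (λ x y → ≈-trans (E≈e i x y) (h x y)) (proj₁ (proj₂ (proj₂ prim)) (toℕ i) (≤D i))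
    where
    finite₁ : ∀ m (P : Fin m → Set) → (∀ x → ¬ ¬ P x) → ¬ ¬ (∀ x → P x)
    finite₁ zero    P h k = k (λ ())
    finite₁ (suc m) P h k = h zero (λ p₀ → finite₁ m (P ∘ suc) (h ∘ suc) (λ ps → k (λ { zero → p₀ ; (suc x) → ps x })))
    finite : ∀ m l (P : Fin m → Fin l → Set) → (∀ x y → ¬ ¬ P x y) → ¬ ¬ (∀ x y → P x y)
    finite m l P h = finite₁ m (λ x → ∀ y → P x y) (λ x → finite₁ l (P x) (h x))

  unit : ∀ x y → ∑ ix (λ i → e i (d x y)) ≈ δ (eqᵇ x y)
  unit x y = ≈-trans (∑-cong ix (λ i → ≈-sym (E≈e i x y))) (≈-trans (≈-sym (sumTo-ix (λ i → E i x y))) (≈-trans (up (proj₁ (proj₂ (proj₂ (proj₂ prim))) x y)) (≈-reflexive (cong δ (isYes≗does (x Fin.≟ y))))))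

  ν-same : ∀ m → Char0Field.fromℕ' K₀ m ≡ ν m
  ν-same zero    = refl
  ν-same (suc m) = cong (1# ⊕_) (ν-same m)

  const₀ : ∀ x y → e zero (d x y) ≈ ν n ⁻¹
  const₀ x y = ≈-trans (≈-sym (E≈e zero x y)) (≈-trans (up (proj₂ (proj₂ (proj₂ (proj₂ prim))) x y))
    (≈-trans (*-identityʳ _) (≈-reflexive (cong _⁻¹ (ν-same n)))))

  n≉0 : ¬ ν n ⁻¹ ≈ 0#
  n≉0 h = positive n x₀ (λ νn≉0 → nontrivial (≈-trans (≈-sym (inverseʳ (ν n) νn≉0)) (≈-trans (*-cong (≈-refl {ν n}) h) (zeroʳ (ν n)))))
    where
    positive : ∀ m → Fin m → ¬ ¬ (¬ ν m ≈ 0#)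
    positive (suc m) _ k = k (char0 m)

  q : Fin (suc D) → Fin (suc D) → Fin (suc D) → Carrier
  q h i j = q₀ (toℕ h) (toℕ i) (toℕ j)

  krein : ∀ i j x y → e i (d x y) ⊛ e j (d x y) ≈ ν n ⁻¹ ⊛ ∑ ix (λ h → q h i j ⊛ e h (d x y))
  krein i j x y = ≈-trans (*-cong (≈-sym (E≈e i x y)) (≈-sym (E≈e j x y))) (≈-trans (up (kr (toℕ i) (toℕ j) (≤D i) (≤D j) x y))
    (*-cong (≈-reflexive (cong _⁻¹ (ν-same n)))
      (≈-trans (sumTo-ix (λ h → q₀ h (toℕ i) (toℕ j) ⊛ E h x y)) (∑-cong ix (λ h → *-cong (≈-refl {q h i j}) (E≈e h x y))))))

  q-one : ∀ i j → q one i j ≡ q₀ 1 (toℕ i) (toℕ j)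
  q-one i j = cong (λ h → q₀ h (toℕ i) (toℕ j)) (toℕ-at 1≤D)

  q-vanish : ∀ i j → i ≢ j → ¬ (toℕ i ≡ suc (toℕ j) ⊎ toℕ j ≡ suc (toℕ i)) → q one i j ≈ 0#
  q-vanish i j i≢j far k = far (Equivalence.to (qp (toℕ i) (toℕ j) (≤D i) (≤D j) (λ e → i≢j (Finₚ.toℕ-injective e)))
    (λ e → k (subst (K₀._≈ K₀.0#) (sym (q-one i j)) e)))

  q-nonzero : ∀ i j → toℕ i ≡ suc (toℕ j) → ¬ q one i j ≈ 0#
  q-nonzero i j i≡ h = h (λ e → Equivalence.from (qp (toℕ i) (toℕ j) (≤D i) (≤D j) (λ e → ℕₚ.<-irrefl (sym e) (ℕₚ.≤-reflexive (sym i≡)))) (inj₁ i≡)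
    (subst (K₀._≈ K₀.0#) (q-one i j) e))

  open M.Idempotents e idem nonzero unit const₀ n≉0 q krein q-vanish q-nonzero

  cosines : Cosines G conn D
  cosines = record
    { field₀ = K ; stable = λ {x} {y} → stable {x} {y} ; W = W ; distinct = W-distinct
    ; eigenvalue = λ k → spanned 1 λ (μ , span) → k (μ one , λ x z → eigen span one x z)
    ; balanced = balanced }

qpoly-cosines : (G : Graph) (conn : Connected G) (D : ℕ) → HasDiameter G D → 1 ≤ D → IsQPolynomial G D → Cosines G conn D
qpoly-cosines G conn D (d≤D , x₀ , _) 1≤D (K₀ , E , q₀ , prim , kr , qp) = Convert.cosines G conn D d≤D 1≤D K₀ E q₀ prim kr qp x₀

-- Short cycles and intersection numbers

module CycleKit (G : Graph) where
  open Graph G using (n; adj; irrefl)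

  Triangle : Set
  Triangle = Σ (Fin n × Fin n × Fin n) λ (x , y , z) → adj x y ≡ true × adj y z ≡ true × adj z x ≡ true

  Quad : Set
  Quad = Σ (Fin n × Fin n × Fin n × Fin n) λ (x , y , z , w) →
    adj x y ≡ true × adj y z ≡ true × adj z w ≡ true × adj w x ≡ true × x ≢ z × y ≢ w

  -- A closed walk of length five: without triangles its vertices are distinct, since a coincidence
  -- would cut off a triangle.
  Pentagon : Set
  Pentagon = Σ (Fin n × Fin n × Fin n × Fin n × Fin n) λ (x , y , z , w , u) →
    adj x y ≡ true × adj y z ≡ true × adj z w ≡ true × adj w u ≡ true × adj u x ≡ true

  Hexagon : Set
  Hexagon = Σ (Fin n × Fin n × Fin n × Fin n × Fin n × Fin n) λ (x , y , z , w , u , t) →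
    adj x y ≡ true × adj y z ≡ true × adj z w ≡ true × adj w u ≡ true × adj u t ≡ true × adj t x ≡ true ×
    x ≢ z × y ≢ w × z ≢ u × w ≢ t × u ≢ x × t ≢ y × x ≢ w × y ≢ u × z ≢ t

  adj⇒≢ : ∀ {x y} → adj x y ≡ true → x ≢ y
  adj⇒≢ {x} e refl = true≢false (trans (sym e) (irrefl x))

  flip : ∀ {x y} → adj x y ≡ true → adj y x ≡ true
  flip {x} {y} e = trans (Graph.sym G y x) e

  triangle⇒cycle : Triangle → HasCycle G 3
  triangle⇒cycle ((x , y , z) , xy , yz , zx) = s≤s (s≤s (s≤s z≤n)) , Vec.lookup vs , lookup-injective distinct , steps , zx
    where
    vs : Vec (Fin n) 3
    vs = x ∷ y ∷ z ∷ []
    distinct : Unique vs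
    distinct = (adj⇒≢ xy ∷ adj⇒≢ zx ∘ sym ∷ []) ∷ (adj⇒≢ yz ∷ []) ∷ [] ∷ []
    steps : ∀ (i : Fin 2) → adj (Vec.lookup vs (inject₁ i)) (Vec.lookup vs (suc i)) ≡ true
    steps zero = xy
    steps (suc zero) = yz

  quad⇒cycle : Quad → HasCycle G 4
  quad⇒cycle ((x , y , z , w) , xy , yz , zw , wx , x≢z , y≢w) = s≤s (s≤s (s≤s z≤n)) , Vec.lookup vs , lookup-injective distinct , steps , wx
    where
    vs : Vec (Fin n) 4
    vs = x ∷ y ∷ z ∷ w ∷ []
    distinct : Unique vs
    distinct = (adj⇒≢ xy ∷ x≢z ∷ adj⇒≢ wx ∘ sym ∷ []) ∷ (adj⇒≢ yz ∷ y≢w ∷ []) ∷ (adj⇒≢ zw ∷ []) ∷ [] ∷ []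
    steps : ∀ (i : Fin 3) → adj (Vec.lookup vs (inject₁ i)) (Vec.lookup vs (suc i)) ≡ true
    steps zero = xy
    steps (suc zero) = yz
    steps (suc (suc zero)) = zw

  pentagon⇒cycle : ¬ Triangle → Pentagon → HasCycle G 5
  pentagon⇒cycle noTri ((x , y , z , w , u) , xy , yz , zw , wu , ux) = s≤s (s≤s (s≤s z≤n)) , Vec.lookup vs , lookup-injective distinct , steps , ux
    where
    vs : Vec (Fin n) 5
    vs = x ∷ y ∷ z ∷ w ∷ u ∷ []
    chord : ∀ {a b c d} → adj b c ≡ true → adj c d ≡ true → adj d a ≡ true → a ≢ b
    chord bc cd da refl = noTri (_ , bc , cd , da)
    distinct : Unique vs
    distinct = (adj⇒≢ xy ∷ chord zw wu ux ∷ chord (flip zw) (flip yz) (flip xy) ∷ adj⇒≢ ux ∘ sym ∷ []) ∷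
      (adj⇒≢ yz ∷ chord wu ux xy ∷ chord (flip wu) (flip zw) (flip yz) ∷ []) ∷ (adj⇒≢ zw ∷ chord ux xy yz ∷ []) ∷ (adj⇒≢ wu ∷ []) ∷ [] ∷ []
    steps : ∀ (i : Fin 4) → adj (Vec.lookup vs (inject₁ i)) (Vec.lookup vs (suc i)) ≡ true
    steps zero = xy
    steps (suc zero) = yz
    steps (suc (suc zero)) = zw
    steps (suc (suc (suc zero))) = wu

  hexagon⇒cycle : Hexagon → HasCycle G 6
  hexagon⇒cycle ((x , y , z , w , u , t) , xy , yz , zw , wu , ut , tx , x≢z , y≢w , z≢u , w≢t , u≢x , t≢y , x≢w , y≢u , z≢t) =
    s≤s (s≤s (s≤s z≤n)) , Vec.lookup vs , lookup-injective distinct , steps , tx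
    where
    vs : Vec (Fin n) 6
    vs = x ∷ y ∷ z ∷ w ∷ u ∷ t ∷ []
    distinct : Unique vs
    distinct = (adj⇒≢ xy ∷ x≢z ∷ x≢w ∷ u≢x ∘ sym ∷ adj⇒≢ tx ∘ sym ∷ []) ∷ (adj⇒≢ yz ∷ y≢w ∷ y≢u ∷ t≢y ∘ sym ∷ []) ∷
      (adj⇒≢ zw ∷ z≢u ∷ z≢t ∷ []) ∷ (adj⇒≢ wu ∷ w≢t ∷ []) ∷ (adj⇒≢ ut ∷ []) ∷ [] ∷ []
    steps : ∀ (i : Fin 5) → adj (Vec.lookup vs (inject₁ i)) (Vec.lookup vs (suc i)) ≡ true
    steps zero = xy
    steps (suc zero) = yz
    steps (suc (suc zero)) = zw
    steps (suc (suc (suc zero))) = wu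
    steps (suc (suc (suc (suc zero)))) = ut

  cycle⇒triangle : HasCycle G 3 → Triangle
  cycle⇒triangle (_ , v , _ , s , c) = _ , s zero , s (suc zero) , c

  cycle⇒quad : HasCycle G 4 → Quad
  cycle⇒quad (_ , v , inj , s , c) = _ , s zero , s (suc zero) , s (suc (suc zero)) , c ,
    (λ e → Finₚ.0≢1+n (inj zero (suc (suc zero)) e)) , (λ e → Finₚ.0≢1+n (Finₚ.suc-injective (inj (suc zero) (suc (suc (suc zero))) e)))

  cycle⇒pentagon : HasCycle G 5 → Pentagon
  cycle⇒pentagon (_ , v , _ , s , c) = _ , s zero , s (suc zero) , s (suc (suc zero)) , s (suc (suc (suc zero))) , c

  girth6 : Hexagon → ¬ Triangle → ¬ Quad → ¬ Pentagon → GirthEq G 6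
  girth6 hex noTri noQuad noPent = hexagon⇒cycle hex , none
    where
    none : ∀ l → l < 6 → ¬ HasCycle G l
    none zero _ ()
    none 1 _ (s≤s () , _)
    none 2 _ (s≤s (s≤s ()) , _)
    none 3 _ = noTri ∘ cycle⇒triangle
    none 4 _ = noQuad ∘ cycle⇒quad
    none 5 _ = noPent ∘ cycle⇒pentagon
    none (suc (suc (suc (suc (suc (suc l)))))) (s≤s (s≤s (s≤s (s≤s (s≤s (s≤s ()))))))

record Setting : Set₁ where
  field
    G : Graph
    D k : ℕ
    conn : Connected G
    regular : IsDistanceRegular G
    diameter : HasDiameter G D
    valency : Valency G k
    3≤D : 3 ≤ D
    3≤k : 3 ≤ k
    noTri : ¬ CycleKit.Triangle G
    noQuad : ¬ CycleKit.Quad G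
    noPent : ¬ CycleKit.Pentagon G

module Local (S : Setting) where
  open Setting S public
  open Metric G conn public

  d≤D : ∀ x y → d x y ≤ D
  d≤D = proj₁ diameter

  apart : ∀ {x y m} → d x y ≡ suc m → x ≢ y
  apart {x} e refl = ℕₚ.0≢1+n (trans (sym (d-refl x)) e)

  2-path : ∀ {x y z} → x ~ y → y ~ z → x ≢ z → d x z ≡ 2
  2-path {x} {y} {z} xy yz x≢z with d x z in e
  ... | 0 = ⊥-elim (x≢z (d≡0⇒≡ e))
  ... | 1 = ⊥-elim (noTri (_ , xy , yz , ~-sym (d≡1⇒~ e)))
  ... | 2 = refl
  ... | suc (suc (suc m)) = ⊥-elim (ℕₚ.<⇒≱ {2} {3 + m} (s≤s (s≤s (s≤s z≤n)))
          (ℕₚ.≤-trans (ℕₚ.≤-reflexive (sym e)) (ℕₚ.≤-trans (d-triangle x y z) (ℕₚ.+-mono-≤ (d≤1 xy) (d≤1 yz)))))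

  3-path : ∀ {x y z w} → x ~ y → y ~ z → z ~ w → x ≢ z → y ≢ w → d x w ≡ 3
  3-path {x} {y} {z} {w} xy yz zw x≢z y≢w with d x w in e
  ... | 0 = ⊥-elim (noTri (_ , xy , yz , subst (z ~_) (sym (d≡0⇒≡ e)) zw))
  ... | 1 = ⊥-elim (noQuad (_ , xy , yz , zw , ~-sym (d≡1⇒~ e) , x≢z , y≢w))
  ... | 2 = let u , xu , e′ = d-step e in ⊥-elim (noPent (_ , xy , yz , zw , ~-sym (d≡1⇒~ e′) , ~-sym xu))
  ... | 3 = refl
  ... | suc (suc (suc (suc m))) = ⊥-elim (ℕₚ.<⇒≱ {3} {4 + m} (s≤s (s≤s (s≤s (s≤s z≤n))))
          (ℕₚ.≤-trans (ℕₚ.≤-reflexive (sym e)) (ℕₚ.≤-trans (d-triangle x y w) (ℕₚ.+-mono-≤ (d≤1 xy)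
            (ℕₚ.≤-trans (d-triangle y z w) (ℕₚ.+-mono-≤ (d≤1 yz) (d≤1 zw)))))))

  middle-unique : ∀ {x y z w} → x ~ y → y ~ z → x ~ w → w ~ z → x ≢ z → y ≡ w
  middle-unique {x} {y} {z} {w} xy yz xw wz x≢z with y Fin.≟ w
  ... | yes y≡w = y≡w
  ... | no y≢w = ⊥-elim (noQuad (_ , xy , yz , ~-sym wz , ~-sym xw , x≢z , y≢w))

  C : Fin n → Fin n → Fin n → Bool
  C x y z = adj x z ∧ (suc (d z y) ≡ᵇ d x y)

  C-elim : ∀ {x y z} → C x y z ≡ true → x ~ z × suc (d z y) ≡ d x y
  C-elim {x} {y} {z} e = let a , b = ∧-true {adj x z} e in a , ≡ᵇ-true _ _ b

  C-intro : ∀ {x y z} → x ~ z → suc (d z y) ≡ d x y → C x y z ≡ true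
  C-intro a b = ∧-intro a (≡ᵇ-intro b)

  private
    x₀ = proj₁ (proj₂ diameter)
    y₀ = proj₁ (proj₂ (proj₂ diameter))
    d₀ : d x₀ y₀ ≡ D
    d₀ = proj₂ (proj₂ (proj₂ diameter))

  pair : ∀ h → h ≤ D → Σ (Fin n × Fin n) λ (x , y) → d x y ≡ h
  pair h h≤D = let x , e = pair-at x₀ y₀ d₀ h h≤D in (x , y₀) , e

  private
    C-count-regular : ∀ {x y x′ y′} → d x y ≡ d x′ y′ → count (C x y) ≡ count (C x′ y′)
    C-count-regular {x} {y} {x′} {y′} e = go (d x y) refl (sym e)
      where
      none : ∀ x y → d x y ≡ 0 → count (C x y) ≡ 0
      none x y eq = count-none (λ z → trans (cong (λ h → adj x z ∧ (suc (d z y) ≡ᵇ h)) eq) (Boolₚ.∧-zeroʳ (adj x z)))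
      as-p : ∀ {g} x y → d x y ≡ suc g → ∀ z → C x y z ≡ ((d x z ≡ᵇ 1) ∧ (d y z ≡ᵇ g))
      as-p {g} x y eq z = cong₂ _∧_ (adj≡ x z) (trans (cong (suc (d z y) ≡ᵇ_) eq) (cong (_≡ᵇ g) (d-sym z y)))
      go : ∀ h → d x y ≡ h → d x′ y′ ≡ h → count (C x y) ≡ count (C x′ y′)
      go zero    eq eq′ = trans (none x y eq) (sym (none x′ y′ eq′))
      go (suc g) eq eq′ = trans (count-cong (as-p x y eq)) (trans (regular x y x′ y′ (trans eq (sym eq′)) 1 g) (sym (count-cong (as-p x′ y′ eq′))))

  c : ℕ → ℕ
  c h with h ≤? D
  ... | yes h≤D = count (C (proj₁ (proj₁ (pair h h≤D))) y₀)
  ... | no _ = 0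

  c-spec : ∀ {h x y} → d x y ≡ h → count (C x y) ≡ c h
  c-spec {h} {x} {y} e with h ≤? D
  ... | yes h≤D = C-count-regular (trans e (sym (proj₂ (pair h h≤D))))
  ... | no h≰D = ⊥-elim (h≰D (subst (_≤ D) e (d≤D x y)))

  c-pos : ∀ {h} → suc h ≤ D → 1 ≤ c (suc h)
  c-pos {h} h<D = let (x , y) , e = pair (suc h) h<D
                      z , xz , e′ = d-step e
                  in subst (1 ≤_) (c-spec e) (count-pos z (C-intro xz (trans (cong suc e′) (sym e))))

  c₁ : c 1 ≡ 1
  c₁ = let (x , y) , e = pair 1 (ℕₚ.≤-trans (s≤s z≤n) 3≤D) in
    trans (sym (c-spec e)) (count-single y (C-intro (d≡1⇒~ e) (trans (cong suc (d-refl y)) (sym e)))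
      (λ z cz → sym (d≡0⇒≡ (ℕₚ.suc-injective (trans (proj₂ (C-elim {x} {y} {z} cz)) e)))))

  c₂ : c 2 ≡ 1
  c₂ = let (x , y) , e = pair 2 (ℕₚ.≤-trans (s≤s (s≤s z≤n)) 3≤D)
           z , xz , e′ = d-step e in
    trans (sym (c-spec e)) (count-single z (C-intro xz (trans (cong suc e′) (sym e)))
      (λ w cw → middle-unique xz (d≡1⇒~ e′) (proj₁ (C-elim {x} {y} {w} cw)) (d≡1⇒~ (ℕₚ.suc-injective (trans (proj₂ (C-elim {x} {y} {w} cw)) e)))
                  (apart e)))

  c≤k : ∀ {h} → h ≤ D → c h ≤ k
  c≤k {h} h≤D = let (x , y) , e = pair h h≤D in
    subst₂ _≤_ (c-spec e) (valency x) (count-mono (λ z cz → proj₁ (C-elim {x} {y} {z} cz)))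

  -- By regularity one pair at distance `h` with such a neighbour is enough, and a geodesic of
  -- length h + 1 contains one.
  further : ∀ {h x y} → d x y ≡ h → h < D → ∃ λ u → x ~ u × d u y ≡ suc h
  further {h} {x} {y} e h<D =
    let (x′ , y′) , e′ = pair (suc h) h<D
        z , x′z , ez = d-step e′
        pos : 0 < pij G z y′ 1 (suc h)
        pos = count-pos x′ (∧-intro (≡ᵇ-intro (~⇒d≡1 (~-sym x′z))) (≡ᵇ-intro (trans (d-sym y′ x′) e′)))
        u , hu = count-∃ _ (subst (0 <_) (regular z y′ x y (trans ez (sym e)) 1 (suc h)) pos)
        a , b = ∧-true {d x u ≡ᵇ 1} hu
    in u , d≡1⇒~ (≡ᵇ-true _ _ a) , trans (d-sym u y) (≡ᵇ-true _ _ b)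

  -- Below the diameter these will be the farther neighbours, at distance `D` the horizontal ones. A
  -- common name lets the last level be treated like the others.
  C̅ : Fin n → Fin n → Fin n → Bool
  C̅ x y z = adj x z ∧ not (suc (d z y) ≡ᵇ d x y)

  C̅-elim : ∀ {x y z} → C̅ x y z ≡ true → x ~ z × suc (d z y) ≢ d x y
  C̅-elim {x} {y} {z} e = let a , b = ∧-true {adj x z} e in a , λ eq → true≢false (trans (sym b) (cong not (≡ᵇ-intro eq)))

  C̅-intro : ∀ {x y z} → x ~ z → suc (d z y) ≢ d x y → C̅ x y z ≡ true
  C̅-intro a ne = ∧-intro a (cong not (≡ᵇ-false ne))

  C+C̅ : ∀ {h x y} → d x y ≡ h → k ≡ c h + count (C̅ x y)
  C+C̅ {h} {x} {y} e = trans (sym (valency x)) (trans (count-split (adj x) (λ z → suc (d z y) ≡ᵇ d x y)) (cong (_+ count (C̅ x y)) (c-spec e)))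

  C̅-exists : ∀ {h x y} → d x y ≡ h → c h < k → ∃ λ u → C̅ x y u ≡ true
  C̅-exists {h} {x} {y} e c<k = count-∃ (C̅ x y) (ℕₚ.+-cancelˡ-< (c h) 0 _ (subst₂ _<_ (sym (ℕₚ.+-identityʳ (c h))) (C+C̅ e) c<k))

  -- If `w` is one step from `y` towards `x`, then C(x;w) is contained in C(x;y).
  c-mono-step : ∀ {h} → suc h ≤ D → c h ≤ c (suc h)
  c-mono-step {zero} h<D = ℕₚ.≤-trans (ℕₚ.≤-reflexive c₀) z≤n
    where
    c₀ : c 0 ≡ 0
    c₀ = let (x , y) , e = pair 0 z≤n in trans (sym (c-spec e)) (count-none (λ z → trans (cong (λ h → adj x z ∧ (suc (d z y) ≡ᵇ h)) e) (Boolₚ.∧-zeroʳ (adj x z))))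
  c-mono-step {suc g} h<D =
    let (x , y) , e = pair (suc (suc g)) h<D
        w , yw , ew = d-step (trans (d-sym y x) e)
        exw = trans (d-sym x w) ew
    in subst₂ _≤_ (c-spec exw) (c-spec e) (count-mono λ z cz →
         let xz , ez = C-elim {x} {w} {z} cz
             dzw = ℕₚ.suc-injective (trans ez exw)
             lower : suc (suc g) ≤ suc (d z y)
             lower = ℕₚ.≤-trans (ℕₚ.≤-reflexive (sym e)) (ℕₚ.≤-trans (d-triangle x z y) (ℕₚ.+-monoˡ-≤ (d z y) (d≤1 xz)))
             upper : d z y ≤ suc g
             upper = ℕₚ.≤-trans (d-triangle z w y) (ℕₚ.≤-trans (ℕₚ.+-mono-≤ (ℕₚ.≤-reflexive dzw) (d≤1 (~-sym yw))) (ℕₚ.≤-reflexive (ℕₚ.+-comm g 1)))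
         in C-intro xz (trans (cong suc (ℕₚ.≤-antisym upper (ℕₚ.≤-pred lower))) (sym e)))

-- Consequences of the balanced relation

module Relations (S : Setting) (cos : Cosines (Setting.G S) (Setting.conn S) (Setting.D S)) where
  open Local S
  open Cosines cos using (field₀; stable; W; distinct; eigenvalue; balanced)
  open FieldKit field₀
  open LinearAlgebra field₀
  open SetoidReasoning setoid

  V : List (Fin n)
  V = allFin n

  δ : Bool → Carrier
  δ b = if b then 1# else 0#

  -- The sequence is continued by W_D beyond the diameter. A neighbour that is not closer stays on
  -- level `D` once it is reached, so `w (suc D)` is the value it contributes, and the relations
  -- keep one form on all levels.
  w : ℕ → Carrier
  w i = W (i ℕ.⊓ D)

  W≡w : ∀ x y → W (d x y) ≡ w (d x y)
  W≡w x y = cong W (sym (ℕₚ.m≤n⇒m⊓n≡m (d≤D x y)))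

  w-⊓ : ∀ i → w (i ℕ.⊓ D) ≡ w i
  w-⊓ i = cong W (trans (ℕₚ.⊓-assoc i D D) (cong (i ℕ.⊓_) (ℕₚ.⊓-idem D)))

  w-distinct : ∀ {i j} → i ≤ D → j ≤ D → i ≢ j → ¬ w i ≈ w j
  w-distinct {i} {j} i≤D j≤D i≢j e =
    let (x , y) , exy = pair i i≤D
        (x′ , y′) , exy′ = pair j j≤D
    in distinct x y x′ y′ (λ eq → i≢j (trans (sym exy) (trans eq exy′)))
         (≈-trans (≈-reflexive (trans (W≡w x y) (cong w exy))) (≈-trans e (≈-reflexive (sym (trans (W≡w x′ y′) (cong w exy′))))))

  w-skip : ∀ {i} → i < D → ¬ w i ≈ w (suc (suc i))
  w-skip {i} i<D e = w-distinct {i} {suc (suc i) ℕ.⊓ D} (ℕₚ.<⇒≤ i<D) (ℕₚ.m⊓n≤n (suc (suc i)) D)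
    (ℕₚ.<⇒≢ (ℕₚ.⊓-glb (ℕₚ.m≤n⇒m≤1+n ℕₚ.≤-refl) i<D)) (≈-trans e (≈-reflexive (sym (w-⊓ (suc (suc i))))))

  ∑δ : ∀ {m} {A : Set} (g : Fin m → A) (p q : A → Bool) (f : A → Carrier) (a b : Carrier) →
       (∀ i → p (g i) ≡ true → q (g i) ≡ true → f (g i) ≈ a) → (∀ i → p (g i) ≡ true → q (g i) ≡ false → f (g i) ≈ b) →
       ∑ (tabulate g) (λ z → δ (p z) ⊛ f z) ≈ ν (count (λ i → p (g i) ∧ q (g i))) ⊛ a ⊕ (ν (count (p ∘ g)) ⊝ ν (count (λ i → p (g i) ∧ q (g i)))) ⊛ b
  ∑δ {zero}  g p q f a b ha hb = ring-solve 2 (λ a b → # 0 :≈ # 0 :* a :+ (# 0 :- # 0) :* b) ≈-refl a b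
  ∑δ {suc m} g p q f a b ha hb with p (g zero) | q (g zero) | ha zero | hb zero | ∑δ (g ∘ suc) p q f a b (ha ∘ suc) (hb ∘ suc)
  ... | true  | true  | fa | _  | ih = ≈-trans (+-cong (*-cong (≈-sym ι-1) (fa refl refl)) ih) (≈-trans (ring-solve 4 (λ a b N P → # 1 :* a :+ (N :* a :+ (P :- N) :* b) :≈ (# 1 :+ N) :* a :+ ((# 1 :+ P) :- (# 1 :+ N)) :* b) ≈-refl a b _ _) (+-cong (*-cong (+-cong ι-1 ≈-refl) ≈-refl) (*-cong (+-cong (+-cong ι-1 ≈-refl) (-‿cong (+-cong ι-1 ≈-refl))) ≈-refl)))
  ... | true  | false | _  | fb | ih = ≈-trans (+-cong (*-cong (≈-sym ι-1) (fb refl refl)) ih) (≈-trans (ring-solve 4 (λ a b N P → # 1 :* b :+ (N :* a :+ (P :- N) :* b) :≈ N :* a :+ ((# 1 :+ P) :- N) :* b) ≈-refl a b _ _) (+-cong ≈-refl (*-cong (+-cong (+-cong ι-1 ≈-refl) ≈-refl) ≈-refl)))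
  ... | false | _     | _  | _  | ih = ≈-trans (+-cong (zeroˡ _) ih) (+-identityˡ _)

  SumC : Fin n → Fin n → Fin n → Carrier
  SumC u x y = ∑ V (λ z → δ (C x y z) ⊛ w (d u z))

  SumC-split : ∀ {h x y} u (q : Fin n → Bool) a b → d x y ≡ h →
    (∀ z → C x y z ≡ true → q z ≡ true → w (d u z) ≈ a) → (∀ z → C x y z ≡ true → q z ≡ false → w (d u z) ≈ b) →
    SumC u x y ≈ ν (count (λ z → C x y z ∧ q z)) ⊛ a ⊕ (ν (c h) ⊝ ν (count (λ z → C x y z ∧ q z))) ⊛ b
  SumC-split {h} {x} {y} u q a b e ha hb = ≈-trans (∑δ id (C x y) q (λ z → w (d u z)) a b ha hb)
    (+-cong ≈-refl (*-cong (+-cong (≈-reflexive (cong ν (c-spec e))) ≈-refl) ≈-refl))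

  SumC-const : ∀ {h x y} u a → d x y ≡ h → (∀ z → C x y z ≡ true → w (d u z) ≈ a) → SumC u x y ≈ ν (c h) ⊛ a
  SumC-const u a e ha = ≈-trans (SumC-split u (λ _ → false) a a e (λ z cz _ → ha z cz) (λ z cz _ → ha z cz))
    (ring-solve 3 (λ N c a → N :* a :+ (c :- N) :* a :≈ c :* a) ≈-refl _ _ _)

  swap-d : ∀ {x y h} → d x y ≡ h → d y x ≡ h
  swap-d {x} {y} e = trans (d-sym y x) e

  at-d : ∀ {x y h} → d x y ≡ h → w (d x y) ≈ w h
  at-d e = ≈-reflexive (cong w e)

  private
    balanced-raw : ∀ g → ¬ ¬ Σ Carrier λ r → ∀ {x y} → d x y ≡ suc g → ∀ u → SumC u x y ⊝ SumC u y x ≈ r ⊛ (w (d u x) ⊝ w (d u y))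
    balanced-raw g k = balanced 1 g λ (Y , h) → k (⊖ Y (suc g) , λ {x} {y} e u → begin
      SumC u x y ⊝ SumC u y x
        ≈⟨ +-cong (∑-cong V (first e u)) (-‿cong (∑-cong V (second e u))) ⟩
      ∑ V (λ z → δ (d x z ≡ᵇ 1) ⊛ (W (d u z) ⊛ δ (d z y ≡ᵇ g))) ⊝ ∑ V (λ z → δ (d x z ≡ᵇ g) ⊛ (W (d u z) ⊛ δ (d z y ≡ᵇ 1)))
        ≈⟨ h u x y ⟩
      Y (d x y) ⊛ (W (d u y) ⊝ W (d u x))
        ≈⟨ *-cong (≈-reflexive (cong Y e)) (≈-reflexive (cong₂ _⊝_ (W≡w u y) (W≡w u x))) ⟩
      Y (suc g) ⊛ (w (d u y) ⊝ w (d u x))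
        ≈⟨ ring-solve 3 (λ y a b → y :* (a :- b) :≈ (:- y) :* (b :- a)) ≈-refl _ _ _ ⟩
      ⊖ Y (suc g) ⊛ (w (d u x) ⊝ w (d u y)) ∎)
      where
      δ-∧ : ∀ a b → δ (a ∧ b) ≈ δ a ⊛ δ b
      δ-∧ true  b = ≈-sym (*-identityˡ _)
      δ-∧ false b = ≈-sym (zeroˡ _)
      first : ∀ {x y} → d x y ≡ suc g → ∀ u z → δ (C x y z) ⊛ w (d u z) ≈ δ (d x z ≡ᵇ 1) ⊛ (W (d u z) ⊛ δ (d z y ≡ᵇ g))
      first {x} {y} e u z = ≈-trans (*-cong (≈-trans (≈-reflexive (cong δ (cong₂ _∧_ (adj≡ x z) (cong (suc (d z y) ≡ᵇ_) e)))) (δ-∧ (d x z ≡ᵇ 1) _)) (≈-reflexive (sym (W≡w u z))))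
        (ring-solve 3 (λ a b c → (a :* b) :* c :≈ a :* (c :* b)) ≈-refl _ _ _)
      second : ∀ {x y} → d x y ≡ suc g → ∀ u z → δ (C y x z) ⊛ w (d u z) ≈ δ (d x z ≡ᵇ g) ⊛ (W (d u z) ⊛ δ (d z y ≡ᵇ 1))
      second {x} {y} e u z = ≈-trans (*-cong (≈-trans (≈-reflexive (cong δ (cong₂ _∧_ (trans (adj≡ y z) (cong (_≡ᵇ 1) (d-sym y z)))
            (trans (cong (suc (d z x) ≡ᵇ_) (swap-d e)) (cong (_≡ᵇ g) (d-sym z x)))))) (δ-∧ (d z y ≡ᵇ 1) _)) (≈-reflexive (sym (W≡w u z))))
        (ring-solve 3 (λ a b c → (a :* b) :* c :≈ b :* (c :* a)) ≈-refl _ _ _)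

    closer-1 : ∀ {g x y} → d x y ≡ suc g → SumC x x y ≈ ν (c (suc g)) ⊛ w 1
    closer-1 {x = x} {y} e = SumC-const x (w 1) e (λ z cz → at-d (~⇒d≡1 (proj₁ (C-elim {x} {y} {z} cz))))

    closer-g : ∀ {g x y} → d x y ≡ suc g → SumC x y x ≈ ν (c (suc g)) ⊛ w g
    closer-g {g} {x} {y} e = SumC-const x (w g) (swap-d e) (λ z cz → at-d (swap-d (ℕₚ.suc-injective (trans (proj₂ (C-elim {y} {x} {z} cz)) (swap-d e)))))

  gap≉0 : ∀ {g} → suc g ≤ D → ¬ w 0 ⊝ w (suc g) ≈ 0#
  gap≉0 g<D = diff≉0 (w-distinct z≤n g<D (λ ()))

  -- The factor forced by the balanced relation at `u = x`, where the sums are c_h W₁ and c_h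
  -- W_{h-1}. With this explicit value `bal` no longer needs a double negation.
  ρ : ℕ → Carrier
  ρ h = ν (c h) ⊛ (w 1 ⊝ w (ℕ.pred h)) ⊛ (w 0 ⊝ w h) ⁻¹

  R0 : ∀ {g} → suc g ≤ D → ν (c (suc g)) ⊛ (w 1 ⊝ w g) ≈ ρ (suc g) ⊛ (w 0 ⊝ w (suc g))
  R0 g<D = ≈-sym (≈-trans (*-assoc _ _ _) (≈-trans (*-cong ≈-refl (≈-trans (*-comm _ _) (inverseʳ _ (gap≉0 g<D)))) (*-identityʳ _)))

  bal : ∀ {g x y} → d x y ≡ suc g → ∀ u → SumC u x y ⊝ SumC u y x ≈ ρ (suc g) ⊛ (w (d u x) ⊝ w (d u y))
  bal {g} {x} {y} e u = stable λ k → balanced-raw g λ (r , hr) → k (≈-trans (hr e u) (*-cong (r≈ρ r hr) ≈-refl))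
    where
    g<D = subst (_≤ D) e (d≤D x y)
    r≈ρ : ∀ r → (∀ {x y} → d x y ≡ suc g → ∀ u → SumC u x y ⊝ SumC u y x ≈ r ⊛ (w (d u x) ⊝ w (d u y))) → r ≈ ρ (suc g)
    r≈ρ r hr = cancelˡ (gap≉0 g<D) (begin
      (w 0 ⊝ w (suc g)) ⊛ r             ≈⟨ *-comm _ _ ⟩
      r ⊛ (w 0 ⊝ w (suc g))             ≈⟨ *-cong ≈-refl (+-cong (≈-sym (at-d (d-refl x))) (-‿cong (≈-sym (at-d e)))) ⟩
      r ⊛ (w (d x x) ⊝ w (d x y))       ≈⟨ ≈-sym (hr e x) ⟩
      SumC x x y ⊝ SumC x y x           ≈⟨ +-cong (closer-1 e) (-‿cong (closer-g e)) ⟩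
      ν (c (suc g)) ⊛ w 1 ⊝ ν (c (suc g)) ⊛ w g  ≈⟨ ring-solve 3 (λ c a b → c :* a :- c :* b :≈ c :* (a :- b)) ≈-refl _ _ _ ⟩
      ν (c (suc g)) ⊛ (w 1 ⊝ w g)       ≈⟨ R0 g<D ⟩
      ρ (suc g) ⊛ (w 0 ⊝ w (suc g))     ≈⟨ *-comm _ _ ⟩
      (w 0 ⊝ w (suc g)) ⊛ ρ (suc g)     ∎)

  ν≉0 : ∀ {m} → 1 ≤ m → ¬ ν m ≈ 0#
  ν≉0 {suc m} _ = char0 m

  -- `ρ 2` does vanish: vertices at distance two have the same single vertex in both sets C.
  ρ≉0 : ∀ {g} → suc g ≤ D → g ≢ 1 → ¬ ρ (suc g) ≈ 0#
  ρ≉0 {g} g<D g≢1 e = *≉0 (ν≉0 (c-pos g<D)) (diff≉0 (w-distinct (ℕₚ.≤-trans (s≤s z≤n) 3≤D) (ℕₚ.≤-trans (ℕₚ.n≤1+n g) g<D) (g≢1 ∘ sym)))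
    (≈-trans (R0 g<D) (≈-trans (*-cong e ≈-refl) (zeroˡ _)))

  Flat : ℕ → Set
  Flat h = ∀ {x u y} → x ~ u → d x y ≡ h → d u y ≢ h

  not-closer : ∀ {x u y h} → x ~ u → d x y ≡ h → suc (d u y) ≢ h → h ≤ d u y
  not-closer {x} {u} {y} xu refl ne = ℕₚ.≤-pred (ℕₚ.≤∧≢⇒< (ℕₚ.≤-trans (d-near {u} y (~-sym xu)) ℕₚ.≤-refl) (ne ∘ sym))

  -- The balanced relation for a neighbour `u` of `x` that is not closer to `y`. All of C(x;y) is at
  -- distance two from `u`; all of C(y;x) is at distance g + 1, because a smaller distance would
  -- give a horizontal edge at level `g`.
  R2′ : ∀ {g x u y} → Flat g → x ~ u → d x y ≡ suc g → suc (d u y) ≢ suc g →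
        ν (c (suc g)) ⊛ (w 2 ⊝ w (suc g)) ≈ ρ (suc g) ⊛ (w 1 ⊝ w (d u y))
  R2′ {g} {x} {u} {y} flat xu e ne = begin
    ν (c (suc g)) ⊛ (w 2 ⊝ w (suc g))
      ≈⟨ ring-solve 3 (λ c a b → c :* (a :- b) :≈ c :* a :- c :* b) ≈-refl _ _ _ ⟩
    ν (c (suc g)) ⊛ w 2 ⊝ ν (c (suc g)) ⊛ w (suc g)
      ≈⟨ ≈-sym (+-cong (SumC-const u (w 2) e near) (-‿cong (SumC-const u (w (suc g)) (swap-d e) opposite))) ⟩
    SumC u x y ⊝ SumC u y x
      ≈⟨ bal e u ⟩
    ρ (suc g) ⊛ (w (d u x) ⊝ w (d u y))
      ≈⟨ *-cong ≈-refl (+-cong (at-d (~⇒d≡1 (~-sym xu))) ≈-refl) ⟩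
    ρ (suc g) ⊛ (w 1 ⊝ w (d u y)) ∎
    where
    near : ∀ z → C x y z ≡ true → w (d u z) ≈ w 2
    near z cz = let xz , ez = C-elim {x} {y} {z} cz in
      at-d (2-path (~-sym xu) xz (λ { refl → ne (trans ez e) }))
    opposite : ∀ z → C y x z ≡ true → w (d u z) ≈ w (suc g)
    opposite z cz = at-d (ℕₚ.≤-antisym upper (ℕₚ.≤∧≢⇒< lower (λ eq → flat xu dxz (sym eq))))
      where
      yz = proj₁ (C-elim {y} {x} {z} cz)
      dxz : d x z ≡ g
      dxz = swap-d (ℕₚ.suc-injective (trans (proj₂ (C-elim {y} {x} {z} cz)) (swap-d e)))
      upper : d u z ≤ suc g
      upper = ℕₚ.≤-trans (d-near z xu) (s≤s (ℕₚ.≤-reflexive dxz))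
      lower : g ≤ d u z
      lower = ℕₚ.≤-pred (ℕₚ.≤-trans (not-closer xu e ne) (ℕₚ.≤-trans (d-triangle u z y) (ℕₚ.≤-trans (ℕₚ.+-monoʳ-≤ (d u z) (d≤1 (~-sym yz))) (ℕₚ.≤-reflexive (ℕₚ.+-comm (d u z) 1)))))

  -- There are no horizontal edges below the diameter: an edge at level h and an edge from level h to
  -- level h + 1 would give the same balanced relation with W h and with W (h + 1).
  flat : ∀ h → h < D → Flat h
  flat 0 _ xu e e′ = ~⇒≢ xu (trans (d≡0⇒≡ e) (sym (d≡0⇒≡ e′)))
  flat 1 _ xu e e′ = noTri (_ , xu , d≡1⇒~ e′ , ~-sym (d≡1⇒~ e))
  flat 2 _ {x} {u} {y} xu e e′ with d-step e
  ... | z , xz , ez = ℕₚ.<-irrefl (trans (sym e′) (3-path (~-sym xu) xz (d≡1⇒~ ez) (λ { refl → ℕₚ.<-irrefl (trans (sym ez) e′) ℕₚ.≤-refl }) (apart e))) ℕₚ.≤-refl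
  flat (suc (suc (suc g))) h<D {x} {u} {y} xu e e′ =
    let v , xv , ev = further e h<D
        h = suc (suc (suc g))
        fl = flat (suc (suc g)) (ℕₚ.<-trans (ℕₚ.n<1+n _) h<D)
        eq₁ = R2′ fl xu e (λ eq → ℕₚ.1+n≢n (trans (cong suc (sym e′)) eq))
        eq₂ = R2′ fl xv e (λ eq → ℕₚ.m≢1+n+m h {1} (sym (trans (cong suc (sym ev)) eq)))
        same = cancelˡ (ρ≉0 (ℕₚ.<⇒≤ h<D) (λ ())) (≈-trans (≈-sym eq₁) eq₂)
    in w-distinct (ℕₚ.<⇒≤ h<D) h<D (ℕₚ.1+n≢n ∘ sym)
         (lc₁ (⊖ 1#) (≈-trans (+-cong ≈-refl (-‿cong (≈-sym (at-d e′)))) (≈-trans same (+-cong ≈-refl (-‿cong (at-d ev)))))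
           (≈-trans (ring-solve 3 (λ a b o → a :- b :≈ (:- # 1) :* ((o :- a) :- (o :- b))) ≈-refl _ _ _) (*-cong (-‿cong ι-1) ≈-refl)))

  up-level : ∀ {x y u h} → d x y ≡ h → x ~ u → suc (d u y) ≢ h → d u y ≡ suc h ℕ.⊓ D
  up-level {x} {y} {u} {h} e xu ne with h ℕ.≟ D
  ... | yes refl = trans (ℕₚ.≤-antisym (d≤D u y) (not-closer xu e ne)) (sym (ℕₚ.m≥n⇒m⊓n≡n (ℕₚ.n≤1+n h)))
  ... | no h≢D = trans (ℕₚ.≤-antisym (ℕₚ.≤-trans (d-near y xu) (s≤s (ℕₚ.≤-reflexive e)))
                          (ℕₚ.≤∧≢⇒< (not-closer xu e ne) (λ eq → flat h h<D xu e (sym eq)))) (sym (ℕₚ.m≤n⇒m⊓n≡m h<D))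
    where h<D = ℕₚ.≤∧≢⇒< (subst (_≤ D) e (d≤D x y)) h≢D

  up-w : ∀ {x y u h} → d x y ≡ h → x ~ u → suc (d u y) ≢ h → w (d u y) ≈ w (suc h)
  up-w {h = h} e xu ne = ≈-trans (at-d (up-level e xu ne)) (≈-reflexive (w-⊓ (suc h)))

  common : Fin n → Fin n → Fin n → ℕ
  common y x u = count (λ z → C y x z ∧ C y u z)

  -- Seen from `u`, a neighbour of `y` is closer than `y` or, by `up-w`, contributes the cosine of
  -- the next level; the closer ones in C(y;x) are counted by `common`.
  SumC-common : ∀ {h x y u g′} → d x y ≡ h → d u y ≡ suc g′ →
    SumC u y x ≈ ν (common y x u) ⊛ w g′ ⊕ (ν (c h) ⊝ ν (common y x u)) ⊛ w (suc (suc g′))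
  SumC-common {h} {x} {y} {u} {g′} e e′ = SumC-split u (C y u) (w g′) (w (suc (suc g′))) (swap-d e)
    (λ z _ cz → at-d (swap-d (ℕₚ.suc-injective (trans (proj₂ (C-elim {y} {u} {z} cz)) (swap-d e′)))))
    (λ z cz ncz → ≈-trans (≈-reflexive (cong w (d-sym u z)))
      (up-w (swap-d e′) (proj₁ (C-elim {y} {x} {z} cz)) (λ eq → true≢false (trans (sym (C-intro (proj₁ (C-elim {y} {x} {z} cz)) (trans eq (sym (swap-d e′))))) ncz))))

  SumC-one : ∀ {h x y u z} a b → d x y ≡ h → C x y z ≡ true → w (d u z) ≈ a → (∀ z′ → C x y z′ ≡ true → z ≢ z′ → w (d u z′) ≈ b) →
    SumC u x y ≈ a ⊕ (ν (c h) ⊝ ι (+ 1)) ⊛ b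
  SumC-one {h} {x} {y} {u} {z} a b e cz ha hb = ≈-trans (SumC-split u (eqᵇ z) a b e
      (λ z′ _ eq → ≈-trans (≈-reflexive (cong (λ t → w (d u t)) (sym (eqᵇ-true z z′ eq)))) ha)
      (λ z′ cz′ ne → hb z′ cz′ (λ { refl → true≢false (trans (sym (eqᵇ-refl z)) ne) })))
    (≈-trans (+-cong (*-cong N≈1 ≈-refl) (*-cong (+-cong ≈-refl (-‿cong N≈1)) ≈-refl)) (+-cong (≈-trans (*-cong ι-1 ≈-refl) (*-identityˡ _)) ≈-refl))
    where
    N≈1 : ν (count (λ t → C x y t ∧ eqᵇ z t)) ≈ ι (+ 1)
    N≈1 = ≈-reflexive (cong ν (count-single z (∧-intro cz (eqᵇ-refl z)) (λ t e → eqᵇ-true z t (proj₂ (∧-true {C x y t} e)))))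

  -- The balanced relation for `u = z` in C(x;y). Since C(y;z) lies inside C(y;x), the intersection
  -- has the full size c_{h-1}.
  R1 : ∀ {g x y} → d x y ≡ suc (suc g) →
    (w 0 ⊕ (ν (c (suc (suc g))) ⊝ ι (+ 1)) ⊛ w 2) ⊝ (ν (c (suc g)) ⊛ w g ⊕ (ν (c (suc (suc g))) ⊝ ν (c (suc g))) ⊛ w (suc (suc g)))
      ≈ ρ (suc (suc g)) ⊛ (w 1 ⊝ w (suc g))
  R1 {g} {x} {y} e with d-step e
  ... | z , xz , ez = begin
    (w 0 ⊕ (ν (c h) ⊝ ι (+ 1)) ⊛ w 2) ⊝ (ν (c (suc g)) ⊛ w g ⊕ (ν (c h) ⊝ ν (c (suc g))) ⊛ w h)
      ≈⟨ +-cong (≈-sym (SumC-one (w 0) (w 2) e (C-intro xz (trans (cong suc ez) (sym e))) (at-d (d-refl z))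
                  (λ z′ cz′ z≢z′ → at-d (2-path (~-sym xz) (proj₁ (C-elim {x} {y} {z′} cz′)) z≢z′))))
           (-‿cong (≈-sym (≈-trans (SumC-common e ez) (≈-reflexive (cong (λ N → ν N ⊛ w g ⊕ (ν (c h) ⊝ ν N) ⊛ w h) all-common))))) ⟩
    SumC z x y ⊝ SumC z y x
      ≈⟨ bal e z ⟩
    ρ h ⊛ (w (d z x) ⊝ w (d z y))
      ≈⟨ *-cong ≈-refl (+-cong (at-d (~⇒d≡1 (~-sym xz))) (-‿cong (at-d ez))) ⟩
    ρ h ⊛ (w 1 ⊝ w (suc g)) ∎
    where
    h = suc (suc g)
    all-common : common y x z ≡ c (suc g)
    all-common = trans (count-cong (λ t → bool-ext (λ b → proj₂ (∧-true {C y x t} b)) (λ ct → ∧-intro (lift t ct) ct))) (c-spec (swap-d ez))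
      where
      lift : ∀ t → C y z t ≡ true → C y x t ≡ true
      lift t ct = let yt , et = C-elim {y} {z} {t} ct
                      dtz = ℕₚ.suc-injective (trans et (swap-d ez))
                  in C-intro yt (trans (cong suc (ℕₚ.≤-antisym
                       (ℕₚ.≤-trans (d-triangle t z x) (ℕₚ.≤-trans (ℕₚ.+-mono-≤ (ℕₚ.≤-reflexive dtz) (d≤1 (~-sym xz))) (ℕₚ.≤-reflexive (ℕₚ.+-comm g 1))))
                       (ℕₚ.≤-pred (ℕₚ.≤-trans (ℕₚ.≤-reflexive (sym (swap-d e))) (d-near x (~-sym yt)))))) (sym (swap-d e)))

  -- Two vertices on level `h` around `y` whose common neighbour `z` lies one level lower.
  record Below (h : ℕ) (y x u : Fin n) : Set where
    constructor below
    field
      {z} : Fin n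
      level : d x y ≡ h
      closer : C x y z ≡ true
      zu : z ~ u
      x≢u : x ≢ u
      level′ : d u y ≡ h

  -- The counterpart of `Below`: the common neighbour `v` lies one level higher, or on the same
  -- level if h = D.
  record Above (h : ℕ) (y x u : Fin n) : Set where
    constructor above
    field
      {v} : Fin n
      level : d x y ≡ h
      farther : C̅ x y v ≡ true
      vu : v ~ u
      x≢u : x ≢ u
      level′ : d u y ≡ h

  -- The balanced relation for `u` at distance two from `x`: the middle vertex `z` contributes W₁,
  -- and the rest of C(x;y) is at distance three from `u` by the girth.
  Rf : ∀ {g x y u} → Below (suc g) y x u →
    (w 1 ⊕ (ν (c (suc g)) ⊝ ι (+ 1)) ⊛ w 3) ⊝ (ν (common y x u) ⊛ w g ⊕ (ν (c (suc g)) ⊝ ν (common y x u)) ⊛ w (suc (suc g)))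
      ≈ ρ (suc g) ⊛ (w 2 ⊝ w (suc g))
  Rf {g} {x} {y} {u} (below {z} e cz zu x≢u e′) = begin
    (w 1 ⊕ (ν (c (suc g)) ⊝ ι (+ 1)) ⊛ w 3) ⊝ (ν (common y x u) ⊛ w g ⊕ (ν (c (suc g)) ⊝ ν (common y x u)) ⊛ w (suc (suc g)))
      ≈⟨ +-cong (≈-sym (SumC-one (w 1) (w 3) e cz (at-d (~⇒d≡1 (~-sym zu)))
                  (λ z′ cz′ z≢z′ → at-d (3-path (~-sym zu) (~-sym xz) (proj₁ (C-elim {x} {y} {z′} cz′)) (x≢u ∘ sym) z≢z′))))
           (-‿cong (≈-sym (SumC-common e e′))) ⟩
    SumC u x y ⊝ SumC u y x
      ≈⟨ bal e u ⟩
    ρ (suc g) ⊛ (w (d u x) ⊝ w (d u y))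
      ≈⟨ *-cong ≈-refl (+-cong (at-d (2-path (~-sym zu) (~-sym xz) (x≢u ∘ sym))) (-‿cong (at-d e′))) ⟩
    ρ (suc g) ⊛ (w 2 ⊝ w (suc g)) ∎
    where xz = proj₁ (C-elim {x} {y} {z} cz)

  -- As in `Rf`, but the middle vertex is not in C(x;y), so the whole of C(x;y) is at distance three
  -- from `u`.
  Rg : ∀ {g x y u} → Above (suc g) y x u →
    ν (c (suc g)) ⊛ w 3 ⊝ (ν (common y x u) ⊛ w g ⊕ (ν (c (suc g)) ⊝ ν (common y x u)) ⊛ w (suc (suc g)))
      ≈ ρ (suc g) ⊛ (w 2 ⊝ w (suc g))
  Rg {g} {x} {y} {u} (above {v} e fv vu x≢u e′) = begin
    ν (c (suc g)) ⊛ w 3 ⊝ (ν (common y x u) ⊛ w g ⊕ (ν (c (suc g)) ⊝ ν (common y x u)) ⊛ w (suc (suc g)))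
      ≈⟨ +-cong (≈-sym (SumC-const u (w 3) e (λ z cz → at-d (3-path (~-sym vu) (~-sym xv) (proj₁ (C-elim {x} {y} {z} cz)) (x≢u ∘ sym)
                  (λ { refl → proj₂ (C̅-elim {x} {y} {v} fv) (proj₂ (C-elim {x} {y} {z} cz)) })))))
           (-‿cong (≈-sym (SumC-common e e′))) ⟩
    SumC u x y ⊝ SumC u y x
      ≈⟨ bal e u ⟩
    ρ (suc g) ⊛ (w (d u x) ⊝ w (d u y))
      ≈⟨ *-cong ≈-refl (+-cong (at-d (2-path (~-sym vu) (~-sym xv) (x≢u ∘ sym))) (-‿cong (at-d e′))) ⟩
    ρ (suc g) ⊛ (w 2 ⊝ w (suc g)) ∎
    where xv = proj₁ (C̅-elim {x} {y} {v} fv)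

  R2 : ∀ {g} → suc g ≤ D → c (suc g) < k → ν (c (suc g)) ⊛ (w 2 ⊝ w (suc g)) ≈ ρ (suc g) ⊛ (w 1 ⊝ w (suc (suc g)))
  R2 {g} g<D c<k = let (x , y) , e = pair (suc g) g<D
                       u , fu = C̅-exists e c<k
                       xu , ne = C̅-elim {x} {y} {u} fu
                       ne′ = λ eq → ne (trans eq (sym e))
                   in ≈-trans (R2′ (flat g g<D) xu e ne′) (*-cong ≈-refl (+-cong ≈-refl (-‿cong (up-w e xu ne′))))

  -- The recurrence of the cosine sequence. No middle term appears even at level `D`, since
  -- `w (suc D)` already equals `w D`.
  three-term : ¬ ¬ Σ Carrier λ θ → ν k ⊛ w 1 ≈ θ ⊛ w 0 × (∀ {g} → suc g ≤ D → ν (c (suc g)) ⊛ w g ⊕ (ν k ⊝ ν (c (suc g))) ⊛ w (suc (suc g)) ≈ θ ⊛ w (suc g))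
  three-term k′ = eigenvalue λ (θ , eig) → k′ (θ , first θ eig , next θ eig)
    where
    Eig : Carrier → Set
    Eig θ = ∀ x z → ∑ V (λ y → δ (d x y ≡ᵇ 1) ⊛ W (d y z)) ≈ θ ⊛ W (d x z)
    sum-of : ∀ θ → Eig θ → ∀ x z → ∑ V (λ y → δ (adj x y) ⊛ w (d y z)) ≈ θ ⊛ w (d x z)
    sum-of θ eig x z = ≈-trans (∑-cong V (λ y → *-cong (≈-reflexive (cong δ (adj≡ x y))) (≈-reflexive (sym (W≡w y z))))) (≈-trans (eig x z) (*-cong ≈-refl (≈-reflexive (W≡w x z))))
    first : ∀ θ → Eig θ → ν k ⊛ w 1 ≈ θ ⊛ w 0
    first θ eig = let (x , _) , _ = pair 0 z≤n in begin
      ν k ⊛ w 1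
        ≈⟨ ring-solve 3 (λ N k a → k :* a :≈ N :* a :+ (k :- N) :* a) ≈-refl (ν (count (λ z → adj x z ∧ false))) (ν k) (w 1) ⟩
      ν (count (λ z → adj x z ∧ false)) ⊛ w 1 ⊕ (ν k ⊝ ν (count (λ z → adj x z ∧ false))) ⊛ w 1
        ≈⟨ ≈-sym (≈-trans (∑δ id (adj x) (λ _ → false) (λ y → w (d y x)) (w 1) (w 1) (λ y a _ → at-d (~⇒d≡1 (~-sym a))) (λ y a _ → at-d (~⇒d≡1 (~-sym a))))
             (+-cong ≈-refl (*-cong (+-cong (≈-reflexive (cong ν (valency x))) ≈-refl) ≈-refl))) ⟩
      ∑ V (λ y → δ (adj x y) ⊛ w (d y x))
        ≈⟨ sum-of θ eig x x ⟩
      θ ⊛ w (d x x)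
        ≈⟨ *-cong ≈-refl (at-d (d-refl x)) ⟩
      θ ⊛ w 0 ∎
    next : ∀ θ → Eig θ → ∀ {g} → suc g ≤ D → ν (c (suc g)) ⊛ w g ⊕ (ν k ⊝ ν (c (suc g))) ⊛ w (suc (suc g)) ≈ θ ⊛ w (suc g)
    next θ eig {g} g<D = let (x , z) , e = pair (suc g) g<D in begin
      ν (c (suc g)) ⊛ w g ⊕ (ν k ⊝ ν (c (suc g))) ⊛ w (suc (suc g))
        ≈⟨ ≈-reflexive (cong (λ N → ν N ⊛ w g ⊕ (ν k ⊝ ν N) ⊛ w (suc (suc g))) (sym (c-spec e))) ⟩
      ν (count (C x z)) ⊛ w g ⊕ (ν k ⊝ ν (count (C x z))) ⊛ w (suc (suc g))
        ≈⟨ ≈-sym (≈-trans (∑δ id (adj x) (λ y → suc (d y z) ≡ᵇ d x z) (λ y → w (d y z)) (w g) (w (suc (suc g)))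
             (λ y a b → at-d (ℕₚ.suc-injective (trans (≡ᵇ-true _ _ b) e)))
             (λ y a b → up-w e a (λ eq → true≢false (trans (sym (≡ᵇ-intro (trans eq (sym e)))) b))))
             (+-cong ≈-refl (*-cong (+-cong (≈-reflexive (cong ν (valency x))) ≈-refl) ≈-refl))) ⟩
      ∑ V (λ y → δ (adj x y) ⊛ w (d y z))
        ≈⟨ sum-of θ eig x z ⟩
      θ ⊛ w (d x z)
        ≈⟨ *-cong ≈-refl (at-d e) ⟩
      θ ⊛ w (suc g) ∎

-- Symmetric designs

module Designs (S : Setting) (cos : Cosines (Setting.G S) (Setting.conn S) (Setting.D S)) where
  open Local S
  open Relations S cos
  open Cosines cos using (field₀; stable)
  open FieldKit field₀

  -- Two instances of `Rf` differ only in the intersection number, whose coefficient W_g - W_{g+2}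
  -- is nonzero.
  common-const : ∀ {g x y u x′ y′ u′} → Below (suc g) y x u → Below (suc g) y′ x′ u′ → common y x u ≡ common y′ x′ u′
  common-const {g} {x} {y} {u} {x′} {y′} {u′} b b′ = ℤₚ.+-injective (ι-injective _ _ (cancelˡ (diff≉0 (w-skip g<D))
      (lc₂ (⊖ 1#) 1# (Rf b) (Rf b′) (≈-trans
        (ring-solve 8 (λ a e p r c N N′ t → (p :- r) :* N :- (p :- r) :* N′ :≈
            (:- # 1) :* (((a :+ (c :- # 1) :* e) :- (N :* p :+ (c :- N) :* r)) :- t) :+ # 1 :* (((a :+ (c :- # 1) :* e) :- (N′ :* p :+ (c :- N′) :* r)) :- t))
          ≈-refl (w 1) (w 3) (w g) (w (suc (suc g))) (ν (c (suc g))) (ν (common y x u)) (ν (common y′ x′ u′)) (ρ (suc g) ⊛ (w 2 ⊝ w (suc g))))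
        (+-cong (*-cong (-‿cong ι-1) ≈-refl) (*-cong ι-1 ≈-refl))))))
    where
    g<D : g < D
    g<D = subst (_≤ D) (Below.level b) (d≤D x y)

  -- `Rf` minus `Rg`. The quotient of two cosine differences is thereby an integer, the source of
  -- all later integrality arguments.
  common-ratio : ∀ {g x y u x′ y′ u′} → Below (suc g) y x u → Above (suc g) y′ x′ u′ →
    w 1 ⊝ w 3 ≈ (ν (common y x u) ⊝ ν (common y′ x′ u′)) ⊛ (w g ⊝ w (suc (suc g)))
  common-ratio {g} {x} {y} {u} {x′} {y′} {u′} b a = lc₂ 1# (⊖ 1#) (Rf b) (Rg a) (≈-trans
    (ring-solve 8 (λ a e p r c N N′ t → (a :- e) :- (N :- N′) :* (p :- r) :≈
        # 1 :* (((a :+ (c :- # 1) :* e) :- (N :* p :+ (c :- N) :* r)) :- t) :+ (:- # 1) :* ((c :* e :- (N′ :* p :+ (c :- N′) :* r)) :- t))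
      ≈-refl (w 1) (w 3) (w g) (w (suc (suc g))) (ν (c (suc g))) (ν (common y x u)) (ν (common y′ x′ u′)) (ρ (suc g) ⊛ (w 2 ⊝ w (suc g))))
    (+-cong (*-cong ι-1 ≈-refl) (*-cong (-‿cong ι-1) ≈-refl)))

  above-const : ∀ {g x y u x′ y′ u′} → Above (suc g) y x u → Above (suc g) y′ x′ u′ → common y x u ≡ common y′ x′ u′
  above-const {g} {x} {y} {u} {x′} {y′} {u′} b b′ = ℤₚ.+-injective (ι-injective _ _ (cancelˡ (diff≉0 (w-skip g<D))
      (lc₂ (⊖ 1#) 1# (Rg b) (Rg b′) (≈-trans
        (ring-solve 7 (λ e p r c N N′ t → (p :- r) :* N :- (p :- r) :* N′ :≈
            (:- # 1) :* ((c :* e :- (N :* p :+ (c :- N) :* r)) :- t) :+ # 1 :* ((c :* e :- (N′ :* p :+ (c :- N′) :* r)) :- t))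
          ≈-refl (w 3) (w g) (w (suc (suc g))) (ν (c (suc g))) (ν (common y x u)) (ν (common y′ x′ u′)) (ρ (suc g) ⊛ (w 2 ⊝ w (suc g))))
        (+-cong (*-cong (-‿cong ι-1) ≈-refl) (*-cong ι-1 ≈-refl))))))
    where
    g<D : g < D
    g<D = subst (_≤ D) (Above.level b) (d≤D x y)

  C̅-count : ∀ {h x y b} → d x y ≡ h → k ≡ c h + b → count (C̅ x y) ≡ b
  C̅-count {h} e k≡ = ℕₚ.+-cancelˡ-≡ (c h) _ _ (trans (sym (C+C̅ e)) k≡)

  C̅-two : ∀ {h x y} → d x y ≡ h → suc (suc (c h)) ≤ k → 1 < count (C̅ x y)
  C̅-two {h} {x} {y} e le = ℕₚ.+-cancelˡ-≤ (c h) 2 _ (subst₂ _≤_ (ℕₚ.+-comm 2 (c h)) (C+C̅ e) le)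

  below-exists : ∀ {g} → suc g ≤ D → suc (suc (c g)) ≤ k → Σ (Fin n × Fin n × Fin n) λ (x , y , u) → Below (suc g) y x u
  below-exists {g} g<D le =
    let (x , y) , e = pair (suc g) g<D
        z , xz , ez = d-step e
        u , fu , x≢u = count-other (C̅ z y) x (C̅-two ez le)
        zu , ne = C̅-elim {z} {y} {u} fu
    in (x , y , u) , below e (C-intro xz (trans (cong suc ez) (sym e))) zu x≢u
         (trans (up-level ez zu (λ eq → ne (trans eq (sym ez)))) (ℕₚ.m≤n⇒m⊓n≡m g<D))

  above-exists : ∀ {h} → suc h ≤ D → 2 ≤ c (suc h) → Σ (Fin n × Fin n × Fin n) λ (x , y , u) → Above h y x u
  above-exists {h} h<D two =
    let (v , y) , e = pair (suc h) h<D
        x , vx , ex = d-step e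
        u , cu , x≢u = count-other (C v y) x (subst (1 <_) (sym (c-spec e)) two)
        vu , eu = C-elim {v} {y} {u} cu
    in (x , y , u) , above ex (C̅-intro (~-sym vx) (λ eq → ℕₚ.m≢1+n+m h {1} (sym (trans (cong suc (sym e)) (trans eq ex))))) vu x≢u (ℕₚ.suc-injective (trans eu e))

  -- On the last level the middle vertex is itself on level `D` and must have two horizontal
  -- neighbours, so k - c_D has to be at least two.
  above-exists-end : suc (suc (c D)) ≤ k → Σ (Fin n × Fin n × Fin n) λ (x , y , u) → Above D y x u
  above-exists-end le =
    let (x , y) , e = pair D ℕₚ.≤-refl
        v , fv = C̅-exists e (ℕₚ.<-trans (ℕₚ.n<1+n _) le)
        xv , ne = C̅-elim {x} {y} {v} fv
        ev = trans (up-level e xv (λ eq → ne (trans eq (sym e)))) (ℕₚ.m≥n⇒m⊓n≡n (ℕₚ.n≤1+n D))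
        u , fu , x≢u = count-other (C̅ v y) x (C̅-two ev le)
        vu , ne′ = C̅-elim {v} {y} {u} fu
    in (x , y , u) , above e fv vu x≢u (trans (up-level ev vu (λ eq → ne′ (trans eq (sym ev)))) (ℕₚ.m≥n⇒m⊓n≡n (ℕₚ.n≤1+n D)))

  C-widen : ∀ {g x y z} → d x y ≡ suc g → x ~ z → d z y ≡ g → ∀ t → C y z t ≡ true → C y x t ≡ true
  C-widen {g} {x} {y} {z} e xz ez t ct =
    let yt , et = C-elim {y} {z} {t} ct
        upper : suc (d t x) ≤ suc g
        upper = ℕₚ.≤-trans (s≤s (d-triangle t z x)) (ℕₚ.≤-trans (ℕₚ.≤-reflexive (cong (_+ d z x) (trans et (swap-d ez))))
                  (ℕₚ.≤-trans (ℕₚ.+-monoʳ-≤ g (d≤1 (~-sym xz))) (ℕₚ.≤-reflexive (ℕₚ.+-comm g 1))))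
        lower : suc g ≤ suc (d t x)
        lower = ℕₚ.≤-trans (ℕₚ.≤-reflexive (sym (swap-d e))) (d-near x (~-sym yt))
    in C-intro yt (trans (ℕₚ.≤-antisym upper lower) (sym (swap-d e)))

  count-subset : ∀ {m} {p q : Fin m → Bool} → (∀ t → q t ≡ true → p t ≡ true) → count (λ t → p t ∧ q t) ≡ count q
  count-subset {p = p} {q} h = count-cong (λ t → bool-ext (λ e → proj₂ (∧-true {p t} e)) (λ e → ∧-intro (h t e) e))

  -- For fixed z at level g, the sets C(y; x) ∖ C(y; z), x running over the neighbours of z at level g + 1, form a
  -- symmetric design.
  design-below : ∀ {g b X} → suc g ≤ D → k ≡ c g + suc b → c (suc g) ≡ c g + suc X →
    ∀ {x y u} → Below (suc g) y x u → Σ ℕ λ f → common y x u ≡ c g + f × b * f ≡ suc X * X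
  design-below {g} {b} {X} g<D k≡ c≡ {x} {y} {u} B@(below {z} e cz zu x≢u e′) = f , trans (splitting u zu′ e′) (cong (_+ f) refl) , identity
    where
    xz = proj₁ (C-elim {x} {y} {z} cz)
    ez : d z y ≡ g
    ez = ℕₚ.suc-injective (trans (proj₂ (C-elim {x} {y} {z} cz)) e)
    zu′ = zu
    p : Fin n → Bool
    p u = C̅ z y u ∧ not (eqᵇ x u)
    q : Fin n → Bool
    q t = C y x t ∧ not (C y z t)
    f = count (λ t → q t ∧ C y u t)

    level-of : ∀ {u} → C̅ z y u ≡ true → d u y ≡ suc g
    level-of {u} fu = let zu , ne = C̅-elim {z} {y} {u} fu in trans (up-level ez zu (λ eq → ne (trans eq (sym ez)))) (ℕₚ.m≤n⇒m⊓n≡m g<D)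

    x-far : C̅ z y x ≡ true
    x-far = C̅-intro (~-sym xz) (λ eq → ℕₚ.m≢1+n+m g {1} (sym (trans (cong suc (sym e)) (trans eq ez))))

    count-p : count p ≡ b
    count-p = ℕₚ.suc-injective (trans (sym (count-remove (C̅ z y) x x-far)) (C̅-count ez k≡))

    count-q : count q ≡ suc X
    count-q = ℕₚ.+-cancelˡ-≡ (c g) _ _ (trans (cong (_+ count q) (sym (trans (count-subset (C-widen e xz ez)) (c-spec (swap-d ez)))))
      (trans (sym (count-split (C y x) (C y z))) (trans (c-spec (swap-d e)) c≡)))

    splitting : ∀ u → z ~ u → d u y ≡ suc g → common y x u ≡ c g + count (λ t → q t ∧ C y u t)
    splitting u zu eu = trans (count-split (λ t → C y x t ∧ C y u t) (C y z)) (cong₂ _+_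
      (trans (count-subset (λ t ct → ∧-intro (C-widen e xz ez t ct) (C-widen eu (~-sym zu) ez t ct))) (c-spec (swap-d ez)))
      (count-cong (λ t → rearrange (C y x t) (C y u t) (C y z t))))
      where
      rearrange : ∀ a b c → (a ∧ b) ∧ not c ≡ (a ∧ not c) ∧ b
      rearrange true  true  c = sym (Boolₚ.∧-identityʳ (not c))
      rearrange true  false c = sym (Boolₚ.∧-zeroʳ (not c))
      rearrange false b     c = refl

    per-u : ∀ u → p u ≡ true → count (λ t → q t ∧ C y u t) ≡ f
    per-u u′ pu = let fu , ne = ∧-true {C̅ z y u′} pu
                      zu″ = proj₁ (C̅-elim {z} {y} {u′} fu)
                      eu = level-of {u′} fu
                  in ℕₚ.+-cancelˡ-≡ (c g) _ _ (trans (sym (splitting u′ zu″ eu))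
                       (trans (common-const (below e cz zu″ (not-eqᵇ-elim x u′ ne) eu) B) (splitting u zu e′)))

    -- The dual count: the blocks through the point `t` belong to the vertices of C(z;t) outside
    -- C(z;y), again c_{g+1} - c_g in number, with `x` among them.
    per-t : ∀ t → q t ≡ true → count (λ u → p u ∧ C y u t) ≡ X
    per-t t qt = trans (count-cong same) (ℕₚ.suc-injective (trans (sym (count-remove _ x x-in)) rest))
      where
      ct = proj₁ (∧-true {C y x t} qt)
      yt = proj₁ (C-elim {y} {x} {t} ct)
      nct : C y z t ≢ true
      nct h = true≢false (trans (sym (proj₂ (∧-true {C y x t} qt))) (cong not h))
      dzt : d z t ≡ suc g
      dzt = swap-d (trans (up-level (swap-d ez) yt (λ eq → nct (C-intro yt (trans eq (sym (swap-d ez)))))) (ℕₚ.m≤n⇒m⊓n≡m g<D))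
      dxt : d x t ≡ g
      dxt = swap-d (ℕₚ.suc-injective (trans (proj₂ (C-elim {y} {x} {t} ct)) (swap-d e)))
      r : Fin n → Bool
      r u = C z t u ∧ not (C z y u)
      not-C⇒C̅ : ∀ {u} → z ~ u → not (C z y u) ≡ true → C̅ z y u ≡ true
      not-C⇒C̅ {u} zu h = ∧-intro zu (trans (cong (λ b → not (b ∧ (suc (d u y) ≡ᵇ d z y))) (sym zu)) h)
      C̅⇒not-C : ∀ {u} → C̅ z y u ≡ true → not (C z y u) ≡ true
      C̅⇒not-C {u} h = let zu , ne = ∧-true {adj z u} h in trans (cong (λ b → not (b ∧ (suc (d u y) ≡ᵇ d z y))) zu) ne
      same : ∀ u → p u ∧ C y u t ≡ r u ∧ not (eqᵇ x u)
      same u = bool-ext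
        (λ h → let pu , cu = ∧-true {p u} h
                   fu , ne = ∧-true {C̅ z y u} pu
                   zu = proj₁ (C̅-elim {z} {y} {u} fu)
                   dut = swap-d (ℕₚ.suc-injective (trans (proj₂ (C-elim {y} {u} {t} cu)) (swap-d (level-of {u} fu))))
               in ∧-intro (∧-intro (C-intro zu (trans (cong suc dut) (sym dzt))) (C̅⇒not-C {u} fu)) ne)
        (λ h → let ru , ne = ∧-true {r u} h
                   cu , nc = ∧-true {C z t u} ru
                   zu , eu = C-elim {z} {t} {u} cu
                   fu = not-C⇒C̅ {u} zu nc
               in ∧-intro (∧-intro fu ne) (C-intro yt (trans (cong suc (swap-d (ℕₚ.suc-injective (trans eu dzt)))) (sym (swap-d (level-of {u} fu))))))
      x-in : r x ≡ true
      x-in = ∧-intro (C-intro (~-sym xz) (trans (cong suc dxt) (sym dzt))) (C̅⇒not-C {x} x-far)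
      inside : ∀ u → C z y u ≡ true → C z t u ≡ true
      inside u cu = let zu , eu = C-elim {z} {y} {u} cu
                        upper : d u t ≤ g
                        upper = ℕₚ.≤-trans (d-triangle u y t) (ℕₚ.≤-trans (ℕₚ.+-monoʳ-≤ (d u y) (d≤1 yt)) (ℕₚ.≤-reflexive (trans (ℕₚ.+-comm (d u y) 1) (trans eu ez))))
                        lower : suc g ≤ suc (d u t)
                        lower = ℕₚ.≤-trans (ℕₚ.≤-reflexive (sym dzt)) (d-near t (~-sym zu))
                    in C-intro zu (trans (ℕₚ.≤-antisym (s≤s upper) lower) (sym dzt))
      rest : count r ≡ suc X
      rest = ℕₚ.+-cancelˡ-≡ (c g) _ _ (trans (cong (_+ count r) (sym (trans (count-subset inside) (c-spec ez))))
        (trans (sym (count-split (C z t) (C z y))) (trans (c-spec dzt) c≡)))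

    -- The relation λ (v - 1) = r (r - 1) of a symmetric design with v = b + 1 points, block size r
    -- = X + 1 and block intersection λ = f.
    identity : b * f ≡ suc X * X
    identity = subst₂ (λ s t → s * f ≡ t * X) count-p count-q (double-count p q (λ u t → C y u t) f X per-u per-t)

  -- For fixed v at level h + 1, the sets C(y; x), x running over C(v; y), form a symmetric design.
  design-above : ∀ {g m e′} → suc (suc g) ≤ D → c (suc (suc g)) ≡ suc m → c (suc g) ≡ suc e′ →
    ∀ {x y u} → Above (suc g) y x u → m * common y x u ≡ suc e′ * e′
  design-above {g} {m} {e′} h<D cm ce {x₁} {y₁} {u₁} A₁ = subst₂ (λ s t → s * common y₁ x₁ u₁ ≡ t * e′) count-p (trans (c-spec (swap-d ex)) ce)
      (double-count p q (λ u t → C y u t) (common y₁ x₁ u₁) e′ per-u per-t)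
    where
    h = suc g
    vy = pair (suc h) h<D
    v = proj₁ (proj₁ vy)
    y = proj₂ (proj₁ vy)
    e : d v y ≡ suc h
    e = proj₂ vy
    x = proj₁ (d-step e)
    vx : v ~ x
    vx = proj₁ (proj₂ (d-step e))
    ex : d x y ≡ h
    ex = proj₂ (proj₂ (d-step e))
    p q : Fin n → Bool
    p u = C v y u ∧ not (eqᵇ x u)
    q t = C y x t
    cx : C v y x ≡ true
    cx = C-intro vx (trans (cong suc ex) (sym e))
    count-p : count p ≡ m
    count-p = ℕₚ.suc-injective (trans (sym (count-remove (C v y) x cx)) (trans (c-spec e) cm))
    per-u : ∀ u → p u ≡ true → count (λ t → q t ∧ C y u t) ≡ common y₁ x₁ u₁
    per-u u pu = let cu , ne = ∧-true {C v y u} pu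
                     vu , eu = C-elim {v} {y} {u} cu
                 in above-const (above ex (C̅-intro (~-sym vx) (λ eq → ℕₚ.m≢1+n+m h {1} (sym (trans (cong suc (sym e)) (trans eq ex))))) vu (not-eqᵇ-elim x u ne) (ℕₚ.suc-injective (trans eu e))) A₁
    -- The blocks through `t` belong to the vertices of C(v;t), a set of c_h vertices that contains
    -- `x`.
    per-t : ∀ t → q t ≡ true → count (λ u → p u ∧ C y u t) ≡ e′
    per-t t ct = trans (count-cong same) (ℕₚ.suc-injective (trans (sym (count-remove (C v t) x x-in)) (trans (c-spec dvt) ce)))
      where
      yt = proj₁ (C-elim {y} {x} {t} ct)
      dxt : d x t ≡ g
      dxt = swap-d (ℕₚ.suc-injective (trans (proj₂ (C-elim {y} {x} {t} ct)) (swap-d ex)))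
      dvt : d v t ≡ h
      dvt = ℕₚ.≤-antisym (ℕₚ.≤-trans (d-near t (~-sym vx)) (s≤s (ℕₚ.≤-reflexive dxt)))
              (ℕₚ.≤-pred (ℕₚ.≤-trans (ℕₚ.≤-reflexive (sym (swap-d e))) (ℕₚ.≤-trans (d-near v (~-sym yt)) (s≤s (ℕₚ.≤-reflexive (d-sym t v))))))
      x-in : C v t x ≡ true
      x-in = C-intro vx (trans (cong suc dxt) (sym dvt))
      same : ∀ u → p u ∧ C y u t ≡ C v t u ∧ not (eqᵇ x u)
      same u = bool-ext
        (λ h′ → let pu , cu = ∧-true {p u} h′
                    cvu , ne = ∧-true {C v y u} pu
                    vu , eu = C-elim {v} {y} {u} cvu
                    dut = swap-d (ℕₚ.suc-injective (trans (proj₂ (C-elim {y} {u} {t} cu)) (swap-d (ℕₚ.suc-injective (trans eu e)))))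
                in ∧-intro (C-intro vu (trans (cong suc dut) (sym dvt))) ne)
        (λ h′ → let cu , ne = ∧-true {C v t u} h′
                    vu , eu = C-elim {v} {t} {u} cu
                    dut = ℕₚ.suc-injective (trans eu dvt)
                    duy : d u y ≡ h
                    duy = ℕₚ.≤-antisym (ℕₚ.≤-trans (d-triangle u t y) (ℕₚ.≤-trans (ℕₚ.+-mono-≤ (ℕₚ.≤-reflexive dut) (d≤1 (~-sym yt))) (ℕₚ.≤-reflexive (ℕₚ.+-comm g 1))))
                            (ℕₚ.≤-pred (ℕₚ.≤-trans (ℕₚ.≤-reflexive (sym e)) (d-near y (~-sym vu))))
                in ∧-intro (∧-intro (C-intro vu (trans (cong suc duy) (sym e))) ne) (C-intro yt (trans (cong suc (swap-d dut)) (sym (swap-d duy)))))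

  sphere : ∀ y {h b} → h < D → k ≡ c h + b → count (λ u → d u y ≡ᵇ h) * b ≡ count (λ u → d u y ≡ᵇ suc h) * c (suc h)
  sphere y {h} {b} h<D k≡ = double-count (λ u → d u y ≡ᵇ h) (λ t → d t y ≡ᵇ suc h) adj b (c (suc h)) up down
    where
    up : ∀ u → (d u y ≡ᵇ h) ≡ true → count (λ t → (d t y ≡ᵇ suc h) ∧ adj u t) ≡ b
    up u eu = let e = ≡ᵇ-true _ _ eu in trans (count-cong (λ t → bool-ext
      (λ h′ → let et , ut = ∧-true {d t y ≡ᵇ suc h} h′ in
        C̅-intro ut (λ eq → ℕₚ.m≢1+n+m h {1} (sym (trans (cong suc (sym (≡ᵇ-true _ _ et))) (trans eq e)))))
      (λ h′ → let ut , ne = C̅-elim {u} {y} {t} h′ in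
        ∧-intro (≡ᵇ-intro (trans (up-level e ut (λ eq → ne (trans eq (sym e)))) (ℕₚ.m≤n⇒m⊓n≡m h<D))) ut))) (C̅-count e k≡)
    down : ∀ t → (d t y ≡ᵇ suc h) ≡ true → count (λ u → (d u y ≡ᵇ h) ∧ adj u t) ≡ c (suc h)
    down t et = let e = ≡ᵇ-true _ _ et in trans (count-cong (λ u → bool-ext
      (λ h′ → let eu , ut = ∧-true {d u y ≡ᵇ h} h′ in C-intro (~-sym ut) (trans (cong suc (≡ᵇ-true _ _ eu)) (sym e)))
      (λ h′ → let tu , eu = C-elim {t} {y} {u} h′ in ∧-intro (≡ᵇ-intro (ℕₚ.suc-injective (trans eu e))) (~-sym tu)))) (c-spec e)

  c₃-divides : ∀ s → k ≡ suc s → c 3 ∣ suc s * s * s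
  c₃-divides s k≡ = divides (k′ 3) (begin
      suc s * s * s       ≡⟨ cong (_* s) (trans (cong (_* s) (sym (trans k₁ k≡))) (trans (sphere y (ℕₚ.<-≤-trans (s≤s (s≤s z≤n)) 3≤D) (trans k≡ (cong (_+ s) (sym c₁)))) (trans (cong (k′ 2 *_) c₂) (ℕₚ.*-identityʳ (k′ 2))))) ⟩
      k′ 2 * s            ≡⟨ sphere y (ℕₚ.<-≤-trans (s≤s (s≤s (s≤s z≤n))) 3≤D) (trans k≡ (cong (_+ s) (sym c₂))) ⟩
      k′ 3 * c 3          ∎)
    where
    open ≡-Reasoning
    y = proj₂ (proj₁ (pair 0 z≤n))
    k′ : ℕ → ℕ
    k′ h = count (λ u → d u y ≡ᵇ h)
    k₁ : k′ 1 ≡ k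
    k₁ = trans (count-cong (λ u → trans (cong (_≡ᵇ 1) (d-sym u y)) (sym (adj≡ y u)))) (valency y)

-- Elimination of the cosine sequence

-- In units of W₂ − W₃, the first differences of the cosine sequence are x = (W₁ − W₂)/(W₂ − W₃) and
-- B = (W₀ − W₃)/(W₁ − W₂); d = c₃ − 1, and f + 1 and f + 1 − l are the block intersections at level 3.
module RatioAlgebra (K : Char0Field 0ℓ 0ℓ) where
  open FieldKit K

  -- `near` and `below` are the relations `R1` and `Rf` at level three, rewritten in the ratios.
  module Quantities (B x d f : Carrier)
    (x≉-1 : ¬ x ⊕ ι (+ 1) ≈ 0#) (B≉0 : ¬ B ≈ 0#) (d≉1 : ¬ d ≈ ι (+ 1))
    (near : B ⊛ ((B ⊝ ι (+ 1)) ⊛ x ⊝ ι (+ 1) ⊕ d) ≈ (d ⊕ ι (+ 1)) ⊛ x)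
    (below : B ⊛ (x ⊝ f ⊕ (d ⊝ f) ⊛ (B ⊝ x ⊝ ι (+ 1))) ≈ d ⊕ ι (+ 1)) where

    -- At B = -1 `near` becomes (d - 1)(x + 1) = 0. This value thus belongs to d = 1, where it gives
    -- the Odd graphs.
    B+1≉0 : ¬ B ⊕ ι (+ 1) ≈ 0#
    B+1≉0 e = *≉0 (diff≉0 d≉1) x≉-1
      (lc₂ (⊖ ι (+ 1)) ((B ⊝ ι (+ 2)) ⊛ x ⊕ d ⊝ ι (+ 1)) near e
        (ring-solve 3 (λ B x d → (d :- # 1) :* (x :+ # 1) :- # 0 :≈
          (:- # 1) :* (B :* ((B :- # 1) :* x :- # 1 :+ d) :- (d :+ # 1) :* x) :+ ((B :- # 2) :* x :+ d :- # 1) :* (B :+ # 1 :- # 0)) ≈-refl B x d))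

    -- This is the degenerate design with c₃ = k - 1. The two relations would give (B + 1)(B - d -
    -- 1) = 0, and neither factor can vanish.
    excluded : ¬ f ≈ d ⊝ ι (+ 1)
    excluded f≈ = *≉0 (*≉0 B≉0 (diff≉0 d≉1)) x≉-1
      (lc₂ (ι (+ 1)) (⊖ (x ⊛ (B ⊕ ι (+ 1)))) near (cancel0 B+1≉0 product)
        (ring-solve 3 (λ B x d → (B :* (d :- # 1)) :* (x :+ # 1) :- # 0 :≈
          # 1 :* (B :* ((B :- # 1) :* x :- # 1 :+ d) :- (d :+ # 1) :* x) :+ (:- (x :* (B :+ # 1))) :* (B :- d :- # 1 :- # 0)) ≈-refl B x d))
      where
      product : (B ⊕ ι (+ 1)) ⊛ (B ⊝ d ⊝ ι (+ 1)) ≈ 0#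
      product = lc₂ (ι (+ 1)) (B ⊛ (B ⊝ x)) below f≈
        (ring-solve 4 (λ B x d f → (B :+ # 1) :* (B :- d :- # 1) :- # 0 :≈
          # 1 :* (B :* (x :- f :+ (d :- f) :* (B :- x :- # 1)) :- (d :+ # 1)) :+ (B :* (B :- x)) :* (f :- (d :- # 1))) ≈-refl B x d f)

    module WithRatio (l : Carrier) (ratio : x ⊕ ι (+ 1) ≈ l ⊛ (B ⊝ x)) where

      -- `near` and `ratio` are linear in `x`; eliminating it splits off the factor B + 1.
      quadratic : l ⊛ B ⊛ B ⊝ (ι (+ 2) ⊛ l ⊕ ι (+ 1)) ⊛ B ⊕ d ⊕ ι (+ 1) ≈ 0#
      quadratic = cancel0 B+1≉0
        (lc₂ (ι (+ 1) ⊕ l) (⊖ (B ⊛ (B ⊝ ι (+ 1)) ⊝ (d ⊕ ι (+ 1)))) near ratio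
          (ring-solve 4 (λ B x d l → (B :+ # 1) :* (l :* B :* B :- (# 2 :* l :+ # 1) :* B :+ d :+ # 1) :- # 0 :≈
            (# 1 :+ l) :* (B :* ((B :- # 1) :* x :- # 1 :+ d) :- (d :+ # 1) :* x) :+ (:- (B :* (B :- # 1) :- (d :+ # 1))) :* (x :+ # 1 :- l :* (B :- x))) ≈-refl B x d l))

      linear₁ : B ⊛ (d ⊝ f ⊕ l ⊛ l ⊕ ι (+ 2) ⊛ l) ≈ l ⊛ d ⊕ f ⊕ ι (+ 2) ⊛ l ⊛ l ⊕ ι (+ 3) ⊛ l ⊕ ι (+ 2)
      linear₁ = cancelˡ B≉0
        (lc₃ (ι (+ 1) ⊕ l) (⊖ (B ⊛ (ι (+ 1) ⊝ d ⊕ f))) (ι (+ 1) ⊕ l) below ratio quadratic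
          (ring-solve 5 (λ B x d f l → B :* (B :* (d :- f :+ l :* l :+ # 2 :* l)) :- B :* (l :* d :+ f :+ # 2 :* l :* l :+ # 3 :* l :+ # 2) :≈
            (# 1 :+ l) :* (B :* (x :- f :+ (d :- f) :* (B :- x :- # 1)) :- (d :+ # 1)) :+ (:- (B :* (# 1 :- d :+ f))) :* (x :+ # 1 :- l :* (B :- x))
              :+ (# 1 :+ l) :* (l :* B :* B :- (# 2 :* l :+ # 1) :* B :+ d :+ # 1 :- # 0)) ≈-refl B x d f l))

      -- The result of eliminating `x` from `near` and `below`, without `l`, after division by B +
      -- 1.
      cubic : d ⊛ B ⊛ B ⊛ (B ⊝ ι (+ 3)) ⊕ (d ⊕ ι (+ 1)) ⊛ (d ⊕ ι (+ 1)) ≈ f ⊛ B ⊛ B ⊛ (B ⊝ ι (+ 2))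
      cubic = cancelˡ B+1≉0
        (lc₂ (B ⊛ B ⊝ B ⊝ d ⊝ ι (+ 1)) (⊖ (B ⊛ (ι (+ 1) ⊝ d ⊕ f))) below near
          (ring-solve 4 (λ B x d f → (B :+ # 1) :* (d :* B :* B :* (B :- # 3) :+ (d :+ # 1) :* (d :+ # 1)) :- (B :+ # 1) :* (f :* B :* B :* (B :- # 2)) :≈
            (B :* B :- B :- d :- # 1) :* (B :* (x :- f :+ (d :- f) :* (B :- x :- # 1)) :- (d :+ # 1))
              :+ (:- (B :* (# 1 :- d :+ f))) :* (B :* ((B :- # 1) :* x :- # 1 :+ d) :- (d :+ # 1) :* x)) ≈-refl B x d f))

      -- By `quadratic`, d + 1 = B (2l + 1 - l B). Substituted into the square in `cubic`, this
      -- makes B² a common factor.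
      square : d ⊛ (B ⊝ ι (+ 3)) ⊝ f ⊛ (B ⊝ ι (+ 2)) ⊕ (ι (+ 2) ⊛ l ⊕ ι (+ 1) ⊝ l ⊛ B) ⊛ (ι (+ 2) ⊛ l ⊕ ι (+ 1) ⊝ l ⊛ B) ≈ 0#
      square = cancel0 (*≉0 B≉0 B≉0)
        (lc₂ (ι (+ 1)) (⊖ (d ⊕ ι (+ 1) ⊕ B ⊛ (ι (+ 2) ⊛ l ⊕ ι (+ 1) ⊝ l ⊛ B))) cubic quadratic
          (ring-solve 4 (λ B d f l → (B :* B) :* (d :* (B :- # 3) :- f :* (B :- # 2) :+ (# 2 :* l :+ # 1 :- l :* B) :* (# 2 :* l :+ # 1 :- l :* B)) :- # 0 :≈
            # 1 :* (d :* B :* B :* (B :- # 3) :+ (d :+ # 1) :* (d :+ # 1) :- f :* B :* B :* (B :- # 2))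
              :+ (:- (d :+ # 1 :+ B :* (# 2 :* l :+ # 1 :- l :* B))) :* (l :* B :* B :- (# 2 :* l :+ # 1) :* B :+ d :+ # 1 :- # 0)) ≈-refl B d f l))

      linear : (l ⊛ l ⊕ l) ⊛ B ≈ ι (+ 2) ⊛ (l ⊛ l ⊕ l) ⊝ (d ⊝ ι (+ 1) ⊝ f)
      linear = cancelˡ (ι≉0 {+ 3} (λ ()))
        (lc₃ (ι (+ 1)) (⊖ ι (+ 1)) l linear₁ square quadratic
          (ring-solve 4 (λ B d f l → # 3 :* ((l :* l :+ l) :* B) :- # 3 :* (# 2 :* (l :* l :+ l) :- (d :- # 1 :- f)) :≈
            # 1 :* (B :* (d :- f :+ l :* l :+ # 2 :* l) :- (l :* d :+ f :+ # 2 :* l :* l :+ # 3 :* l :+ # 2))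
              :+ (:- # 1) :* (d :* (B :- # 3) :- f :* (B :- # 2) :+ (# 2 :* l :+ # 1 :- l :* B) :* (# 2 :* l :+ # 1 :- l :* B) :- # 0)
              :+ l :* (l :* B :* B :- (# 2 :* l :+ # 1) :* B :+ d :+ # 1 :- # 0)) ≈-refl B d f l))

      -- The two equations `linear₁` and `linear` are of degree one in `B`; their resultant involves
      -- only `l`, `d` and `f`, which come from integers.
      norm : l ⊛ (l ⊕ ι (+ 1)) ⊛ (l ⊕ ι (+ 1)) ⊛ f ≈ (d ⊝ ι (+ 1) ⊝ f) ⊛ ((l ⊕ ι (+ 1)) ⊛ (l ⊝ ι (+ 1) ⊝ l ⊛ l) ⊝ (d ⊝ ι (+ 1) ⊝ f))
      norm = lc₂ (⊖ (l ⊛ l ⊕ l)) (d ⊝ f ⊕ l ⊛ l ⊕ ι (+ 2) ⊛ l) linear₁ linear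
        (ring-solve 4 (λ B d f l → l :* (l :+ # 1) :* (l :+ # 1) :* f :- (d :- # 1 :- f) :* ((l :+ # 1) :* (l :- # 1 :- l :* l) :- (d :- # 1 :- f)) :≈
          (:- (l :* l :+ l)) :* (B :* (d :- f :+ l :* l :+ # 2 :* l) :- (l :* d :+ f :+ # 2 :* l :* l :+ # 3 :* l :+ # 2))
            :+ (d :- f :+ l :* l :+ # 2 :* l) :* ((l :* l :+ l) :* B :- (# 2 :* (l :* l :+ l) :- (d :- # 1 :- f)))) ≈-refl B d f l)

-- Number-theoretic obstructions

private
  excess : ∀ {a b} c → a ≡ b → a ≡ b + suc c → ⊥
  excess {a} {b} c e e′ = ℕₚ.m≢1+m+n b (trans (sym e) (trans e′ (ℕₚ.+-suc b c)))

-- A rational root e / m of the monic polynomial t² - a t - b is an integer.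
monic-root : ∀ e m a b → e * e ≡ a * (m * e) + b * (m * m) → 1 ≤ m → m ∣ e
monic-root e m a b eq 1≤m with gcd[m,n]∣m e m | gcd[m,n]∣n e m
... | divides e′ e≡ | divides m′ m≡ = divides e′ (trans e≡ (cong (e′ *_) (trans (sym (ℕₚ.*-identityˡ g)) (trans (cong (_* g) (sym m′≡1)) (sym m≡)))))
  where
  g = gcd e m
  instance
    g≢0 : NonZero g
    g≢0 = ℕ.≢-nonZero (λ g≡0 → ℕₚ.<⇒≢ 1≤m (sym (trans m≡ (trans (cong (m′ *_) g≡0) (ℕₚ.*-zeroʳ m′)))))
  coprime : Coprime m′ e′
  coprime {c} (divides p m′≡ , divides q e′≡) = Div.∣1⇒≡1 (Div.*-cancelʳ-∣ g (subst (c * g ∣_) (sym (ℕₚ.*-identityˡ g))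
    (gcd-greatest (divides q (trans e≡ (trans (cong (_* g) e′≡) (ℕₚ.*-assoc q c g)))) (divides p (trans m≡ (trans (cong (_* g) m′≡) (ℕₚ.*-assoc p c g)))))))
  reduced : e′ * e′ ≡ m′ * (a * e′ + b * m′)
  reduced = ℕₚ.*-cancelʳ-≡ _ _ (g * g) {{ℕₚ.m*n≢0 g g}} (begin
    e′ * e′ * (g * g)                            ≡⟨ expand₁ e′ g ⟩
    (e′ * g) * (e′ * g)                          ≡⟨ cong₂ _*_ (sym e≡) (sym e≡) ⟩
    e * e                                        ≡⟨ eq ⟩
    a * (m * e) + b * (m * m)                    ≡⟨ cong₂ (λ s t → a * (s * t) + b * (s * s)) m≡ e≡ ⟩
    a * (m′ * g * (e′ * g)) + b * (m′ * g * (m′ * g))  ≡⟨ expand₂ a b m′ e′ g ⟩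
    m′ * (a * e′ + b * m′) * (g * g)             ∎)
    where
    open ≡-Reasoning
    expand₁ : ∀ e g → e * e * (g * g) ≡ (e * g) * (e * g)
    expand₁ = ℕR.solve-∀
    expand₂ : ∀ a b m e g → a * (m * g * (e * g)) + b * (m * g * (m * g)) ≡ m * (a * e + b * m) * (g * g)
    expand₂ = ℕR.solve-∀
  m′≡1 : m′ ≡ 1
  m′≡1 = coprime (Div.∣-refl , coprime-divisor coprime (divides (a * e′ + b * m′) (trans reduced (ℕₚ.*-comm m′ _))))

-- l = m + 1 ≥ 2 is minus the ratio W₁ − W₃ : W₂ − W₄, and d, f, s are as in RatioAlgebra.
record Parameters (s d f m : ℕ) : Set where
  field
    n : ℕ
    1≤n : 1 ≤ n
    1≤m : 1 ≤ m
  N = n + (suc m * suc m + suc m + 1)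
  e = m * N
  field
    N*n : N * n ≡ suc m * f
    d≡ : d ≡ f + 1 + e
    1≤f : 1 ≤ f
    design : f * s ≡ d * (f + e)

-- With l = m + 1, the quotient t = e / m satisfies t² = (l² + l + 1) t + l f. By `monic-root` it is
-- an integer N; the other root is -n, whence N n = l f.
parameters : ∀ {s d f m e} → 1 ≤ m → 1 ≤ f → d ≡ f + 1 + e → f * s ≡ d * (f + e) →
             suc m * (m * m) * f + e * (m * (suc m * suc m + suc m + 1)) ≡ e * e → Parameters s d f m
parameters {s} {d} {f} {m} {e} 1≤m 1≤f d≡ design norm = record
  { n = N ∸ Q ; 1≤n = ℕₚ.m<n⇒0<n∸m Q<N ; 1≤m = 1≤m ; N*n = trans (cong (_* (N ∸ Q)) N≡) N*n
  ; d≡ = trans d≡ (cong (λ t → f + 1 + t) e≡′) ; 1≤f = 1≤f ; design = trans design (cong (λ t → d * (f + t)) e≡′) }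
  where
  rearrange : ∀ m f e → suc m * (m * m) * f + e * (m * (suc m * suc m + suc m + 1)) ≡ (suc m * suc m + suc m + 1) * (m * e) + suc m * f * (m * m)
  rearrange = ℕR.solve-∀
  m∣e : m ∣ e
  m∣e = monic-root e m (suc m * suc m + suc m + 1) (suc m * f) (trans (sym norm) (rearrange m f e)) 1≤m
  N = _∣_.quotient m∣e
  e≡ : e ≡ N * m
  e≡ = _∣_.equality m∣e
  Q = suc m * suc m + suc m + 1
  instance
    m≢0 : NonZero m
    m≢0 = ℕ.>-nonZero 1≤m
    mm≢0 : NonZero (m * m)
    mm≢0 = ℕₚ.m*n≢0 m m
  key : suc m * f + N * Q ≡ N * N
  key = ℕₚ.*-cancelʳ-≡ _ _ (m * m) (trans (left m f N Q) (trans (subst (λ e → suc m * (m * m) * f + e * (m * Q) ≡ e * e) e≡ norm) (right N m)))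
    where
    left : ∀ m f N Q → (suc m * f + N * Q) * (m * m) ≡ suc m * (m * m) * f + (N * m) * (m * Q)
    left = ℕR.solve-∀
    right : ∀ N m → (N * m) * (N * m) ≡ N * N * (m * m)
    right = ℕR.solve-∀
  Q<N : Q < N
  Q<N with Q <? N
  ... | yes h = h
  ... | no h = ⊥-elim (ℕₚ.<-irrefl (sym key) (ℕₚ.≤-<-trans {N * N} {N * Q} (ℕₚ.*-monoʳ-≤ N (ℕₚ.≮⇒≥ h)) (ℕₚ.m<n+m (N * Q) (ℕₚ.≤-trans 1≤f (ℕₚ.m≤m+n f (m * f))))))
  N≡ : N ∸ Q + Q ≡ N
  N≡ = ℕₚ.m∸n+n≡m (ℕₚ.<⇒≤ Q<N)
  N*n : N * (N ∸ Q) ≡ suc m * f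
  N*n = trans (ℕₚ.*-distribˡ-∸ N N Q) (trans (cong (_∸ N * Q) (sym key)) (ℕₚ.m+n∸n≡m (suc m * f) (N * Q)))
  e≡′ : e ≡ m * (N ∸ Q + Q)
  e≡′ = trans e≡ (trans (ℕₚ.*-comm N m) (cong (m *_) (sym N≡)))

module _ {s d f m : ℕ} (P : Parameters s d f m) where
  open Parameters P

  private
    l = suc m
    instance
      m≢0 : NonZero m
      m≢0 = ℕ.>-nonZero 1≤m
      f≢0 : NonZero f
      f≢0 = ℕ.>-nonZero 1≤f
      n≢0 : NonZero n
      n≢0 = ℕ.>-nonZero 1≤n
      N≢0 : NonZero N
      N≢0 = ℕ.>-nonZero (ℕₚ.≤-trans 1≤n (ℕₚ.m≤m+n n _))

    module Family (n≡m : n ≡ m) where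
      f≡ : f ≡ (m + 3) * m
      f≡ = ℕₚ.*-cancelˡ-≡ f ((m + 3) * m) l (trans (sym (subst (λ n → (n + (l * l + l + 1)) * n ≡ l * f) n≡m N*n)) (poly m))
        where
        poly : ∀ m → (m + (suc m * suc m + suc m + 1)) * m ≡ suc m * ((m + 3) * m)
        poly = ℕR.solve-∀
      d≡′ : d ≡ m * (m + 2) * (m + 3) + 1
      d≡′ = trans (subst₂ (λ f n → d ≡ f + 1 + m * (n + (l * l + l + 1))) f≡ n≡m d≡) (poly m)
        where
        poly : ∀ m → (m + 3) * m + 1 + m * (m + (suc m * suc m + suc m + 1)) ≡ m * (m + 2) * (m + 3) + 1
        poly = ℕR.solve-∀
      s≡ : s ≡ d * (m + 2)
      s≡ = ℕₚ.*-cancelˡ-≡ s (d * (m + 2)) f (trans design (trans (cong₂ (λ f n → d * (f + m * (n + (l * l + l + 1)))) f≡ n≡m) (trans (poly m d) (cong (_* (d * (m + 2))) (sym f≡)))))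
        where
        poly : ∀ m d → d * ((m + 3) * m + m * (m + (suc m * suc m + suc m + 1))) ≡ (m + 3) * m * (d * (m + 2))
        poly = ℕR.solve-∀
      c∣s+l : suc d ∣ suc s + l
      c∣s+l = divides (m + 2) (trans (cong (λ s → suc s + l) s≡) (poly m d))
        where
        poly : ∀ m d → suc (d * (m + 2)) + suc m ≡ (m + 2) * suc d
        poly = ℕR.solve-∀

  -- The family n = l − 1 survives all eigenvalue conditions; it dies because k₃ = k s² / c₃ is not an integer.
  k₃-obstruction : n ≡ m → suc d ∣ suc (suc s) * suc s * suc s → ⊥
  k₃-obstruction n≡m c∣ = conclude (Div.∣m+n∣m⇒∣n c∣sum c∣first)
    where
    open Family n≡m
    S = suc s
    -- Modulo d + 1 one has S ≡ -l, so (S + 1) S² ≡ -m l². But m l² is positive and smaller than d +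
    -- 1.
    c∣step : suc d ∣ (suc S * l * (S + l) + suc S * S * S)
    c∣step = Div.∣m∣n⇒∣m+n (Div.∣n⇒∣m*n (suc S * l) c∣s+l) c∣
    c∣first : suc d ∣ suc S * l * l
    c∣first = Div.∣m+n∣m⇒∣n (subst (suc d ∣_) (poly S l) c∣step) (Div.∣n⇒∣m*n (suc S * S) c∣s+l)
      where
      poly : ∀ S l → suc S * l * (S + l) + suc S * S * S ≡ suc S * S * (S + l) + suc S * l * l
      poly = ℕR.solve-∀
    c∣sum : suc d ∣ suc S * l * l + m * l * l
    c∣sum = subst (suc d ∣_) (poly S m) (Div.∣m⇒∣m*n (l * l) c∣s+l)
      where
      poly : ∀ S m → (S + suc m) * (suc m * suc m) ≡ suc S * suc m * suc m + m * suc m * suc m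
      poly = ℕR.solve-∀
    conclude : suc d ∣ m * l * l → ⊥
    conclude (divides zero eq) = ℕ.≢-nonZero⁻¹ (m * l * l) {{ℕₚ.m*n≢0 (m * l) l {{ℕₚ.m*n≢0 m l}}}} eq
    conclude (divides (suc q) eq) = excess ((3 * m + 1) * l + m + q * suc d) (sym eq) (trans (cong (λ d → suc d + q * suc d) d≡′) (trans (poly m q) (cong (λ d → m * l * l + suc ((3 * m + 1) * l + m + q * suc d)) (sym d≡′))))
      where
      poly : ∀ m q → suc (m * (m + 2) * (m + 3) + 1) + q * suc (m * (m + 2) * (m + 3) + 1) ≡ m * suc m * suc m + suc ((3 * m + 1) * suc m + m + q * suc (m * (m + 2) * (m + 3) + 1))
      poly = ℕR.solve-∀

  -- The case c₄ = k. Subtracting the design identities leaves (1 + l) s + f + 1 + l = 2d, which is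
  -- too large for d ≤ s.
  bipartite₄-obstruction : ∀ {d′} → d ≡ suc d′ → d ≤ s → f * s ≡ d * d′ → (1 + f + l) * suc s ≡ suc d * d → ⊥
  bipartite₄-obstruction {d′} refl d≤s eq₁ eq₂ = ℕₚ.<-irrefl (sym summed) (ℕₚ.≤-trans (s≤s (ℕₚ.+-mono-≤ d≤s d≤s)) (ℕₚ.≤-trans (ℕₚ.m≤m+n (suc (s + s)) (m * s + f + l)) (ℕₚ.≤-reflexive (poly₃ s m f))))
    where
    poly₁ : ∀ f m s → (1 + f + suc m) * suc s ≡ ((1 + suc m) * s + f + 1 + suc m) + f * s
    poly₁ = ℕR.solve-∀
    poly₂ : ∀ d → suc (suc d) * suc d ≡ (suc d + suc d) + suc d * d
    poly₂ = ℕR.solve-∀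
    poly₃ : ∀ s m f → suc (s + s) + (m * s + f + suc m) ≡ (1 + suc m) * s + f + 1 + suc m
    poly₃ = ℕR.solve-∀
    summed : (1 + l) * s + f + 1 + l ≡ suc d′ + suc d′
    summed = ℕₚ.+-cancelʳ-≡ (f * s) _ _ (trans (sym (poly₁ f m s)) (trans eq₂ (trans (poly₂ d′) (cong (λ t → suc d′ + suc d′ + t) (sym eq₁)))))

  private
    n₁ = ℕ.pred n
    m₁ = ℕ.pred m
    n≡ : n ≡ suc n₁
    n≡ = sym (ℕₚ.suc-pred n)
    m≡ : m ≡ suc m₁
    m≡ = sym (ℕₚ.suc-pred m)

  -- This encodes W₅ = W₄: with K = n + 1 + l m and l B = -K, the equation B² - 1 = -m B times l² is
  -- K (K - l m) = l². Positivity of n and m makes the left side too large.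
  flat₄-obstruction : (n + 1 + l * m) * (n + 1) ≡ l * l → ⊥
  flat₄-obstruction eq = impossible n₁ m₁ (subst₂ (λ n m → (n + 1 + suc m * m) * (n + 1) ≡ suc m * suc m) n≡ m≡ eq)
    where
    impossible : ∀ n m → (suc n + 1 + suc (suc m) * suc m) * (suc n + 1) ≡ suc (suc m) * suc (suc m) → ⊥
    impossible n m eq = excess (n * n + 4 * n + n * (suc (suc m) * suc m) + m * m + 2 * m + 3) eq (poly n m)
      where
      poly : ∀ n m → (suc n + 1 + suc (suc m) * suc m) * (suc n + 1) ≡ suc (suc m) * suc (suc m) + suc (n * n + 4 * n + n * (suc (suc m) * suc m) + m * m + 2 * m + 3)
      poly = ℕR.solve-∀

  flat₅-obstruction : (n + 1 + l * m) * ((n + 1) * (n + 1) + n * (l * l)) ≡ l * l * (n + 1) → ⊥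
  flat₅-obstruction eq = impossible n₁ m₁ (subst₂ (λ n m → (n + 1 + suc m * m) * ((n + 1) * (n + 1) + n * (suc m * suc m)) ≡ suc m * suc m * (n + 1)) n≡ m≡ eq)
    where
    impossible : ∀ n m → (suc n + 1 + suc (suc m) * suc m) * ((suc n + 1) * (suc n + 1) + suc n * (suc (suc m) * suc (suc m))) ≡ suc (suc m) * suc (suc m) * (suc n + 1) → ⊥
    impossible n m eq = excess (3 + 4 * n + n * n + (n + 2 + suc (suc m) * suc m) * (n * (suc (suc m) * suc (suc m))) + suc (suc m) * suc m * (suc (suc m) * suc (suc m)) + (n + 1 + suc (suc m) * suc m) * ((n + 2) * (n + 2))) eq (poly n m)
      where
      poly : ∀ n m → (suc n + 1 + suc (suc m) * suc m) * ((suc n + 1) * (suc n + 1) + suc n * (suc (suc m) * suc (suc m)))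
           ≡ suc (suc m) * suc (suc m) * (suc n + 1)
             + suc (3 + 4 * n + n * n + (n + 2 + suc (suc m) * suc m) * (n * (suc (suc m) * suc (suc m))) + suc (suc m) * suc m * (suc (suc m) * suc (suc m)) + (n + 1 + suc (suc m) * suc m) * ((n + 2) * (n + 2)))
      poly = ℕR.solve-∀

  -- The equation forces i n < l. With l = i n + w + 1 it becomes i (n + 1)² = (w + 1) l², and the
  -- right side is larger unless i = 1 and w = 0, that is l = n + 1.
  level₅-family : ∀ i → i * ((n + 1) * (n + 1) + n * (l * l)) ≡ l * l * l → n ≡ m
  level₅-family zero eq = ⊥-elim (ℕₚ.0≢1+n eq)
  level₅-family i@(suc i₁) eq = ℕₚ.suc-injective (cases i₁ w w≡ reduced)
    where
    in<l : i * n < l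
    in<l with i * n <? l
    ... | yes h = h
    ... | no h = ⊥-elim (ℕₚ.<-irrefl (sym eq) (ℕₚ.≤-<-trans (ℕₚ.*-monoˡ-≤ l (ℕₚ.*-monoˡ-≤ l (ℕₚ.≮⇒≥ h)))
            (ℕₚ.<-≤-trans (ℕₚ.m<n+m (i * n * l * l) {i * ((n + 1) * (n + 1))} (ℕₚ.<-≤-trans (ℕₚ.n<1+n 0) (ℕₚ.≤-trans (ℕₚ.≤-trans (s≤s z≤n) (ℕₚ.≤-reflexive (sym (suc-square n)))) (ℕₚ.m≤m+n _ _))))
              (ℕₚ.≤-reflexive (poly i n l)))))
      where
      poly : ∀ i n l → i * ((n + 1) * (n + 1)) + i * n * l * l ≡ i * ((n + 1) * (n + 1) + n * (l * l))
      poly = ℕR.solve-∀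
      suc-square : ∀ n → (n + 1) * (n + 1) ≡ suc (n * n + 2 * n)
      suc-square = ℕR.solve-∀
    w = ℕ.pred (l ∸ i * n)
    w≡ : l ≡ i * n + suc w
    w≡ = trans (sym (ℕₚ.m+[n∸m]≡n (ℕₚ.<⇒≤ in<l))) (cong (λ t → i * n + t) (sym (ℕₚ.suc-pred (l ∸ i * n) {{ℕ.>-nonZero (ℕₚ.m<n⇒0<n∸m in<l)}})))
    reduced : i * ((n + 1) * (n + 1)) ≡ suc w * ((i * n + suc w) * (i * n + suc w))
    reduced = ℕₚ.+-cancelʳ-≡ (i * n * (l * l)) _ _ (trans (poly₁ i n l) (trans eq (trans (trans (ℕₚ.*-assoc l l l) (cong (_* (l * l)) w≡)) (trans (poly₂ (i * n) (suc w) (l * l)) (cong (λ L → suc w * (L * L) + i * n * (l * l)) w≡)))))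
      where
      poly₁ : ∀ i n l → i * ((n + 1) * (n + 1)) + i * n * (l * l) ≡ i * ((n + 1) * (n + 1) + n * (l * l))
      poly₁ = ℕR.solve-∀
      poly₂ : ∀ p w q → (p + w) * q ≡ w * q + p * q
      poly₂ = ℕR.solve-∀
    cases : ∀ i₁ w → l ≡ suc i₁ * n + suc w → suc i₁ * ((n + 1) * (n + 1)) ≡ suc w * ((suc i₁ * n + suc w) * (suc i₁ * n + suc w)) → suc n ≡ l
    cases zero zero l≡ _ = trans (poly n) (sym l≡)
      where
      poly : ∀ n → suc n ≡ 1 * n + 1
      poly = ℕR.solve-∀
    cases zero (suc w) l≡ eq = ⊥-elim (excess (suc w * ((n + suc (suc w)) * (n + suc (suc w))) + (1 + w) * (2 * n + w + 2) + w) (sym eq) (poly n w))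
      where
      poly : ∀ n w → suc (suc w) * ((1 * n + suc (suc w)) * (1 * n + suc (suc w))) ≡ 1 * ((n + 1) * (n + 1)) + suc (suc w * ((n + suc (suc w)) * (n + suc (suc w))) + (1 + w) * (2 * n + w + 2) + w)
      poly = ℕR.solve-∀
    cases (suc a) w l≡ eq = ⊥-elim (contra n₁ (subst (λ n → suc (suc a) * ((n + 1) * (n + 1)) ≡ suc w * ((suc (suc a) * n + suc w) * (suc (suc a) * n + suc w))) n≡ eq))
      where
      poly : ∀ a w b → suc w * ((suc (suc a) * suc b + suc w) * (suc (suc a) * suc b + suc w)) ≡ suc (suc a) * ((suc b + 1) * (suc b + 1))
        + suc (a + (1 + a) * (a + (2 + a) * (2 * b + b * b)) + w * ((suc (suc a) * suc b + suc w) * (suc (suc a) * suc b + suc w)) + w * (2 * (suc (suc a) * suc b) + w + 2))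
      poly = ℕR.solve-∀
      contra : ∀ b → suc (suc a) * ((suc b + 1) * (suc b + 1)) ≡ suc w * ((suc (suc a) * suc b + suc w) * (suc (suc a) * suc b + suc w)) → ⊥
      contra b eq = excess (a + (1 + a) * (a + (2 + a) * (2 * b + b * b)) + w * ((suc (suc a) * suc b + suc w) * (suc (suc a) * suc b + suc w)) + w * (2 * (suc (suc a) * suc b) + w + 2)) (sym eq) (poly a w b)

  -- The case D = 5, c₅ = k, with k = s + 2, c₃ = d + 1 and b = k - c₃ - 1. The designs express b
  -- and c₄ - c₃ through n and one number Z; the integer ratio at level four gives a second equation
  -- for Z. Eliminating Z leaves `balance`.
  bipartite₅-obstruction : ∀ {b X f₄ g₄ j} → s ≡ d + b → (1 + f + l) * (d + suc X) ≡ suc d * d → b * f₄ ≡ suc X * X →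
    suc s * g₄ ≡ (suc d + suc X) * (d + suc X) → suc d + f₄ ≡ g₄ + j → j * (n + 1) ≡ l * l → ⊥
  bipartite₅-obstruction {b} {X₁} {f₄} {g₄} {j} s≡ g-eq f₄-eq g₄-eq F₄-eq j-eq = by-size
    where
    open ≡-Reasoning
    X = suc X₁
    N₁ = n + l * l + l
    N≡ : N ≡ suc N₁
    N≡ = poly n m
      where
      poly : ∀ n m → n + (suc m * suc m + suc m + 1) ≡ suc (n + suc m * suc m + suc m)
      poly = ℕR.solve-∀
    fb : f * b ≡ d * e
    fb = ℕₚ.+-cancelˡ-≡ (f * d) _ _ (begin
      f * d + f * b  ≡⟨ sym (ℕₚ.*-distribˡ-+ f d b) ⟩
      f * (d + b)    ≡⟨ cong (f *_) (sym s≡) ⟩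
      f * s          ≡⟨ design ⟩
      d * (f + e)    ≡⟨ trans (ℕₚ.*-distribˡ-+ d f e) (cong (_+ d * e) (ℕₚ.*-comm d f)) ⟩
      f * d + d * e  ∎)
    nb : n * b ≡ d * l * m
    nb = ℕₚ.*-cancelˡ-≡ _ _ N (begin
      N * (n * b)      ≡⟨ sym (ℕₚ.*-assoc N n b) ⟩
      N * n * b        ≡⟨ cong (_* b) N*n ⟩
      l * f * b        ≡⟨ ℕₚ.*-assoc l f b ⟩
      l * (f * b)      ≡⟨ cong (l *_) fb ⟩
      l * (d * (m * N))  ≡⟨ poly l d m N ⟩
      N * (d * l * m)  ∎)
      where
      poly : ∀ l d m N → l * (d * (m * N)) ≡ N * (d * l * m)
      poly = ℕR.solve-∀
    gX : (1 + f + l) * X ≡ d * (m * N₁)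
    gX = ℕₚ.+-cancelˡ-≡ ((1 + f + l) * d) _ _ (begin
      (1 + f + l) * d + (1 + f + l) * X   ≡⟨ sym (ℕₚ.*-distribˡ-+ (1 + f + l) d X) ⟩
      (1 + f + l) * (d + X)               ≡⟨ g-eq ⟩
      suc d * d                           ≡⟨ cong (λ t → suc t * d) (trans d≡ (cong (λ t → f + 1 + m * t) N≡)) ⟩
      suc (f + 1 + m * suc N₁) * d        ≡⟨ poly f m N₁ d ⟩
      (1 + f + l) * d + d * (m * N₁)      ∎)
      where
      poly : ∀ f m N d → suc (f + 1 + m * suc N) * d ≡ (1 + f + suc m) * d + d * (m * N)
      poly = ℕR.solve-∀
    lg : l * (1 + f + l) ≡ N₁ * (n + 1)
    lg = begin
      l * (1 + f + l)            ≡⟨ poly₁ l f ⟩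
      l * f + (l + l * l)        ≡⟨ cong (_+ (l + l * l)) (trans (sym N*n) (cong (_* n) N≡)) ⟩
      suc N₁ * n + (l + l * l)   ≡⟨ poly₂ n l ⟩
      N₁ * (n + 1)               ∎
      where
      poly₁ : ∀ l f → l * (1 + f + l) ≡ l * f + (l + l * l)
      poly₁ = ℕR.solve-∀
      poly₂ : ∀ n l → suc (n + l * l + l) * n + (l + l * l) ≡ (n + l * l + l) * (n + 1)
      poly₂ = ℕR.solve-∀
    instance
      N₁≢0 : NonZero N₁
      N₁≢0 = ℕ.>-nonZero (ℕₚ.≤-trans 1≤n (ℕₚ.≤-trans (ℕₚ.m≤m+n n (l * l)) (ℕₚ.m≤m+n (n + l * l) l)))
    [n+1]X : (n + 1) * X ≡ n * b
    [n+1]X = ℕₚ.*-cancelˡ-≡ _ _ N₁ (begin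
      N₁ * ((n + 1) * X)     ≡⟨ sym (ℕₚ.*-assoc N₁ (n + 1) X) ⟩
      N₁ * (n + 1) * X       ≡⟨ cong (_* X) (sym lg) ⟩
      l * (1 + f + l) * X    ≡⟨ ℕₚ.*-assoc l (1 + f + l) X ⟩
      l * ((1 + f + l) * X)  ≡⟨ cong (l *_) gX ⟩
      l * (d * (m * N₁))     ≡⟨ poly l d m N₁ ⟩
      N₁ * (d * l * m)       ≡⟨ cong (N₁ *_) (sym nb) ⟩
      N₁ * (n * b)           ∎)
      where
      poly : ∀ l d m N → l * (d * (m * N)) ≡ N * (d * l * m)
      poly = ℕR.solve-∀
    -- By `[n+1]X` the numbers X and b are in the ratio n : n + 1, and Z is the common factor.
    Z = b ∸ X
    X≤b : X ≤ b
    X≤b = ℕₚ.*-cancelˡ-≤ (suc n) (ℕₚ.≤-trans (ℕₚ.≤-reflexive (trans (cong (_* X) (ℕₚ.+-comm 1 n)) [n+1]X)) (ℕₚ.*-monoˡ-≤ b (ℕₚ.n≤1+n n)))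
    b≡ : b ≡ X + Z
    b≡ = sym (ℕₚ.m+[n∸m]≡n X≤b)
    X≡ : X ≡ n * Z
    X≡ = ℕₚ.+-cancelˡ-≡ (n * X) _ _ (begin
      n * X + X        ≡⟨ poly n X ⟩
      (n + 1) * X      ≡⟨ [n+1]X ⟩
      n * b            ≡⟨ cong (n *_) b≡ ⟩
      n * (X + Z)      ≡⟨ ℕₚ.*-distribˡ-+ n X Z ⟩
      n * X + n * Z    ∎)
      where
      poly : ∀ n X → n * X + X ≡ (n + 1) * X
      poly = ℕR.solve-∀
    b≡′ : b ≡ (n + 1) * Z
    b≡′ = trans b≡ (trans (cong (_+ Z) X≡) (poly n Z))
      where
      poly : ∀ n Z → n * Z + Z ≡ (n + 1) * Z
      poly = ℕR.solve-∀
    instance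
      Z≢0 : NonZero Z
      Z≢0 = ℕ.≢-nonZero (λ Z≡0 → ℕₚ.0≢1+n (sym (trans X≡ (trans (cong (n *_) Z≡0) (ℕₚ.*-zeroʳ n)))))
    S = suc s
    S≡ : S ≡ suc d + b
    S≡ = cong suc s≡
    sjb : S * j * b ≡ suc d * (Z * (Z + 1))
    sjb = ℕₚ.+-cancelˡ-≡ ((suc d + X) * (d + X) * b) _ _ (begin
      (suc d + X) * (d + X) * b + S * j * b   ≡⟨ cong (λ t → t * b + S * j * b) (sym g₄-eq) ⟩
      S * g₄ * b + S * j * b                  ≡⟨ poly₁ S g₄ b j ⟩
      S * ((g₄ + j) * b)                      ≡⟨ cong (λ t → S * (t * b)) (sym F₄-eq) ⟩
      S * ((suc d + f₄) * b)                  ≡⟨ poly₂ S (suc d) f₄ b ⟩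
      S * (suc d * b + b * f₄)                ≡⟨ cong (λ t → S * (suc d * b + t)) f₄-eq ⟩
      S * (suc d * b + X * X₁)                ≡⟨ cong (_* (suc d * b + X * X₁)) S≡ ⟩
      (suc d + b) * (suc d * b + X * X₁)      ≡⟨ cong (λ b → (suc d + b) * (suc d * b + X * X₁)) b≡ ⟩
      (suc d + (X + Z)) * (suc d * (X + Z) + X * X₁)  ≡⟨ poly₃ d X₁ Z ⟩
      (suc d + X) * (d + X) * (X + Z) + suc d * (Z * (Z + 1))  ≡⟨ cong (λ b → (suc d + X) * (d + X) * b + suc d * (Z * (Z + 1))) (sym b≡) ⟩
      (suc d + X) * (d + X) * b + suc d * (Z * (Z + 1))  ∎)
      where
      poly₁ : ∀ S g b j → S * g * b + S * j * b ≡ S * ((g + j) * b)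
      poly₁ = ℕR.solve-∀
      poly₂ : ∀ S c f b → S * ((c + f) * b) ≡ S * (c * b + b * f)
      poly₂ = ℕR.solve-∀
      poly₃ : ∀ d X Z → (suc d + (suc X + Z)) * (suc d * (suc X + Z) + suc X * X) ≡ (suc d + suc X) * (d + suc X) * (suc X + Z) + suc d * (Z * (Z + 1))
      poly₃ = ℕR.solve-∀
    sll : S * (l * l) ≡ suc d * (Z + 1)
    sll = ℕₚ.*-cancelˡ-≡ _ _ Z (begin
      Z * (S * (l * l))          ≡⟨ cong (λ t → Z * (S * t)) (sym j-eq) ⟩
      Z * (S * (j * (n + 1)))    ≡⟨ poly₁ Z S j n ⟩
      S * j * ((n + 1) * Z)      ≡⟨ cong (S * j *_) (sym b≡′) ⟩
      S * j * b                  ≡⟨ sjb ⟩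
      suc d * (Z * (Z + 1))      ≡⟨ poly₂ Z (suc d) ⟩
      Z * (suc d * (Z + 1))      ∎)
      where
      poly₁ : ∀ Z S j n → Z * (S * (j * (n + 1))) ≡ S * j * ((n + 1) * Z)
      poly₁ = ℕR.solve-∀
      poly₂ : ∀ Z c → c * (Z * (Z + 1)) ≡ Z * (c * (Z + 1))
      poly₂ = ℕR.solve-∀
    nZ : n * (n + 1) * Z ≡ d * l * m
    nZ = trans (ℕₚ.*-assoc n (n + 1) Z) (trans (cong (n *_) (sym b≡′)) nb)
    F₁ = n * (n + 1) * (l + 1)
    U = (l * l + n) * (l * l + n) + n
    ld : l * d ≡ U
    ld = begin
      l * d                        ≡⟨ cong (l *_) d≡ ⟩
      l * (f + 1 + m * N)          ≡⟨ poly₁ l f m N ⟩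
      l * f + (l + l * (m * N))    ≡⟨ cong (_+ (l + l * (m * N))) (sym N*n) ⟩
      N * n + (l + l * (m * N))    ≡⟨ poly₂ n m ⟩
      U                            ∎
      where
      poly₁ : ∀ l f m N → l * (f + 1 + m * N) ≡ l * f + (l + l * (m * N))
      poly₁ = ℕR.solve-∀
      poly₂ : ∀ n m → (n + (suc m * suc m + suc m + 1)) * n + (suc m + suc m * (m * (n + (suc m * suc m + suc m + 1)))) ≡ (suc m * suc m + n) * (suc m * suc m + n) + n
      poly₂ = ℕR.solve-∀
    balance : d * F₁ + F₁ + l * l * l * (n + 1) * d ≡ d * (U + l)
    balance = ℕₚ.*-cancelˡ-≡ _ _ m (ℕₚ.+-cancelˡ-≡ (suc d * (n * (n + 1))) _ _ (begin
      suc d * (n * (n + 1)) + m * (d * F₁ + F₁ + l * l * l * (n + 1) * d)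
        ≡⟨ poly₁ d n m ⟩
      suc d * (l * l) * (n * (n + 1)) + l * l * (n + 1) * (d * l * m)
        ≡⟨ cong (λ t → suc d * (l * l) * (n * (n + 1)) + l * l * (n + 1) * t) (sym nZ) ⟩
      suc d * (l * l) * (n * (n + 1)) + l * l * (n + 1) * (n * (n + 1) * Z)
        ≡⟨ poly₂ d l n Z ⟩
      n * (n + 1) * ((suc d + (n + 1) * Z) * (l * l))
        ≡⟨ cong (λ t → n * (n + 1) * (t * (l * l))) (sym (trans S≡ (cong (λ t → suc d + t) b≡′))) ⟩
      n * (n + 1) * (S * (l * l))
        ≡⟨ cong (n * (n + 1) *_) sll ⟩
      n * (n + 1) * (suc d * (Z + 1))
        ≡⟨ poly₃ n d Z ⟩
      suc d * (n * (n + 1)) + suc d * (n * (n + 1) * Z)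
        ≡⟨ cong (λ t → suc d * (n * (n + 1)) + suc d * t) nZ ⟩
      suc d * (n * (n + 1)) + suc d * (d * l * m)
        ≡⟨ poly₄ d n l m ⟩
      suc d * (n * (n + 1)) + m * (d * (l * d + l))
        ≡⟨ cong (λ t → suc d * (n * (n + 1)) + m * (d * (t + l))) ld ⟩
      suc d * (n * (n + 1)) + m * (d * (U + l)) ∎))
      where
      poly₁ : ∀ d n m → suc d * (n * (n + 1)) + m * (d * (n * (n + 1) * (suc m + 1)) + n * (n + 1) * (suc m + 1) + suc m * suc m * suc m * (n + 1) * d)
        ≡ suc d * (suc m * suc m) * (n * (n + 1)) + suc m * suc m * (n + 1) * (d * suc m * m)
      poly₁ = ℕR.solve-∀
      poly₂ : ∀ d l n Z → suc d * (l * l) * (n * (n + 1)) + l * l * (n + 1) * (n * (n + 1) * Z) ≡ n * (n + 1) * ((suc d + (n + 1) * Z) * (l * l))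
      poly₂ = ℕR.solve-∀
      poly₃ : ∀ n d Z → n * (n + 1) * (suc d * (Z + 1)) ≡ suc d * (n * (n + 1)) + suc d * (n * (n + 1) * Z)
      poly₃ = ℕR.solve-∀
      poly₄ : ∀ d n l m → suc d * (n * (n + 1)) + suc d * (d * l * m) ≡ suc d * (n * (n + 1)) + m * (d * (l * d + l))
      poly₄ = ℕR.solve-∀
    large : ∀ t → n ≡ l + t → ⊥
    large t n≡l+t = ℕ.≢-nonZero⁻¹ F₁ {{ℕₚ.m*n≢0 (n * (n + 1)) (l + 1) {{ℕₚ.m*n≢0 n (n + 1) {{n≢0}} {{ℕ.>-nonZero (ℕₚ.m≤n+m 1 n)}}}} {{ℕ.>-nonZero (ℕₚ.m≤n+m 1 l)}}}}
      (ℕₚ.m+n≡0⇒m≡0 F₁ (ℕₚ.+-cancelˡ-≡ (d * (U + l)) (F₁ + d * G) 0 (begin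
        d * (U + l) + (F₁ + d * G)             ≡⟨ poly₁ d (U + l) F₁ G ⟩
        d * (U + l + G) + F₁                   ≡⟨ cong (λ x → d * x + F₁) (subst (λ n → (l * l + n) * (l * l + n) + n + l + G ≡ n * (n + 1) * (l + 1) + l * l * l * (n + 1)) (sym n≡l+t) (poly₂ m t)) ⟩
        d * (F₁ + l * l * l * (n + 1)) + F₁    ≡⟨ poly₃ d F₁ (l * l * l * (n + 1)) ⟩
        d * F₁ + F₁ + l * l * l * (n + 1) * d  ≡⟨ balance ⟩
        d * (U + l)                            ≡⟨ sym (ℕₚ.+-identityʳ _) ⟩
        d * (U + l) + 0                        ∎)))
      where
      G = l * (t * t + m + t + l * l * t)
      poly₁ : ∀ d u F G → d * u + (F + d * G) ≡ d * (u + G) + F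
      poly₁ = ℕR.solve-∀
      poly₂ : ∀ m t → (suc m * suc m + (suc m + t)) * (suc m * suc m + (suc m + t)) + (suc m + t) + suc m + suc m * (t * t + m + t + suc m * suc m * t)
        ≡ (suc m + t) * (suc m + t + 1) * (suc m + 1) + suc m * suc m * suc m * (suc m + t + 1)
      poly₂ = ℕR.solve-∀
      poly₃ : ∀ d F q → d * (F + q) + F ≡ d * F + F + q * d
      poly₃ = ℕR.solve-∀
    small : ∀ t → m ≡ n + t → ⊥
    small t m≡n+t = excess (((n * n + n) * m + 2 * m + 1) + (2 * suc m * (suc m * suc m * t + 2 * t * n) + d″ * (suc m * (suc m * suc m * t + n * n + n + 2 * t * n + 1)))) (sym F₁≡) (trans (cong (_* G) d≡″) (poly₂ n m t d″))
      where
      G = l * (l * l * t + n * n + n + 2 * t * n + 1)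
      d″ = ℕ.pred f + e
      d≡″ : d ≡ 2 + d″
      d≡″ = trans d≡ (trans (cong (λ f → f + 1 + e) (sym (ℕₚ.suc-pred f))) (poly (ℕ.pred f) e))
        where
        poly : ∀ f e → suc f + 1 + e ≡ 2 + (f + e)
        poly = ℕR.solve-∀
      F₁≡ : F₁ ≡ d * G
      F₁≡ = ℕₚ.+-cancelˡ-≡ (d * (F₁ + l * l * l * (n + 1))) _ _ (begin
        d * (F₁ + l * l * l * (n + 1)) + F₁       ≡⟨ poly₃ d F₁ (l * l * l * (n + 1)) ⟩
        d * F₁ + F₁ + l * l * l * (n + 1) * d     ≡⟨ balance ⟩
        d * (U + l)                               ≡⟨ cong (d *_) (subst (λ m → (suc m * suc m + n) * (suc m * suc m + n) + n + suc m ≡ n * (n + 1) * (suc m + 1) + suc m * suc m * suc m * (n + 1) + suc m * (suc m * suc m * t + n * n + n + 2 * t * n + 1)) (sym m≡n+t) (poly₁ n t)) ⟩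
        d * (F₁ + l * l * l * (n + 1) + G)        ≡⟨ ℕₚ.*-distribˡ-+ d (F₁ + l * l * l * (n + 1)) G ⟩
        d * (F₁ + l * l * l * (n + 1)) + d * G    ∎)
        where
        poly₁ : ∀ n t → (suc (n + t) * suc (n + t) + n) * (suc (n + t) * suc (n + t) + n) + n + suc (n + t)
          ≡ n * (n + 1) * (suc (n + t) + 1) + suc (n + t) * suc (n + t) * suc (n + t) * (n + 1) + suc (n + t) * (suc (n + t) * suc (n + t) * t + n * n + n + 2 * t * n + 1)
        poly₁ = ℕR.solve-∀
        poly₃ : ∀ d F q → d * (F + q) + F ≡ d * F + F + q * d
        poly₃ = ℕR.solve-∀
      poly₂ : ∀ n m t d → (2 + d) * (suc m * (suc m * suc m * t + n * n + n + 2 * t * n + 1))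
        ≡ n * (n + 1) * (suc m + 1) + suc (((n * n + n) * m + 2 * m + 1) + (2 * suc m * (suc m * suc m * t + 2 * t * n) + d * (suc m * (suc m * suc m * t + n * n + n + 2 * t * n + 1))))
      poly₂ = ℕR.solve-∀
    -- In `balance` the left side is larger if n ≥ l, and the right side is larger if n ≤ m.
    by-size : ⊥
    by-size with n ≤? m
    ... | yes n≤m = small (m ∸ n) (sym (ℕₚ.m+[n∸m]≡n n≤m))
    ... | no n≰m = large (n ∸ l) (sym (ℕₚ.m+[n∸m]≡n (ℕₚ.≰⇒> n≰m)))

-- Descent of polynomial identities from the field to ℕ

module Descent (K : Char0Field 0ℓ 0ℓ) where
  open FieldKit K

  -- Subtraction is left out so that a polynomial can be evaluated in ℕ as well; negative terms are
  -- moved to the other side.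
  data Poly (m : ℕ) : Set where
    arg : Fin m → Poly m
    cst : ℕ → Poly m
    _⊞_ _⊠_ : Poly m → Poly m → Poly m
  infixl 6 _⊞_
  infixl 7 _⊠_

  evalℕ : ∀ {m} → Poly m → Vec ℕ m → ℕ
  evalℕ (arg i) ρ = Vec.lookup ρ i
  evalℕ (cst c) ρ = c
  evalℕ (p ⊞ q) ρ = evalℕ p ρ + evalℕ q ρ
  evalℕ (p ⊠ q) ρ = evalℕ p ρ * evalℕ q ρ

  evalν : ∀ {m} → Poly m → Vec ℕ m → Carrier
  evalν (arg i) ρ = ν (Vec.lookup ρ i)
  evalν (cst c) ρ = ι (+ c)
  evalν (p ⊞ q) ρ = evalν p ρ ⊕ evalν q ρ
  evalν (p ⊠ q) ρ = evalν p ρ ⊛ evalν q ρ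

  evalν-hom : ∀ {m} (p : Poly m) ρ → ν (evalℕ p ρ) ≈ evalν p ρ
  evalν-hom (arg i) ρ = ≈-refl
  evalν-hom (cst c) ρ = ≈-refl
  evalν-hom (p ⊞ q) ρ = ≈-trans (ν-+ (evalℕ p ρ) (evalℕ q ρ)) (+-cong (evalν-hom p ρ) (evalν-hom q ρ))
  evalν-hom (p ⊠ q) ρ = ≈-trans (ν-* (evalℕ p ρ) (evalℕ q ρ)) (*-cong (evalν-hom p ρ) (evalν-hom q ρ))

  ν-injective : ∀ {a b} → ν a ≈ ν b → a ≡ b
  ν-injective {a} {b} e = ℤₚ.+-injective (ι-injective (+ a) (+ b) e)

  descend : ∀ {m} (p q : Poly m) ρ → evalν p ρ ≈ evalν q ρ → evalℕ p ρ ≡ evalℕ q ρ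
  descend p q ρ e = ν-injective (≈-trans (evalν-hom p ρ) (≈-trans e (≈-sym (evalν-hom q ρ))))

-- The cosines of levels three to six in terms of two ratios

module LevelThree (K : Char0Field 0ℓ 0ℓ) where
  open FieldKit K

  module Cosines₃ (w₀ w₁ w₂ w₃ w₄ ρ d : Carrier)
    (w₁≉w₂ : ¬ w₁ ≈ w₂) (w₂≉w₃ : ¬ w₂ ≈ w₃) (w₀≉w₃ : ¬ w₀ ≈ w₃) (w₁≉w₃ : ¬ w₁ ≈ w₃) (ρ≉0 : ¬ ρ ≈ 0#)
    (r₀ : (d ⊕ ι (+ 1)) ⊛ (w₁ ⊝ w₂) ≈ ρ ⊛ (w₀ ⊝ w₃))
    (r₁ : (w₀ ⊕ d ⊛ w₂) ⊝ (w₁ ⊕ d ⊛ w₃) ≈ ρ ⊛ (w₁ ⊝ w₂))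
    (r₂ : (d ⊕ ι (+ 1)) ⊛ (w₂ ⊝ w₃) ≈ ρ ⊛ (w₁ ⊝ w₄)) where

    -- `t` is the unit of length. `B` satisfies both ρ₃ B = c₃ and W₁ - W₄ = B t, so the differences
    -- of W₀, ..., W₄ are polynomials in `x` and `B` times `t`.
    t x B : Carrier
    t = w₂ ⊝ w₃
    x = (w₁ ⊝ w₂) ⊛ t ⁻¹
    B = (w₀ ⊝ w₃) ⊛ (w₁ ⊝ w₂) ⁻¹

    t≉0 : ¬ t ≈ 0#
    t≉0 = diff≉0 w₂≉w₃

    private
      unit-cancel : ∀ {a b} → ¬ b ≈ 0# → a ≈ a ⊛ b ⁻¹ ⊛ b
      unit-cancel {a} {b} b≉0 = ≈-sym (≈-trans (*-assoc _ _ _) (≈-trans (*-cong ≈-refl (≈-trans (*-comm _ _) (inverseʳ b b≉0))) (*-identityʳ a)))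

    w₁₂ : w₁ ⊝ w₂ ≈ x ⊛ t
    w₁₂ = unit-cancel t≉0

    w₀₃ : w₀ ⊝ w₃ ≈ B ⊛ (w₁ ⊝ w₂)
    w₀₃ = unit-cancel (diff≉0 w₁≉w₂)

    ρB : ρ ⊛ B ≈ d ⊕ ι (+ 1)
    ρB = cancelˡ (diff≉0 w₁≉w₂) (lc₂ (⊖ ι (+ 1)) (⊖ ρ) r₀ w₀₃
      (ring-solve 5 (λ a b ρ B d → a :* (ρ :* B) :- a :* (d :+ # 1) :≈ (:- # 1) :* ((d :+ # 1) :* a :- ρ :* b) :+ (:- ρ) :* (b :- B :* a)) ≈-refl (w₁ ⊝ w₂) (w₀ ⊝ w₃) ρ B d))

    w₁₄ : w₁ ⊝ w₄ ≈ B ⊛ t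
    w₁₄ = cancelˡ ρ≉0 (lc₂ (⊖ ι (+ 1)) (⊖ t) r₂ ρB
      (ring-solve 5 (λ t a ρ B d → ρ :* a :- ρ :* (B :* t) :≈ (:- # 1) :* ((d :+ # 1) :* t :- ρ :* a) :+ (:- t) :* (ρ :* B :- (d :+ # 1))) ≈-refl t (w₁ ⊝ w₄) ρ B d))

    w₁₃ : w₁ ⊝ w₃ ≈ (x ⊕ ι (+ 1)) ⊛ t
    w₁₃ = lc₁ (ι (+ 1)) w₁₂ (ring-solve 4 (λ a b c x → a :- c :- (x :+ # 1) :* (b :- c) :≈ # 1 :* (a :- b :- x :* (b :- c))) ≈-refl w₁ w₂ w₃ x)

    w₂₄ : w₂ ⊝ w₄ ≈ (B ⊝ x) ⊛ t
    w₂₄ = lc₂ (ι (+ 1)) (⊖ ι (+ 1)) w₁₄ w₁₂ (ring-solve 6 (λ a b e t x B → b :- e :- (B :- x) :* t :≈ # 1 :* (a :- e :- B :* t) :+ (:- # 1) :* (a :- b :- x :* t)) ≈-refl w₁ w₂ w₄ t x B)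

    w₀₄ : w₀ ⊝ w₄ ≈ (B ⊝ ι (+ 1)) ⊛ (x ⊕ ι (+ 1)) ⊛ t
    w₀₄ = lc₃ (ι (+ 1)) (ι (+ 1)) (B ⊝ ι (+ 1)) w₀₃ w₁₄ w₁₂
      (ring-solve 7 (λ z a b c e x B → z :- e :- (B :- # 1) :* (x :+ # 1) :* (b :- c) :≈
        # 1 :* (z :- c :- B :* (a :- b)) :+ # 1 :* (a :- e :- B :* (b :- c)) :+ (B :- # 1) :* (a :- b :- x :* (b :- c))) ≈-refl w₀ w₁ w₂ w₃ w₄ x B)

    x+1≉0 : ¬ x ⊕ ι (+ 1) ≈ 0#
    x+1≉0 e = diff≉0 w₁≉w₃ (≈-trans w₁₃ (≈-trans (*-cong e ≈-refl) (zeroˡ t)))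

    x≉0 : ¬ x ≈ 0#
    x≉0 e = diff≉0 w₁≉w₂ (≈-trans w₁₂ (≈-trans (*-cong e ≈-refl) (zeroˡ t)))

    B≉0 : ¬ B ≈ 0#
    B≉0 e = diff≉0 w₀≉w₃ (≈-trans w₀₃ (≈-trans (*-cong e ≈-refl) (zeroˡ _)))

    w₀₁ : w₀ ⊝ w₁ ≈ ((B ⊝ ι (+ 1)) ⊛ x ⊝ ι (+ 1)) ⊛ t
    w₀₁ = lc₂ (ι (+ 1)) (B ⊝ ι (+ 1)) w₀₃ w₁₂
      (ring-solve 6 (λ z a b c x B → z :- a :- ((B :- # 1) :* x :- # 1) :* (b :- c) :≈ # 1 :* (z :- c :- B :* (a :- b)) :+ (B :- # 1) :* (a :- b :- x :* (b :- c))) ≈-refl w₀ w₁ w₂ w₃ x B)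

    near : B ⊛ ((B ⊝ ι (+ 1)) ⊛ x ⊝ ι (+ 1) ⊕ d) ≈ (d ⊕ ι (+ 1)) ⊛ x
    near = cancelˡ t≉0 (≈-trans scaled (≈-trans (*-cong ≈-refl w₁₂) (ring-solve 3 (λ t x d → (d :+ # 1) :* (x :* t) :≈ t :* ((d :+ # 1) :* x)) ≈-refl t x d)))
      where
      scaled : t ⊛ (B ⊛ ((B ⊝ ι (+ 1)) ⊛ x ⊝ ι (+ 1) ⊕ d)) ≈ (d ⊕ ι (+ 1)) ⊛ (w₁ ⊝ w₂)
      scaled = lc₃ B (⊖ B) (w₁ ⊝ w₂) r₁ w₀₁ ρB
        (ring-solve 8 (λ z a b c x B ρ d → (b :- c) :* (B :* ((B :- # 1) :* x :- # 1 :+ d)) :- (d :+ # 1) :* (a :- b) :≈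
          B :* ((z :+ d :* b) :- (a :+ d :* c) :- ρ :* (a :- b)) :+ (:- B) :* (z :- a :- ((B :- # 1) :* x :- # 1) :* (b :- c)) :+ (a :- b) :* (ρ :* B :- (d :+ # 1))) ≈-refl w₀ w₁ w₂ w₃ x B ρ d)

    block-eq : ∀ {f} → (w₁ ⊕ d ⊛ w₃) ⊝ ((f ⊕ ι (+ 1)) ⊛ w₂ ⊕ (d ⊝ f) ⊛ w₄) ≈ ρ ⊛ (w₂ ⊝ w₃) →
            B ⊛ (x ⊝ f ⊕ (d ⊝ f) ⊛ (B ⊝ x ⊝ ι (+ 1))) ≈ d ⊕ ι (+ 1)
    block-eq {f} rf = cancelˡ t≉0 (lc₂ (ι (+ 1)) t scaled ρB
        (ring-solve 6 (λ t x B ρ d f → t :* (B :* (x :- f :+ (d :- f) :* (B :- x :- # 1))) :- t :* (d :+ # 1) :≈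
          # 1 :* (t :* (B :* (x :- f :+ (d :- f) :* (B :- x :- # 1))) :- B :* (ρ :* t)) :+ t :* (ρ :* B :- (d :+ # 1))) ≈-refl t x B ρ d f))
      where
      scaled : t ⊛ (B ⊛ (x ⊝ f ⊕ (d ⊝ f) ⊛ (B ⊝ x ⊝ ι (+ 1)))) ≈ B ⊛ (ρ ⊛ (w₂ ⊝ w₃))
      scaled = lc₃ B (⊖ (B ⊛ (d ⊝ f))) (⊖ (B ⊛ (ι (+ 1) ⊝ (d ⊝ f)))) rf w₁₄ w₁₂
        (ring-solve 9 (λ a b c e x B ρ d f → (b :- c) :* (B :* (x :- f :+ (d :- f) :* (B :- x :- # 1))) :- B :* (ρ :* (b :- c)) :≈
          B :* ((a :+ d :* c) :- ((f :+ # 1) :* b :+ (d :- f) :* e) :- ρ :* (b :- c)) :+ (:- (B :* (d :- f))) :* (a :- e :- B :* (b :- c))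
            :+ (:- (B :* (# 1 :- (d :- f)))) :* (a :- b :- x :* (b :- c))) ≈-refl w₁ w₂ w₃ w₄ x B ρ d f)

    ratio : ∀ {l} → w₁ ⊝ w₃ ≈ l ⊛ (w₂ ⊝ w₄) → x ⊕ ι (+ 1) ≈ l ⊛ (B ⊝ x)
    ratio {l} h = cancelˡ t≉0 (lc₃ (⊖ ι (+ 1)) (ι (+ 1)) l w₁₃ h w₂₄
      (ring-solve 6 (λ p q t x B l → t :* (x :+ # 1) :- t :* (l :* (B :- x)) :≈ (:- # 1) :* (p :- (x :+ # 1) :* t) :+ # 1 :* (p :- l :* q) :+ l :* (q :- (B :- x) :* t)) ≈-refl (w₁ ⊝ w₃) (w₂ ⊝ w₄) t x B l))

    flat₃ : w₄ ≈ w₃ → B ≈ x ⊕ ι (+ 1)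
    flat₃ e = cancelˡ t≉0 (lc₃ (⊖ ι (+ 1)) (ι (+ 1)) (⊖ ι (+ 1)) w₁₄ w₁₃ e
      (ring-solve 6 (λ a c e t x B → t :* B :- t :* (x :+ # 1) :≈ (:- # 1) :* (a :- e :- B :* t) :+ # 1 :* (a :- c :- (x :+ # 1) :* t) :+ (:- # 1) :* (e :- c)) ≈-refl w₁ w₃ w₄ t x B))

    -- The recursion `R02` at level four determines W₅; `LevelFive` continues with W₆.
    module LevelFour {w₅ : Carrier} (rec : (w₂ ⊝ w₄) ⊛ (w₀ ⊝ w₄) ≈ (w₁ ⊝ w₃) ⊛ (w₁ ⊝ w₅)) where

      P : Carrier
      P = (B ⊝ x) ⊛ (B ⊝ ι (+ 1))

      w₁₅ : w₁ ⊝ w₅ ≈ P ⊛ t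
      w₁₅ = cancelˡ (*≉0 x+1≉0 t≉0) (≈-trans (*-cong (≈-sym w₁₃) ≈-refl) (≈-trans (≈-sym rec) (≈-trans (*-cong w₂₄ w₀₄)
        (ring-solve 3 (λ t x B → (B :- x) :* t :* ((B :- # 1) :* (x :+ # 1) :* t) :≈ (x :+ # 1) :* t :* ((B :- x) :* (B :- # 1) :* t)) ≈-refl t x B))))

      module _ {l : Carrier} (h : x ⊕ ι (+ 1) ≈ l ⊛ (B ⊝ x)) where

        flat₄ : w₅ ≈ w₄ → B ⊛ B ⊝ ι (+ 1) ≈ (l ⊕ ι (+ 1)) ⊛ B
        flat₄ e = lc₂ (l ⊕ ι (+ 1)) (B ⊝ ι (+ 1)) P≈B h
          (ring-solve 3 (λ x B l → B :* B :- # 1 :- (l :+ # 1) :* B :≈ (l :+ # 1) :* ((B :- x) :* (B :- # 1) :- B) :+ (B :- # 1) :* (x :+ # 1 :- l :* (B :- x))) ≈-refl x B l)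
          where
          P≈B : P ≈ B
          P≈B = cancelˡ t≉0 (lc₃ (⊖ ι (+ 1)) (ι (+ 1)) (⊖ ι (+ 1)) w₁₅ w₁₄ e
            (ring-solve 6 (λ a e₅ e₄ t P B → t :* P :- t :* B :≈ (:- # 1) :* (a :- e₅ :- P :* t) :+ # 1 :* (a :- e₄ :- B :* t) :+ (:- # 1) :* (e₅ :- e₄)) ≈-refl w₁ w₅ w₄ t P B))

        ratio₄ : ∀ {l₄} → w₁ ⊝ w₃ ≈ l₄ ⊛ (w₃ ⊝ w₅) → l ≈ l₄ ⊛ (B ⊝ ι (+ 1) ⊝ l)
        ratio₄ {l₄} h₄ = cancelˡ x+1≉0 (lc₂ l (⊖ (l₄ ⊛ (B ⊝ ι (+ 1)))) in-t h
            (ring-solve 4 (λ x B l l₄ → (x :+ # 1) :* l :- (x :+ # 1) :* (l₄ :* (B :- # 1 :- l)) :≈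
              l :* (x :+ # 1 :- l₄ :* ((B :- x) :* (B :- # 1) :- (x :+ # 1))) :+ (:- (l₄ :* (B :- # 1))) :* (x :+ # 1 :- l :* (B :- x))) ≈-refl x B l l₄))
          where
          in-t : x ⊕ ι (+ 1) ≈ l₄ ⊛ (P ⊝ (x ⊕ ι (+ 1)))
          in-t = cancelˡ t≉0 (lc₃ (⊖ (ι (+ 1) ⊕ l₄)) (ι (+ 1)) l₄ w₁₃ h₄ w₁₅
            (ring-solve 7 (λ a c e t x P l → t :* (x :+ # 1) :- t :* (l :* (P :- (x :+ # 1))) :≈
              (:- (# 1 :+ l)) :* (a :- c :- (x :+ # 1) :* t) :+ # 1 :* (a :- c :- l :* (c :- e)) :+ l :* (a :- e :- P :* t)) ≈-refl w₁ w₃ w₅ t x P l₄))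

        module LevelFive {w₆ : Carrier} (l+1≉0 : ¬ l ⊕ ι (+ 1) ≈ 0#) (B+1≉0 : ¬ B ⊕ ι (+ 1) ≈ 0#)
                         (rec₅ : (w₂ ⊝ w₅) ⊛ (w₀ ⊝ w₅) ≈ (w₁ ⊝ w₄) ⊛ (w₁ ⊝ w₆)) where

          w₂₅ : w₂ ⊝ w₅ ≈ (P ⊝ x) ⊛ t
          w₂₅ = lc₂ (ι (+ 1)) (⊖ ι (+ 1)) w₁₅ w₁₂ (ring-solve 6 (λ a b e t x P → b :- e :- (P :- x) :* t :≈ # 1 :* (a :- e :- P :* t) :+ (:- # 1) :* (a :- b :- x :* t)) ≈-refl w₁ w₂ w₅ t x P)

          w₀₅ : w₀ ⊝ w₅ ≈ (B ⊛ B ⊝ B ⊝ ι (+ 1)) ⊛ t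
          w₀₅ = ≈-trans (lc₃ (ι (+ 1)) (ι (+ 1)) (⊖ ι (+ 1)) w₀₄ w₁₅ w₁₄
              (ring-solve 7 (λ z a e₄ e₅ t x B → z :- e₅ :- ((B :- # 1) :* (x :+ # 1) :+ (B :- x) :* (B :- # 1) :- B) :* t :≈
                # 1 :* (z :- e₄ :- (B :- # 1) :* (x :+ # 1) :* t) :+ # 1 :* (a :- e₅ :- (B :- x) :* (B :- # 1) :* t) :+ (:- # 1) :* (a :- e₄ :- B :* t)) ≈-refl w₀ w₁ w₄ w₅ t x B))
            (ring-solve 3 (λ t x B → ((B :- # 1) :* (x :+ # 1) :+ (B :- x) :* (B :- # 1) :- B) :* t :≈ (B :* B :- B :- # 1) :* t) ≈-refl t x B)

          y : Carrier
          y = (w₁ ⊝ w₆) ⊛ t ⁻¹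

          w₁₆ : w₁ ⊝ w₆ ≈ y ⊛ t
          w₁₆ = unit-cancel t≉0

          By : (P ⊝ x) ⊛ (B ⊛ B ⊝ B ⊝ ι (+ 1)) ≈ B ⊛ y
          By = cancelˡ (*≉0 t≉0 t≉0) (≈-trans (ring-solve 3 (λ t a b → t :* t :* (a :* b) :≈ (a :* t) :* (b :* t)) ≈-refl t _ _)
            (≈-trans (≈-sym (*-cong w₂₅ w₀₅)) (≈-trans rec₅ (≈-trans (*-cong w₁₄ w₁₆) (ring-solve 3 (λ t a b → (a :* t) :* (b :* t) :≈ t :* t :* (a :* b)) ≈-refl t B y)))))

          py : (l ⊕ ι (+ 1)) ⊛ y ≈ (B ⊝ l) ⊛ (B ⊛ B ⊝ B ⊝ ι (+ 1))
          py = cancelˡ B≉0 (lc₂ (⊖ (l ⊕ ι (+ 1))) (⊖ (B ⊛ (B ⊛ B ⊝ B ⊝ ι (+ 1)))) By h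
            (ring-solve 4 (λ x B l y → B :* ((l :+ # 1) :* y) :- B :* ((B :- l) :* (B :* B :- B :- # 1)) :≈
              (:- (l :+ # 1)) :* (((B :- x) :* (B :- # 1) :- x) :* (B :* B :- B :- # 1) :- B :* y) :+ (:- (B :* (B :* B :- B :- # 1))) :* (x :+ # 1 :- l :* (B :- x))) ≈-refl x B l y))

          flat₅ : w₆ ≈ w₅ → (B ⊝ l) ⊛ (B ⊛ B ⊝ B ⊝ ι (+ 1)) ≈ B ⊛ B ⊝ ι (+ 1)
          flat₅ e = lc₃ (⊖ ι (+ 1)) (l ⊕ ι (+ 1)) (⊖ (B ⊝ ι (+ 1))) py y≈P h
            (ring-solve 4 (λ x B l y → (B :- l) :* (B :* B :- B :- # 1) :- (B :* B :- # 1) :≈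
              (:- # 1) :* ((l :+ # 1) :* y :- (B :- l) :* (B :* B :- B :- # 1)) :+ (l :+ # 1) :* (y :- (B :- x) :* (B :- # 1)) :+ (:- (B :- # 1)) :* (x :+ # 1 :- l :* (B :- x))) ≈-refl x B l y)
            where
            y≈P : y ≈ P
            y≈P = cancelˡ t≉0 (lc₃ (⊖ ι (+ 1)) (ι (+ 1)) (⊖ ι (+ 1)) w₁₆ w₁₅ e
              (ring-solve 6 (λ a e₆ e₅ t y P → t :* y :- t :* P :≈ (:- # 1) :* (a :- e₆ :- y :* t) :+ # 1 :* (a :- e₅ :- P :* t) :+ (:- # 1) :* (e₆ :- e₅)) ≈-refl w₁ w₆ w₅ t y P))

          w₄₆ : w₄ ⊝ w₆ ≈ (y ⊝ B) ⊛ t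
          w₄₆ = lc₂ (ι (+ 1)) (⊖ ι (+ 1)) w₁₆ w₁₄ (ring-solve 6 (λ a e₄ e₆ t y B → e₄ :- e₆ :- (y :- B) :* t :≈ # 1 :* (a :- e₆ :- y :* t) :+ (:- # 1) :* (a :- e₄ :- B :* t)) ≈-refl w₁ w₄ w₆ t y B)

          ratio₅ : ∀ {l₅} → w₁ ⊝ w₃ ≈ l₅ ⊛ (w₄ ⊝ w₆) → l₅ ⊛ (B ⊛ B ⊝ (ι (+ 2) ⊕ l) ⊛ B ⊕ l) ≈ l
          ratio₅ {l₅} h₅ = cancelˡ B+1≉0 (lc₃ (⊖ (l ⊕ ι (+ 1))) (⊖ l₅) (ι (+ 1)) in-t py h
            (ring-solve 5 (λ x B l y l₅ → (B :+ # 1) :* (l₅ :* (B :* B :- (# 2 :+ l) :* B :+ l)) :- (B :+ # 1) :* l :≈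
              (:- (l :+ # 1)) :* (x :+ # 1 :- l₅ :* (y :- B)) :+ (:- l₅) :* ((l :+ # 1) :* y :- (B :- l) :* (B :* B :- B :- # 1)) :+ # 1 :* (x :+ # 1 :- l :* (B :- x))) ≈-refl x B l y l₅))
            where
            in-t : x ⊕ ι (+ 1) ≈ l₅ ⊛ (y ⊝ B)
            in-t = cancelˡ t≉0 (lc₃ (⊖ ι (+ 1)) (ι (+ 1)) l₅ w₁₃ h₅ w₄₆
              (ring-solve 7 (λ p q t x y B l → t :* (x :+ # 1) :- t :* (l :* (y :- B)) :≈ (:- # 1) :* (p :- (x :+ # 1) :* t) :+ # 1 :* (p :- l :* q) :+ l :* (q :- (y :- B) :* t))
                ≈-refl (w₁ ⊝ w₃) (w₄ ⊝ w₆) t x y B l₅))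

-- Level three: exclusion of c₃ = 1, and the integer parameters for c₃ at least 3

module Elimination (S : Setting) (cos : Cosines (Setting.G S) (Setting.conn S) (Setting.D S)) where
  open Local S
  open Relations S cos
  open Designs S cos
  open Cosines cos using (field₀; stable)
  open FieldKit field₀
  open Descent field₀

  3≤D′ : ∀ {h} → h ≤ 3 → h ≤ D
  3≤D′ h≤3 = ℕₚ.≤-trans h≤3 3≤D

  s₂ : ℕ
  s₂ = k ∸ 2

  k≡ : k ≡ suc (suc s₂)
  k≡ = sym (ℕₚ.m+[n∸m]≡n {2} {k} (ℕₚ.≤-trans (s≤s (s≤s z≤n)) 3≤k))

  1≤s₂ : 1 ≤ s₂
  1≤s₂ = ℕₚ.≤-pred (ℕₚ.≤-pred (subst (3 ≤_) k≡ 3≤k))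

  -- In the field `s` is k - 1, whereas the parameter called `s` in `Parameters` is `s₂`, that is k
  -- - 2.
  s : Carrier
  s = ν s₂ ⊕ ι (+ 1)

  ν-suc : ∀ m → ν (suc m) ≈ ν m ⊕ ι (+ 1)
  ν-suc m = ≈-trans (+-comm _ _) (+-cong ≈-refl (≈-sym ι-1))

  νk : ν k ≈ s ⊕ ι (+ 1)
  νk = ≈-trans (≈-reflexive (cong ν k≡)) (≈-trans (ν-suc (suc s₂)) (+-cong (ν-suc s₂) ≈-refl))

  c<k : ∀ {h} → h < D → c h < k
  c<k {h} h<D = let (x , y) , e = pair h (ℕₚ.<⇒≤ h<D)
                    u , xu , eu = further e h<D
                in ℕₚ.<-≤-trans (ℕₚ.m<m+n (c h) (count-pos u (C̅-intro {x} {y} {u} xu (λ eq → ℕₚ.m≢1+n+m h {1} (sym (trans (cong suc (sym eu)) (trans eq e)))))))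
                     (ℕₚ.≤-reflexive (sym (C+C̅ e)))

  -- The quotient of `R2` by `R0`: both c_h and ρ_h cancel, and a recursion among the cosines alone
  -- remains.
  R02 : ∀ {g} → suc g ≤ D → g ≢ 1 → c (suc g) < k →
        (w 2 ⊝ w (suc g)) ⊛ (w 0 ⊝ w (suc g)) ≈ (w 1 ⊝ w g) ⊛ (w 1 ⊝ w (suc (suc g)))
  R02 {g} g<D g≢1 c<k = cancelˡ (*≉0 (ρ≉0 g<D g≢1) (ν≉0 (c-pos g<D)))
    (lc₂ (ρ (suc g) ⊛ (w 0 ⊝ w (suc g))) (⊖ (ρ (suc g) ⊛ (w 1 ⊝ w (suc (suc g))))) (R2 g<D c<k) (R0 g<D)
      (ring-solve 6 (λ r c a b a′ b′ → r :* c :* (a :* b′) :- r :* c :* (a′ :* b) :≈ (r :* b′) :* (c :* a :- r :* b) :+ (:- (r :* b)) :* (c :* a′ :- r :* b′))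
        ≈-refl (ρ (suc g)) (ν (c (suc g))) (w 2 ⊝ w (suc g)) (w 1 ⊝ w (suc (suc g))) (w 1 ⊝ w g) (w 0 ⊝ w (suc g))))

  ν1 : ∀ {a} → a ≡ 1 → ν a ≈ ι (+ 1)
  ν1 refl = ≈-refl

  module Level3 (c₃<k : c 3 < k) (d : Carrier) (νc₃ : ν (c 3) ≈ d ⊕ ι (+ 1)) where

    r₀ : (d ⊕ ι (+ 1)) ⊛ (w 1 ⊝ w 2) ≈ ρ 3 ⊛ (w 0 ⊝ w 3)
    r₀ = ≈-trans (*-cong (≈-sym νc₃) ≈-refl) (R0 (3≤D′ ℕₚ.≤-refl))

    r₂ : (d ⊕ ι (+ 1)) ⊛ (w 2 ⊝ w 3) ≈ ρ 3 ⊛ (w 1 ⊝ w 4)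
    r₂ = ≈-trans (*-cong (≈-sym νc₃) ≈-refl) (R2 (3≤D′ ℕₚ.≤-refl) c₃<k)

    r₁ : (w 0 ⊕ d ⊛ w 2) ⊝ (w 1 ⊕ d ⊛ w 3) ≈ ρ 3 ⊛ (w 1 ⊝ w 2)
    r₁ = lc₃ (ι (+ 1)) (⊖ w 2 ⊕ w 3) (w 1 ⊝ w 3) (R1 {1} (proj₂ (pair 3 (3≤D′ ℕₚ.≤-refl)))) νc₃ (ν1 c₂)
      (ring-solve 8 (λ z a b e d c c′ r → (z :+ d :* b) :- (a :+ d :* e) :- r :≈
        # 1 :* ((z :+ (c :- # 1) :* b) :- (c′ :* a :+ (c :- c′) :* e) :- r) :+ ((:- b) :+ e) :* (c :- (d :+ # 1)) :+ (a :- e) :* (c′ :- # 1))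
        ≈-refl (w 0) (w 1) (w 2) (w 3) d (ν (c 3)) (ν (c 2)) (ρ 3 ⊛ (w 1 ⊝ w 2)))

    open LevelThree.Cosines₃ field₀ (w 0) (w 1) (w 2) (w 3) (w 4) (ρ 3) d
      (w-distinct (3≤D′ (s≤s z≤n)) (3≤D′ (s≤s (s≤s z≤n))) (λ ())) (w-distinct (3≤D′ (s≤s (s≤s z≤n))) (3≤D′ ℕₚ.≤-refl) (λ ()))
      (w-distinct z≤n (3≤D′ ℕₚ.≤-refl) (λ ())) (w-distinct (3≤D′ (s≤s z≤n)) (3≤D′ ℕₚ.≤-refl) (λ ()))
      (ρ≉0 (3≤D′ ℕₚ.≤-refl) (λ ())) r₀ r₁ r₂ public

    Eigen : Carrier → Set
    Eigen θ = ν k ⊛ w 1 ≈ θ ⊛ w 0 × (∀ {g} → suc g ≤ D → ν (c (suc g)) ⊛ w g ⊕ (ν k ⊝ ν (c (suc g))) ⊛ w (suc (suc g)) ≈ θ ⊛ w (suc g))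

    -- By `w₀₁` this is (W₀ - W₁) / (W₂ - W₃).
    u₀ : Carrier
    u₀ = (B ⊝ ι (+ 1)) ⊛ x ⊝ ι (+ 1)

    u₀≉0 : ¬ u₀ ≈ 0#
    u₀≉0 e = w-distinct z≤n (3≤D′ (s≤s z≤n)) (λ ()) (undiff (≈-trans w₀₁ (≈-trans (*-cong e ≈-refl) (zeroˡ t))))

    module _ {θ : Carrier} (eig : Eigen θ) where
      private
        e₀ : (s ⊕ ι (+ 1)) ⊛ w 1 ≈ θ ⊛ w 0
        e₀ = ≈-trans (*-cong (≈-sym νk) ≈-refl) (proj₁ eig)
        e₁ : w 0 ⊕ s ⊛ w 2 ≈ θ ⊛ w 1
        e₁ = lc₃ (ι (+ 1)) (w 2 ⊝ w 0) (⊖ w 2) (proj₂ eig (3≤D′ (s≤s z≤n))) (ν1 c₁) νk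
          (ring-solve 6 (λ z b s c k r → z :+ s :* b :- r :≈ # 1 :* (c :* z :+ (k :- c) :* b :- r) :+ (b :- z) :* (c :- # 1) :+ (:- b) :* (k :- (s :+ # 1)))
            ≈-refl (w 0) (w 2) s (ν (c 1)) (ν k) (θ ⊛ w 1))
        e₂ : w 1 ⊕ s ⊛ w 3 ≈ θ ⊛ w 2
        e₂ = lc₃ (ι (+ 1)) (w 3 ⊝ w 1) (⊖ w 3) (proj₂ eig (3≤D′ (s≤s (s≤s z≤n)))) (ν1 c₂) νk
          (ring-solve 6 (λ z b s c k r → z :+ s :* b :- r :≈ # 1 :* (c :* z :+ (k :- c) :* b :- r) :+ (b :- z) :* (c :- # 1) :+ (:- b) :* (k :- (s :+ # 1)))
            ≈-refl (w 1) (w 3) s (ν (c 2)) (ν k) (θ ⊛ w 2))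

      eigen₁ : (θ ⊕ ι (+ 1)) ⊛ u₀ ≈ s ⊛ x
      eigen₁ = cancelˡ t≉0 (≈-trans (ring-solve 3 (λ t θ u → t :* (θ :* u) :≈ θ :* (u :* t)) ≈-refl t (θ ⊕ ι (+ 1)) u₀)
        (≈-trans (*-cong ≈-refl (≈-sym w₀₁)) (≈-trans mid (≈-trans (*-cong ≈-refl w₁₂) (ring-solve 3 (λ t s x → s :* (x :* t) :≈ t :* (s :* x)) ≈-refl t s x)))))
        where
        mid : (θ ⊕ ι (+ 1)) ⊛ (w 0 ⊝ w 1) ≈ s ⊛ (w 1 ⊝ w 2)
        mid = lc₂ (⊖ ι (+ 1)) (ι (+ 1)) e₀ e₁ (ring-solve 5 (λ θ s z a b → (θ :+ # 1) :* (z :- a) :- s :* (a :- b) :≈ (:- # 1) :* ((s :+ # 1) :* a :- θ :* z) :+ # 1 :* (z :+ s :* b :- θ :* a)) ≈-refl θ s (w 0) (w 1) (w 2))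

      eigen₂ : θ ⊛ x ≈ u₀ ⊕ s
      eigen₂ = cancelˡ t≉0 (≈-trans (ring-solve 3 (λ t θ x → t :* (θ :* x) :≈ θ :* (x :* t)) ≈-refl t θ x)
        (≈-trans (*-cong ≈-refl (≈-sym w₁₂)) (≈-trans mid (≈-trans (+-cong w₀₁ ≈-refl) (ring-solve 3 (λ t s u → u :* t :+ s :* t :≈ t :* (u :+ s)) ≈-refl t s u₀)))))
        where
        mid : θ ⊛ (w 1 ⊝ w 2) ≈ (w 0 ⊝ w 1) ⊕ s ⊛ (w 2 ⊝ w 3)
        mid = lc₂ (⊖ ι (+ 1)) (ι (+ 1)) e₁ e₂ (ring-solve 6 (λ θ s z a b e → θ :* (a :- b) :- (z :- a :+ s :* (b :- e)) :≈ (:- # 1) :* (z :+ s :* b :- θ :* a) :+ # 1 :* (a :+ s :* e :- θ :* b)) ≈-refl θ s (w 0) (w 1) (w 2) (w 3))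

  s₂≉0 : ¬ ν s₂ ≈ 0#
  s₂≉0 = ν≉0 1≤s₂

  -- For c₃ = c₂ the blocks at level three are empty and the design gives nothing, so the eigenvalue
  -- equations have to decide. Together with `near` they yield u₀ (k - 2)(B + 1) = 0, hence B = -1,
  -- and then x = -1, against W₁ ≠ W₃.
  c₃≢1 : c 3 < k → c 3 ≢ 1
  c₃≢1 c₃<k c₃≡1 = three-term λ (θ , eig) → contradiction θ eig
    where
    νc₃ : ν (c 3) ≈ 0# ⊕ ι (+ 1)
    νc₃ = ≈-trans (ν1 c₃≡1) (≈-sym (+-identityˡ _))
    open Level3 c₃<k 0# νc₃
    Bu : B ⊛ u₀ ≈ x
    Bu = lc₁ (ι (+ 1)) near (ring-solve 2 (λ B x → B :* ((B :- # 1) :* x :- # 1) :- x :≈ # 1 :* (B :* ((B :- # 1) :* x :- # 1 :+ # 0) :- (# 0 :+ # 1) :* x)) ≈-refl B x)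
    contradiction : ∀ θ → Eigen θ → ⊥
    contradiction θ eig = x+1≉0 (lc₂ (ι (+ 1)) (⊖ ((B ⊝ ι (+ 2)) ⊛ x ⊝ ι (+ 1))) Bu B≈-1
        (ring-solve 2 (λ B x → x :+ # 1 :- # 0 :≈ # 1 :* (B :* ((B :- # 1) :* x :- # 1) :- x) :+ (:- ((B :- # 2) :* x :- # 1)) :* (B :+ # 1 :- # 0)) ≈-refl B x))
      where
      B≈-1 : B ⊕ ι (+ 1) ≈ 0#
      B≈-1 = cancel0 (*≉0 u₀≉0 s₂≉0) (lc₃ (ι (+ 1)) (⊖ B) (θ ⊕ s) (eigen₂ eig) (eigen₁ eig) Bu
        (ring-solve 4 (λ B x θ s₂ → (((B :- # 1) :* x :- # 1) :* s₂) :* (B :+ # 1) :- # 0 :≈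
          # 1 :* (θ :* x :- (((B :- # 1) :* x :- # 1) :+ (s₂ :+ # 1))) :+ (:- B) :* ((θ :+ # 1) :* ((B :- # 1) :* x :- # 1) :- (s₂ :+ # 1) :* x)
            :+ (θ :+ (s₂ :+ # 1)) :* (B :* ((B :- # 1) :* x :- # 1) :- x)) ≈-refl B x θ (ν s₂)))

  module Large (c₃<k : c 3 < k) {d₁ : ℕ} (c₃≡ : c 3 ≡ suc (suc d₁)) (1≤d₁ : 1 ≤ d₁) where

    dℕ : ℕ
    dℕ = suc d₁

    d≤s₂ : dℕ ≤ s₂
    d≤s₂ = ℕₚ.≤-pred (ℕₚ.≤-pred (subst₂ (λ a b → suc a ≤ b) c₃≡ k≡ c₃<k))

    two≤c₃ : 2 ≤ c 3
    two≤c₃ = ℕₚ.≤-trans (s≤s (s≤s z≤n)) (ℕₚ.≤-reflexive (sym c₃≡))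

    c₄≥2 : 4 ≤ D → 2 ≤ c 4
    c₄≥2 4≤D = ℕₚ.≤-trans two≤c₃ (c-mono-step 4≤D)

    belows = below-exists {2} (3≤D′ ℕₚ.≤-refl) (subst (λ c → suc (suc c) ≤ k) (sym c₂) 3≤k)

    block = design-below {2} (3≤D′ ℕₚ.≤-refl) (trans k≡ (cong (_+ suc s₂) (sym c₂))) (trans c₃≡ (cong (_+ dℕ) (sym c₂))) (proj₂ belows)

    f : ℕ
    f = proj₁ block

    F = common (proj₁ (proj₂ (proj₁ belows))) (proj₁ (proj₁ belows)) (proj₂ (proj₂ (proj₁ belows)))

    F≡ : F ≡ suc f
    F≡ = trans (proj₁ (proj₂ block)) (cong (_+ f) c₂)

    s₂f : s₂ * f ≡ dℕ * d₁
    s₂f = proj₂ (proj₂ block)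

    1≤f : 1 ≤ f
    1≤f = ℕₚ.n≢0⇒n>0 (λ f≡0 → ℕₚ.<⇒≢ (ℕₚ.*-mono-≤ {1} {dℕ} (s≤s z≤n) 1≤d₁) (trans (sym (ℕₚ.*-zeroʳ s₂)) (trans (cong (s₂ *_) (sym f≡0)) s₂f)))

    f≤d₁ : f ≤ d₁
    f≤d₁ = ℕₚ.*-cancelˡ-≤ dℕ (ℕₚ.≤-trans (ℕₚ.*-monoˡ-≤ f d≤s₂) (ℕₚ.≤-reflexive s₂f))

    νc : ∀ (d : Carrier) → ν dℕ ≈ d → ν (c 3) ≈ d ⊕ ι (+ 1)
    νc d e = ≈-trans (≈-reflexive (cong ν c₃≡)) (≈-trans (ν-suc dℕ) (+-cong e ≈-refl))

    module Setup (d : Carrier) (νd : ν dℕ ≈ d) where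
      open Level3 c₃<k d (νc d νd) public

      rf : (w 1 ⊕ d ⊛ w 3) ⊝ ((ν f ⊕ ι (+ 1)) ⊛ w 2 ⊕ (d ⊝ ν f) ⊛ w 4) ≈ ρ 3 ⊛ (w 2 ⊝ w 3)
      rf = lc₃ (ι (+ 1)) (⊖ w 3 ⊕ w 4) (w 2 ⊝ w 4) (Rf (proj₂ belows)) (νc d νd) (≈-trans (≈-reflexive (cong ν F≡)) (ν-suc f))
        (ring-solve 9 (λ a b e h d f c F r → (a :+ d :* e) :- ((f :+ # 1) :* b :+ (d :- f) :* h) :- r :≈
          # 1 :* ((a :+ (c :- # 1) :* e) :- (F :* b :+ (c :- F) :* h) :- r) :+ ((:- e) :+ h) :* (c :- (d :+ # 1)) :+ (b :- h) :* (F :- (f :+ # 1)))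
          ≈-refl (w 1) (w 2) (w 3) (w 4) d (ν f) (ν (c 3)) (ν F) (ρ 3 ⊛ (w 2 ⊝ w 3)))

      d≉1 : ¬ d ≈ ι (+ 1)
      d≉1 e = ℕₚ.<⇒≢ 1≤d₁ (sym (ℕₚ.suc-injective (ν-injective {dℕ} {1} (≈-trans νd e))))

      open RatioAlgebra.Quantities field₀ B x d (ν f) x+1≉0 B≉0 d≉1 near (block-eq rf) public

    f≢d₁ : f ≢ d₁
    f≢d₁ f≡ = excluded (lc₁ (⊖ ι (+ 1)) (≈-trans (ν-suc d₁) (+-cong (≈-reflexive (cong ν (sym f≡))) ≈-refl)) (ring-solve 2 (λ f d → f :- (d :- # 1) :≈ (:- # 1) :* (d :- (f :+ # 1))) ≈-refl (ν f) (ν dℕ)))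
      where
      open Setup (ν dℕ) ≈-refl

    e : ℕ
    e = d₁ ∸ f

    e≡ : d₁ ≡ f + e
    e≡ = sym (ℕₚ.m+[n∸m]≡n f≤d₁)

    1≤e : 1 ≤ e
    1≤e = ℕₚ.m<n⇒0<n∸m (ℕₚ.≤∧≢⇒< f≤d₁ f≢d₁)

    dᶠ : Carrier
    dᶠ = ν f ⊕ ι (+ 1) ⊕ ν e

    d≡ : dℕ ≡ f + 1 + e
    d≡ = trans (cong suc e≡) (cong (_+ e) (ℕₚ.+-comm 1 f))

    νd : ν dℕ ≈ dᶠ
    νd = ≈-trans (≈-reflexive (cong ν d≡)) (≈-trans (ν-+ (f + 1) e) (+-cong (ν-+ f 1) ≈-refl))

    open Setup dᶠ νd public

    d<s₂ : dℕ < s₂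
    d<s₂ = ℕₚ.≤∧≢⇒< d≤s₂ (λ d≡s₂ → f≢d₁ (ℕₚ.*-cancelˡ-≡ f d₁ dℕ (trans (cong (_* f) d≡s₂) s₂f)))

    c₃+2≤k : suc (suc (c 3)) ≤ k
    c₃+2≤k = subst₂ (λ a b → suc (suc a) ≤ b) (sym c₃≡) (sym k≡) (s≤s (s≤s d<s₂))

    aboves : Σ (Fin n × Fin n × Fin n) λ (x , y , u) → Above 3 y x u
    aboves with 3 ℕ.≟ D
    ... | yes 3≡D = subst (λ h → Σ (Fin n × Fin n × Fin n) λ (x , y , u) → Above h y x u) (sym 3≡D) (above-exists-end (subst (λ h → suc (suc (c h)) ≤ k) 3≡D c₃+2≤k))
    ... | no 3≢D = above-exists (ℕₚ.≤∧≢⇒< 3≤D 3≢D) (c₄≥2 (ℕₚ.≤∧≢⇒< 3≤D 3≢D))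

    g₃ : ℕ
    g₃ = common (proj₁ (proj₂ (proj₁ aboves))) (proj₁ (proj₁ aboves)) (proj₂ (proj₂ (proj₁ aboves)))

    w-ratio : w 1 ⊝ w 3 ≈ (ν F ⊝ ν g₃) ⊛ (w 2 ⊝ w 4)
    w-ratio = common-ratio (proj₂ belows) (proj₂ aboves)

    -- For l = a ≥ 0 all terms of `norm` can be collected on one side with positive signs, and `e`
    -- is positive. The integer l is therefore negative.
    ratio-not-natural : ∀ a → ¬ w 1 ⊝ w 3 ≈ ν a ⊛ (w 2 ⊝ w 4)
    ratio-not-natural a h = ℕₚ.<⇒≢ (ℕₚ.≤-trans (ℕₚ.*-mono-≤ {1} {e} 1≤e (ℕₚ.m≤n+m 1 (a * a * a + e))) (ℕₚ.m≤n+m (e * (a * a * a + e + 1)) (a * (a + 1) * (a + 1) * f))) (sym positive)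
      where
      A Fv E : Poly 3
      A = arg zero
      Fv = arg (suc zero)
      E = arg (suc (suc zero))
      positive : a * (a + 1) * (a + 1) * f + e * (a * a * a + e + 1) ≡ 0
      positive = descend (A ⊠ (A ⊞ cst 1) ⊠ (A ⊞ cst 1) ⊠ Fv ⊞ E ⊠ (A ⊠ A ⊠ A ⊞ E ⊞ cst 1)) (cst 0) (a ∷ f ∷ e ∷ [])
        (lc₁ (ι (+ 1)) (WithRatio.norm (ν a) (ratio h)) (ring-solve 3 (λ a f e → (a :* (a :+ # 1) :* (a :+ # 1) :* f :+ e :* (a :* a :* a :+ e :+ # 1)) :- # 0 :≈
          # 1 :* (a :* (a :+ # 1) :* (a :+ # 1) :* f :- ((f :+ # 1 :+ e) :- # 1 :- f) :* ((a :+ # 1) :* (a :- # 1 :- a :* a) :- ((f :+ # 1 :+ e) :- # 1 :- f)))) ≈-refl (ν a) (ν f) (ν e)))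

    ν-∸ : ∀ {a b} → b ≤ a → ν a ⊝ ν b ≈ ν (a ∸ b)
    ν-∸ {a} {b} b≤a = lc₁ (ι (+ 1)) (≈-trans (≈-reflexive (cong ν (sym (ℕₚ.m+[n∸m]≡n {b} {a} b≤a)))) (ν-+ b (a ∸ b)))
      (ring-solve 3 (λ F g a → F :- g :- a :≈ # 1 :* (F :- (g :+ a))) ≈-refl (ν a) (ν b) (ν (a ∸ b)))

    F<g₃ : F < g₃
    F<g₃ = ℕₚ.≰⇒> λ g₃≤F → ratio-not-natural (F ∸ g₃) (≈-trans w-ratio (*-cong (ν-∸ {F} {g₃} g₃≤F) ≈-refl))

    m : ℕ
    m = g₃ ∸ suc F

    g₃≡ : g₃ ≡ suc F + m
    g₃≡ = sym (ℕₚ.m+[n∸m]≡n F<g₃)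

    L l : Carrier
    L = ι (+ 1) ⊕ ν m
    l = ⊖ L

    l≈ : ν F ⊝ ν g₃ ≈ l
    l≈ = lc₁ (⊖ ι (+ 1)) (≈-trans (≈-reflexive (cong ν g₃≡)) (≈-trans (ν-+ (suc F) m) (+-cong (ν-suc F) ≈-refl)))
      (ring-solve 3 (λ F g m → F :- g :- (:- (# 1 :+ m)) :≈ (:- # 1) :* (g :- (F :+ # 1 :+ m))) ≈-refl (ν F) (ν g₃) (ν m))

    x-ratio : x ⊕ ι (+ 1) ≈ l ⊛ (B ⊝ x)
    x-ratio = ratio (≈-trans w-ratio (*-cong l≈ ≈-refl))

    open WithRatio l x-ratio public

    normℕ : suc m * (m * m) * f + e * (m * (suc m * suc m + suc m + 1)) ≡ e * e
    normℕ = descend ((cst 1 ⊞ M) ⊠ (M ⊠ M) ⊠ Fv ⊞ E ⊠ (M ⊠ ((cst 1 ⊞ M) ⊠ (cst 1 ⊞ M) ⊞ (cst 1 ⊞ M) ⊞ cst 1))) (E ⊠ E) (m ∷ f ∷ e ∷ [])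
      (lc₁ (⊖ ι (+ 1)) norm (ring-solve 3 (λ m f e → ((# 1 :+ m) :* (m :* m) :* f :+ e :* (m :* ((# 1 :+ m) :* (# 1 :+ m) :+ (# 1 :+ m) :+ # 1))) :- e :* e :≈
        (:- # 1) :* ((:- (# 1 :+ m)) :* ((:- (# 1 :+ m)) :+ # 1) :* ((:- (# 1 :+ m)) :+ # 1) :* f :- ((f :+ # 1 :+ e) :- # 1 :- f) :* (((:- (# 1 :+ m)) :+ # 1) :* ((:- (# 1 :+ m)) :- # 1 :- (:- (# 1 :+ m)) :* (:- (# 1 :+ m))) :- ((f :+ # 1 :+ e) :- # 1 :- f)))) ≈-refl (ν m) (ν f) (ν e)))
      where
      M Fv E : Poly 3
      M = arg zero
      Fv = arg (suc zero)
      E = arg (suc (suc zero))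

    1≤m : 1 ≤ m
    1≤m = ℕₚ.n≢0⇒n>0 (λ m≡0 → ℕₚ.<⇒≢ (ℕₚ.*-mono-≤ 1≤e 1≤e) (trans (sym (trans (cong (λ m → suc m * (m * m) * f + e * (m * (suc m * suc m + suc m + 1))) m≡0) (ℕₚ.*-zeroʳ e))) normℕ))

    design : f * s₂ ≡ dℕ * (f + e)
    design = trans (ℕₚ.*-comm f s₂) (trans s₂f (cong (dℕ *_) e≡))

    params : Parameters s₂ dℕ f m
    params = parameters 1≤m 1≤f d≡ design normℕ

    open Parameters params using (N; N*n; 1≤n) renaming (n to nn; e to mN; d≡ to d≡mN)

    lℕ : ℕ
    lℕ = suc m

    n₁ K : Carrier
    n₁ = ν nn ⊕ ι (+ 1)
    K = n₁ ⊕ L ⊛ ν m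

    e≡mN : e ≡ m * N
    e≡mN = ℕₚ.+-cancelˡ-≡ (f + 1) _ _ (trans (sym d≡) d≡mN)

    -- `linear` divided by m. It makes B a rational number in n and m, so that later relations,
    -- multiplied by a power of l, become equations in ℕ.
    LB : L ⊛ B ≈ ⊖ K
    LB = cancelˡ (ν≉0 1≤m) (lc₂ (ι (+ 1)) (⊖ ι (+ 1)) linear νe
      (ring-solve 5 (λ B m f e n → m :* ((# 1 :+ m) :* B) :- m :* (:- (n :+ # 1 :+ (# 1 :+ m) :* m)) :≈
        # 1 :* (((:- (# 1 :+ m)) :* (:- (# 1 :+ m)) :+ (:- (# 1 :+ m))) :* B :- (# 2 :* ((:- (# 1 :+ m)) :* (:- (# 1 :+ m)) :+ (:- (# 1 :+ m))) :- ((f :+ # 1 :+ e) :- # 1 :- f)))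
          :+ (:- # 1) :* (e :- m :* (n :+ ((# 1 :+ m) :* (# 1 :+ m) :+ (# 1 :+ m) :+ # 1)))) ≈-refl B (ν m) (ν f) (ν e) (ν nn)))
      where
      νe : ν e ≈ ν m ⊛ (ν nn ⊕ (L ⊛ L ⊕ L ⊕ ι (+ 1)))
      νe = ≈-trans (≈-reflexive (cong ν e≡mN)) (evalν-hom (arg zero ⊠ (arg (suc zero) ⊞ ((cst 1 ⊞ arg zero) ⊠ (cst 1 ⊞ arg zero) ⊞ (cst 1 ⊞ arg zero) ⊞ cst 1))) (m ∷ nn ∷ []))

    l+1≉0 : ¬ l ⊕ ι (+ 1) ≈ 0#
    l+1≉0 e = ν≉0 1≤m (lc₁ (⊖ ι (+ 1)) e (ring-solve 1 (λ m → m :- # 0 :≈ (:- # 1) :* ((:- (# 1 :+ m)) :+ # 1 :- # 0)) ≈-refl (ν m)))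

    k₃-contradiction : nn ≡ m → ⊥
    k₃-contradiction nn≡m = k₃-obstruction params nn≡m (subst (_∣ suc (suc s₂) * suc s₂ * suc s₂) c₃≡ (c₃-divides (suc s₂) k≡))

    -- W₄ = W₃ becomes K = l², which means n = m, the family excluded through k₃.
    diameter₃ : D ≡ 3 → ⊥
    diameter₃ refl = k₃-contradiction (ℕₚ.suc-injective (ℕₚ.+-cancelʳ-≡ (lℕ * m) _ _ (trans (cong (_+ lℕ * m) (ℕₚ.+-comm 1 nn)) (trans K≡LL (poly m)))))
      where
      poly : ∀ m → suc m * suc m ≡ suc m + suc m * m
      poly = ℕR.solve-∀
      K≡LL : nn + 1 + lℕ * m ≡ lℕ * lℕ
      K≡LL = descend (arg (suc zero) ⊞ cst 1 ⊞ (cst 1 ⊞ arg zero) ⊠ arg zero) ((cst 1 ⊞ arg zero) ⊠ (cst 1 ⊞ arg zero)) (m ∷ nn ∷ [])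
        (lc₃ (⊖ L) (⊖ (L ⊛ (ι (+ 1) ⊕ l))) (ι (+ 1)) x-ratio (flat₃ (≈-reflexive refl)) LB
          (ring-solve 4 (λ B x m n → (n :+ # 1 :+ (# 1 :+ m) :* m) :- (# 1 :+ m) :* (# 1 :+ m) :≈
            (:- (# 1 :+ m)) :* (x :+ # 1 :- (:- (# 1 :+ m)) :* (B :- x)) :+ (:- ((# 1 :+ m) :* (# 1 :+ (:- (# 1 :+ m))))) :* (B :- (x :+ # 1))
              :+ # 1 :* ((# 1 :+ m) :* B :- (:- (n :+ # 1 :+ (# 1 :+ m) :* m)))) ≈-refl B x (ν m) (ν nn)))

-- The case 3 ≤ c₃ < k

module LargeDiameter (S : Setting) (cos : Cosines (Setting.G S) (Setting.conn S) (Setting.D S))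
  (c₃<k : Local.c S 3 < Setting.k S) {d₁ : ℕ} (c₃≡ : Local.c S 3 ≡ suc (suc d₁)) (1≤d₁ : 1 ≤ d₁) where
  open Local S
  open Relations S cos
  open Designs S cos
  open Elimination S cos
  open Large c₃<k c₃≡ 1≤d₁
  open Cosines cos using (field₀; stable)
  open FieldKit field₀
  open Descent field₀

  private
    nn = Parameters.n params

    Mₚ Nₚ Lₚ n₁ₚ Kₚ : Poly 2
    Mₚ = arg zero
    Nₚ = arg (suc zero)
    Lₚ = cst 1 ⊞ Mₚ
    n₁ₚ = Nₚ ⊞ cst 1
    Kₚ = n₁ₚ ⊞ Lₚ ⊠ Mₚ

  g₃≡′ : g₃ ≡ 1 + f + lℕ
  g₃≡′ = trans g₃≡ (trans (cong (λ F → suc F + m) F≡) (poly f m))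
    where
    poly : ∀ f m → suc (suc f) + m ≡ 1 + f + suc m
    poly = ℕR.solve-∀

  f*s₂ : f * s₂ ≡ dℕ * d₁
  f*s₂ = trans (ℕₚ.*-comm f s₂) s₂f

  c₄-design : 4 ≤ D → ∀ {c₄} → c 4 ≡ suc c₄ → (1 + f + lℕ) * c₄ ≡ suc dℕ * dℕ
  c₄-design 4≤D {c₄} c₄≡ = trans (cong (_* c₄) (sym g₃≡′)) (trans (ℕₚ.*-comm g₃ c₄) (design-above 4≤D c₄≡ c₃≡ (proj₂ aboves)))

  diameter₄-bipartite : 4 ≤ D → c 4 ≢ k
  diameter₄-bipartite 4≤D c₄≡k = bipartite₄-obstruction params refl d≤s₂ f*s₂ (c₄-design 4≤D (trans c₄≡k k≡))

  diameter₄-flat : D ≡ 4 → c 4 < k → ⊥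
  diameter₄-flat refl c₄<k = flat₄-obstruction params (descend (Kₚ ⊠ n₁ₚ) (Lₚ ⊠ Lₚ) (m ∷ nn ∷ [])
    (lc₂ (L ⊛ L) (⊖ (L ⊛ B ⊝ K ⊕ ν m ⊛ L)) (LevelFour.flat₄ (R02 {3} (ℕₚ.≤-refl) (λ ()) c₄<k) x-ratio (≈-reflexive refl)) LB
      (ring-solve 3 (λ B m n → (n :+ # 1 :+ (# 1 :+ m) :* m) :* (n :+ # 1) :- (# 1 :+ m) :* (# 1 :+ m) :≈
        ((# 1 :+ m) :* (# 1 :+ m)) :* (B :* B :- # 1 :- ((:- (# 1 :+ m)) :+ # 1) :* B)
          :+ (:- ((# 1 :+ m) :* B :- (n :+ # 1 :+ (# 1 :+ m) :* m) :+ m :* (# 1 :+ m))) :* ((# 1 :+ m) :* B :- (:- (n :+ # 1 :+ (# 1 :+ m) :* m)))) ≈-refl B (ν m) (ν nn))))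

  module AtLeastFive (5≤D : 5 ≤ D) where

    4≤D : 4 ≤ D
    4≤D = ℕₚ.≤-trans (ℕₚ.n≤1+n 4) 5≤D

    c₄<k : c 4 < k
    c₄<k = c<k 5≤D

    -- If c₄ = k - 1, the design identities at levels three and four give (l + 1) s₂ = 2d, while d <
    -- s₂.
    c₄+2≤k : suc (suc (c 4)) ≤ k
    c₄+2≤k = ℕₚ.≤∧≢⇒< c₄<k λ c₄+1≡k → impossible (ℕₚ.suc-injective (trans c₄+1≡k k≡))
      where
      impossible : c 4 ≡ suc s₂ → ⊥
      impossible c₄≡ = ℕₚ.<-irrefl refl (ℕₚ.≤-trans (ℕₚ.+-mono-≤ d<s₂ d≤s₂) (ℕₚ.≤-trans (ℕₚ.m≤m+n (s₂ + s₂) (m * s₂)) (ℕₚ.≤-reflexive (ℕₚ.+-cancelʳ-≡ (f * s₂) _ _ (begin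
        (s₂ + s₂ + m * s₂) + f * s₂   ≡⟨ poly₁ s₂ m f ⟩
        (1 + f + suc m) * s₂          ≡⟨ c₄-design 4≤D c₄≡ ⟩
        suc dℕ * dℕ                   ≡⟨ poly₂ d₁ ⟩
        (dℕ + dℕ) + dℕ * d₁           ≡⟨ cong (λ t → dℕ + dℕ + t) (sym f*s₂) ⟩
        (dℕ + dℕ) + f * s₂            ∎)))))
        where
        open ≡-Reasoning
        poly₁ : ∀ s m f → (s + s + m * s) + f * s ≡ (1 + f + suc m) * s
        poly₁ = ℕR.solve-∀
        poly₂ : ∀ d → suc (suc d) * suc d ≡ (suc d + suc d) + suc d * d
        poly₂ = ℕR.solve-∀

    open LevelFour (R02 {3} 4≤D (λ ()) c₄<k) using (ratio₄; module LevelFive)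

    belows₄ = below-exists {3} 4≤D c₃+2≤k
    aboves₄ = above-exists {4} 5≤D (ℕₚ.≤-trans (c₄≥2 4≤D) (c-mono-step 5≤D))

    F₄ g₄ : ℕ
    F₄ = common (proj₁ (proj₂ (proj₁ belows₄))) (proj₁ (proj₁ belows₄)) (proj₂ (proj₂ (proj₁ belows₄)))
    g₄ = common (proj₁ (proj₂ (proj₁ aboves₄))) (proj₁ (proj₁ aboves₄)) (proj₂ (proj₂ (proj₁ aboves₄)))

    -- The integer ratio at level four is l₄ = F₄ - g₄; `ratio₄` multiplied by l, with l B = -K
    -- inserted.
    F₄-g₄ : F₄ * (nn + 1) ≡ lℕ * lℕ + g₄ * (nn + 1)
    F₄-g₄ = descend (arg (suc (suc zero)) ⊠ (arg (suc zero) ⊞ cst 1)) ((cst 1 ⊞ arg zero) ⊠ (cst 1 ⊞ arg zero) ⊞ arg (suc (suc (suc zero))) ⊠ (arg (suc zero) ⊞ cst 1)) (m ∷ nn ∷ F₄ ∷ g₄ ∷ [])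
      (lc₂ L (ν F₄ ⊝ ν g₄) (ratio₄ x-ratio (common-ratio (proj₂ belows₄) (proj₂ aboves₄))) LB
        (ring-solve 5 (λ B m n F g → F :* (n :+ # 1) :- ((# 1 :+ m) :* (# 1 :+ m) :+ g :* (n :+ # 1)) :≈
          (# 1 :+ m) :* ((:- (# 1 :+ m)) :- (F :- g) :* (B :- # 1 :- (:- (# 1 :+ m)))) :+ (F :- g) :* ((# 1 :+ m) :* B :- (:- (n :+ # 1 :+ (# 1 :+ m) :* m)))) ≈-refl B (ν m) (ν nn) (ν F₄) (ν g₄)))

    Rec₅ : c 5 < k → (w 2 ⊝ w 5) ⊛ (w 0 ⊝ w 5) ≈ (w 1 ⊝ w 4) ⊛ (w 1 ⊝ w 6)
    Rec₅ c₅<k = R02 {4} 5≤D (λ ()) c₅<k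

    diameter₅-flat : D ≡ 5 → c 5 < k → ⊥
    diameter₅-flat refl c₅<k = flat₅-obstruction params (descend (Kₚ ⊠ (n₁ₚ ⊠ n₁ₚ ⊞ Nₚ ⊠ (Lₚ ⊠ Lₚ))) (Lₚ ⊠ Lₚ ⊠ n₁ₚ) (m ∷ nn ∷ [])
      (lc₂ (⊖ (L ⊛ L ⊛ L)) ((L ⊛ B) ⊛ (L ⊛ B) ⊝ (L ⊛ B) ⊛ K ⊕ K ⊛ K ⊕ (L ⊛ L ⊝ ι (+ 2) ⊛ L) ⊛ (L ⊛ B ⊝ K) ⊝ L ⊛ L ⊝ L ⊛ L ⊛ L)
        (LevelFive.flat₅ x-ratio l+1≉0 B+1≉0 (Rec₅ c₅<k) (≈-reflexive refl)) LB
        (ring-solve 3 (λ B m n →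
          let l = # 1 :+ m ; n₁ = n :+ # 1 ; k = n₁ :+ l :* m in
          k :* (n₁ :* n₁ :+ n :* (l :* l)) :- l :* l :* n₁ :≈
            (:- (l :* l :* l)) :* ((B :- (:- l)) :* (B :* B :- B :- # 1) :- (B :* B :- # 1))
            :+ ((l :* B) :* (l :* B) :- (l :* B) :* k :+ k :* k :+ (l :* l :- # 2 :* l) :* (l :* B :- k) :- l :* l :- l :* l :* l) :* (l :* B :- (:- k))) ≈-refl B (ν m) (ν nn))))

    -- At level five the integer ratio equals -i, and `ratio₅` turns into the hypothesis of
    -- `level₅-family`, which again forces n = m.
    diameter≥6 : 6 ≤ D → ⊥
    diameter≥6 6≤D = k₃-contradiction (level₅-family params i (ℕₚ.+-cancelʳ-≡ (F₅ * Q) _ _ (trans (sym (ℕₚ.*-distribʳ-+ Q i F₅)) (trans (cong (_* Q) (ℕₚ.m∸n+n≡m F₅≤g₅)) g₅-F₅))))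
      where
      belows₅ = below-exists {4} 5≤D c₄+2≤k
      aboves₅ = above-exists {5} 6≤D (ℕₚ.≤-trans (ℕₚ.≤-trans (c₄≥2 4≤D) (c-mono-step 5≤D)) (c-mono-step 6≤D))
      F₅ g₅ i Q : ℕ
      F₅ = common (proj₁ (proj₂ (proj₁ belows₅))) (proj₁ (proj₁ belows₅)) (proj₂ (proj₂ (proj₁ belows₅)))
      g₅ = common (proj₁ (proj₂ (proj₁ aboves₅))) (proj₁ (proj₁ aboves₅)) (proj₂ (proj₂ (proj₁ aboves₅)))
      i = g₅ ∸ F₅
      Q = (nn + 1) * (nn + 1) + nn * (lℕ * lℕ)
      g₅-F₅ : g₅ * Q ≡ lℕ * lℕ * lℕ + F₅ * Q
      g₅-F₅ = descend (arg (suc (suc (suc zero))) ⊠ Qₚ) ((cst 1 ⊞ arg zero) ⊠ (cst 1 ⊞ arg zero) ⊠ (cst 1 ⊞ arg zero) ⊞ arg (suc (suc zero)) ⊠ Qₚ) (m ∷ nn ∷ F₅ ∷ g₅ ∷ [])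
        (lc₂ (⊖ (L ⊛ L)) ((ν F₅ ⊝ ν g₅) ⊛ (L ⊛ B ⊝ K ⊝ (ι (+ 2) ⊝ L) ⊛ L))
          (LevelFive.ratio₅ x-ratio l+1≉0 B+1≉0 (Rec₅ (c<k 6≤D)) (common-ratio (proj₂ belows₅) (proj₂ aboves₅))) LB
          (ring-solve 5 (λ B m n F g →
            let l = # 1 :+ m ; n₁ = n :+ # 1 ; k = n₁ :+ l :* m ; q = n₁ :* n₁ :+ n :* (l :* l) in
            g :* q :- (l :* l :* l :+ F :* q) :≈
              (:- (l :* l)) :* ((F :- g) :* (B :* B :- (# 2 :+ (:- l)) :* B :+ (:- l)) :- (:- l))
              :+ ((F :- g) :* (l :* B :- k :- (# 2 :- l) :* l)) :* (l :* B :- (:- k))) ≈-refl B (ν m) (ν nn) (ν F₅) (ν g₅)))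
        where
        Qₚ : Poly 4
        Qₚ = (arg (suc zero) ⊞ cst 1) ⊠ (arg (suc zero) ⊞ cst 1) ⊞ arg (suc zero) ⊠ ((cst 1 ⊞ arg zero) ⊠ (cst 1 ⊞ arg zero))
      F₅≤g₅ : F₅ ≤ g₅
      F₅≤g₅ = ℕₚ.*-cancelʳ-≤ F₅ g₅ Q {{ℕ.>-nonZero (ℕₚ.≤-trans (ℕₚ.*-mono-≤ (ℕₚ.m≤n+m 1 nn) (ℕₚ.m≤n+m 1 nn)) (ℕₚ.m≤m+n _ (nn * (lℕ * lℕ))))}} (ℕₚ.≤-trans (ℕₚ.m≤n+m (F₅ * Q) (lℕ * lℕ * lℕ)) (ℕₚ.≤-reflexive (sym g₅-F₅)))

    -- When c₅ = k no neighbour stays away from `y` at level five, and the recursion for W₆ is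
    -- missing. Its place is taken by the design formed by all k neighbours of a vertex at level
    -- five.
    diameter₅-bipartite : c 5 ≢ k
    diameter₅-bipartite c₅≡k = bipartite₅-obstruction params {b} {X} {f₄} {g₄} {j} s₂≡ (c₄-design 4≤D c₄≡)
        (proj₂ (proj₂ block₄)) (trans (design-above {3} 5≤D (trans c₅≡k k≡) c₄≡ (proj₂ aboves₄)) refl) F₄≡ j-eq
      where
      b X₀ X f₄ j : ℕ
      b = s₂ ∸ dℕ
      s₂≡ : s₂ ≡ dℕ + b
      s₂≡ = sym (ℕₚ.m+[n∸m]≡n d≤s₂)
      X₀ = c 4 ∸ c 3
      c₄≡₀ : c 4 ≡ suc dℕ + X₀
      c₄≡₀ = trans (sym (ℕₚ.m+[n∸m]≡n (c-mono-step 4≤D))) (cong (_+ X₀) c₃≡)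
      X₀≢0 : X₀ ≢ 0
      X₀≢0 X₀≡0 = ℕₚ.<⇒≢ e-big (ℕₚ.+-cancelˡ-≡ (2 + f) _ _ (trans (poly₁ f m) (trans (ℕₚ.*-cancelʳ-≡ (1 + f + lℕ) (suc dℕ) dℕ (c₄-design 4≤D (trans c₄≡₀ (trans (cong (λ t → suc dℕ + t) X₀≡0) (ℕₚ.+-identityʳ (suc dℕ))))))
          (trans (cong suc d≡) (trans (poly₂ f e) (cong (λ e → 2 + f + e) e≡mN))))))
        where
        e-big : m < m * Parameters.N params
        e-big = ℕₚ.<-≤-trans (ℕₚ.m<m+n m 1≤m) (ℕₚ.≤-trans (ℕₚ.≤-reflexive (poly₃ m)) (ℕₚ.*-monoʳ-≤ m (ℕₚ.≤-trans (ℕₚ.+-monoˡ-≤ 1 (s≤s {0} z≤n)) (ℕₚ.≤-trans (ℕₚ.+-monoˡ-≤ 1 (ℕₚ.m≤n+m lℕ (lℕ * lℕ))) (ℕₚ.m≤n+m _ nn)))))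
          where
          poly₃ : ∀ m → m + m ≡ m * 2
          poly₃ = ℕR.solve-∀
        poly₁ : ∀ f m → 2 + f + m ≡ 1 + f + suc m
        poly₁ = ℕR.solve-∀
        poly₂ : ∀ f e → suc (f + 1 + e) ≡ 2 + f + e
        poly₂ = ℕR.solve-∀
      X = ℕ.pred X₀
      X₀≡ : X₀ ≡ suc X
      X₀≡ = sym (ℕₚ.suc-pred X₀ {{ℕ.≢-nonZero X₀≢0}})
      c₄≡ : c 4 ≡ suc (dℕ + suc X)
      c₄≡ = trans c₄≡₀ (cong (λ t → suc dℕ + t) X₀≡)
      block₄ = design-below {3} 4≤D (trans k≡ (trans (cong (λ s → suc (suc s)) s₂≡) (trans (cong suc (sym (ℕₚ.+-suc dℕ b))) (cong (_+ suc b) (sym c₃≡))))) (trans c₄≡ (cong (_+ suc X) (sym c₃≡))) (proj₂ belows₄)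
      f₄ = proj₁ block₄
      j = F₄ ∸ g₄
      g₄≤F₄ : g₄ ≤ F₄
      g₄≤F₄ = ℕₚ.*-cancelʳ-≤ g₄ F₄ (nn + 1) {{ℕ.>-nonZero (ℕₚ.m≤n+m 1 nn)}} (ℕₚ.≤-trans (ℕₚ.m≤n+m _ (lℕ * lℕ)) (ℕₚ.≤-reflexive (sym F₄-g₄)))
      F₄≡ : suc dℕ + f₄ ≡ g₄ + j
      F₄≡ = trans (cong (_+ f₄) (sym c₃≡)) (trans (sym (proj₁ (proj₂ block₄))) (sym (ℕₚ.m+[n∸m]≡n g₄≤F₄)))
      j-eq : j * (nn + 1) ≡ lℕ * lℕ
      j-eq = ℕₚ.+-cancelʳ-≡ (g₄ * (nn + 1)) _ _ (trans (sym (ℕₚ.*-distribʳ-+ (nn + 1) j g₄)) (trans (cong (_* (nn + 1)) (ℕₚ.m∸n+n≡m g₄≤F₄)) F₄-g₄))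

  contradiction : ⊥
  contradiction with 4 ≤? D
  ... | no 4≰D = diameter₃ (ℕₚ.≤-antisym (ℕₚ.≤-pred (ℕₚ.≰⇒> 4≰D)) 3≤D)
  ... | yes 4≤D with c 4 ℕ.≟ k
  ... | yes c₄≡k = diameter₄-bipartite 4≤D c₄≡k
  ... | no c₄≢k with 5 ≤? D
  ... | no 5≰D = diameter₄-flat (ℕₚ.≤-antisym (ℕₚ.≤-pred (ℕₚ.≰⇒> 5≰D)) 4≤D) (ℕₚ.≤∧≢⇒< (c≤k 4≤D) c₄≢k)
  ... | yes 5≤D with 6 ≤? D
  ... | yes 6≤D = AtLeastFive.diameter≥6 5≤D 6≤D
  ... | no 6≰D with c 5 ℕ.≟ k
  ... | yes c₅≡k = AtLeastFive.diameter₅-bipartite 5≤D c₅≡k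
  ... | no c₅≢k = AtLeastFive.diameter₅-flat 5≤D (ℕₚ.≤-antisym (ℕₚ.≤-pred (ℕₚ.≰⇒> 6≰D)) 5≤D) (ℕₚ.≤∧≢⇒< (c≤k 5≤D) c₅≢k)

-- The case c₃ = 2

odd : ℕ → Bool
odd 0 = false
odd 1 = true
odd (suc (suc i)) = odd i

not≢self : ∀ b → not b ≢ b
not≢self true  ()
not≢self false ()

odd-suc : ∀ i → odd (suc i) ≡ not (odd i)
odd-suc 0 = refl
odd-suc 1 = refl
odd-suc (suc (suc i)) = odd-suc i

double : ℕ → ℕ
double 0 = 0
double (suc m) = suc (suc (double m))

parity : ∀ i → Σ ℕ λ m → i ≡ double m ⊎ i ≡ suc (double m)
parity 0 = 0 , inj₁ refl
parity 1 = 0 , inj₂ refl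
parity (suc (suc i)) with parity i
... | m , inj₁ refl = suc m , inj₁ refl
... | m , inj₂ refl = suc m , inj₂ refl

odd-double : ∀ m → odd (double m) ≡ false
odd-double zero    = refl
odd-double (suc m) = odd-double m

odd-suc-double : ∀ m → odd (suc (double m)) ≡ true
odd-suc-double zero    = refl
odd-suc-double (suc m) = odd-suc-double m

double≡ : ∀ m → double m ≡ m + m
double≡ zero    = refl
double≡ (suc m) = cong suc (trans (cong suc (double≡ m)) (sym (ℕₚ.+-suc m m)))

module Small (S : Setting) (cos : Cosines (Setting.G S) (Setting.conn S) (Setting.D S))
  (c₃<k : Local.c S 3 < Setting.k S) (c₃≡2 : Local.c S 3 ≡ 2) where
  open Local S
  open Relations S cos
  open Designs S cos
  open Elimination S cos
  open Cosines cos using (field₀; stable)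
  open FieldKit field₀
  open Descent field₀

  νc₃ : ν (c 3) ≈ ι (+ 1) ⊕ ι (+ 1)
  νc₃ = ≈-trans (≈-reflexive (cong ν c₃≡2)) (ν-suc 1)

  open Level3 c₃<k (ι (+ 1)) νc₃

  -- For d = 1 `near` factors as x (B + 1)(B - 2) = 0, and B = -1 is the root wanted. For B = 2 and
  -- D = 3, W₄ = W₃ gives W₀ = W₁. For D ≥ 4 the designs leave block intersections F = 1 and g a
  -- divisor of 2; g = 1 gives x = -1 and g = 2 gives 3 = 0.
  B≉2 : ¬ B ≈ ι (+ 2)
  B≉2 B≈2 with 3 ℕ.≟ D
  ... | yes refl = u₀≉0 (lc₂ (ι (+ 1) ⊕ x) (⊖ ι (+ 1)) B≈2 (flat₃ (≈-reflexive refl))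
        (ring-solve 2 (λ B x → ((B :- # 1) :* x :- # 1) :- # 0 :≈ (# 1 :+ x) :* (B :- # 2) :+ (:- # 1) :* (B :- (x :+ # 1))) ≈-refl B x))
  ... | no 3≢D = by-block g refl
    where
    4≤D : 4 ≤ D
    4≤D = ℕₚ.≤∧≢⇒< 3≤D 3≢D
    belows = below-exists {2} (3≤D′ ℕₚ.≤-refl) (subst (λ c → suc (suc c) ≤ k) (sym c₂) 3≤k)
    c₄≥2 : 2 ≤ c 4
    c₄≥2 = subst (_≤ c 4) c₃≡2 (c-mono-step 4≤D)
    aboves = above-exists {3} 4≤D c₄≥2
    block = design-below {2} (3≤D′ ℕₚ.≤-refl) (trans k≡ (cong (_+ suc s₂) (sym c₂))) (trans c₃≡2 (cong (_+ 1) (sym c₂))) (proj₂ belows)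
    F g c₄ : ℕ
    F = common (proj₁ (proj₂ (proj₁ belows))) (proj₁ (proj₁ belows)) (proj₂ (proj₂ (proj₁ belows)))
    g = common (proj₁ (proj₂ (proj₁ aboves))) (proj₁ (proj₁ aboves)) (proj₂ (proj₂ (proj₁ aboves)))
    F≡1 : F ≡ 1
    F≡1 = trans (proj₁ (proj₂ block)) (cong₂ _+_ c₂ (f≡0 (proj₁ block) (proj₂ (proj₂ block))))
      where
      f≡0 : ∀ f → s₂ * f ≡ 0 → f ≡ 0
      f≡0 f eq = ℕₚ.*-cancelˡ-≡ f 0 s₂ {{ℕ.>-nonZero 1≤s₂}} (trans eq (sym (ℕₚ.*-zeroʳ s₂)))
    c₄ = ℕ.pred (c 4)
    c₄g : c₄ * g ≡ 2
    c₄g = design-above {2} {c₄} {1} 4≤D (sym (ℕₚ.suc-pred (c 4) {{ℕ.>-nonZero (ℕₚ.≤-trans (s≤s z≤n) c₄≥2)}})) c₃≡2 (proj₂ aboves)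
    w-ratio : ∀ g′ → g ≡ g′ → x ⊕ ι (+ 1) ≈ (ι (+ 1) ⊝ ν g′) ⊛ (B ⊝ x)
    w-ratio g′ g≡ = ratio (≈-trans (common-ratio (proj₂ belows) (proj₂ aboves)) (*-cong (+-cong (≈-reflexive (cong ν F≡1)) (-‿cong (≈-reflexive (cong ν g≡)))) ≈-refl))
    by-block : ∀ g′ → g ≡ g′ → ⊥
    by-block 0 g≡ = ℕₚ.0≢1+n (trans (sym (ℕₚ.*-zeroʳ c₄)) (trans (cong (c₄ *_) (sym g≡)) c₄g))
    by-block 1 g≡ = x+1≉0 (≈-trans (w-ratio 1 g≡) (≈-trans (*-cong (-‿inverseʳ _) ≈-refl) (zeroˡ _)))
    by-block 2 g≡ = ι≉0 {+ 3} (λ ()) (lc₂ (ι (+ 1)) (⊖ ι (+ 1)) (≈-trans (w-ratio 2 g≡) (*-cong (+-cong ≈-refl (-‿cong (ν-suc 1))) ≈-refl)) B≈2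
      (ring-solve 2 (λ B x → # 3 :- # 0 :≈ # 1 :* ((x :+ # 1) :- (# 1 :- (# 1 :+ # 1)) :* (B :- x)) :+ (:- # 1) :* (B :- # 2)) ≈-refl B x))
    by-block g′@(suc (suc (suc g″))) g≡ = too-big c₄ (subst (λ g → c₄ * g ≡ 2) g≡ c₄g)
      where
      too-big : ∀ c → c * g′ ≢ 2
      too-big zero ()
      too-big (suc c) ()

  B+1≈0 : B ⊕ ι (+ 1) ≈ 0#
  B+1≈0 = stable λ h → B≉2 (undiff (cancel0 h (cancel0 x≉0 (lc₁ (ι (+ 1)) near
    (ring-solve 2 (λ B x → x :* ((B :+ # 1) :* (B :- # 2)) :- # 0 :≈ # 1 :* (B :* ((B :- # 1) :* x :- # 1 :+ # 1) :- (# 1 :+ # 1) :* x)) ≈-refl B x)))))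

  ρ₃ : ρ 3 ≈ ⊖ ι (+ 2)
  ρ₃ = lc₂ (⊖ ι (+ 1)) (ρ 3) ρB B+1≈0 (ring-solve 2 (λ r B → r :- (:- # 2) :≈ (:- # 1) :* (r :* B :- (# 1 :+ # 1)) :+ r :* (B :+ # 1 :- # 0)) ≈-refl (ρ 3) B)

  module _ {θ : Carrier} (eig : Eigen θ) where
    private
      E₁ : x ⊛ (ι (+ 2) ⊛ θ ⊕ ι (+ 2) ⊕ s) ≈ ⊖ (θ ⊕ ι (+ 1))
      E₁ = lc₂ (⊖ ι (+ 1)) ((θ ⊕ ι (+ 1)) ⊛ x) (eigen₁ eig) B+1≈0
        (ring-solve 4 (λ B x θ s → x :* (# 2 :* θ :+ # 2 :+ s) :- (:- (θ :+ # 1)) :≈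
          (:- # 1) :* ((θ :+ # 1) :* ((B :- # 1) :* x :- # 1) :- s :* x) :+ ((θ :+ # 1) :* x) :* (B :+ # 1 :- # 0)) ≈-refl B x θ s)
      E₂ : (θ ⊕ ι (+ 2)) ⊛ x ≈ s ⊝ ι (+ 1)
      E₂ = lc₂ (ι (+ 1)) x (eigen₂ eig) B+1≈0
        (ring-solve 4 (λ B x θ s → (θ :+ # 2) :* x :- (s :- # 1) :≈ # 1 :* (θ :* x :- (((B :- # 1) :* x :- # 1) :+ s)) :+ x :* (B :+ # 1 :- # 0)) ≈-refl B x θ s)
      other≉0 : ¬ θ ⊕ s ⊕ ι (+ 1) ≈ 0#
      other≉0 e = *≉0 s₂≉0 x+1≉0 (lc₂ x (⊖ ι (+ 1)) e E₂
        (ring-solve 3 (λ x θ s₂ → s₂ :* (x :+ # 1) :- # 0 :≈ x :* (θ :+ (s₂ :+ # 1) :+ # 1 :- # 0) :+ (:- # 1) :* ((θ :+ # 2) :* x :- ((s₂ :+ # 1) :- # 1))) ≈-refl x θ (ν s₂)))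

    -- Eliminating `x` from the two eigenvalue equations leaves (θ + s + 1)(θ + s) = 0, and θ = -k
    -- would give x = -1. The value -(k - 1) is an eigenvalue of the Odd graph.
    θ+s≈0 : θ ⊕ s ≈ 0#
    θ+s≈0 = cancel0 other≉0 (lc₂ (θ ⊕ ι (+ 2)) (⊖ (ι (+ 2) ⊛ θ ⊕ ι (+ 2) ⊕ s)) E₁ E₂
      (ring-solve 3 (λ x θ s → (θ :+ s :+ # 1) :* (θ :+ s) :- # 0 :≈
        (θ :+ # 2) :* (x :* (# 2 :* θ :+ # 2 :+ s) :- (:- (θ :+ # 1))) :+ (:- (# 2 :* θ :+ # 2 :+ s)) :* ((θ :+ # 2) :* x :- (s :- # 1))) ≈-refl x θ s))

    x-rel : ι (+ 2) ⊛ x ⊕ ι (+ 1) ≈ s ⊛ (x ⊕ ι (+ 1))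
    x-rel = lc₂ (ι (+ 1)) (⊖ x) E₂ θ+s≈0
      (ring-solve 3 (λ x θ s → (# 2 :* x :+ # 1) :- s :* (x :+ # 1) :≈ # 1 :* ((θ :+ # 2) :* x :- (s :- # 1)) :+ (:- x) :* (θ :+ s :- # 0)) ≈-refl x θ s)

  ε : Carrier
  ε = (x ⊕ ι (+ 1)) ⊛ t

  ε≉0 : ¬ ε ≈ 0#
  ε≉0 = *≉0 x+1≉0 t≉0

  w₀₁′ : w 0 ⊝ w 1 ≈ ⊖ (s ⊛ ε)
  w₀₁′ = stable λ k → three-term λ (θ , eig) → k (lc₃ (ι (+ 1)) (x ⊛ t) (⊖ t) w₀₁ B+1≈0 (x-rel eig)
    (ring-solve 6 (λ z a x B s t → z :- a :- (:- (s :* ((x :+ # 1) :* t))) :≈ # 1 :* (z :- a :- ((B :- # 1) :* x :- # 1) :* t) :+ (x :* t) :* (B :+ # 1 :- # 0)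
      :+ (:- t) :* ((# 2 :* x :+ # 1) :- s :* (x :+ # 1))) ≈-refl (w 0) (w 1) x B s t))

  w₂′ : w 2 ≈ w 0 ⊕ ε
  w₂′ = lc₃ (⊖ ι (+ 1)) (⊖ ι (+ 1)) (⊖ (x ⊛ t)) w₀₁ w₁₂ B+1≈0
    (ring-solve 6 (λ z a b x B t → b :- (z :+ (x :+ # 1) :* t) :≈ (:- # 1) :* (z :- a :- ((B :- # 1) :* x :- # 1) :* t) :+ (:- # 1) :* (a :- b :- x :* t) :+ (:- (x :* t)) :* (B :+ # 1 :- # 0)) ≈-refl (w 0) (w 1) (w 2) x B t)

  w₃′ : w 3 ≈ w 1 ⊝ ε
  w₃′ = lc₁ (⊖ ι (+ 1)) w₁₃ (ring-solve 3 (λ a c e → c :- (a :- e) :≈ (:- # 1) :* (a :- c :- e)) ≈-refl (w 1) (w 3) ε)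

  -- What `R02` at level i - 1 requires in order to determine `w i`. If c_D < k, it also covers the
  -- index D + 1.
  Reach : ℕ → Set
  Reach zero    = ⊤
  Reach (suc h) = h ≤ D × c h < k

  reach : ∀ {i} → i ≤ D → Reach i
  reach {zero}  _   = _
  reach {suc h} h<D = ℕₚ.<⇒≤ h<D , c<k h<D

  private
    next : ∀ {g} a b e → suc (suc (suc g)) ≤ D → c (suc (suc (suc g))) < k →
      w 2 ⊝ w (suc (suc (suc g))) ≈ a ⊛ ε → w 0 ⊝ w (suc (suc (suc g))) ≈ b ⊛ ε → w 1 ⊝ w (suc (suc g)) ≈ e ⊛ ε →
      ∀ z → a ⊛ b ≈ e ⊛ z → w 1 ⊝ w (suc (suc (suc (suc g)))) ≈ z ⊛ ε
    next {g} a b e h≤D c<k ha hb he z ab = cancelˡ (diff≉0 (w-distinct (ℕₚ.≤-trans (s≤s z≤n) h≤D) (ℕₚ.<⇒≤ h≤D) (λ ())))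
      (≈-trans (≈-sym (R02 h≤D (λ ()) c<k)) (≈-trans (*-cong ha hb) (≈-trans (ring-solve 3 (λ a b t → a :* t :* (b :* t) :≈ (a :* b) :* (t :* t)) ≈-refl a b ε)
        (≈-trans (*-cong ab ≈-refl) (≈-trans (ring-solve 3 (λ e z t → (e :* z) :* (t :* t) :≈ e :* t :* (z :* t)) ≈-refl e z ε) (*-cong (≈-sym he) ≈-refl))))))

  private
    ν-2 : ∀ m → ν (suc (suc m)) ≈ ν m ⊕ ι (+ 2)
    ν-2 m = ≈-trans (ν-suc (suc m)) (≈-trans (+-cong (ν-suc m) ≈-refl) (≈-trans (+-assoc _ _ _) (+-cong ≈-refl (≈-sym (ι-+ (+ 1) (+ 1))))))

    even-step : ∀ m → w (suc (double (suc m))) ≈ w 1 ⊝ ν (suc m) ⊛ ε → w (double (suc m)) ≈ w 0 ⊕ ν (suc m) ⊛ ε →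
      suc (double (suc m)) ≤ D → c (suc (double (suc m))) < k → w (double (suc (suc m))) ≈ w 0 ⊕ ν (suc (suc m)) ⊛ ε
    even-step m odd-ih even-ih h≤D c<k = ≈-trans
        (lc₂ (⊖ ι (+ 1)) (⊖ ι (+ 1)) wₙ w₀₁′ (ring-solve 6 (λ z a y M s E → y :- (z :+ (M :+ # 2) :* E) :≈ (:- # 1) :* (a :- y :- (s :- M :- # 2) :* E) :+ (:- # 1) :* (z :- a :- (:- (s :* E))))
          ≈-refl (w 0) (w 1) (w (double (suc (suc m)))) (ν m) s ε))
        (+-cong ≈-refl (*-cong (≈-sym (ν-2 m)) ≈-refl))
      where
      wₕ = ≈-trans odd-ih (+-cong ≈-refl (-‿cong (*-cong (ν-suc m) ≈-refl)))
      w₉ = ≈-trans even-ih (+-cong ≈-refl (*-cong (ν-suc m) ≈-refl))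
      wₙ = next {double m} (ν m ⊕ ι (+ 2) ⊝ s) (ν m ⊕ ι (+ 1) ⊝ s) (s ⊝ ν m ⊝ ι (+ 1)) h≤D c<k
        (lc₃ (ι (+ 1)) (⊖ ι (+ 1)) (ι (+ 1)) w₂′ wₕ w₀₁′ (ring-solve 7 (λ z a b y M s E → b :- y :- (M :+ # 2 :- s) :* E :≈
          # 1 :* (b :- (z :+ E)) :+ (:- # 1) :* (y :- (a :- (M :+ # 1) :* E)) :+ # 1 :* (z :- a :- (:- (s :* E)))) ≈-refl (w 0) (w 1) (w 2) (w (suc (double (suc m)))) (ν m) s ε))
        (lc₂ (⊖ ι (+ 1)) (ι (+ 1)) wₕ w₀₁′ (ring-solve 6 (λ z a y M s E → z :- y :- (M :+ # 1 :- s) :* E :≈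
          (:- # 1) :* (y :- (a :- (M :+ # 1) :* E)) :+ # 1 :* (z :- a :- (:- (s :* E)))) ≈-refl (w 0) (w 1) (w (suc (double (suc m)))) (ν m) s ε))
        (lc₂ (⊖ ι (+ 1)) (⊖ ι (+ 1)) w₉ w₀₁′ (ring-solve 6 (λ z a y M s E → a :- y :- (s :- M :- # 1) :* E :≈
          (:- # 1) :* (y :- (z :+ (M :+ # 1) :* E)) :+ (:- # 1) :* (z :- a :- (:- (s :* E)))) ≈-refl (w 0) (w 1) (w (double (suc m))) (ν m) s ε))
        (s ⊝ ν m ⊝ ι (+ 2)) (ring-solve 2 (λ M s → (M :+ # 2 :- s) :* (M :+ # 1 :- s) :≈ (s :- M :- # 1) :* (s :- M :- # 2)) ≈-refl (ν m) s)

    odd-step : ∀ m → w (double (suc (suc m))) ≈ w 0 ⊕ ν (suc (suc m)) ⊛ ε → w (suc (double (suc m))) ≈ w 1 ⊝ ν (suc m) ⊛ ε →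
      double (suc (suc m)) ≤ D → c (double (suc (suc m))) < k → w (suc (double (suc (suc m)))) ≈ w 1 ⊝ ν (suc (suc m)) ⊛ ε
    odd-step m even-ih odd-ih h≤D c<k = ≈-trans
        (lc₁ (⊖ ι (+ 1)) wₙ (ring-solve 4 (λ a y M E → y :- (a :- (M :+ # 2) :* E) :≈ (:- # 1) :* (a :- y :- (M :+ # 2) :* E)) ≈-refl (w 1) (w (suc (double (suc (suc m))))) (ν m) ε))
        (+-cong ≈-refl (-‿cong (*-cong (≈-sym (ν-2 m)) ≈-refl)))
      where
      wₕ = ≈-trans even-ih (+-cong ≈-refl (*-cong (ν-2 m) ≈-refl))
      w₉ = ≈-trans odd-ih (+-cong ≈-refl (-‿cong (*-cong (ν-suc m) ≈-refl)))
      wₙ = next {suc (double m)} (⊖ (ν m ⊕ ι (+ 1))) (⊖ (ν m ⊕ ι (+ 2))) (ν m ⊕ ι (+ 1)) h≤D c<k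
        (lc₂ (ι (+ 1)) (⊖ ι (+ 1)) w₂′ wₕ (ring-solve 5 (λ z b y M E → b :- y :- (:- (M :+ # 1)) :* E :≈
          # 1 :* (b :- (z :+ E)) :+ (:- # 1) :* (y :- (z :+ (M :+ # 2) :* E))) ≈-refl (w 0) (w 2) (w (double (suc (suc m)))) (ν m) ε))
        (lc₁ (⊖ ι (+ 1)) wₕ (ring-solve 4 (λ z y M E → z :- y :- (:- (M :+ # 2)) :* E :≈ (:- # 1) :* (y :- (z :+ (M :+ # 2) :* E))) ≈-refl (w 0) (w (double (suc (suc m)))) (ν m) ε))
        (lc₁ (⊖ ι (+ 1)) w₉ (ring-solve 4 (λ a y M E → a :- y :- (M :+ # 1) :* E :≈ (:- # 1) :* (y :- (a :- (M :+ # 1) :* E))) ≈-refl (w 1) (w (suc (double (suc m)))) (ν m) ε))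
        (ν m ⊕ ι (+ 2)) (ring-solve 1 (λ M → (:- (M :+ # 1)) :* (:- (M :+ # 2)) :≈ (M :+ # 1) :* (M :+ # 2)) ≈-refl (ν m))

  even-w : ∀ m → Reach (double m) → w (double m) ≈ w 0 ⊕ ν m ⊛ ε
  odd-w : ∀ m → Reach (suc (double m)) → w (suc (double m)) ≈ w 1 ⊝ ν m ⊛ ε

  even-w 0 _ = ≈-sym (≈-trans (+-cong ≈-refl (zeroˡ ε)) (+-identityʳ _))
  even-w 1 _ = ≈-trans w₂′ (+-cong ≈-refl (≈-sym (≈-trans (*-cong ι-1 ≈-refl) (*-identityˡ ε))))
  even-w (suc (suc m)) (h≤D , c<k) = even-step m (odd-w (suc m) (reach h≤D)) (even-w (suc m) (reach (ℕₚ.≤-trans (ℕₚ.n≤1+n _) h≤D))) h≤D c<k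

  odd-w 0 _ = ≈-sym (≈-trans (+-cong ≈-refl (≈-trans (-‿cong (zeroˡ ε)) -0#≈0#)) (+-identityʳ _))
  odd-w 1 _ = ≈-trans w₃′ (+-cong ≈-refl (-‿cong (≈-sym (≈-trans (*-cong ι-1 ≈-refl) (*-identityˡ ε)))))
  odd-w (suc (suc m)) (h≤D , c<k) = odd-step m (even-w (suc (suc m)) (reach h≤D)) (odd-w (suc m) (reach (ℕₚ.≤-trans (ℕₚ.n≤1+n _) h≤D))) h≤D c<k

  νs : ν (suc s₂) ≈ s
  νs = ν-suc s₂

  private
    meet₀ : ∀ {M} → w 0 ⊕ M ⊛ ε ≈ w 1 ⊝ M ⊛ ε → M ⊕ M ≈ s
    meet₀ {M} e = cancelˡ ε≉0 (lc₂ (ι (+ 1)) (⊖ ι (+ 1)) e w₀₁′ (ring-solve 5 (λ z a M s E → E :* (M :+ M) :- E :* s :≈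
      # 1 :* ((z :+ M :* E) :- (a :- M :* E)) :+ (:- # 1) :* (z :- a :- (:- (s :* E)))) ≈-refl (w 0) (w 1) M s ε))
    meet₁ : ∀ {M} → w 1 ⊝ M ⊛ ε ≈ w 0 ⊕ (M ⊕ ι (+ 1)) ⊛ ε → M ⊕ M ⊕ ι (+ 1) ≈ s
    meet₁ {M} e = cancelˡ ε≉0 (lc₂ (⊖ ι (+ 1)) (⊖ ι (+ 1)) e w₀₁′ (ring-solve 5 (λ z a M s E → E :* (M :+ M :+ # 1) :- E :* s :≈
      (:- # 1) :* ((a :- M :* E) :- (z :+ (M :+ # 1) :* E)) :+ (:- # 1) :* (z :- a :- (:- (s :* E)))) ≈-refl (w 0) (w 1) M s ε))
    unmeet₀ : ∀ {M} → M ⊕ M ≈ s → w 0 ⊕ M ⊛ ε ≈ w 1 ⊝ M ⊛ ε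
    unmeet₀ {M} e = lc₂ ε (ι (+ 1)) e w₀₁′ (ring-solve 5 (λ z a M s E → (z :+ M :* E) :- (a :- M :* E) :≈ E :* (M :+ M :- s) :+ # 1 :* (z :- a :- (:- (s :* E)))) ≈-refl (w 0) (w 1) M s ε)
    unmeet₁ : ∀ {M} → M ⊕ M ⊕ ι (+ 1) ≈ s → w 1 ⊝ M ⊛ ε ≈ w 0 ⊕ (M ⊕ ι (+ 1)) ⊛ ε
    unmeet₁ {M} e = lc₂ (⊖ ε) (⊖ ι (+ 1)) e w₀₁′ (ring-solve 5 (λ z a M s E → (a :- M :* E) :- (z :+ (M :+ # 1) :* E) :≈ (:- E) :* (M :+ M :+ # 1 :- s) :+ (:- # 1) :* (z :- a :- (:- (s :* E)))) ≈-refl (w 0) (w 1) M s ε)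

    ν-double : ∀ m → ν (double m) ≈ ν m ⊕ ν m
    ν-double m = ≈-trans (≈-reflexive (cong ν (double≡ m))) (ν-+ m m)

    ν-suc-double : ∀ m → ν (suc (double m)) ≈ ν m ⊕ ν m ⊕ ι (+ 1)
    ν-suc-double m = ≈-trans (ν-suc (double m)) (+-cong (ν-double m) ≈-refl)

    even-w⁺ : ∀ m → Reach (double (suc m)) → w (double (suc m)) ≈ w 0 ⊕ (ν m ⊕ ι (+ 1)) ⊛ ε
    even-w⁺ m r = ≈-trans (even-w (suc m) r) (+-cong ≈-refl (*-cong (ν-suc m) ≈-refl))

  -- The increasing and the decreasing progression would meet at the consecutive indices k - 1 and
  -- k, both within the diameter, against `w-distinct`.
  D≤s : ¬ suc (suc s₂) ≤ D
  D≤s s<D with parity (suc s₂)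
  ... | m , inj₁ e = w-distinct {double m} {suc (double m)} (ℕₚ.<⇒≤ s<D′) s<D′ (ℕₚ.1+n≢n ∘ sym)
        (≈-trans (even-w m (reach (ℕₚ.<⇒≤ s<D′))) (≈-trans (unmeet₀ (≈-trans (≈-sym (ν-double m)) (≈-trans (≈-reflexive (cong ν (sym e))) νs))) (≈-sym (odd-w m (reach s<D′)))))
    where s<D′ = subst (λ i → suc i ≤ D) e s<D
  ... | m , inj₂ e = w-distinct {suc (double m)} {double (suc m)} (ℕₚ.<⇒≤ s<D′) s<D′ (ℕₚ.1+n≢n ∘ sym)
        (≈-trans (odd-w m (reach (ℕₚ.<⇒≤ s<D′))) (≈-trans (unmeet₁ (≈-trans (≈-sym (ν-suc-double m)) (≈-trans (≈-reflexive (cong ν (sym e))) νs))) (≈-sym (even-w⁺ m (reach s<D′)))))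
    where s<D′ = subst (λ i → suc i ≤ D) e s<D

  -- If c_D = k, the last equation of the recurrence reads k W_{D-1} = θ W_D. With θ = -s it gives D
  -- = 2s + 1 or D = 2s + 2, beyond the bound of `D≤s`; the first value is the diameter of a doubled
  -- Odd graph.
  cD<k : c D < k
  cD<k = ℕₚ.≤∧≢⇒< (c≤k ℕₚ.≤-refl) λ cD≡k → three-term λ (θ , eig) → bipartite cD≡k θ eig
    where
    bipartite : c D ≡ k → ∀ θ → Eigen θ → ⊥
    bipartite cD≡k θ eig = by-parity (parity D)
      where
      k₁ : (s ⊕ ι (+ 1)) ⊛ w 1 ≈ θ ⊛ w 0
      k₁ = ≈-trans (*-cong (≈-sym νk) ≈-refl) (proj₁ eig)
      last : ∀ {g} → suc g ≡ D → (s ⊕ ι (+ 1)) ⊛ w g ≈ θ ⊛ w (suc g)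
      last {g} refl = lc₃ (ι (+ 1)) (w (suc (suc g)) ⊝ w g) (⊖ w (suc (suc g)) ) (proj₂ eig ℕₚ.≤-refl) (≈-trans (≈-reflexive (cong ν cD≡k)) νk) νk
        (ring-solve 6 (λ p q c k K r → K :* p :- r :≈ # 1 :* (c :* p :+ (k :- c) :* q :- r) :+ (q :- p) :* (c :- K) :+ (:- q) :* (k :- K))
          ≈-refl (w g) (w (suc (suc g))) (ν (c (suc g))) (ν k) (s ⊕ ι (+ 1)) (θ ⊛ w (suc g)))
      θ≈ = θ+s≈0 eig
      by-parity : (Σ ℕ λ m → D ≡ double m ⊎ D ≡ suc (double m)) → ⊥
      by-parity (zero , inj₁ e) = ℕₚ.<⇒≢ (ℕₚ.≤-trans (s≤s z≤n) 3≤D) (sym e)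
      by-parity (suc m , inj₁ e) = D≤s (ℕₚ.≤-trans (ℕₚ.n≤1+n (suc (suc s₂))) (ℕₚ.≤-trans (ℕₚ.≤-trans (s≤s (s≤s (s≤s (ℕₚ.m≤m+n s₂ (suc s₂))))) (ℕₚ.≤-reflexive (poly s₂))) (ℕₚ.≤-reflexive (sym (trans e (trans (cong (λ m → double (suc m)) m≡) (double≡ (suc (suc s₂)))))))))
        where
        poly : ∀ s → suc (suc (suc (s + suc s))) ≡ suc (suc s) + suc (suc s)
        poly = ℕR.solve-∀
        Hₒ = odd-w m (reach (ℕₚ.≤-trans (ℕₚ.n≤1+n _) (ℕₚ.≤-reflexive (sym e))))
        Hₑ = even-w⁺ m (reach (ℕₚ.≤-reflexive (sym e)))
        L : (s ⊕ ι (+ 1)) ⊛ (w 1 ⊝ ν m ⊛ ε) ≈ θ ⊛ (w 0 ⊕ (ν m ⊕ ι (+ 1)) ⊛ ε)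
        L = ≈-trans (*-cong ≈-refl (≈-sym Hₒ)) (≈-trans (last (sym e)) (*-cong ≈-refl Hₑ))
        m≡ : m ≡ suc s₂
        m≡ = ν-injective (≈-trans (cancelˡ ε≉0 (lc₃ (⊖ ι (+ 1)) (ι (+ 1)) (⊖ ((ν m ⊕ ι (+ 1)) ⊛ ε)) L k₁ θ≈
          (ring-solve 6 (λ z a M s θ E → E :* M :- E :* s :≈ (:- # 1) :* ((s :+ # 1) :* (a :- M :* E) :- θ :* (z :+ (M :+ # 1) :* E)) :+ # 1 :* ((s :+ # 1) :* a :- θ :* z)
            :+ (:- ((M :+ # 1) :* E)) :* (θ :+ s :- # 0)) ≈-refl (w 0) (w 1) (ν m) s θ ε))) (≈-sym νs))
      by-parity (m , inj₂ e) = D≤s (ℕₚ.≤-trans (s≤s (s≤s (ℕₚ.≤-trans (ℕₚ.m≤m+n s₂ (suc s₂)) (ℕₚ.≤-refl)))) (ℕₚ.≤-reflexive (sym (trans e (trans (cong (λ m → suc (double m)) m≡) (trans (cong suc (double≡ (suc s₂))) refl))))))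
        where
        Hₑ = even-w m (reach (ℕₚ.≤-trans (ℕₚ.n≤1+n _) (ℕₚ.≤-reflexive (sym e))))
        Hₒ = odd-w m (reach (ℕₚ.≤-reflexive (sym e)))
        L : (s ⊕ ι (+ 1)) ⊛ (w 0 ⊕ ν m ⊛ ε) ≈ θ ⊛ (w 1 ⊝ ν m ⊛ ε)
        L = ≈-trans (*-cong ≈-refl (≈-sym Hₑ)) (≈-trans (last (sym e)) (*-cong ≈-refl Hₒ))
        combined : (s ⊕ ι (+ 1)) ⊛ (w 0 ⊕ ν m ⊛ ε) ⊕ s ⊛ (w 1 ⊝ ν m ⊛ ε) ≈ (s ⊕ ι (+ 1)) ⊛ w 1 ⊕ s ⊛ w 0
        combined = lc₃ (ι (+ 1)) (⊖ ι (+ 1)) (w 1 ⊝ ν m ⊛ ε ⊝ w 0) L k₁ θ≈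
          (ring-solve 6 (λ z a M s θ E → (s :+ # 1) :* (z :+ M :* E) :+ s :* (a :- M :* E) :- ((s :+ # 1) :* a :+ s :* z) :≈
            # 1 :* ((s :+ # 1) :* (z :+ M :* E) :- θ :* (a :- M :* E)) :+ (:- # 1) :* ((s :+ # 1) :* a :- θ :* z) :+ (a :- M :* E :- z) :* (θ :+ s :- # 0)) ≈-refl (w 0) (w 1) (ν m) s θ ε)
        m≡ : m ≡ suc s₂
        m≡ = ν-injective (≈-trans (cancelˡ ε≉0 (lc₂ (ι (+ 1)) (⊖ ι (+ 1)) combined w₀₁′
          (ring-solve 5 (λ z a M s E → E :* M :- E :* s :≈ # 1 :* ((s :+ # 1) :* (z :+ M :* E) :+ s :* (a :- M :* E) :- ((s :+ # 1) :* a :+ s :* z)) :+ (:- # 1) :* (z :- a :- (:- (s :* E)))) ≈-refl (w 0) (w 1) (ν m) s ε))) (≈-sym νs))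

  -- As c_D < k, the recursion reaches index D + 1, where `w` repeats W_D. The two progressions have
  -- equal consecutive terms only at index k - 1.
  D≡s : D ≡ suc s₂
  D≡s with parity D
  ... | m , inj₁ e = trans e (ν-injective (≈-trans (ν-double m) (≈-trans (meet₀ (≈-trans (≈-sym (even-w m (reach (ℕₚ.≤-reflexive (sym e))))) (≈-trans (≈-trans (≈-reflexive (cong w (sym e))) (≈-trans (≈-reflexive (sym end)) (≈-reflexive (cong (λ i → w (suc i)) e)))) (odd-w m (subst (λ i → i ≤ D × c i < k) e (ℕₚ.≤-refl , cD<k)))))) (≈-sym νs))))
    where
    end : w (suc D) ≡ w D
    end = cong W (trans (ℕₚ.m≥n⇒m⊓n≡n (ℕₚ.n≤1+n D)) (sym (ℕₚ.⊓-idem D)))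
      where
      open Cosines cos using (W)
  ... | m , inj₂ e = trans e (ν-injective (≈-trans (ν-suc-double m) (≈-trans (meet₁ (≈-trans (≈-sym (odd-w m (reach (ℕₚ.≤-reflexive (sym e))))) (≈-trans (≈-trans (≈-reflexive (cong w (sym e))) (≈-trans (≈-reflexive (sym end)) (≈-reflexive (cong (λ i → w (suc i)) e)))) (even-w⁺ m (subst (λ i → i ≤ D × c i < k) e (ℕₚ.≤-refl , cD<k)))))) (≈-sym νs))))
    where
    end : w (suc D) ≡ w D
    end = cong W (trans (ℕₚ.m≥n⇒m⊓n≡n (ℕₚ.n≤1+n D)) (sym (ℕₚ.⊓-idem D)))
      where
      open Cosines cos using (W)

  k≡D+1 : k ≡ suc D
  k≡D+1 = trans k≡ (cong suc (sym D≡s))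

-- In girth six such a walk is a hexagon.
record Hex {V : Set} (_~_ : V → V → Set) (v₀ v₁ v₂ v₃ v₄ v₅ : V) : Set where
  field
    a₀₁ : v₀ ~ v₁
    a₁₂ : v₁ ~ v₂
    a₂₃ : v₂ ~ v₃
    a₃₄ : v₃ ~ v₄
    a₄₅ : v₄ ~ v₅
    a₅₀ : v₅ ~ v₀
    n₀₂ : v₀ ≢ v₂
    n₁₃ : v₁ ≢ v₃
    n₂₄ : v₂ ≢ v₄
    n₃₅ : v₃ ≢ v₅
    n₄₀ : v₄ ≢ v₀
    n₅₁ : v₅ ≢ v₁

rotate : ∀ {V : Set} {_~_ : V → V → Set} {v₀ v₁ v₂ v₃ v₄ v₅} → Hex _~_ v₀ v₁ v₂ v₃ v₄ v₅ → Hex _~_ v₁ v₂ v₃ v₄ v₅ v₀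
rotate h = record { a₀₁ = a₁₂ ; a₁₂ = a₂₃ ; a₂₃ = a₃₄ ; a₃₄ = a₄₅ ; a₄₅ = a₅₀ ; a₅₀ = a₀₁
                  ; n₀₂ = n₁₃ ; n₁₃ = n₂₄ ; n₂₄ = n₃₅ ; n₃₅ = n₄₀ ; n₄₀ = n₅₁ ; n₅₁ = n₀₂ }
  where
  open Hex h

private
  -- Two equations between edge sums of a hexagon determine the pattern up to one exception, in
  -- which the parities alternate all the way round.
  bits : ∀ b₀ b₁ b₂ b₃ b₄ b₅ → bit b₀ + bit b₅ ≡ bit b₂ + bit b₃ → bit b₁ + bit b₀ ≡ bit b₃ + bit b₄ → b₀ ≡ b₃ ⊎ (b₁ ≡ not b₀ × b₂ ≡ b₀ × b₄ ≡ b₀ × b₅ ≡ not b₀)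
  bits true  _     _     true  _     _     _ _ = inj₁ refl
  bits false _     _     false _     _     _ _ = inj₁ refl
  bits true  false true  false true  false _ _ = inj₂ (refl , refl , refl , refl)
  bits true  true  _     false true  _     _ ()
  bits true  true  _     false false _     _ ()
  bits true  false _     false false _     _ ()
  bits true  _     true  false _     true  ()
  bits true  _     false false _     true  ()
  bits true  _     false false _     false ()
  bits false true  false true  false true  _ _ = inj₂ (refl , refl , refl , refl)
  bits false true  _     true  true  _     _ ()
  bits false false _     true  true  _     _ ()
  bits false false _     true  false _     _ ()
  bits false _     true  true  _     true  ()
  bits false _     true  true  _     false ()
  bits false _     false true  _     false ()

  argmin : ∀ {m} (f : Fin (suc m) → ℕ) → ∃ λ i → ∀ j → f i ≤ f j
  argmin {zero} f = zero , λ { zero → ℕₚ.≤-refl }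
  argmin {suc m} f with argmin (f ∘ suc)
  ... | i , least with f zero ≤? f (suc i)
  ... | yes le = zero , λ { zero → ℕₚ.≤-refl ; (suc j) → ℕₚ.≤-trans le (least j) }
  ... | no gt = suc i , λ { zero → ℕₚ.<⇒≤ (ℕₚ.≰⇒> gt) ; (suc j) → least j }

  -- Both edges at a lowest vertex have that vertex as lower end.
  no-alternation : ∀ a₀ a₁ a₂ a₃ a₄ a₅ → let p = λ x y → odd (x ℕ.⊓ y) in
    p a₀ a₁ ≢ p a₁ a₂ → p a₁ a₂ ≢ p a₂ a₃ → p a₂ a₃ ≢ p a₃ a₄ → p a₃ a₄ ≢ p a₄ a₅ → p a₄ a₅ ≢ p a₅ a₀ → p a₅ a₀ ≢ p a₀ a₁ → ⊥
  no-alternation a₀ a₁ a₂ a₃ a₄ a₅ h₁ h₂ h₃ h₄ h₅ h₀ with argmin (Vec.lookup (a₀ ∷ a₁ ∷ a₂ ∷ a₃ ∷ a₄ ∷ a₅ ∷ []))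
  ... | i , least = at-lowest i least
    where
    f : Fin 6 → ℕ
    f = Vec.lookup (a₀ ∷ a₁ ∷ a₂ ∷ a₃ ∷ a₄ ∷ a₅ ∷ [])
    same : ∀ {x y z} → y ≤ x → y ≤ z → odd (x ℕ.⊓ y) ≡ odd (y ℕ.⊓ z)
    same y≤x y≤z = cong odd (trans (ℕₚ.m≥n⇒m⊓n≡n y≤x) (sym (ℕₚ.m≤n⇒m⊓n≡m y≤z)))
    at-lowest : ∀ i → (∀ j → f i ≤ f j) → ⊥
    at-lowest zero l = h₀ (same (l (suc (suc (suc (suc (suc zero)))))) (l (suc zero)))
    at-lowest (suc zero) l = h₁ (same (l zero) (l (suc (suc zero))))
    at-lowest (suc (suc zero)) l = h₂ (same (l (suc zero)) (l (suc (suc (suc zero)))))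
    at-lowest (suc (suc (suc zero))) l = h₃ (same (l (suc (suc zero))) (l (suc (suc (suc (suc zero))))))
    at-lowest (suc (suc (suc (suc zero)))) l = h₄ (same (l (suc (suc (suc zero)))) (l (suc (suc (suc (suc (suc zero)))))))
    at-lowest (suc (suc (suc (suc (suc zero))))) l = h₅ (same (l (suc (suc (suc (suc zero))))) (l zero))

record OddParameters (S : Setting) : Set where
  open Local S
  field
    c₃≡2 : c 3 ≡ 2
    k≡D+1 : k ≡ suc D
    all-c<k : ∀ {h} → h ≤ D → c h < k
    level : ∀ h → h < D → ∀ {x u y} → x ~ u → d x y ≡ h → d u y ≢ h
    opposite : ∀ {v₀ v₁ v₂ v₃ v₄ v₅} → Hex _~_ v₀ v₁ v₂ v₃ v₄ v₅ → ∀ u → odd (d v₀ u ℕ.⊓ d v₁ u) ≡ odd (d v₃ u ℕ.⊓ d v₄ u)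

module SmallParity (S : Setting) (cos : Cosines (Setting.G S) (Setting.conn S) (Setting.D S))
  (c₃<k : Local.c S 3 < Setting.k S) (c₃≡2 : Local.c S 3 ≡ 2) where
  open Local S
  open Relations S cos
  open Elimination S cos
  open Small S cos c₃<k c₃≡2
  open Cosines cos using (field₀)
  open FieldKit field₀
  open Descent field₀

  all-c<k : ∀ {h} → h ≤ D → c h < k
  all-c<k {h} h≤D with h ℕ.≟ D
  ... | yes refl = cD<k
  ... | no h≢D = c<k (ℕₚ.≤∧≢⇒< h≤D h≢D)

  κ : Carrier
  κ = w 0 ⊕ w 1

  -- The two progressions have opposite steps, so a sum of neighbouring terms depends only on the
  -- parity of the smaller index.
  pair-sum : ∀ i → i ≤ D → w i ⊕ w (suc i) ≈ κ ⊕ ν (bit (odd i)) ⊛ ε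
  pair-sum i i≤D with parity i
  ... | m , inj₁ refl = ≈-trans (+-cong (even-w m (reach i≤D)) (odd-w m (i≤D , all-c<k i≤D)))
        (≈-trans (ring-solve 4 (λ z a M E → (z :+ M :* E) :+ (a :- M :* E) :≈ z :+ a :+ # 0 :* E) ≈-refl (w 0) (w 1) (ν m) ε)
          (+-cong ≈-refl (*-cong (≈-reflexive (cong (ν ∘ bit) (sym (odd-double m)))) ≈-refl)))
  ... | m , inj₂ refl = ≈-trans (+-cong (odd-w m (reach i≤D)) (≈-trans (even-w (suc m) (i≤D , all-c<k i≤D)) (+-cong ≈-refl (*-cong (ν-suc m) ≈-refl))))
        (≈-trans (ring-solve 4 (λ z a M E → (a :- M :* E) :+ (z :+ (M :+ # 1) :* E) :≈ z :+ a :+ # 1 :* E) ≈-refl (w 0) (w 1) (ν m) ε)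
          (+-cong ≈-refl (*-cong (≈-reflexive (cong (ν ∘ bit) (sym (odd-suc-double m)))) ≈-refl)))

  edge-bit : Fin n → Fin n → Fin n → Bool
  edge-bit x y u = odd (d x u ℕ.⊓ d y u)

  -- A horizontal edge at level `D` obeys the same formula, because `w (suc D)` equals `w D`.
  edge-sum : ∀ {x y} u → x ~ y → w (d x u) ⊕ w (d y u) ≈ κ ⊕ ν (bit (edge-bit x y u)) ⊛ ε
  edge-sum {x} {y} u xy with suc (d y u) ℕ.≟ d x u
  ... | yes eq = ≈-trans (+-comm _ _) (≈-trans (+-cong ≈-refl (≈-reflexive (cong w (sym eq)))) (≈-trans (pair-sum (d y u) (d≤D y u))
        (+-cong ≈-refl (*-cong (≈-reflexive (cong (ν ∘ bit ∘ odd) (sym (ℕₚ.m≥n⇒m⊓n≡n (ℕₚ.≤-trans (ℕₚ.n≤1+n _) (ℕₚ.≤-reflexive eq)))))) ≈-refl))))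
  ... | no ne = ≈-trans (+-cong ≈-refl (up-w refl xy ne)) (≈-trans (pair-sum (d x u) (d≤D x u))
        (+-cong ≈-refl (*-cong (≈-reflexive (cong (ν ∘ bit ∘ odd) (sym (ℕₚ.m≤n⇒m⊓n≡m (not-closer xy refl ne))))) ≈-refl)))

  private
    SumC-two : ∀ {x y p q} u → d x y ≡ 3 → x ~ p → p ~ q → q ~ y → p ≢ y → ∀ {p′ q′} → x ~ p′ → p′ ~ q′ → q′ ~ y → p′ ≢ y → p ≢ p′ →
      SumC u x y ≈ w (d u p) ⊕ w (d u p′)
    SumC-two {x} {y} {p} {q} u e xp pq qy p≢y {p′} {q′} xp′ p′q′ q′y p′≢y p≢p′ =
      ≈-trans (SumC-one {3} {x} {y} {u} {p} (w (d u p)) (w (d u p′)) e cp ≈-refl (λ z cz p≢z → ≈-reflexive (cong (λ t → w (d u t)) (sym (only z cz p≢z)))))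
        (+-cong ≈-refl (≈-trans (*-cong (+-cong νc₃ ≈-refl) ≈-refl) (≈-trans (ring-solve 1 (λ a → (# 1 :+ # 1 :- # 1) :* a :≈ a) ≈-refl (w (d u p′))) ≈-refl)))
      where
      cp : C x y p ≡ true
      cp = C-intro xp (trans (cong suc (2-path pq qy p≢y)) (sym e))
      cp′ : C x y p′ ≡ true
      cp′ = C-intro xp′ (trans (cong suc (2-path p′q′ q′y p′≢y)) (sym e))
      only : ∀ z → C x y z ≡ true → p ≢ z → p′ ≡ z
      only z cz p≢z = count-unique (ℕₚ.≤-reflexive (ℕₚ.suc-injective (trans (sym (count-remove (C x y) p cp)) (trans (c-spec e) c₃≡2))))
        (∧-intro cp′ (not-eqᵇ p≢p′)) (∧-intro cz (not-eqᵇ p≢z))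

    -- The balanced relation for v₀ and v₃, whose sets C are the remaining vertices of the hexagon.
    -- As ρ₃ = -2, the values at v₀ and at v₃ occur twice, once for each hexagon edge there, and the
    -- relation becomes one between edge sums.
    two-opposite : ∀ {v₀ v₁ v₂ v₃ v₄ v₅} → Hex _~_ v₀ v₁ v₂ v₃ v₄ v₅ → ∀ u →
      bit (edge-bit v₀ v₁ u) + bit (edge-bit v₅ v₀ u) ≡ bit (edge-bit v₂ v₃ u) + bit (edge-bit v₃ v₄ u)
    two-opposite {v₀} {v₁} {v₂} {v₃} {v₄} {v₅} hex u = ν-injective (≈-trans (ν-+ (bit (edge-bit v₀ v₁ u)) (bit (edge-bit v₅ v₀ u))) (≈-trans (cancelˡ ε≉0 combine) (≈-sym (ν-+ (bit (edge-bit v₂ v₃ u)) (bit (edge-bit v₃ v₄ u))))))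
      where
      open Hex hex
      w′ : Fin n → Carrier
      w′ v = w (d v u)
      flip : ∀ v → w (d u v) ≈ w′ v
      flip v = ≈-reflexive (cong w (d-sym u v))
      e = 3-path a₀₁ a₁₂ a₂₃ n₀₂ n₁₃
      raw : (w′ v₁ ⊕ w′ v₅) ⊝ (w′ v₂ ⊕ w′ v₄) ≈ (⊖ ι (+ 2)) ⊛ (w′ v₀ ⊝ w′ v₃)
      raw = ≈-trans (≈-sym (+-cong
          (≈-trans (SumC-two u e a₀₁ a₁₂ a₂₃ n₁₃ (~-sym a₅₀) (~-sym a₄₅) (~-sym a₃₄) (n₃₅ ∘ sym) (n₅₁ ∘ sym)) (+-cong (flip v₁) (flip v₅)))
          (-‿cong (≈-trans (SumC-two u (swap-d e) (~-sym a₂₃) (~-sym a₁₂) (~-sym a₀₁) (n₀₂ ∘ sym) a₃₄ a₄₅ a₅₀ n₄₀ n₂₄) (+-cong (flip v₂) (flip v₄))))))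
        (≈-trans (bal e u) (*-cong ρ₃ (+-cong (flip v₀) (-‿cong (flip v₃)))))
      P = ν (bit (edge-bit v₀ v₁ u)) ⊕ ν (bit (edge-bit v₅ v₀ u))
      Q = ν (bit (edge-bit v₂ v₃ u)) ⊕ ν (bit (edge-bit v₃ v₄ u))
      left : w′ v₁ ⊕ w′ v₅ ⊕ ι (+ 2) ⊛ w′ v₀ ≈ ι (+ 2) ⊛ κ ⊕ P ⊛ ε
      left = lc₂ (ι (+ 1)) (ι (+ 1)) (edge-sum u a₀₁) (edge-sum u a₅₀) (ring-solve 7 (λ a b z K p q E → a :+ b :+ # 2 :* z :- (# 2 :* K :+ (p :+ q) :* E) :≈
        # 1 :* (z :+ a :- (K :+ p :* E)) :+ # 1 :* (b :+ z :- (K :+ q :* E))) ≈-refl (w′ v₁) (w′ v₅) (w′ v₀) κ (ν (bit (edge-bit v₀ v₁ u))) (ν (bit (edge-bit v₅ v₀ u))) ε)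
      right : w′ v₂ ⊕ w′ v₄ ⊕ ι (+ 2) ⊛ w′ v₃ ≈ ι (+ 2) ⊛ κ ⊕ Q ⊛ ε
      right = lc₂ (ι (+ 1)) (ι (+ 1)) (edge-sum u a₂₃) (edge-sum u a₃₄) (ring-solve 7 (λ a b z K p q E → a :+ b :+ # 2 :* z :- (# 2 :* K :+ (p :+ q) :* E) :≈
        # 1 :* (a :+ z :- (K :+ p :* E)) :+ # 1 :* (z :+ b :- (K :+ q :* E))) ≈-refl (w′ v₂) (w′ v₄) (w′ v₃) κ (ν (bit (edge-bit v₂ v₃ u))) (ν (bit (edge-bit v₃ v₄ u))) ε)
      combine : ε ⊛ P ≈ ε ⊛ Q
      combine = lc₃ (⊖ ι (+ 1)) (ι (+ 1)) (ι (+ 1)) left right raw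
        (ring-solve 8 (λ p q z y K P Q E → E :* P :- E :* Q :≈ (:- # 1) :* (p :+ # 2 :* z :- (# 2 :* K :+ P :* E)) :+ # 1 :* (q :+ # 2 :* y :- (# 2 :* K :+ Q :* E)) :+ # 1 :* (p :- q :- (:- # 2) :* (z :- y)))
          ≈-refl (w′ v₁ ⊕ w′ v₅) (w′ v₂ ⊕ w′ v₄) (w′ v₀) (w′ v₃) κ P Q ε)

    decide : ∀ a₀ a₁ a₂ a₃ a₄ a₅ → let p = λ x y → odd (x ℕ.⊓ y) in
      p a₀ a₁ ≡ p a₃ a₄ ⊎ (p a₁ a₂ ≡ not (p a₀ a₁) × p a₂ a₃ ≡ p a₀ a₁ × p a₄ a₅ ≡ p a₀ a₁ × p a₅ a₀ ≡ not (p a₀ a₁)) → p a₀ a₁ ≡ p a₃ a₄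
    decide a₀ a₁ a₂ a₃ a₄ a₅ (inj₁ b₀≡b₃) = b₀≡b₃
    decide a₀ a₁ a₂ a₃ a₄ a₅ (inj₂ (b₁≡ , b₂≡ , b₄≡ , b₅≡)) = decidable-stable (odd (a₀ ℕ.⊓ a₁) Boolₚ.≟ odd (a₃ ℕ.⊓ a₄)) λ b₀≢b₃ →
      no-alternation a₀ a₁ a₂ a₃ a₄ a₅
        (λ eq → not≢self (odd (a₀ ℕ.⊓ a₁)) (trans (sym b₁≡) (sym eq)))
        (λ eq → not≢self (odd (a₀ ℕ.⊓ a₁)) (trans (sym b₁≡) (trans eq b₂≡)))
        (λ eq → b₀≢b₃ (trans (sym b₂≡) eq))
        (λ eq → b₀≢b₃ (trans (sym b₄≡) (sym eq)))
        (λ eq → not≢self (odd (a₀ ℕ.⊓ a₁)) (trans (sym b₅≡) (trans (sym eq) b₄≡)))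
        (λ eq → not≢self (odd (a₀ ℕ.⊓ a₁)) (trans (sym b₅≡) eq))

  opposite : ∀ {v₀ v₁ v₂ v₃ v₄ v₅} → Hex _~_ v₀ v₁ v₂ v₃ v₄ v₅ → ∀ u → edge-bit v₀ v₁ u ≡ edge-bit v₃ v₄ u
  opposite {v₀} {v₁} {v₂} {v₃} {v₄} {v₅} hex u = decide (d v₀ u) (d v₁ u) (d v₂ u) (d v₃ u) (d v₄ u) (d v₅ u)
    (bits (edge-bit v₀ v₁ u) (edge-bit v₁ v₂ u) (edge-bit v₂ v₃ u) (edge-bit v₃ v₄ u) (edge-bit v₄ v₅ u) (edge-bit v₅ v₀ u)
      (two-opposite hex u) (two-opposite (rotate hex) u))

  oddParameters : OddParameters S
  oddParameters = record { c₃≡2 = c₃≡2 ; k≡D+1 = k≡D+1 ; all-c<k = all-c<k ; level = λ h h<D {x} {u} {y} → flat h h<D {x} {u} {y} ; opposite = opposite }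

-- Girth of generalized hexagons and Odd graphs

count-∨ : ∀ {m} (p q : Fin m → Bool) → count p + count q ≡ count (λ i → p i ∨ q i) + count (λ i → p i ∧ q i)
count-∨ {zero} p q = refl
count-∨ {suc m} p q with p zero | q zero | count-∨ (p ∘ suc) (q ∘ suc)
... | true  | true  | ih = cong suc (trans (ℕₚ.+-suc _ _) (trans (cong suc ih) (sym (ℕₚ.+-suc _ _))))
... | true  | false | ih = cong suc ih
... | false | true  | ih = trans (ℕₚ.+-suc _ _) (cong suc ih)
... | false | false | ih = ih

count≤ : ∀ {m} (p : Fin m → Bool) → count p ≤ m
count≤ {zero} p = z≤n
count≤ {suc m} p with p zero
... | true  = s≤s (count≤ (p ∘ suc))
... | false = ℕₚ.m≤n⇒m≤1+n (count≤ (p ∘ suc))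

Disjoint : ∀ {m} → (Fin m → Bool) → (Fin m → Bool) → Set
Disjoint p q = ∀ i → p i ∧ q i ≡ false

∧-false : ∀ {a b} → a ∧ b ≡ false → a ≡ true → b ≡ false
∧-false e refl = e

disjoint-sym : ∀ {m} {p q : Fin m → Bool} → Disjoint p q → Disjoint q p
disjoint-sym {p = p} {q} h i = trans (Boolₚ.∧-comm (q i) (p i)) (h i)

disjoint-∪ : ∀ {m} {p q r : Fin m → Bool} → Disjoint p r → Disjoint q r → Disjoint (λ i → p i ∨ q i) r
disjoint-∪ {p = p} {q} {r} h h′ i with p i | h i
... | true  | e = e
... | false | _ = h′ i

disjoint-sum : ∀ {m} (p q : Fin m → Bool) → Disjoint p q → count p + count q ≡ count (λ i → p i ∨ q i)
disjoint-sum p q h = trans (count-∨ p q) (trans (cong (λ t → count (λ i → p i ∨ q i) + t) (count-none h)) (ℕₚ.+-identityʳ _))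

count-difference : ∀ {m} (p q : Fin m → Bool) → count p ≡ count q → count (λ i → p i ∧ not (q i)) ≡ count (λ i → q i ∧ not (p i))
count-difference p q e = ℕₚ.+-cancelˡ-≡ (count (λ i → p i ∧ q i)) _ _
  (trans (sym (count-split p q)) (trans e (trans (count-split q p) (cong (_+ count (λ i → q i ∧ not (p i))) (count-cong (λ i → Boolₚ.∧-comm (q i) (p i)))))))

count-zero : ∀ {m} {p : Fin m → Bool} → count p ≡ 0 → ∀ i → p i ≡ false
count-zero e i = ≢true⇒false (λ pi → ℕₚ.<⇒≢ (count-pos i pi) (sym e))

∧-not-false : ∀ {a b} → a ∧ not b ≡ false → a ≡ true → b ≡ true
∧-not-false {true} {true} e _ = refl

union-grows : ∀ {m} (p q : Fin m → Bool) → count p ≡ count q → ¬ (∀ i → p i ≡ q i) → suc (count p) ≤ count (λ i → p i ∨ q i)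
union-grows p q e p≢q with count (λ i → q i ∧ not (p i)) in e₀
... | zero = ⊥-elim (p≢q (λ i → bool-ext (∧-not-false (count-zero (trans (count-difference p q e) e₀) i)) (∧-not-false (count-zero e₀ i))))
... | suc j = ℕₚ.≤-trans (s≤s (ℕₚ.≤-trans (ℕₚ.m≤m+n (count p) j) ℕₚ.≤-refl)) (ℕₚ.≤-reflexive (trans (trans (sym (ℕₚ.+-suc (count p) j)) (cong (λ t → count p + t) (sym e₀)))
    (trans (disjoint-sum p (λ i → q i ∧ not (p i)) (λ i → absorb (p i) (q i))) (count-cong (λ i → join (p i) (q i))))))
  where
  absorb : ∀ a b → a ∧ (b ∧ not a) ≡ false
  absorb true  true  = refl
  absorb true  false = refl
  absorb false b     = refl
  join : ∀ a b → a ∨ (b ∧ not a) ≡ a ∨ b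
  join true  b     = refl
  join false true  = refl
  join false false = refl

size≡count : ∀ {m} (S : Sub.Subset m) → Sub.∣ S ∣ ≡ count (Vec.lookup S)
size≡count []          = refl
size≡count (true ∷ S)  = cong suc (size≡count S)
size≡count (false ∷ S) = size≡count S

lookup-ext : ∀ {m} {S T : Sub.Subset m} → (∀ i → Vec.lookup S i ≡ Vec.lookup T i) → S ≡ T
lookup-ext {S = []} {[]} h = refl
lookup-ext {S = s ∷ S} {t ∷ T} h = cong₂ _∷_ (h zero) (lookup-ext (h ∘ suc))

∩⊥⇒disjoint : ∀ {m} (S T : Sub.Subset m) → S Sub.∩ T ≡ Sub.⊥ → Disjoint (Vec.lookup S) (Vec.lookup T)
∩⊥⇒disjoint (s ∷ S) (t ∷ T) e zero    = cong Vec.head e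
∩⊥⇒disjoint (s ∷ S) (t ∷ T) e (suc i) = ∩⊥⇒disjoint S T (cong Vec.tail e) i

disjoint⇒∩⊥ : ∀ {m} (S T : Sub.Subset m) → Disjoint (Vec.lookup S) (Vec.lookup T) → S Sub.∩ T ≡ Sub.⊥
disjoint⇒∩⊥ []      []      h = refl
disjoint⇒∩⊥ (s ∷ S) (t ∷ T) h = cong₂ _∷_ (h zero) (disjoint⇒∩⊥ S T (h ∘ suc))

oddVertex≡ : ∀ {D} {s t : OddVertex D} → proj₁ s ≡ proj₁ t → s ≡ t
oddVertex≡ {s = S , e} {.S , e′} refl = cong (λ e → S , e) (ℕₚ.≡-irrelevant e e′)

cycle-map : ∀ G H (f : Fin (Graph.n G) → Fin (Graph.n H)) → (∀ x y → f x ≡ f y → x ≡ y) →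
  (∀ x y → Graph.adj G x y ≡ true → Graph.adj H (f x) (f y) ≡ true) → ∀ l → HasCycle G l → HasCycle H l
cycle-map G H f inj pres (suc l) (3≤l , v , v-inj , steps , close) =
  3≤l , f ∘ v , (λ i j e → v-inj i j (inj _ _ e)) , (λ i → pres _ _ (steps i)) , pres _ _ close

≅-girth : ∀ {G H g} → G ≅ H → GirthEq H g → GirthEq G g
≅-girth {G} {H} {g} (f , pres) (cyc , least) = cycle-map H G from from-inj from-pres g cyc ,
  λ l l<g → least l l<g ∘ cycle-map G H to to-inj (λ x y e → trans (sym (pres x y)) e) l
  where
  open Inverse f using (to; from; strictlyInverseˡ; strictlyInverseʳ)
  to-inj : ∀ x y → to x ≡ to y → x ≡ y
  to-inj x y e = trans (sym (strictlyInverseʳ x)) (trans (cong from e) (strictlyInverseʳ y))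
  from-inj : ∀ x y → from x ≡ from y → x ≡ y
  from-inj x y e = trans (sym (strictlyInverseˡ x)) (trans (cong to e) (strictlyInverseˡ y))
  from-pres : ∀ x y → Graph.adj H x y ≡ true → Graph.adj G (from x) (from y) ≡ true
  from-pres x y e = trans (pres (from x) (from y)) (trans (cong₂ (Graph.adj H) (strictlyInverseˡ x) (strictlyInverseˡ y)) e)

-- The colouring excludes odd cycles and c₂ = 1 excludes quadrangles. Two geodesics between vertices
-- at distance three, available because c₃ = k > 1, form a hexagon.
genHexagon-girth : ∀ {k} H → 3 ≤ k → IsGenHexagon1 k H → GirthEq H 6
genHexagon-girth {k} H 3≤k (conn , _ , (_ , x , y , e) , (colour , proper) , _ , _ , level₂ , level₃) = girth6 hexagon noTri noQuad noPent
  where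
  open Metric H conn
  open CycleKit H
  alternate : ∀ {a b c : Bool} → a ≢ b → b ≢ c → a ≡ c
  alternate {true}  {true}          h _ = ⊥-elim (h refl)
  alternate {false} {false}         h _ = ⊥-elim (h refl)
  alternate {true}  {false} {true}  _ _ = refl
  alternate {true}  {false} {false} _ h = ⊥-elim (h refl)
  alternate {false} {true}  {true}  _ h = ⊥-elim (h refl)
  alternate {false} {true}  {false} _ _ = refl
  two-steps : ∀ {x y z} → x ~ y → y ~ z → colour x ≡ colour z
  two-steps xy yz = alternate (proper _ _ xy) (proper _ _ yz)
  noTri : ¬ Triangle
  noTri (_ , xy , yz , zx) = proper _ _ zx (sym (two-steps xy yz))
  noPent : ¬ Pentagon
  noPent (_ , xy , yz , zw , wu , ux) = proper _ _ ux (sym (trans (two-steps xy yz) (two-steps zw wu)))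
  distance-two : ∀ {x y z} → x ~ y → y ~ z → x ≢ z → d x z ≡ 2
  distance-two {x} {y} {z} xy yz x≢z = ℕₚ.≤-antisym (ℕₚ.≤-trans (d-triangle x y z) (ℕₚ.+-mono-≤ (d≤1 xy) (d≤1 yz)))
    (ℕₚ.≤∧≢⇒< (d-pos x≢z) (λ e → proper _ _ (d≡1⇒~ (sym e)) (two-steps xy yz)))
  noQuad : ¬ Quad
  noQuad ((x , y , z , w) , xy , yz , zw , wx , x≢z , y≢w) =
    y≢w (count-unique (ℕₚ.≤-reflexive (proj₂ (level₂ x z e₂))) (closer (~-sym yz) (~⇒d≡1 xy)) (closer zw (~⇒d≡1 (~-sym wx))))
    where
    e₂ = distance-two xy yz x≢z
    closer : ∀ {t} → z ~ t → d x t ≡ 1 → (adj z t ∧ (d x t ≡ᵇ (d x z ∸ 1))) ≡ true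
    closer zt et = ∧-intro zt (≡ᵇ-intro (trans et (sym (cong (_∸ 1) e₂))))
  lower : Fin n → Bool
  lower z = adj y z ∧ (d x z ≡ᵇ (d x y ∸ 1))
  lower-elim : ∀ z → lower z ≡ true → y ~ z × d x z ≡ 2
  lower-elim z h = let a , b = ∧-true {adj y z} h in a , trans (≡ᵇ-true _ _ b) (cong (_∸ 1) e)
  2≤c₃ : 1 < count lower
  2≤c₃ = subst (1 <_) (sym (level₃ x y e)) (ℕₚ.≤-trans (s≤s (s≤s z≤n)) 3≤k)
  different : ∀ {x y y′ i j} → d x y ≡ i → d x y′ ≡ j → i ≢ j → y ≢ y′
  different e e′ i≢j refl = i≢j (trans (sym e) e′)
  assemble : ∀ {z₁ z₂ w₁ w₂} → y ~ z₁ → d x z₁ ≡ 2 → y ~ z₂ → d x z₂ ≡ 2 → z₁ ≢ z₂ → x ~ w₁ → w₁ ~ z₁ → x ~ w₂ → w₂ ~ z₂ → Hexagon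
  assemble {z₁} {z₂} {w₁} {w₂} yz₁ e₁ yz₂ e₂ z₁≢z₂ xw₁ w₁z₁ xw₂ w₂z₂ =
    (x , w₁ , z₁ , y , z₂ , w₂) , xw₁ , w₁z₁ , ~-sym yz₁ , yz₂ , ~-sym w₂z₂ , ~-sym xw₂ ,
    different (d-refl x) e₁ (λ ()) , w₁≢y , z₁≢z₂ , different e (~⇒d≡1 xw₂) (λ ()) , different e₂ (d-refl x) (λ ()) ,
    (λ w₂≡w₁ → noQuad (_ , w₁z₁ , ~-sym yz₁ , yz₂ , subst (z₂ ~_) w₂≡w₁ (~-sym w₂z₂) , w₁≢y , z₁≢z₂)) ,
    different (d-refl x) e (λ ()) , different (~⇒d≡1 xw₁) e₂ (λ ()) , different e₁ (~⇒d≡1 xw₂) (λ ())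
    where
    w₁≢y : w₁ ≢ y
    w₁≢y = different (~⇒d≡1 xw₁) e (λ ())
  hexagon : Hexagon
  hexagon =
    let z₁ , h₁ = count-∃ lower (ℕₚ.<-trans (s≤s z≤n) 2≤c₃)
        z₂ , h₂ , z₁≢z₂ = count-other lower z₁ 2≤c₃
        yz₁ , e₁ = lower-elim z₁ h₁
        yz₂ , e₂ = lower-elim z₂ h₂
        w₁ , xw₁ , f₁ = d-step e₁
        w₂ , xw₂ , f₂ = d-step e₂
    in assemble yz₁ e₁ yz₂ e₂ z₁≢z₂ xw₁ (d≡1⇒~ f₁) xw₂ (d≡1⇒~ f₂)

private
  block : ∀ E F → Bool → Bool → Vec Bool (E + F)
  block E F a b = Vec.replicate E a Vec.++ Vec.replicate F b

  block-∩ : ∀ E F → block E F true false Sub.∩ block E F false true ≡ Sub.⊥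
  block-∩ zero    zero    = refl
  block-∩ zero    (suc F) = cong (false ∷_) (block-∩ zero F)
  block-∩ (suc E) F       = cong (false ∷_) (block-∩ E F)

  block-size₁ : ∀ E F → Sub.∣ block E F true false ∣ ≡ E
  block-size₁ zero    zero    = refl
  block-size₁ zero    (suc F) = block-size₁ zero F
  block-size₁ (suc E) F       = cong suc (block-size₁ E F)

  block-size₂ : ∀ E F → Sub.∣ block E F false true ∣ ≡ F
  block-size₂ zero    zero    = refl
  block-size₂ zero    (suc F) = cong suc (block-size₂ zero F)
  block-size₂ (suc E) F       = block-size₂ E F

-- With p, q, r the first three points and A, B disjoint (D-1)-sets of further points, the hexagon is
-- A+q, B+r, A+p, B+q, A+r, B+p.
odd-hexagon : ∀ {N} E′ → let E = suc E′; Vertex = Σ (Sub.Subset N) λ S → Sub.∣ S ∣ ≡ suc E in N ≡ 3 + (E + E) →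
  Σ (Vertex × Vertex × Vertex × Vertex × Vertex × Vertex) λ ((x , _) , (y , _) , (z , _) , (w , _) , (u , _) , (t , _)) →
    (x Sub.∩ y ≡ Sub.⊥ × y Sub.∩ z ≡ Sub.⊥ × z Sub.∩ w ≡ Sub.⊥ × w Sub.∩ u ≡ Sub.⊥ × u Sub.∩ t ≡ Sub.⊥ × t Sub.∩ x ≡ Sub.⊥) ×
    x ≢ z × y ≢ w × z ≢ u × w ≢ t × u ≢ x × t ≢ y × x ≢ w × y ≢ u × z ≢ t
odd-hexagon E′ refl =
  ((false ∷ true ∷ false ∷ A , cong suc sA) , (false ∷ false ∷ true ∷ B , cong suc sB) , (true ∷ false ∷ false ∷ A , cong suc sA) ,
   (false ∷ true ∷ false ∷ B , cong suc sB) , (false ∷ false ∷ true ∷ A , cong suc sA) , (true ∷ false ∷ false ∷ B , cong suc sB)) ,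
  (tails AB , tails BA , tails AB , tails BA , tails AB , tails BA) ,
  (λ ()) , (λ ()) , (λ ()) , (λ ()) , (λ ()) , (λ ()) , (λ ()) , (λ ()) , (λ ())
  where
  E = suc E′
  A = block E E true false
  B = block E E false true
  sA = block-size₁ E E
  sB = block-size₂ E E
  AB : A Sub.∩ B ≡ Sub.⊥
  AB = block-∩ E E
  BA : B Sub.∩ A ≡ Sub.⊥
  BA = disjoint⇒∩⊥ B A (disjoint-sym {p = Vec.lookup A} {Vec.lookup B} (∩⊥⇒disjoint A B AB))
  tails : ∀ {m} {v : Vec Bool m} → v ≡ Sub.⊥ → Vec._∷_ false (false ∷ false ∷ v) ≡ Sub.⊥
  tails = cong (λ v → false ∷ false ∷ false ∷ v)

-- Short cycles fail by counting in 2D + 1 points: a triangle needs three disjoint D-sets, and a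
-- quadrangle two disjoint unions of at least D + 1 points each. In a pentagon, x would meet the
-- disjoint sets z and w in at least D - 1 points each, too many for D ≥ 3.
odd-girth : ∀ {D} G → 3 ≤ D → IsoOdd G D → GirthEq G 6
odd-girth {suc zero} G (s≤s ())
odd-girth {suc (suc zero)} G (s≤s (s≤s ()))
odd-girth {suc (suc (suc E))} G 3≤D (f , adjacency) = girth6 hexagon noTri noQuad noPent
  where
  open CycleKit G
  open Graph G using (n; adj)
  open Inverse f using (to; from; strictlyInverseˡ; strictlyInverseʳ)
  D = suc (suc (suc E))
  N = suc (D + D)
  φ : Fin n → Fin N → Bool
  φ x = Vec.lookup (proj₁ (to x))
  size : ∀ x → count (φ x) ≡ D
  size x = trans (sym (size≡count (proj₁ (to x)))) (proj₂ (to x))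
  apart : ∀ {x y} → adj x y ≡ true → Disjoint (φ x) (φ y)
  apart {x} {y} xy = ∩⊥⇒disjoint (proj₁ (to x)) (proj₁ (to y)) (Equivalence.to (adjacency x y) xy)
  distinct : ∀ {x y} → x ≢ y → ¬ (∀ i → φ x i ≡ φ y i)
  distinct {x} {y} x≢y h = x≢y (trans (sym (strictlyInverseʳ x)) (trans (cong from (oddVertex≡ (lookup-ext h))) (strictlyInverseʳ y)))
  poly₁ : ∀ E → suc (suc (suc (suc (suc (suc E)) + suc (suc (suc E))) + E)) ≡ suc (suc (suc E)) + suc (suc (suc E)) + suc (suc (suc E))
  poly₁ = ℕR.solve-∀
  noTri : ¬ Triangle
  noTri ((x , y , z) , xy , yz , zx) = ℕₚ.1+n≰n {N} (ℕₚ.≤-trans (ℕₚ.≤-trans (s≤s (ℕₚ.≤-trans (ℕₚ.n≤1+n N) (s≤s (ℕₚ.m≤m+n N E)))) (ℕₚ.≤-reflexive (poly₁ E)))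
    (ℕₚ.≤-trans (ℕₚ.≤-reflexive (trans (sym (cong₂ _+_ (cong₂ _+_ (size x) (size y)) (size z)))
      (trans (cong (_+ count (φ z)) (disjoint-sum (φ x) (φ y) (apart xy))) (disjoint-sum (λ i → φ x i ∨ φ y i) (φ z) (disjoint-∪ {p = φ x} {φ y} {φ z} (disjoint-sym {p = φ z} {φ x} (apart zx)) (apart yz))))))
      (count≤ (λ i → (φ x i ∨ φ y i) ∨ φ z i))))
  union : ∀ {x y} → x ≢ y → suc D ≤ count (λ i → φ x i ∨ φ y i)
  union {x} {y} x≢y = subst (λ s → suc s ≤ count (λ i → φ x i ∨ φ y i)) (size x) (union-grows (φ x) (φ y) (trans (size x) (sym (size y))) (distinct x≢y))
  noQuad : ¬ Quad
  noQuad ((x , y , z , w) , xy , yz , zw , wx , x≢z , y≢w) = ℕₚ.1+n≰n {N} (ℕₚ.≤-trans (ℕₚ.≤-reflexive (cong suc (sym (ℕₚ.+-suc D D))))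
    (ℕₚ.≤-trans (ℕₚ.+-mono-≤ (union x≢z) (union y≢w)) (ℕₚ.≤-trans (ℕₚ.≤-reflexive (disjoint-sum (λ i → φ x i ∨ φ z i) (λ i → φ y i ∨ φ w i) (disjoint-∪ {p = φ x} {φ z} {λ i → φ y i ∨ φ w i}
      (below x (apart xy) (apart (flip wx))) (below z (apart (flip yz)) (apart zw))))) (count≤ (λ i → (φ x i ∨ φ z i) ∨ (φ y i ∨ φ w i))))))
    where
    below : ∀ v → Disjoint (φ v) (φ y) → Disjoint (φ v) (φ w) → Disjoint (φ v) (λ i → φ y i ∨ φ w i)
    below v h h′ = disjoint-sym {p = λ i → φ y i ∨ φ w i} {φ v}
      (disjoint-∪ {p = φ y} {φ w} {φ v} (disjoint-sym {p = φ v} {φ y} h) (disjoint-sym {p = φ v} {φ w} h′))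
  common : ∀ {x y z} → adj x y ≡ true → adj y z ≡ true → D ≤ suc (count (λ i → φ x i ∧ φ z i))
  common {x} {y} {z} xy yz = ℕₚ.+-cancelˡ-≤ u D (suc i) (ℕₚ.≤-trans (subst₂ (λ s s′ → s + s′ ≤ N) refl (size y)
      (ℕₚ.≤-trans (ℕₚ.≤-reflexive (disjoint-sum (λ i → φ x i ∨ φ z i) (φ y) (disjoint-∪ {p = φ x} {φ z} {φ y} (apart xy) (apart (flip yz))))) (count≤ (λ i → (φ x i ∨ φ z i) ∨ φ y i))))
    (ℕₚ.≤-reflexive (trans (cong suc (trans (sym (cong₂ _+_ (size x) (size z))) (count-∨ (φ x) (φ z)))) (sym (ℕₚ.+-suc u i)))))
    where
    u = count (λ i → φ x i ∨ φ z i)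
    i = count (λ i → φ x i ∧ φ z i)
  noPent : ¬ Pentagon
  noPent ((x , y , z , w , u) , xy , yz , zw , wu , ux) = ℕₚ.1+n≰n {suc (suc D)} (ℕₚ.≤-trans (ℕₚ.≤-trans (ℕₚ.≤-reflexive (ℕₚ.+-comm 3 D)) (ℕₚ.+-monoʳ-≤ D 3≤D))
    (ℕₚ.≤-trans (ℕₚ.+-mono-≤ (common xy yz) (common (flip ux) (flip wu)))
    (ℕₚ.≤-trans (ℕₚ.≤-reflexive (cong suc (ℕₚ.+-suc i j))) (s≤s (s≤s (ℕₚ.≤-trans (ℕₚ.≤-reflexive (disjoint-sum (λ t → φ x t ∧ φ z t) (λ t → φ x t ∧ φ w t) (λ t → clash (φ x t) (φ z t) (φ w t) (apart zw t))))
      (ℕₚ.≤-trans (count-mono (λ t → inside (φ x t) (φ z t) (φ w t))) (ℕₚ.≤-reflexive (size x)))))))))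
    where
    i = count (λ t → φ x t ∧ φ z t)
    j = count (λ t → φ x t ∧ φ w t)
    clash : ∀ a b c → b ∧ c ≡ false → (a ∧ b) ∧ (a ∧ c) ≡ false
    clash true  b c e = e
    clash false b c e = refl
    inside : ∀ a b c → (a ∧ b) ∨ (a ∧ c) ≡ true → a ≡ true
    inside true b c e = refl
  hexagon : Hexagon
  hexagon =
    let (x , y , z , w , u , t) , (xy , yz , zw , wu , ut , tx) , x≢z , y≢w , z≢u , w≢t , u≢x , t≢y , x≢w , y≢u , z≢t =
          odd-hexagon (suc E) (cong (λ m → 3 + m) (trans (ℕₚ.+-suc (suc E) (suc (suc E))) refl))
    in (from x , from y , from z , from w , from u , from t) , edge xy , edge yz , edge zw , edge wu , edge ut , edge tx ,
       differ x≢z , differ y≢w , differ z≢u , differ w≢t , differ u≢x , differ t≢y , differ x≢w , differ y≢u , differ z≢t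
    where
    edge : ∀ {x y} → proj₁ x Sub.∩ proj₁ y ≡ Sub.⊥ → adj (from x) (from y) ≡ true
    edge {x} {y} e = Equivalence.from (adjacency (from x) (from y))
      (trans (cong₂ (λ s t → proj₁ s Sub.∩ proj₁ t) (strictlyInverseˡ x) (strictlyInverseˡ y)) e)
    differ : ∀ {x y} → proj₁ x ≢ proj₁ y → from x ≢ from y
    differ {x} {y} ne e = ne (cong proj₁ (trans (sym (strictlyInverseˡ x)) (trans (cong to e) (strictlyInverseˡ y))))

-- Reconstruction of the Odd graph

count-≤ : ∀ {m k} {p : Fin m → Bool} {q : Fin k → Bool} (f : ∀ i → p i ≡ true → Fin k) → (∀ i pi → q (f i pi) ≡ true) →
  (∀ i j pi pj → f i pi ≡ f j pj → i ≡ j) → count p ≤ count q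
count-≤ {zero} f hq inj = z≤n
count-≤ {suc m} {k} {p} {q} f hq inj = by-head (p zero) refl
  where
  by-head : ∀ b → p zero ≡ b → (if p zero then 1 else 0) + count (p ∘ suc) ≤ count q
  by-head false e = subst (_≤ count q) (sym (cong (λ b → (if b then 1 else 0) + count (p ∘ suc)) e))
    (count-≤ (f ∘ suc) (λ i → hq (suc i)) (λ i j pi pj eq → Finₚ.suc-injective (inj (suc i) (suc j) pi pj eq)))
  by-head true e = subst₂ _≤_ (sym (cong (λ b → (if b then 1 else 0) + count (p ∘ suc)) e)) (sym (count-remove q (f zero e) (hq zero e)))
    (s≤s (count-≤ {q = λ z → q z ∧ not (eqᵇ (f zero e) z)} (f ∘ suc)
      (λ i pi → ∧-intro (hq (suc i) pi) (not-eqᵇ (λ eq → Finₚ.0≢1+n (inj zero (suc i) e pi eq))))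
      (λ i j pi pj eq → Finₚ.suc-injective (inj (suc i) (suc j) pi pj eq))))

record Enumeration {n} (p : Fin n → Bool) (m : ℕ) : Set where
  field
    at : Fin m → Fin n
    holds : ∀ i → p (at i) ≡ true
    injective : ∀ i j → at i ≡ at j → i ≡ j
    onto : ∀ x → p x ≡ true → ∃ λ i → at i ≡ x

enumerate : ∀ {n} (p : Fin n → Bool) → Enumeration p (count p)
enumerate {zero} p = record { at = λ () ; holds = λ () ; injective = λ () ; onto = λ () }
enumerate {suc n} p = by-head (p zero) refl
  where
  open Enumeration (enumerate (p ∘ suc))
  by-head : ∀ b → p zero ≡ b → Enumeration p ((if p zero then 1 else 0) + count (p ∘ suc))
  by-head false e = subst (λ b → Enumeration p ((if b then 1 else 0) + count (p ∘ suc))) (sym e) record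
    { at = suc ∘ at ; holds = holds ; injective = λ i j eq → injective i j (Finₚ.suc-injective eq) ; onto = onto′ }
    where
    onto′ : ∀ x → p x ≡ true → ∃ λ i → suc (at i) ≡ x
    onto′ zero px = ⊥-elim (true≢false (trans (sym px) e))
    onto′ (suc x) px = let i , eq = onto x px in i , cong suc eq
  by-head true e = subst (λ b → Enumeration p ((if b then 1 else 0) + count (p ∘ suc))) (sym e) record
    { at = at′ ; holds = holds′ ; injective = injective′ ; onto = onto′ }
    where
    at′ : Fin (suc (count (p ∘ suc))) → Fin (suc n)
    at′ zero = zero
    at′ (suc i) = suc (at i)
    holds′ : ∀ i → p (at′ i) ≡ true
    holds′ zero = e
    holds′ (suc i) = holds i
    injective′ : ∀ i j → at′ i ≡ at′ j → i ≡ j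
    injective′ zero zero _ = refl
    injective′ (suc i) (suc j) eq = cong suc (injective i j (Finₚ.suc-injective eq))
    onto′ : ∀ x → p x ≡ true → ∃ λ i → at′ i ≡ x
    onto′ zero _ = zero , refl
    onto′ (suc x) px = let i , eq = onto x px in suc i , cong suc eq

-- The points of the underlying set are the sets P x y, x ~ y, and the vertex z becomes the set of points P x y with z ∈ P x y.
module OddReconstruction (S : Setting) (parameters : OddParameters S) where
  open Local S
  open OddParameters parameters

  P : Fin n → Fin n → Fin n → Bool
  P x y u = odd (d x u ℕ.⊓ d y u)

  _≐_ : (p q : Fin n → Bool) → Set
  p ≐ q = ∀ u → p u ≡ q u

  P-low : ∀ {x y u h} → d x u ≡ h → h ≤ d y u → P x y u ≡ odd h
  P-low refl le = cong odd (ℕₚ.m≤n⇒m⊓n≡m le)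

  P-swap : ∀ x y → P x y ≐ P y x
  P-swap x y u = cong odd (ℕₚ.⊓-comm (d x u) (d y u))

  P-left : ∀ x y → P x y x ≡ false
  P-left x y = P-low (d-refl x) z≤n

  P-right : ∀ x y → P x y y ≡ false
  P-right x y = trans (P-swap x y y) (P-left y x)

  -- The ends of the path are at distance three, and since c₃ = 2 a second geodesic joins them.
  hexagon-through : ∀ {a x y b} → a ~ x → x ~ y → y ~ b → a ≢ y → x ≢ b → ∃ λ y′ → ∃ λ x′ → Hex _~_ a x y b y′ x′
  hexagon-through {a} {x} {y} {b} ax xy yb a≢y x≢b =
    let e = 3-path ax xy yb a≢y x≢b
        x′ , cx′ , x≢x′ = count-other (C a b) x (subst (1 <_) (sym (trans (c-spec e) c₃≡2)) (s≤s (s≤s z≤n)))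
        ax′ , ex′ = C-elim {a} {b} {x′} cx′
        dx′b = ℕₚ.suc-injective (trans ex′ e)
        y′ , x′y′ , dy′b = d-step dx′b
    in y′ , x′ , record
      { a₀₁ = ax ; a₁₂ = xy ; a₂₃ = yb ; a₃₄ = ~-sym (d≡1⇒~ dy′b) ; a₄₅ = ~-sym x′y′ ; a₅₀ = ~-sym ax′
      ; n₀₂ = a≢y ; n₁₃ = x≢b ; n₅₁ = x≢x′ ∘ sym
      ; n₂₄ = λ y≡y′ → noQuad (_ , ax , xy , subst (_~ x′) (sym y≡y′) (~-sym x′y′) , ~-sym ax′ , a≢y , x≢x′)
      ; n₃₅ = apart dx′b ∘ sym
      ; n₄₀ = λ y′≡a → ℕₚ.0≢1+n (ℕₚ.suc-injective (trans (sym dy′b) (trans (cong (λ t → d t b) y′≡a) e))) }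

  -- The edge is exchanged for the opposite edge of a hexagon that contains two steps of a geodesic
  -- from `x` to `z`. By `opposite` the point is unchanged, while the distance to `z` drops by two.
  nearer : ∀ {x y h} z → x ~ y → d x z ≡ suc (suc h) → suc (suc h) ≤ d y z →
    ∃ λ b → ∃ λ v → b ~ v × d b z ≡ h × h ≤ d v z × P x y ≐ P b v
  nearer {x} {y} {h} z xy e le =
    let a , xa , ea = d-step e
        b , ab , eb = d-step ea
        v , w , hex = hexagon-through (~-sym xy) xa ab
          (λ y≡a → ℕₚ.1+n≰n (subst (suc (suc h) ≤_) (trans (cong (λ t → d t z) y≡a) ea) le))
          (λ x≡b → ℕₚ.m≢1+m+n h {1} (trans (sym eb) (trans (cong (λ t → d t z) (sym x≡b)) (trans e (cong suc (ℕₚ.+-comm 1 h))))))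
        same : P x y ≐ P b v
        same u = trans (P-swap x y u) (opposite hex u)
        bv = Hex.a₃₄ hex
        -- If `v` were closer to `z` than `b`, the smaller distance would be h - 1, whose parity
        -- contradicts that of h + 2 on the edge `x`, `y`.
        bound : ¬ d v z < h
        bound lt = odd≢odd-suc (d v z)
          (trans (sym (P-low refl (ℕₚ.≤-trans (ℕₚ.<⇒≤ lt) (ℕₚ.≤-reflexive (sym eb)))))
          (trans (P-swap v b z) (trans (sym (same z)) (trans (P-low e le)
            (cong odd (ℕₚ.≤-antisym (ℕₚ.≤-trans (ℕₚ.≤-reflexive (sym eb)) (d-near z (~-sym bv))) lt))))))
    in b , v , bv , eb , ℕₚ.≮⇒≥ bound , same
    where
    odd≢odd-suc : ∀ i → odd i ≢ odd (suc i)
    odd≢odd-suc i eq = not≢self (odd i) (sym (trans eq (odd-suc i)))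

  -- Repeated use of `nearer` moves the edge until it ends at `z`. For an odd distance, in
  -- `to-neighbour`, it stops at a neighbour of `z`.
  to-vertex : ∀ m {x y} z → x ~ y → d x z ≡ double m → double m ≤ d y z → ∃ λ x′ → z ~ x′ × P x y ≐ P z x′
  to-vertex zero {x} {y} z xy e _ = y , subst (_~ y) (d≡0⇒≡ e) xy , λ u → cong (λ t → P t y u) (d≡0⇒≡ e)
  to-vertex (suc m) z xy e le =
    let b , v , bv , eb , le′ , same = nearer z xy e le
        x′ , zx′ , same′ = to-vertex m z bv eb le′
    in x′ , zx′ , λ u → trans (same u) (same′ u)

  to-neighbour : ∀ m {x y} z → x ~ y → d x z ≡ suc (double m) → suc (double m) ≤ d y z →
    ∃ λ b → ∃ λ v → z ~ b × b ~ v × z ≢ v × P x y ≐ P b v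
  to-neighbour zero {x} {y} z xy e le = x , y , ~-sym (d≡1⇒~ e) , xy , (λ z≡y → ℕₚ.<⇒≢ le (sym (trans (cong (d y) z≡y) (d-refl y)))) , λ u → refl
  to-neighbour (suc m) z xy e le =
    let b , v , bv , eb , le′ , same = nearer z xy e le
        b′ , v′ , zb′ , b′v′ , z≢v′ , same′ = to-neighbour m z bv eb le′
    in b′ , v′ , zb′ , b′v′ , z≢v′ , λ u → trans (same u) (same′ u)

  private
    missing-low : ∀ {x y} z → x ~ y → P x y z ≡ false → d x z ≤ d y z → ∃ λ x′ → z ~ x′ × P x y ≐ P z x′
    missing-low {x} {y} z xy h le with parity (d x z)
    ... | m , inj₁ e = to-vertex m z xy e (subst (_≤ d y z) e le)
    ... | m , inj₂ e = ⊥-elim (true≢false (trans (sym (odd-suc-double m)) (trans (sym (P-low e (subst (_≤ d y z) e le))) h)))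

  missing : ∀ {x y} z → x ~ y → P x y z ≡ false → ∃ λ x′ → z ~ x′ × P x y ≐ P z x′
  missing {x} {y} z xy h with ℕₚ.≤-total (d x z) (d y z)
  ... | inj₁ le = missing-low z xy h le
  ... | inj₂ ge = let x′ , zx′ , same = missing-low z (~-sym xy) (trans (P-swap y x z) h) ge in x′ , zx′ , λ u → trans (P-swap x y u) (same u)

  private
    containing-low : ∀ {x y} z → x ~ y → P x y z ≡ true → d x z ≤ d y z → ∃ λ b → ∃ λ v → z ~ b × b ~ v × z ≢ v × P x y ≐ P b v
    containing-low {x} {y} z xy h le with parity (d x z)
    ... | m , inj₂ e = to-neighbour m z xy e (subst (_≤ d y z) e le)
    ... | m , inj₁ e = ⊥-elim (true≢false (trans (sym h) (trans (P-low e (subst (_≤ d y z) e le)) (odd-double m))))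

  containing : ∀ {x y} z → x ~ y → P x y z ≡ true → ∃ λ b → ∃ λ v → z ~ b × b ~ v × z ≢ v × P x y ≐ P b v
  containing {x} {y} z xy h with ℕₚ.≤-total (d x z) (d y z)
  ... | inj₁ le = containing-low z xy h le
  ... | inj₂ ge = let b , v , zb , bv , z≢v , same = containing-low z (~-sym xy) (trans (P-swap y x z) h) ge
                  in b , v , zb , bv , z≢v , λ u → trans (P-swap x y u) (same u)

  -- The point is P b v with `b` a neighbour of `z`. A neighbour `u` of `z` is `b` itself or has
  -- distances two and three from `b` and `v`; the minimum is even in both cases.
  P-disjoint : ∀ {x y z u} → x ~ y → z ~ u → P x y z ≡ true → P x y u ≡ false
  P-disjoint {x} {y} {z} {u} xy zu h = let b , v , zb , bv , z≢v , same = containing z xy h in trans (same u) (by-cases zb bv z≢v (u Fin.≟ b))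
    where
    by-cases : ∀ {b v} → z ~ b → b ~ v → z ≢ v → Dec (u ≡ b) → P b v u ≡ false
    by-cases {b} {v} zb bv z≢v (yes u≡b) = trans (cong (P b v) u≡b) (P-left b v)
    by-cases {b} {v} zb bv z≢v (no u≢b) = P-low (trans (d-sym b u) (2-path (~-sym zu) zb u≢b))
      (ℕₚ.≤-trans (ℕₚ.n≤1+n 2) (ℕₚ.≤-reflexive (sym (trans (d-sym v u) (3-path (~-sym zu) zb bv u≢b z≢v)))))

  P-beyond : ∀ {z x v} → z ~ x → z ~ v → x ≢ v → P z x v ≡ true
  P-beyond zx zv x≢v = P-low (~⇒d≡1 zv) (ℕₚ.≤-trans (s≤s z≤n) (ℕₚ.≤-reflexive (sym (2-path (~-sym zx) zv x≢v))))

  P-separates : ∀ {z x x′} → z ~ x → z ~ x′ → P z x ≐ P z x′ → x ≡ x′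
  P-separates {z} {x} {x′} zx zx′ same with x Fin.≟ x′
  ... | yes x≡x′ = x≡x′
  ... | no x≢x′ = ⊥-elim (true≢false (trans (sym (P-beyond zx zx′ x≢x′)) (trans (same x′) (P-right z x′))))

  private
    z₀ : Fin n
    z₀ = proj₁ (proj₂ diameter)

    base : ∃ λ u → z₀ ~ u
    base = count-∃ (adj z₀) (ℕₚ.≤-trans (s≤s z≤n) (ℕₚ.≤-trans 3≤k (ℕₚ.≤-reflexive (sym (valency z₀)))))

    u₀ : Fin n
    u₀ = proj₁ base

    u₀z₀ : u₀ ~ z₀
    u₀z₀ = ~-sym (proj₂ base)

    around-z₀ : Enumeration (adj z₀) (suc D)
    around-z₀ = subst (Enumeration (adj z₀)) (trans (valency z₀) k≡D+1) (enumerate (adj z₀))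

    others : Fin n → Bool
    others v = adj u₀ v ∧ not (eqᵇ z₀ v)

    around-u₀ : Enumeration others D
    around-u₀ = subst (Enumeration others) (ℕₚ.suc-injective (trans (sym (count-remove (adj u₀) z₀ u₀z₀)) (trans (valency u₀) k≡D+1))) (enumerate others)

    module Z = Enumeration around-z₀
    module U = Enumeration around-u₀

    others-elim : ∀ j → u₀ ~ U.at j × z₀ ≢ U.at j
    others-elim j = let a , b = ∧-true {adj u₀ (U.at j)} (U.holds j) in a , not-eqᵇ-elim z₀ (U.at j) b

    -- Representatives of the 2D + 1 points. Those whose set misses z₀ come from the k = D + 1 edges
    -- at z₀; those containing z₀ miss its neighbour u₀ and come from the D other edges at u₀.
    edge : Fin (suc D) ⊎ Fin D → Fin n × Fin n
    edge (inj₁ i) = z₀ , Z.at i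
    edge (inj₂ j) = u₀ , U.at j

    point : Fin (suc D) ⊎ Fin D → Fin n → Bool
    point s = P (proj₁ (edge s)) (proj₂ (edge s))

    edge-adjacent : ∀ s → proj₁ (edge s) ~ proj₂ (edge s)
    edge-adjacent (inj₁ i) = Z.holds i
    edge-adjacent (inj₂ j) = proj₁ (others-elim j)

    cross : ∀ i j → ¬ point (inj₁ i) ≐ point (inj₂ j)
    cross i j same = true≢false (trans (sym (P-beyond (proj₁ (others-elim j)) u₀z₀ (proj₂ (others-elim j) ∘ sym)))
      (trans (sym (same z₀)) (P-left z₀ (Z.at i))))

    point-injective : ∀ s t → point s ≐ point t → s ≡ t
    point-injective (inj₁ i) (inj₁ j) same = cong inj₁ (Z.injective i j (P-separates (Z.holds i) (Z.holds j) same))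
    point-injective (inj₂ i) (inj₂ j) same = cong inj₂ (U.injective i j (P-separates (proj₁ (others-elim i)) (proj₁ (others-elim j)) same))
    point-injective (inj₁ i) (inj₂ j) same = ⊥-elim (cross i j same)
    point-injective (inj₂ j) (inj₁ i) same = ⊥-elim (cross i j (sym ∘ same))

    point-onto : ∀ {x y} → x ~ y → ∃ λ s → P x y ≐ point s
    point-onto {x} {y} xy = by-z₀ (P x y z₀) refl
      where
      by-z₀ : ∀ b → P x y z₀ ≡ b → ∃ λ s → P x y ≐ point s
      by-z₀ false h = let v , z₀v , same = missing z₀ xy h
                          i , at≡v = Z.onto v z₀v
                      in inj₁ i , λ u → trans (same u) (cong (λ t → P z₀ t u) (sym at≡v))
      by-z₀ true h = let v , u₀v , same = missing u₀ xy (P-disjoint xy (~-sym u₀z₀) h)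
                         z₀≢v = λ z₀≡v → true≢false (trans (sym h) (trans (same z₀) (trans (cong (P u₀ v) z₀≡v) (P-right u₀ v))))
                         j , at≡v = U.onto v (∧-intro u₀v (not-eqᵇ z₀≢v))
                     in inj₂ j , λ u → trans (same u) (cong (λ t → P u₀ t u) (sym at≡v))

  N : ℕ
  N = suc (D + D)

  Φ : Fin n → Fin N → Bool
  Φ z i = point (Fin.splitAt (suc D) i) z

  private
    pt : Fin N → Fin n → Bool
    pt i z = Φ z i

    pt-missing : ∀ i z → Φ z i ≡ false → ∃ λ x → z ~ x × pt i ≐ P z x
    pt-missing i z h = missing z (edge-adjacent (Fin.splitAt (suc D) i)) h

    pt-injective : ∀ i j → pt i ≐ pt j → i ≡ j
    pt-injective i j same = trans (sym (Finₚ.join-splitAt (suc D) D i)) (trans (cong (Fin.join (suc D) D)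
      (point-injective (Fin.splitAt (suc D) i) (Fin.splitAt (suc D) j) same)) (Finₚ.join-splitAt (suc D) D j))

    pt-onto : ∀ {x y} → x ~ y → ∃ λ i → P x y ≐ pt i
    pt-onto xy = let s , same = point-onto xy in Fin.join (suc D) D s ,
      λ u → trans (same u) (cong (λ t → point t u) (sym (Finₚ.splitAt-join (suc D) D s)))

  Φ-disjoint : ∀ {z u} → z ~ u → Disjoint (Φ z) (Φ u)
  Φ-disjoint {z} {u} zu i = by-head (Φ z i) refl
    where
    by-head : ∀ b → Φ z i ≡ b → Φ z i ∧ Φ u i ≡ false
    by-head false e = cong (_∧ Φ u i) e
    by-head true e = trans (cong (_∧ Φ u i) e) (P-disjoint (edge-adjacent (Fin.splitAt (suc D) i)) zu e)

  private
    count-true : ∀ m → count {m} (λ _ → true) ≡ m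
    count-true zero    = refl
    count-true (suc m) = cong suc (count-true m)

    complement : ∀ {m} (p : Fin m → Bool) → m ≡ count p + count (not ∘ p)
    complement {m} p = trans (sym (count-true m)) (count-split (λ _ → true) p)

    not-false : ∀ {b} → not b ≡ true → b ≡ false
    not-false {false} _ = refl

    -- The neighbours x of `z` correspond bijectively to the points missing `z`, by way of P z x,
    -- and their number is k = D + 1.
    co-size : ∀ z → count (not ∘ Φ z) ≡ suc D
    co-size z = trans (ℕₚ.≤-antisym
        (count-≤ {p = not ∘ Φ z} {adj z} (λ i h → proj₁ (there′ i h)) (λ i h → proj₁ (proj₂ (there′ i h)))
          (λ i j hi hj eq → pt-injective i j (λ u → trans (proj₂ (proj₂ (there′ i hi)) u) (trans (cong (λ t → P z t u) eq) (sym (proj₂ (proj₂ (there′ j hj)) u))))))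
        (count-≤ {p = adj z} {not ∘ Φ z} (λ x zx → proj₁ (pt-onto zx)) (λ x zx → cong not (trans (sym (proj₂ (pt-onto zx) z)) (P-left z x)))
          (λ x y zx zy eq → P-separates zx zy (λ u → trans (proj₂ (pt-onto zx) u) (trans (cong (λ t → pt t u) eq) (sym (proj₂ (pt-onto zy) u)))))))
      (trans (valency z) k≡D+1)
      where
      there′ : ∀ i → not (Φ z i) ≡ true → ∃ λ x → z ~ x × pt i ≐ P z x
      there′ i h = pt-missing i z (not-false h)

  Φ-size : ∀ z → count (Φ z) ≡ D
  Φ-size z = ℕₚ.+-cancelʳ-≡ (suc D) _ _ (trans (cong (λ t → count (Φ z) + t) (sym (co-size z))) (trans (sym (complement (Φ z))) (sym (ℕₚ.+-suc D D))))

  -- Points given by edges at `x` miss `x`, hence also `y`. An edge to a vertex closer to `y` makes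
  -- d(x,y) - 1 even, and an edge to one not closer, which exists as c_h < k on every level, makes
  -- d(x,y) even.
  Φ-injective : ∀ x y → (∀ i → Φ x i ≡ Φ y i) → x ≡ y
  Φ-injective x y same with x Fin.≟ y
  ... | yes x≡y = x≡y
  ... | no x≢y = ⊥-elim (distance (d x y) refl)
    where
    avoids : ∀ {x′} → x ~ x′ → P x x′ y ≡ false
    avoids {x′} xx′ = let i , at = pt-onto xx′ in trans (at y) (trans (sym (same i)) (trans (sym (at x)) (P-left x x′)))
    distance : ∀ h → d x y ≡ h → ⊥
    distance zero e = x≢y (d≡0⇒≡ e)
    distance (suc h) e =
      let x′ , xx′ , e′ = d-step e
          x″ , cx″ = C̅-exists e (all-c<k (subst (_≤ D) e (d≤D x y)))
          xx″ , ne = C̅-elim {x} {y} {x″} cx″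
          far : suc h ≤ d x″ y
          far = ℕₚ.≤-pred (ℕₚ.≤∧≢⇒< (ℕₚ.≤-trans (ℕₚ.≤-reflexive (sym e)) (d-near y (~-sym xx″))) (λ eq → ne (trans (sym eq) (sym e))))
          even₁ : odd h ≡ false
          even₁ = trans (sym (P-low e′ (ℕₚ.≤-trans (ℕₚ.n≤1+n h) (ℕₚ.≤-reflexive (sym e))))) (trans (P-swap x′ x y) (avoids xx′))
          even₂ : odd (suc h) ≡ false
          even₂ = trans (sym (P-low e far)) (avoids xx″)
      in true≢false (trans (cong not (sym even₁)) (trans (sym (odd-suc h)) even₂))

  private
    outside : ∀ x y → Disjoint (Φ x) (Φ y) → count (λ i → not (Φ x i) ∧ not (Φ y i)) ≡ 1
    outside x y h = ℕₚ.+-cancelˡ-≡ D _ _ (trans (cong (_+ count (λ i → not (Φ x i) ∧ not (Φ y i))) (trans (sym (Φ-size y)) (count-cong inside)))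
      (trans (sym (count-split (not ∘ Φ x) (Φ y))) (trans (co-size x) (ℕₚ.+-comm 1 D))))
      where
      inside : ∀ i → Φ y i ≡ not (Φ x i) ∧ Φ y i
      inside i with Φ x i | h i
      ... | true  | e = e
      ... | false | _ = refl

    -- Two disjoint D-sets miss exactly one of the 2D + 1 points.
    opposite-values : ∀ {x y i j} → Disjoint (Φ x) (Φ y) → Φ x i ≡ false → Φ y i ≡ false → j ≢ i → Φ y j ≡ not (Φ x j)
    opposite-values {x} {y} {i} {j} h xi yi j≢i = bool-ext
      (λ yj → cong not (∧-false (disjoint-sym {p = Φ x} {Φ y} h j) yj))
      (λ xj → flip-not (λ yj → j≢i (count-unique {p = λ i → not (Φ x i) ∧ not (Φ y i)} (ℕₚ.≤-reflexive (outside x y h)) {j} {i} (∧-intro xj (cong not yj)) (∧-intro (cong not xi) (cong not yi)))))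
      where
      flip-not : ∀ {b} → b ≢ false → b ≡ true
      flip-not {true}  _ = refl
      flip-not {false} h = ⊥-elim (h refl)

    neighbour-at : ∀ x i → Φ x i ≡ false → ∃ λ x′ → x ~ x′ × Φ x′ i ≡ false
    neighbour-at x i h = let x′ , xx′ , same = pt-missing i x h in x′ , xx′ , trans (same x′) (P-right x x′)

  -- Besides Φ x, the set Φ y misses a single point i. The neighbour of `x` whose set misses i has
  -- the same set as `y`, so it is `y`.
  Φ-adjacent : ∀ x y → Disjoint (Φ x) (Φ y) → x ~ y
  Φ-adjacent x y h =
    let i , hi = count-∃ (λ i → not (Φ x i) ∧ not (Φ y i)) (ℕₚ.≤-reflexive (sym (outside x y h)))
        xi , yi = ∧-true {not (Φ x i)} hi
        x′ , xx′ , x′i = neighbour-at x i (not-false xi)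
        agree : ∀ j → Φ x′ j ≡ Φ y j
        agree j = by-index j i x′ (not-false xi) (not-false yi) xx′ x′i (j Fin.≟ i)
    in subst (x ~_) (Φ-injective x′ y agree) xx′
    where
    by-index : ∀ j i x′ → Φ x i ≡ false → Φ y i ≡ false → x ~ x′ → Φ x′ i ≡ false → Dec (j ≡ i) → Φ x′ j ≡ Φ y j
    by-index j i x′ xi yi xx′ x′i (yes refl) = trans x′i (sym yi)
    by-index j i x′ xi yi xx′ x′i (no j≢i) = trans (opposite-values {x} {x′} (Φ-disjoint xx′) xi x′i j≢i) (sym (opposite-values {x} {y} h xi yi j≢i))

  -- Two steps through points b ∉ Φ x and a ∈ Φ x exchange a for b.
  Φ-onto : ∀ (T : Fin N → Bool) → count T ≡ D → ∃ λ x → ∀ i → Φ x i ≡ T i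
  Φ-onto T size = approach (count (λ i → T i ∧ not (Φ z₀ i))) z₀ ℕₚ.≤-refl
    where
    approach : ∀ m x → count (λ i → T i ∧ not (Φ x i)) ≤ m → ∃ λ x → ∀ i → Φ x i ≡ T i
    exchange : ∀ m x b → T b ∧ not (Φ x b) ≡ true → count (λ i → T i ∧ not (Φ x i)) ≤ suc m → ∃ λ x → ∀ i → Φ x i ≡ T i
    balance : ∀ x → count (λ i → T i ∧ not (Φ x i)) ≡ count (λ i → Φ x i ∧ not (T i))
    balance x = count-difference T (Φ x) (trans size (sym (Φ-size x)))
    search-step : ∀ m x → count (λ i → T i ∧ not (Φ x i)) ≤ m → Dec (count (λ i → T i ∧ not (Φ x i)) ≡ 0) → ∃ λ x → ∀ i → Φ x i ≡ T i
    search-step m x le (yes e) = x , λ i → bool-ext (∧-not-false (count-zero {p = λ i → Φ x i ∧ not (T i)} (trans (sym (balance x)) e) i)) (∧-not-false (count-zero {p = λ i → T i ∧ not (Φ x i)} e i))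
    search-step zero x le (no ne) = ⊥-elim (ne (ℕₚ.n≤0⇒n≡0 le))
    search-step (suc m) x le (no ne) = let b , hb = count-∃ (λ i → T i ∧ not (Φ x i)) (ℕₚ.n≢0⇒n>0 ne) in exchange m x b hb le
    approach m x le = search-step m x le (count (λ i → T i ∧ not (Φ x i)) ℕ.≟ 0)
    exchange m x b hb le =
      let Tb , xb = ∧-true {T b} hb
          a , ha = count-∃ (λ i → Φ x i ∧ not (T i)) (subst (0 <_) (balance x) (count-pos {p = λ i → T i ∧ not (Φ x i)} b hb))
          xa , Ta = ∧-true {Φ x a} ha
          x′ , xx′ , x′b = neighbour-at x b (not-false xb)
          x″ , x′x″ , x″a = neighbour-at x′ a (∧-false (Φ-disjoint xx′ a) xa)
      in approach m x″ (ℕₚ.≤-pred (ℕₚ.≤-trans (s≤s (count-mono {p = λ i → T i ∧ not (Φ x″ i)} {λ i → (T i ∧ not (Φ x i)) ∧ not (eqᵇ b i)} (closer a b x′ x″ (not-false Ta) x′b xx′ x′x″ (∧-false (Φ-disjoint xx′ a) xa) x″a)))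
           (ℕₚ.≤-trans (ℕₚ.≤-reflexive (sym (count-remove (λ i → T i ∧ not (Φ x i)) b hb))) le)))
      where
      closer : ∀ a b x′ x″ → T a ≡ false → Φ x′ b ≡ false → x ~ x′ → x′ ~ x″ → Φ x′ a ≡ false → Φ x″ a ≡ false →
        ∀ j → T j ∧ not (Φ x″ j) ≡ true → (T j ∧ not (Φ x j)) ∧ not (eqᵇ b j) ≡ true
      closer a b x′ x″ Ta x′b xx′ x′x″ x′a x″a j hj =
        let Tj , x″j = ∧-true {T j} hj
            j≢a = λ j≡a → true≢false (trans (sym Tj) (trans (cong T j≡a) Ta))
            x′j = x′-value (Φ x′ j) (trans (sym x″j) (cong not (opposite-values {x′} {x″} (Φ-disjoint x′x″) x′a x″a j≢a)))
        in ∧-intro (∧-intro Tj (cong not (∧-false (disjoint-sym {p = Φ x} {Φ x′} (Φ-disjoint xx′) j) x′j)))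
             (not-eqᵇ {x = b} {j} (λ b≡j → true≢false (trans (sym x′j) (trans (cong (Φ x′) (sym b≡j)) x′b))))
        where
        x′-value : ∀ b → true ≡ not (not b) → b ≡ true
        x′-value true _ = refl

  isoOdd : IsoOdd G D
  isoOdd = mk↔ₛ′ to from (λ (T , size) → oddVertex≡ (trans (Vecₚ.tabulate-cong (proj₂ (Φ-onto (Vec.lookup T) (trans (sym (size≡count T)) size)))) (Vecₚ.tabulate∘lookup T)))
      (λ x → Φ-injective _ x (λ i → trans (proj₂ (Φ-onto (Vec.lookup (proj₁ (to x))) (trans (sym (size≡count (proj₁ (to x)))) (proj₂ (to x)))) i) (Vecₚ.lookup∘tabulate (Φ x) i))) ,
    λ x y → mk⇔ (λ xy → disjoint⇒∩⊥ _ _ (λ i → trans (cong₂ _∧_ (Vecₚ.lookup∘tabulate (Φ x) i) (Vecₚ.lookup∘tabulate (Φ y) i)) (Φ-disjoint xy i)))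
      (λ e → Φ-adjacent x y (λ i → trans (sym (cong₂ _∧_ (Vecₚ.lookup∘tabulate (Φ x) i) (Vecₚ.lookup∘tabulate (Φ y) i))) (∩⊥⇒disjoint (proj₁ (to x)) (proj₁ (to y)) e i)))
    where
    to : Fin n → OddVertex D
    to x = Vec.tabulate (Φ x) , trans (size≡count (Vec.tabulate (Φ x))) (trans (count-cong (Vecₚ.lookup∘tabulate (Φ x))) (Φ-size x))
    from : OddVertex D → Fin n
    from (T , size) = proj₁ (Φ-onto (Vec.lookup T) (trans (sym (size≡count T)) size))

-- The hexagon case

module BipartiteDiameterThree (S : Setting) (D≡3 : Setting.D S ≡ 3) (c₃≡k : Local.c S 3 ≡ Setting.k S)
  (level : ∀ h → h < Setting.D S → ∀ {x u y} → Local._~_ S x u → Local.d S x y ≡ h → Local.d S u y ≢ h) where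
  open Local S

  -- Below level three this is `level`; on level three all k neighbours are closer, because c₃ = k.
  uneven : ∀ {x u} y → x ~ u → d u y ≢ d x y
  uneven {x} {u} y xu e with d x y ℕ.≟ 3
  ... | no ≢3 = level (d x y) (ℕₚ.≤∧≢⇒< (d≤D x y) (λ e → ≢3 (trans e D≡3))) xu refl e
  ... | yes ≡3 = ℕₚ.1+n≢n (trans (closer (suc (d u y) ℕ.≟ d x y)) (sym e))
    where
    closer : Dec (suc (d u y) ≡ d x y) → suc (d u y) ≡ d x y
    closer (yes p) = p
    closer (no p) = ⊥-elim (ℕₚ.<⇒≢ (ℕₚ.m<m+n (c 3) (count-pos u (C̅-intro xu p))) (trans c₃≡k (C+C̅ ≡3)))

  adjacent-levels : ∀ {x u} y → x ~ u → d u y ≡ suc (d x y) ⊎ d x y ≡ suc (d u y)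
  adjacent-levels {x} {u} y xu with ℕₚ.<-cmp (d u y) (d x y)
  ... | tri≈ _ e _ = ⊥-elim (uneven y xu e)
  ... | tri< lt _ _ = inj₂ (ℕₚ.≤-antisym (d-near y (~-sym xu)) lt)
  ... | tri> _ _ gt = inj₁ (ℕₚ.≤-antisym (d-near y xu) gt)

  bipartition : Bipartite G
  bipartition = (λ z → odd (d z y₀)) , proper
    where
    y₀ = proj₁ (proj₂ diameter)
    proper : ∀ x u → x ~ u → odd (d x y₀) ≢ odd (d u y₀)
    proper x u xu e with adjacent-levels y₀ xu
    ... | inj₁ up   = not≢self (odd (d x y₀)) (sym (trans e (trans (cong odd up) (odd-suc (d x y₀)))))
    ... | inj₂ down = not≢self (odd (d u y₀)) (trans (sym (trans (cong odd down) (odd-suc (d u y₀)))) e)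

  bpar-spec : ∀ {h} x y → d x y ≡ h → k ≡ c h + bpar G x y
  bpar-spec {h} x y e = trans (C+C̅ (trans (d-sym y x) e)) (cong (λ t → c h + t) (count-cong λ z → bool-ext
    (λ cz → let yz , ne = C̅-elim {y} {x} {z} cz in ∧-intro yz (≡ᵇ-intro (up yz ne)))
    (λ bz → let yz , e′ = ∧-true {adj y z} bz in C̅-intro yz (λ eq → ℕₚ.<⇒≢ (ℕₚ.m<n+m (d x y) {2} (s≤s z≤n))
      (trans (trans (d-sym x y) (sym eq)) (cong suc (trans (d-sym z x) (≡ᵇ-true _ _ e′))))))))
    where
    up : ∀ {z} → y ~ z → suc (d z x) ≢ d y x → d x z ≡ suc (d x y)
    up {z} yz ne with adjacent-levels x yz
    ... | inj₁ p = trans (d-sym x z) (trans p (cong suc (d-sym y x)))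
    ... | inj₂ q = ⊥-elim (ne (sym q))

  cpar-spec : ∀ {h} x y → d x y ≡ suc h → cpar G x y ≡ c (suc h)
  cpar-spec {h} x y e = trans (count-cong λ z → cong (adj y z ∧_) (trans (cong₂ (λ a b → a ≡ᵇ (b ∸ 1)) (d-sym x z) e) (cong (suc (d z x) ≡ᵇ_) (sym e′)))) (c-spec e′)
    where
    e′ : d y x ≡ suc h
    e′ = trans (d-sym y x) e

  c₀ : c 0 ≡ 0
  c₀ = let (x , y) , e = pair 0 z≤n in trans (sym (c-spec e)) (count-none (λ z → trans (cong (λ h → adj x z ∧ (suc (d z y) ≡ᵇ h)) e) (Boolₚ.∧-zeroʳ (adj x z))))

  genHexagon : IsGenHexagon1 k G
  genHexagon = conn , regular , subst (HasDiameter G) D≡3 diameter , bipartition ,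
    (λ x y e → sym (trans (bpar-spec x y e) (cong (_+ bpar G x y) c₀))) ,
    (λ x y e → sym (cong (_∸ 1) (trans (bpar-spec x y e) (cong (_+ bpar G x y) c₁))) , trans (cpar-spec x y e) c₁) ,
    (λ x y e → sym (cong (_∸ 1) (trans (bpar-spec x y e) (cong (_+ bpar G x y) c₂))) , trans (cpar-spec x y e) c₂) ,
    (λ x y e → trans (cpar-spec x y e) c₃≡k)

module Dichotomy (S : Setting) (cos : Cosines (Setting.G S) (Setting.conn S) (Setting.D S)) where
  open Local S
  open Relations S cos using (flat)
  open Elimination S cos using (c₃≢1; c<k)

  private
    small : c 3 < k → OddParameters S
    small c₃<k = by-value (c 3) refl
      where
      by-value : ∀ m → c 3 ≡ m → OddParameters S
      by-value 0 e = ⊥-elim (ℕₚ.<⇒≢ (c-pos 3≤D) (sym e))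
      by-value 1 e = ⊥-elim (c₃≢1 c₃<k e)
      by-value 2 e = SmallParity.oddParameters S cos c₃<k e
      by-value (suc (suc (suc m))) e = ⊥-elim (LargeDiameter.contradiction S cos c₃<k e (s≤s z≤n))

  dichotomy : OddParameters S ⊎ IsGenHexagon1 k G
  dichotomy with D ℕ.≟ 3
  ... | no D≢3 = inj₁ (small (c<k (ℕₚ.≤∧≢⇒< 3≤D (D≢3 ∘ sym))))
  ... | yes D≡3 with c 3 ℕ.≟ k
  ... | no c₃≢k = inj₁ (small (ℕₚ.≤∧≢⇒< (c≤k 3≤D) c₃≢k))
  ... | yes c₃≡k = inj₂ (BipartiteDiameterThree.genHexagon S D≡3 c₃≡k λ h h<D {x} {u} {y} → flat h h<D {x} {u} {y})

girth6⇒characterization : (G : Graph) (D k : ℕ) → Connected G → IsDistanceRegular G → HasDiameter G D → Valency G k →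
  3 ≤ D → 3 ≤ k → IsQPolynomial G D → GirthEq G 6 → IsoOdd G D ⊎ Σ Graph (λ H → IsGenHexagon1 k H × (G ≅ H))
girth6⇒characterization G D k conn regular diameter valency 3≤D 3≤k qpoly (_ , shorter) = conclude (Dichotomy.dichotomy S cosines)
  where
  open CycleKit G
  S : Setting
  S = record
    { G = G ; D = D ; k = k ; conn = conn ; regular = regular ; diameter = diameter ; valency = valency ; 3≤D = 3≤D ; 3≤k = 3≤k
    ; noTri = shorter 3 (s≤s (s≤s (s≤s (s≤s z≤n)))) ∘ triangle⇒cycle
    ; noQuad = shorter 4 (s≤s (s≤s (s≤s (s≤s (s≤s z≤n))))) ∘ quad⇒cycle
    ; noPent = λ pent → shorter 5 ℕₚ.≤-refl (pentagon⇒cycle (shorter 3 (s≤s (s≤s (s≤s (s≤s z≤n)))) ∘ triangle⇒cycle) pent) }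
  cosines : Cosines G conn D
  cosines = qpoly-cosines G conn D diameter (ℕₚ.≤-trans (s≤s z≤n) 3≤D) qpoly
  conclude : OddParameters S ⊎ IsGenHexagon1 k G → IsoOdd G D ⊎ Σ Graph (λ H → IsGenHexagon1 k H × (G ≅ H))
  conclude (inj₁ parameters) = inj₁ (OddReconstruction.isoOdd S parameters)
  conclude (inj₂ hexagon) = inj₂ (G , hexagon , mk↔ₛ′ id id (λ _ → refl) (λ _ → refl) , λ _ _ → refl)

theorem6p7 : (G : Graph) (D k : ℕ) →
  Connected G → IsDistanceRegular G → HasDiameter G D → Valency G k →
  3 ≤ D → 3 ≤ k → IsQPolynomial G D →
  GirthEq G 6 ⇔ (IsoOdd G D ⊎ Σ Graph (λ H → IsGenHexagon1 k H × (G ≅ H)))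
theorem6p7 G D k conn regular diameter valency 3≤D 3≤k qpoly = mk⇔
  (girth6⇒characterization G D k conn regular diameter valency 3≤D 3≤k qpoly)
  λ { (inj₁ odd) → odd-girth G 3≤D odd ; (inj₂ (H , hexagon , iso)) → ≅-girth iso (genHexagon-girth H 3≤k hexagon) }
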